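{- Let $n\ge 1$ and let $\mathrm{NO}_n(z)$ be the $n$th Nekrasov--Okounkov polynomial. Then $\mathrm{NO}_n(z)$ has a unique zero of maximal modulus among its complex zeros. This zero is real, negative, and simple.
   Context: The Nekrasov--Okounkov polynomials are \[ \mathrm{NO}_n(z)=\sum_{\lambda\vdash n}\ \prod_{h\in H(\lambda)}\left(1+\frac{z}{h^2}\right), \] where the sum is over all partitions $\lambda$ of $n$ and $H(\lambda)$ is the multiset of hook lengths of $\lambda$. By the Nekrasov--Okounkov hook-length formula they are equivalently given by the formal power series identity \[ \sum_{n=0}^{\infty}\mathrm{NO}_n(z)q^n=\prod_{m=1}^{\infty}(1-q^m)^{ -z-1}. \] Equivalently, $\mathrm{NO}_n(z)=P_n(z+1)$, where $P_0(z)=1$ and $P_n(z)=\frac{z}{n}\sum_{k=1}^n\sigma(k)P_{n-k}(z)$ for $n\ge1$, with $\sigma(k)=\sum_{d\mid k}d$. "Unique zero of maximal modulus" means that there is a zero $\alpha$ such that every zero $\beta\neq\alpha$ satisfies $|\beta|<|\alpha|$; "simple" means multiplicity one. -}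

module Defs where

open import Algebra.Bundles using (CommutativeRing; CommutativeSemiring)
open import Algebra.Bundles.Raw using (RawRing)
import Algebra.Definitions.RawMonoid as RawMonoidDefinitions
import Algebra.Properties.Ring as RingProperties
import Algebra.Solver.Ring.NaturalCoefficients.Default as NatCoefficients
open import Data.List.Base
  using (List; []; _∷_; _++_; map; foldr; filter; length; upTo; concatMap; cartesianProductWith)
open import Data.List.Relation.Unary.All using (All; all?)
open import Data.List.Relation.Unary.Linked using (Linked; linked?)
open import Data.Nat.Base as ℕ using (ℕ; zero; suc; _∸_; _≥_)
open import Data.Nat.ListAction using (sum)
import Data.Nat.Properties as ℕ
open import Data.Product.Base using (∃; _×_; _,_; proj₁; proj₂)
open import Data.Sum.Base using (_⊎_; inj₁; inj₂)
open import Level using (Lift; lift; _⊔_) renaming (suc to lsuc)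
open import Relation.Binary.Core using (Rel)
open import Relation.Binary.Definitions using (tri<; tri≈; tri>)
open import Relation.Binary.PropositionalEquality.Core using (_≡_)
open import Relation.Binary.Structures using (IsStrictTotalOrder)
open import Relation.Nullary using (Dec; ¬_; contradiction)
open import Relation.Nullary.Decidable using (_×-dec_)
open import Relation.Unary using (Pred)

------------------------------------------------------------------------
-- The real numbers

-- The standard library has no real numbers.  They are taken here to be any
-- Dedekind-complete ordered field; classically such a field exists and is
-- unique up to isomorphism.  Trichotomy and completeness are meant in their
-- usual classical form, so that instances require excluded middle.
-- As is customary, inversion is total and unspecified at 0#.

record CompleteOrderedField c ℓ₁ ℓ₂ : Set (lsuc (c ⊔ ℓ₁ ⊔ ℓ₂)) where
  infix 4 _<_ _≤_
  infix 8 _⁻¹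
  field
    commutativeRing : CommutativeRing c ℓ₁

  open CommutativeRing commutativeRing public

  field
    0≉1                : 0# ≉ 1#
    _⁻¹                : Carrier → Carrier
    ⁻¹-inverseʳ        : ∀ x → x ≉ 0# → x * x ⁻¹ ≈ 1#
    _<_                : Rel Carrier ℓ₂
    isStrictTotalOrder : IsStrictTotalOrder _≈_ _<_
    +-monoˡ-<          : ∀ {x y} z → x < y → x + z < y + z
    *-pos              : ∀ {x y} → 0# < x → 0# < y → 0# < x * y

  _≤_ : Rel Carrier (ℓ₁ ⊔ ℓ₂)
  x ≤ y = x < y ⊎ x ≈ y

  UpperBound : ∀ {p} → Pred Carrier p → Pred Carrier _
  UpperBound S u = ∀ x → S x → x ≤ u

  field
    supremum : (S : Pred Carrier (c ⊔ ℓ₁ ⊔ ℓ₂)) → ∃ S → ∃ (UpperBound S) →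
               ∃ λ s → UpperBound S s × (∀ u → UpperBound S u → s ≤ u)

module SemiringIdentities {c ℓ} (R : CommutativeSemiring c ℓ) where
  open CommutativeSemiring R
  open NatCoefficients R using (solve; _:+_; _:*_; _:=_; con)

  x+[x²+x+1] : ∀ x → x + ((x * x + x) + 1#) ≈ (x + 1#) * (x + 1#)
  x+[x²+x+1] = solve 1 (λ a → a :+ ((a :* a :+ a) :+ con 1) := (a :+ con 1) :* (a :+ con 1)) refl

  swap-left : ∀ x y z → x * (y * z) ≈ y * (x * z)
  swap-left = solve 3 (λ a b e → a :* (b :* e) := b :* (a :* e)) refl

  square-+ : ∀ x y → (x + y) * (x + y) ≈ x * x + y * ((x + x) + y)
  square-+ = solve 2 (λ a b → (a :+ b) :* (a :+ b) := a :* a :+ b :* ((a :+ a) :+ b)) refl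

  double-square : ∀ x u → (x * x + x * x) * u ≈ x * ((x + x) * u)
  double-square = solve 2 (λ a v → (a :* a :+ a :* a) :* v := a :* ((a :+ a) :* v)) refl

  regroup : ∀ x d u → ((x + x) + d) * u + d * u ≈ ((x + d) + (x + d)) * u
  regroup = solve 3 (λ a b v → ((a :+ a) :+ b) :* v :+ b :* v := ((a :+ b) :+ (a :+ b)) :* v) refl

  quadruple-square : ∀ x u → (x * x + x * x + (x * x + x * x)) * (u * u) ≈ ((x + x) * u) * ((x + x) * u)
  quadruple-square = solve 2 (λ a v → (a :* a :+ a :* a :+ (a :* a :+ a :* a)) :* (v :* v)
                                := ((a :+ a) :* v) :* ((a :+ a) :* v)) refl

  complete-square : ∀ x d u → (((x + x) + d) * u) * (((x + x) + d) * u)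
    ≈ x * (((x + d) + (x + d) + ((x + d) + (x + d))) * (u * u)) + (d * u) * (d * u)
  complete-square = solve 3 (λ a b v → (((a :+ a) :+ b) :* v) :* (((a :+ a) :+ b) :* v)
      := a :* (((a :+ b) :+ (a :+ b) :+ ((a :+ b) :+ (a :+ b))) :* (v :* v)) :+ (b :* v) :* (b :* v)) refl

module SquareRoots {c ℓ₁ ℓ₂} (F : CompleteOrderedField c ℓ₁ ℓ₂) where
  open CompleteOrderedField F
  open IsStrictTotalOrder isStrictTotalOrder
    using (compare; <-respʳ-≈; <-respˡ-≈)
    renaming (trans to <-trans; irrefl to <-irrefl)
  open RingProperties ring using (-‿distribʳ-*; -‿distribˡ-*; -‿involutive)
  open SemiringIdentities commutativeSemiring

  private
    ≤-<-trans : ∀ {x y z} → x ≤ y → y < z → x < z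
    ≤-<-trans (inj₁ x<y) y<z = <-trans x<y y<z
    ≤-<-trans (inj₂ x≈y) y<z = <-respˡ-≈ (sym x≈y) y<z

    <-≤-trans : ∀ {x y z} → x < y → y ≤ z → x < z
    <-≤-trans x<y (inj₁ y<z) = <-trans x<y y<z
    <-≤-trans x<y (inj₂ y≈z) = <-respʳ-≈ y≈z x<y

    ≤-trans : ∀ {x y z} → x ≤ y → y ≤ z → x ≤ z
    ≤-trans (inj₁ x<y) y≤z = inj₁ (<-≤-trans x<y y≤z)
    ≤-trans (inj₂ x≈y) (inj₁ y<z) = inj₁ (<-respˡ-≈ (sym x≈y) y<z)
    ≤-trans (inj₂ x≈y) (inj₂ y≈z) = inj₂ (trans x≈y y≈z)

    ≤⇒≯ : ∀ {x y} → x ≤ y → ¬ (y < x)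
    ≤⇒≯ x≤y y<x = <-irrefl refl (≤-<-trans x≤y y<x)

    ≮⇒≤ : ∀ {x y} → ¬ (y < x) → x ≤ y
    ≮⇒≤ {x} {y} y≮x with compare x y
    ... | tri< x<y _ _ = inj₁ x<y
    ... | tri≈ _ x≈y _ = inj₂ x≈y
    ... | tri> _ _ y<x = contradiction y<x y≮x

    +-monoʳ-< : ∀ {x y} z → x < y → z + x < z + y
    +-monoʳ-< z x<y = <-respʳ-≈ (+-comm _ z) (<-respˡ-≈ (+-comm _ z) (+-monoˡ-< z x<y))

    +-monoʳ-≤ : ∀ {x y} z → x ≤ y → z + x ≤ z + y
    +-monoʳ-≤ z (inj₁ x<y) = inj₁ (+-monoʳ-< z x<y)
    +-monoʳ-≤ z (inj₂ x≈y) = inj₂ (+-congˡ x≈y)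

    x<x+p : ∀ {p} x → 0# < p → x < x + p
    x<x+p x 0<p = <-respˡ-≈ (+-identityʳ x) (+-monoʳ-< x 0<p)

    x≤x+p : ∀ {p} x → 0# ≤ p → x ≤ x + p
    x≤x+p x 0≤p = ≤-trans (inj₂ (sym (+-identityʳ x))) (+-monoʳ-≤ x 0≤p)

    gap : ∀ {x y} → x < y → ∃ λ d → 0# < d × y ≈ x + d
    gap {x} {y} x<y =
      y + - x , <-respˡ-≈ (-‿inverseʳ x) (+-monoˡ-< (- x) x<y) ,
      trans (sym (trans (+-congʳ (-‿inverseʳ x)) (+-identityˡ y)))
        (trans (+-assoc x (- x) y) (+-congˡ (+-comm (- x) y)))

    pos-+ : ∀ {x y} → 0# ≤ x → 0# < y → 0# < x + y
    pos-+ {x} 0≤x 0<y = ≤-<-trans 0≤x (x<x+p x 0<y)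

    *-monoʳ-< : ∀ {x y z} → 0# < z → x < y → z * x < z * y
    *-monoʳ-< {x} {y} {z} 0<z x<y with gap x<y
    ... | d , 0<d , y≈x+d =
      <-respʳ-≈ (sym (trans (*-congˡ y≈x+d) (distribˡ z x d))) (x<x+p (z * x) (*-pos 0<z 0<d))

    *-monoʳ-≤ : ∀ {x y z} → 0# ≤ z → x ≤ y → z * x ≤ z * y
    *-monoʳ-≤ (inj₁ 0<z) (inj₁ x<y) = inj₁ (*-monoʳ-< 0<z x<y)
    *-monoʳ-≤ {x} {y} (inj₂ 0≈z) (inj₁ _) =
      inj₂ (trans (*-congʳ (sym 0≈z)) (trans (zeroˡ x) (trans (sym (zeroˡ y)) (*-congʳ 0≈z))))
    *-monoʳ-≤ _ (inj₂ x≈y) = inj₂ (*-congˡ x≈y)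

    *-nonneg : ∀ {x y} → 0# ≤ x → 0# ≤ y → 0# ≤ x * y
    *-nonneg {x} 0≤x 0≤y = ≤-trans (inj₂ (sym (zeroʳ x))) (*-monoʳ-≤ 0≤x 0≤y)

    square-mono-< : ∀ {s t} → 0# ≤ t → t < s → t * t < s * s
    square-mono-< {s} {t} 0≤t t<s =
      ≤-<-trans (*-monoʳ-≤ 0≤t (inj₁ t<s)) (<-respˡ-≈ (*-comm s t) (*-monoʳ-< 0<s t<s))
      where 0<s = ≤-<-trans 0≤t t<s

    -x>0 : ∀ {x} → x < 0# → 0# < - x
    -x>0 {x} x<0 = <-respʳ-≈ (+-identityˡ (- x)) (<-respˡ-≈ (-‿inverseʳ x) (+-monoˡ-< (- x) x<0))

  square-nonneg : ∀ x → 0# ≤ x * x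
  square-nonneg x with compare x 0#
  ... | tri> _ _ 0<x = inj₁ (*-pos 0<x 0<x)
  ... | tri≈ _ x≈0 _ = inj₂ (sym (trans (*-congʳ x≈0) (zeroˡ x)))
  ... | tri< x<0 _ _ = inj₁ (<-respʳ-≈ -x*-x≈x*x (*-pos (-x>0 x<0) (-x>0 x<0)))
    where
    -x*-x≈x*x : - x * - x ≈ x * x
    -x*-x≈x*x = trans (sym (-‿distribˡ-* x (- x)))
      (trans (-‿cong (sym (-‿distribʳ-* x x))) (-‿involutive (x * x)))

  sum-of-squares-nonneg : ∀ x y → 0# ≤ x * x + y * y
  sum-of-squares-nonneg x y = ≤-trans (square-nonneg x) (x≤x+p (x * x) (square-nonneg y))

  private
    0<1 : 0# < 1#
    0<1 with square-nonneg 1#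
    ... | inj₁ 0<1*1 = <-respʳ-≈ (*-identityˡ 1#) 0<1*1
    ... | inj₂ 0≈1*1 = contradiction (trans 0≈1*1 (*-identityˡ 1#)) 0≉1

    ≉-of-pos : ∀ {x} → 0# < x → x ≉ 0#
    ≉-of-pos 0<x x≈0 = <-irrefl (sym x≈0) 0<x

    ⁻¹-pos : ∀ {x} → 0# < x → 0# < x ⁻¹
    ⁻¹-pos {x} 0<x with compare 0# (x ⁻¹)
    ... | tri< 0<x⁻¹ _ _ = 0<x⁻¹
    ... | tri≈ _ 0≈x⁻¹ _ = contradiction
      (trans (sym (zeroʳ x)) (trans (*-congˡ 0≈x⁻¹) (⁻¹-inverseʳ x (≉-of-pos 0<x)))) 0≉1
    ... | tri> _ _ x⁻¹<0 = contradiction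
      (<-trans 0<1 (<-respˡ-≈ (⁻¹-inverseʳ x (≉-of-pos 0<x)) (<-respʳ-≈ (zeroʳ x) (*-monoʳ-< 0<x x⁻¹<0))))
      (<-irrefl refl)

    divide : ∀ {x y} → 0# < x → 0# < y → ∃ λ q → 0# < q × x * q ≈ y
    divide {x} {y} 0<x 0<y = y * x ⁻¹ , *-pos 0<y (⁻¹-pos 0<x) ,
      trans (swap-left x y (x ⁻¹)) (trans (*-congˡ (⁻¹-inverseʳ x (≉-of-pos 0<x))) (*-identityʳ y))

    -- If r² < x then r can be enlarged, by h with (2r + 1 + d) h = d where d = x - r².
    enlarge′ : ∀ {x r d h} → 0# ≤ r → 0# < d → x ≈ r * r + d → 0# < h →
               (((r + r) + 1#) + d) * h ≈ d → (r + h) * (r + h) ≤ x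
    enlarge′ {x} {r} {d} {h} 0≤r 0<d x≈r²+d 0<h Dh≈d =
      ≤-trans (inj₂ (square-+ r h)) (≤-trans (+-monoʳ-≤ (r * r) h[2r+h]≤hD)
        (inj₂ (trans (+-congˡ (trans (*-comm h D) Dh≈d)) (sym x≈r²+d))))
      where
      D : Carrier
      D = ((r + r) + 1#) + d

      0<2r+1 : 0# < (r + r) + 1#
      0<2r+1 = pos-+ (≤-trans 0≤r (x≤x+p r 0≤r)) 0<1

      d<D : d < D
      d<D = <-respʳ-≈ (+-comm d ((r + r) + 1#)) (x<x+p d 0<2r+1)

      h≤1 : h ≤ 1#
      h≤1 = ≮⇒≤ λ 1<h → <-irrefl refl (<-trans d<D
        (<-respʳ-≈ Dh≈d (<-respˡ-≈ (*-identityʳ D) (*-monoʳ-< (pos-+ (inj₁ 0<2r+1) 0<d) 1<h))))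

      h[2r+h]≤hD : h * ((r + r) + h) ≤ h * D
      h[2r+h]≤hD = *-monoʳ-≤ (inj₁ 0<h)
        (≤-trans (+-monoʳ-≤ (r + r) h≤1) (x≤x+p ((r + r) + 1#) (inj₁ 0<d)))

    enlarge : ∀ {x r} → 0# ≤ r → r * r < x → ∃ λ h → 0# < h × (r + h) * (r + h) ≤ x
    enlarge {x} {r} 0≤r r²<x =
      let d , 0<d , x≈r²+d = gap r²<x
          0<D = pos-+ (inj₁ (pos-+ (≤-trans 0≤r (x≤x+p r 0≤r)) 0<1)) 0<d
          h , 0<h , Dh≈d = divide 0<D 0<d
      in h , 0<h , enlarge′ 0≤r 0<d x≈r²+d 0<h Dh≈d

    -- If x < r² then r can be replaced by t = (r² + x) / 2r.
    shrink′ : ∀ {x r d u} → 0# ≤ x → r * r ≈ x + d → 0# < d → 0# < u → (r + r) * u ≈ 1# →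
              ∃ λ t → t < r × 0# ≤ t × x ≤ t * t
    shrink′ {x} {r} {d} {u} 0≤x r²≈x+d 0<d 0<u 2ru≈1 =
      t , <-respʳ-≈ t+e≈r (x<x+p t (*-pos 0<d 0<u)) ,
      *-nonneg (inj₁ (pos-+ (≤-trans 0≤x (x≤x+p x 0≤x)) 0<d)) (inj₁ 0<u) ,
      ≤-trans (x≤x+p x (square-nonneg e)) (inj₂ (sym t²≈x+e²))
      where
      t e : Carrier
      t = ((x + x) + d) * u
      e = d * u

      x+d≈r² : x + d ≈ r * r
      x+d≈r² = sym r²≈x+d

      t+e≈r : t + e ≈ r
      t+e≈r = trans (regroup x d u) (trans (*-congʳ (+-cong x+d≈r² x+d≈r²))
        (trans (double-square r u) (trans (*-congˡ 2ru≈1) (*-identityʳ r))))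

      4[x+d]u²≈1 : ((x + d) + (x + d) + ((x + d) + (x + d))) * (u * u) ≈ 1#
      4[x+d]u²≈1 = trans
        (*-congʳ (+-cong (+-cong x+d≈r² x+d≈r²) (+-cong x+d≈r² x+d≈r²)))
        (trans (quadruple-square r u) (trans (*-cong 2ru≈1 2ru≈1) (*-identityˡ 1#)))

      t²≈x+e² : t * t ≈ x + e * e
      t²≈x+e² = trans (complete-square x d u)
        (+-congʳ (trans (*-congˡ 4[x+d]u²≈1) (*-identityʳ x)))

    shrink : ∀ {x r} → 0# ≤ x → 0# ≤ r → x < r * r → ∃ λ t → t < r × 0# ≤ t × x ≤ t * t
    shrink {x} {r} 0≤x (inj₂ 0≈r) x<r² = contradiction
      (<-respʳ-≈ (trans (*-congʳ (sym 0≈r)) (zeroˡ r)) x<r²) (≤⇒≯ 0≤x)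
    shrink 0≤x (inj₁ 0<r) x<r² =
      let d , 0<d , r²≈x+d = gap x<r²
          0<2r = pos-+ (inj₁ 0<r) 0<r
      in shrink′ 0≤x r²≈x+d 0<d (⁻¹-pos 0<2r) (⁻¹-inverseʳ _ (≉-of-pos 0<2r))

    SquareAtMost : Carrier → Pred Carrier (c ⊔ ℓ₁ ⊔ ℓ₂)
    SquareAtMost x t = Lift (c ⊔ ℓ₁ ⊔ ℓ₂) (t * t ≤ x)

    bound : ∀ {x b} → 0# ≤ b → x ≤ b * b → UpperBound (SquareAtMost x) b
    bound 0≤b x≤b² t (lift t²≤x) = ≮⇒≤ λ b<t →
      ≤⇒≯ (≤-trans t²≤x x≤b²) (square-mono-< 0≤b b<t)

    x≤[x+1]² : ∀ {x} → 0# ≤ x → x ≤ (x + 1#) * (x + 1#)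
    x≤[x+1]² {x} 0≤x = ≤-trans
      (x≤x+p x (inj₁ (pos-+ (≤-trans (square-nonneg x) (x≤x+p (x * x) 0≤x)) 0<1)))
      (inj₂ (x+[x²+x+1] x))

    sup-squares : ∀ {x r} → 0# ≤ x → UpperBound (SquareAtMost x) r →
                  (∀ u → UpperBound (SquareAtMost x) u → r ≤ u) → 0# ≤ r × r * r ≈ x
    sup-squares {x} {r} 0≤x upper least = 0≤r , r²≈x
      where
      0≤r : 0# ≤ r
      0≤r = upper 0# (lift (≤-trans (inj₂ (zeroˡ 0#)) 0≤x))

      r²≈x : r * r ≈ x
      r²≈x with compare (r * r) x
      ... | tri≈ _ eq _   = eq
      ... | tri< r²<x _ _ =
        let h , 0<h , [r+h]²≤x = enlarge 0≤r r²<x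
        in contradiction (x<x+p r 0<h) (≤⇒≯ (upper (r + h) (lift [r+h]²≤x)))
      ... | tri> _ _ x<r² =
        let t , t<r , 0≤t , x≤t² = shrink 0≤x 0≤r x<r²
        in contradiction t<r (≤⇒≯ (least t (bound 0≤t x≤t²)))

  sqrt : ∀ x → 0# ≤ x → ∃ λ r → 0# ≤ r × r * r ≈ x
  sqrt x 0≤x =
    let r , upper , least = supremum (SquareAtMost x)
          (0# , lift (≤-trans (inj₂ (zeroˡ 0#)) 0≤x))
          (x + 1# , bound (inj₁ (pos-+ 0≤x 0<1)) (x≤[x+1]² 0≤x))
    in r , sup-squares 0≤x upper least

------------------------------------------------------------------------
-- The complex numbers

module ComplexNumbers {c ℓ₁ ℓ₂} (F : CompleteOrderedField c ℓ₁ ℓ₂) where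
  private module ℝ = CompleteOrderedField F
  open SquareRoots F using (sqrt; sum-of-squares-nonneg)

  record ℂ : Set c where
    constructor _+i_
    field
      re im : ℝ.Carrier

  open ℂ public

  fromReal : ℝ.Carrier → ℂ
  fromReal x = x +i ℝ.0#

  complexRing : RawRing c ℓ₁
  complexRing = record
    { Carrier = ℂ
    ; _≈_     = λ z w → (re z ℝ.≈ re w) × (im z ℝ.≈ im w)
    ; _+_     = λ z w → (re z ℝ.+ re w) +i (im z ℝ.+ im w)
    ; _*_     = λ z w → (re z ℝ.* re w ℝ.+ ℝ.- (im z ℝ.* im w)) +i
                        (re z ℝ.* im w ℝ.+ im z ℝ.* re w)
    ; -_      = λ z → (ℝ.- re z) +i (ℝ.- im z)
    ; 0#      = fromReal ℝ.0#
    ; 1#      = fromReal ℝ.1#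
    }

  ∣_∣ : ℂ → ℝ.Carrier
  ∣ z ∣ = proj₁ (sqrt (re z ℝ.* re z ℝ.+ im z ℝ.* im z) (sum-of-squares-nonneg (re z) (im z)))

------------------------------------------------------------------------
-- Polynomials in one variable

-- A polynomial is its list of coefficients, constant term first; trailing
-- zeros are allowed, so equality of polynomials is _≋_.

module Polynomials {c ℓ} (R : RawRing c ℓ) where
  open RawRing R
  infix  4 _≋_
  infixl 6 _⊕_
  infixl 7 _·_ _⊗_
  infixr 8 _^_

  Poly : Set c
  Poly = List Carrier

  coeff : Poly → ℕ → Carrier
  coeff []      _       = 0#
  coeff (a ∷ p) zero    = a
  coeff (a ∷ p) (suc k) = coeff p k

  _≋_ : Rel Poly ℓ
  p ≋ q = ∀ k → coeff p k ≈ coeff q k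

  _⊕_ : Poly → Poly → Poly
  []      ⊕ q       = q
  (a ∷ p) ⊕ []      = a ∷ p
  (a ∷ p) ⊕ (b ∷ q) = (a + b) ∷ (p ⊕ q)

  _·_ : Carrier → Poly → Poly
  a · p = map (a *_) p

  _⊗_ : Poly → Poly → Poly
  []      ⊗ q = []
  (a ∷ p) ⊗ q = a · q ⊕ (0# ∷ p ⊗ q)

  _^_ : Poly → ℕ → Poly
  p ^ zero  = 1# ∷ []
  p ^ suc m = p ⊗ p ^ m

  ∑ ∏ : List Poly → Poly
  ∑ = foldr _⊕_ []
  ∏ = foldr _⊗_ (1# ∷ [])

  eval : Poly → Carrier → Carrier
  eval []      z = 0#
  eval (a ∷ p) z = a + z * eval p z

  IsZero : Poly → Carrier → Set ℓ
  IsZero p α = eval p α ≈ 0#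

  X-_ : Carrier → Poly
  X- α = (- α) ∷ 1# ∷ []

  HasMultiplicity : Poly → Carrier → ℕ → Set (c ⊔ ℓ)
  HasMultiplicity p α m = ∃ λ q → p ≋ (X- α) ^ m ⊗ q × ¬ IsZero q α

  IsSimpleZero : Poly → Carrier → Set (c ⊔ ℓ)
  IsSimpleZero p α = HasMultiplicity p α 1

------------------------------------------------------------------------
-- Integer partitions and hook lengths

infix 4 _⊢_ _⊢?_

_⊢_ : List ℕ → ℕ → Set
μ ⊢ n = Linked _≥_ μ × All (_≥ 1) μ × sum μ ≡ n

_⊢?_ : ∀ μ n → Dec (μ ⊢ n)
μ ⊢? n = linked? ℕ._≥?_ μ ×-dec all? (ℕ._≥? 1) μ ×-dec (sum μ ℕ.≟ n)

words : List ℕ → ℕ → List (List ℕ)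
words as zero    = [] ∷ []
words as (suc l) = cartesianProductWith _∷_ as (words as l)

-- A partition of n has at most n parts, each at most n, so this lists every
-- partition of n exactly once.
partitions : ℕ → List (List ℕ)
partitions n = filter (_⊢? n) (concatMap (words (upTo (suc n))) (upTo (suc n)))

-- The cell in column j (counted from 0) of the first row r has arm r ∸ suc j,
-- and its leg is the number of rows below of length greater than j.
hookLengths : List ℕ → List ℕ
hookLengths []       = []
hookLengths (r ∷ rs) =
  map (λ j → suc ((r ∸ suc j) ℕ.+ length (filter (j ℕ.<?_) rs))) (upTo r) ++ hookLengths rs

------------------------------------------------------------------------
-- The Nekrasov–Okounkov polynomials

module NekrasovOkounkov {c ℓ₁ ℓ₂} (F : CompleteOrderedField c ℓ₁ ℓ₂) where
  private module ℝ = CompleteOrderedField F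
  open RawMonoidDefinitions ℝ.+-rawMonoid using () renaming (_×_ to _×ℝ_)
  open CompleteOrderedField F public
    using (_≈_; _<_; 0#)
  open ComplexNumbers F public
  open RawRing complexRing public
    using () renaming (_≈_ to _≈ℂ_; 1# to 1ℂ)
  open Polynomials complexRing public

  fromℕ : ℕ → ℝ.Carrier
  fromℕ n = n ×ℝ ℝ.1#

  -- 1 + z / h²
  hookFactor : ℕ → Poly
  hookFactor h = 1ℂ ∷ fromReal ((fromℕ h ℝ.* fromℕ h) ℝ.⁻¹) ∷ []

  NO : ℕ → Poly
  NO n = ∑ (map (λ μ → ∏ (map hookFactor (hookLengths μ))) (partitions n))

  IsUniqueZeroOfMaximalModulus : Poly → ℂ → Set (c ⊔ ℓ₁ ⊔ ℓ₂)
  IsUniqueZeroOfMaximalModulus p α =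
    IsZero p α × (∀ β → IsZero p β → ¬ (β ≈ℂ α) → ∣ β ∣ ℝ.< ∣ α ∣)

{-# OPTIONS --safe #-}
module Submission where

-- For z = -m² the hook product of 1 + z/h² is a diagonal entry of an explicit kernel V m l l′ in
-- the beta numbers l, l′ of two partitions, consisting of two alternants and a factor of Cauchy
-- type.  The residue theorem yields a commutation relation between V and the operators that move
-- one beta number by k; its trace over the tuples of given sum is
-- n NOₙ(z) = (1 + z) Σⱼ σ(j) NOₙ₋ⱼ(z), first for half-odd m and hence for all z.
--
-- The reciprocal Σ tⱼ qʲ of Σ σ(n + 1) (-q)ⁿ has nonnegative coefficients, and it transforms the
-- recursion into (-1)ⁿ NOₙ(-x) = (x - 1) wₙ, where
--   (x - 1) wₙ = (n + 1) wₙ₊₁ + Σ_{j ≥ 1} tⱼ (n + 1 - j) wₙ₊₁₋ⱼ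
-- is the eigenvalue equation of a nonnegative Hessenberg matrix.  At the largest real zero ρ > 1
-- of wₙ the preceding wₖ are positive.  As in the Perron–Frobenius theorem, the largest ratio
-- ∣wₖ(z)∣ / wₖ(ρ) shows ∣z - 1∣ ≤ ρ - 1 for every zero z, and this disc touches the circle of radius
-- ρ only in ρ.  The same comparison with the derivative, taken in the dual numbers, shows that ρ is simple.

-- The zeros are reached through the divisor recursion, whereas `NO` is given by hook lengths; so
-- the hook-length formula itself has to be proved, and the kernel serves for this. `V` is, up to
-- sign, a Cauchy determinant: an N-particle matrix element of a vertex operator, and the moves of
-- one beta number are the modes of the Heisenberg algebra. With finitely many particles the
-- commutation relations fail near the bottom of the Fermi sea. They survive on tuples that contain
-- 0, ..., k - 1, and taking N = n makes this automatic in the range of sums that the partitions of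
-- n require. Non-integral m keep all denominators m + a - b away from zero, and half-odd m already
-- give infinitely many z.
--
-- The recursion for (-1)ⁿ NOₙ(-x) has alternating signs, so no positivity argument applies to it
-- directly; the reciprocal series is what makes the matrix nonnegative. Its coefficients are
-- themselves given by an alternating recursion. Their positivity follows from tⱼ ≥ 2 tⱼ₋₁ for j ≥
-- 3, which lets the crude bound σ(j) ≤ j² control all but finitely many terms.

open import Defs
open import Algebra.Bundles using (CommutativeRing)
import Algebra.Properties.AbelianGroup as AbProps
import Algebra.Properties.Ring as RingProps
import Algebra.Properties.Semiring.Mult as SMultProps
import Algebra.Solver.Ring as RingSolver
open import Algebra.Solver.Ring.AlmostCommutativeRing using (_-Raw-AlmostCommutative⟶_; fromCommutativeRing)
open import Data.Fin.Base as Fin using (Fin; fromℕ<; punchIn; suc; toℕ; zero)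
import Data.Fin.Properties as Fin
open import Data.Integer.Base as ℤ using (+_; -[1+_]; _⊖_; ℤ)
import Data.Integer.Properties as ℤ
import Data.Integer.Solver as ℤSolver
open import Data.List.Base as List using (List; []; _++_; _∷_; applyUpTo; cartesianProductWith; concatMap; filter; length; map; upTo)
import Data.List.Properties as List
open import Data.List.Relation.Unary.All as All using (All; []; _∷_)
import Data.List.Relation.Unary.All.Properties as All
open import Data.List.Relation.Unary.AllPairs using (AllPairs; []; _∷_)
import Data.List.Relation.Unary.AllPairs.Properties as AllPairs
open import Data.List.Relation.Unary.Linked as Linked using (Linked; [-]; []; _∷_)
open import Data.Maybe.Base using (Maybe; just; nothing)
open import Data.Nat.Base as ℕ using (_!; _≥_; suc; s≤s; zero; z≤n; ℕ)
open import Data.Nat.Divisibility using (_∣?_; divides; ∣⇒≤)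
import Data.Nat.ListAction as ℕ
import Data.Nat.Properties as ℕ
open import Data.Nat.Solver using (module +-*-Solver)
open import Data.Product.Base using (_,_; _×_; proj₁; proj₂; ∃; ∃₂)
open import Data.Sum.Base using (_⊎_; inj₁; inj₂)
open import Data.Unit.Base using (tt; ⊤)
open import Data.Vec.Base as Vec using (Vec; []; _[_]≔_; _∷_; lookup)
import Data.Vec.Properties as Vec
open import Function.Base using (_∘_; id)
open import Level using (Lift; _⊔_; lift)
open import Relation.Binary.Definitions using (tri<; tri>; tri≈)
open import Relation.Binary.PropositionalEquality as ≡ using (_≡_; _≢_)
import Relation.Binary.Reasoning.Setoid as SetoidReasoning
open import Relation.Binary.Structures using (IsStrictTotalOrder)
open import Relation.Nullary using (Dec; contradiction; no; yes; ¬_)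
open import Relation.Nullary.Decidable using (True; _×-dec_; toWitness)
open import Relation.Unary using (Decidable)

-- Sums, products and inequalities

module IntegerSolver {c ℓ} (R : CommutativeRing c ℓ) where
  open CommutativeRing R hiding (zero)
  open SMultProps semiring using (×-homo-+; ×1-homo-*) renaming (_×_ to _×ₙ_)
  open RingProps ring using (-‿involutive; -‿distribˡ-*; -0#≈0#)
  open AbProps +-abelianGroup using (⁻¹-∙-comm)
  open SetoidReasoning setoid

  nat : ℕ → Carrier
  nat n = n ×ₙ 1#

  nat-+ : ∀ m n → nat (m ℕ.+ n) ≈ nat m + nat n
  nat-+ = ×-homo-+ 1#

  nat-* : ∀ m n → nat (m ℕ.* n) ≈ nat m * nat n
  nat-* = ×1-homo-*

  nat-cong : ∀ {m n} → m ≡ n → nat m ≈ nat n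
  nat-cong ≡.refl = refl

  private
    int₀ : ℤ → Carrier
    int₀ (+ n)    = nat n
    int₀ -[1+ n ] = - nat (suc n)

    int₀-cong : ∀ {i j} → i ≡ j → int₀ i ≈ int₀ j
    int₀-cong ≡.refl = refl

    cancel : ∀ x y z → (x + y) + - (x + z) ≈ y + - z
    cancel x y z = begin
      (x + y) + - (x + z)   ≈⟨ +-cong (+-comm x y) (sym (⁻¹-∙-comm x z)) ⟩
      (y + x) + (- x + - z) ≈⟨ +-assoc y x _ ⟩
      y + (x + (- x + - z)) ≈⟨ +-congˡ (sym (+-assoc x _ _)) ⟩
      y + ((x + - x) + - z) ≈⟨ +-congˡ (trans (+-congʳ (-‿inverseʳ x)) (+-identityˡ _)) ⟩
      y + - z               ∎

    int₀-⊖ : ∀ m n → int₀ (m ⊖ n) ≈ nat m + - nat n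
    int₀-⊖ m       zero    = sym (trans (+-congˡ -0#≈0#) (+-identityʳ _))
    int₀-⊖ zero    (suc n) = sym (+-identityˡ _)
    int₀-⊖ (suc m) (suc n) = begin
      int₀ (suc m ⊖ suc n)   ≈⟨ int₀-cong (ℤ.[1+m]⊖[1+n]≡m⊖n m n) ⟩
      int₀ (m ⊖ n)           ≈⟨ int₀-⊖ m n ⟩
      nat m + - nat n       ≈⟨ cancel 1# _ _ ⟨
      nat (suc m) + - nat (suc n) ∎

    int₀-neg : ∀ i → int₀ (ℤ.- i) ≈ - int₀ i
    int₀-neg (+ zero)  = sym -0#≈0#
    int₀-neg (+ suc n) = refl
    int₀-neg -[1+ n ]  = sym (-‿involutive _)

    int₀-+ : ∀ i j → int₀ (i ℤ.+ j) ≈ int₀ i + int₀ j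
    int₀-+ (+ m)    (+ n)    = nat-+ m n
    int₀-+ (+ m)    -[1+ n ] = int₀-⊖ m (suc n)
    int₀-+ -[1+ m ] (+ n)    = trans (int₀-⊖ n (suc m)) (+-comm _ _)
    int₀-+ -[1+ m ] -[1+ n ] = begin
      - nat (suc (suc (m ℕ.+ n)))   ≈⟨ -‿cong (nat-cong (≡.cong suc (≡.sym (ℕ.+-suc m n)))) ⟩
      - nat (suc m ℕ.+ suc n)       ≈⟨ -‿cong (nat-+ (suc m) (suc n)) ⟩
      - (nat (suc m) + nat (suc n)) ≈⟨ ⁻¹-∙-comm _ _ ⟨
      - nat (suc m) + - nat (suc n) ∎

    int₀-*⁺ : ∀ m j → int₀ (+ m ℤ.* j) ≈ nat m * int₀ j
    int₀-*⁺ zero    j = trans (int₀-cong (ℤ.*-zeroˡ j)) (sym (zeroˡ _))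
    int₀-*⁺ (suc m) j = begin
      int₀ (+ suc m ℤ.* j)       ≈⟨ int₀-cong (ℤ.suc-* (+ m) j) ⟩
      int₀ (j ℤ.+ + m ℤ.* j)     ≈⟨ int₀-+ j (+ m ℤ.* j) ⟩
      int₀ j + int₀ (+ m ℤ.* j)   ≈⟨ +-cong (sym (*-identityˡ _)) (int₀-*⁺ m j) ⟩
      1# * int₀ j + nat m * int₀ j ≈⟨ distribʳ _ _ _ ⟨
      nat (suc m) * int₀ j       ∎

    int₀-* : ∀ i j → int₀ (i ℤ.* j) ≈ int₀ i * int₀ j
    int₀-* (+ m)    j = int₀-*⁺ m j
    int₀-* -[1+ m ] j = begin
      int₀ (-[1+ m ] ℤ.* j)        ≈⟨ int₀-cong (≡.sym (ℤ.neg-distribˡ-* (+ suc m) j)) ⟩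
      int₀ (ℤ.- (+ suc m ℤ.* j))   ≈⟨ int₀-neg (+ suc m ℤ.* j) ⟩
      - int₀ (+ suc m ℤ.* j)       ≈⟨ -‿cong (int₀-*⁺ (suc m) j) ⟩
      - (nat (suc m) * int₀ j)     ≈⟨ -‿distribˡ-* _ _ ⟩
      - nat (suc m) * int₀ j       ∎

  -- Agrees with int₀, but sends 1 to 1# definitionally, so that solver
  -- constants match the ring's own unit.
  int : ℤ → Carrier
  int (+ 1) = 1#
  int i     = int₀ i

  int-cong : ∀ {i j} → i ≡ j → int i ≈ int j
  int-cong ≡.refl = refl

  int≈int₀ : ∀ i → int i ≈ int₀ i
  int≈int₀ (+ zero)        = refl
  int≈int₀ (+ suc zero)    = sym (+-identityʳ 1#)
  int≈int₀ (+ suc (suc n)) = refl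
  int≈int₀ -[1+ n ]        = refl

  int-nat : ∀ n → int (+ n) ≈ nat n
  int-nat n = int≈int₀ (+ n)

  int-neg : ∀ i → int (ℤ.- i) ≈ - int i
  int-neg i = trans (int≈int₀ (ℤ.- i)) (trans (int₀-neg i) (-‿cong (sym (int≈int₀ i))))

  int-+ : ∀ i j → int (i ℤ.+ j) ≈ int i + int j
  int-+ i j = trans (int≈int₀ (i ℤ.+ j)) (trans (int₀-+ i j) (+-cong (sym (int≈int₀ i)) (sym (int≈int₀ j))))

  int-* : ∀ i j → int (i ℤ.* j) ≈ int i * int j
  int-* i j = trans (int≈int₀ (i ℤ.* j)) (trans (int₀-* i j) (*-cong (sym (int≈int₀ i)) (sym (int≈int₀ j))))

  private
    morphism : ℤ.+-*-rawRing -Raw-AlmostCommutative⟶ fromCommutativeRing R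
    morphism = record
      { ⟦_⟧    = int
      ; +-homo = int-+
      ; *-homo = int-*
      ; -‿homo = int-neg
      ; 0-homo = refl
      ; 1-homo = refl
      }

    _≟_ : ∀ i j → Maybe (int i ≈ int j)
    i ≟ j with i ℤ.≟ j
    ... | yes i≡j = just (int-cong i≡j)
    ... | no  _   = nothing

  open RingSolver ℤ.+-*-rawRing (fromCommutativeRing R) morphism _≟_ public
    using (solve; con; _:=_; _:+_; _:*_; _:-_; :-_)

module Sums {c ℓ} (R : CommutativeRing c ℓ) where
  open CommutativeRing R hiding (zero)
  open IntegerSolver R
  open SetoidReasoning setoid

  ∑ : ∀ n → (Fin n → Carrier) → Carrier
  ∑ zero    f = 0#
  ∑ (suc n) f = f zero + ∑ n (f ∘ suc)

  ∑-cong : ∀ n {f g} → (∀ i → f i ≈ g i) → ∑ n f ≈ ∑ n g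
  ∑-cong zero    eq = refl
  ∑-cong (suc n) eq = +-cong (eq zero) (∑-cong n (eq ∘ suc))

  ∑-zero : ∀ n {f} → (∀ i → f i ≈ 0#) → ∑ n f ≈ 0#
  ∑-zero zero    eq = refl
  ∑-zero (suc n) eq = trans (+-cong (eq zero) (∑-zero n (eq ∘ suc))) (+-identityˡ 0#)

  private
    interchange : ∀ a b c d → (a + b) + (c + d) ≈ (a + c) + (b + d)
    interchange = solve 4 (λ a b c d → (a :+ b) :+ (c :+ d) := (a :+ c) :+ (b :+ d)) refl

  ∑-+ : ∀ n f g → ∑ n (λ i → f i + g i) ≈ ∑ n f + ∑ n g
  ∑-+ zero    f g = sym (+-identityˡ 0#)
  ∑-+ (suc n) f g = trans (+-congˡ (∑-+ n _ _)) (interchange _ _ _ _)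

  ∑-* : ∀ n k f → ∑ n (λ i → k * f i) ≈ k * ∑ n f
  ∑-* zero    k f = sym (zeroʳ k)
  ∑-* (suc n) k f = trans (+-congˡ (∑-* n k _)) (sym (distribˡ _ _ _))

  ∑-const : ∀ n x → ∑ n (λ _ → x) ≈ nat n * x
  ∑-const zero    x = sym (zeroˡ x)
  ∑-const (suc n) x = trans (+-cong (sym (*-identityˡ x)) (∑-const n x)) (sym (distribʳ x 1# (nat n)))

  ∑-swap : ∀ m n (f : Fin m → Fin n → Carrier) →
           ∑ m (λ i → ∑ n (f i)) ≈ ∑ n (λ j → ∑ m (λ i → f i j))
  ∑-swap zero    n f = sym (∑-zero n (λ _ → refl))
  ∑-swap (suc m) n f = trans (+-congˡ (∑-swap m n (f ∘ suc))) (sym (∑-+ n _ _))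

  ∑-single : ∀ n {f} i → (∀ j → j ≢ i → f j ≈ 0#) → ∑ n f ≈ f i
  ∑-single (suc n) zero    vanish =
    trans (+-congˡ (∑-zero n (λ j → vanish (suc j) λ ()))) (+-identityʳ _)
  ∑-single (suc n) (suc i) vanish =
    trans (+-cong (vanish zero λ ()) (∑-single n i (λ j j≢i → vanish (suc j) (j≢i ∘ Fin.suc-injective))))
      (+-identityˡ _)

  ∑-pair : ∀ n {f} i j → i ≢ j → (∀ k → k ≢ i → k ≢ j → f k ≈ 0#) → ∑ n f ≈ f i + f j
  ∑-pair (suc n) zero    zero    i≢j vanish = contradiction ≡.refl i≢j
  ∑-pair (suc n) zero    (suc j) i≢j vanish =
    +-congˡ (∑-single n j (λ k k≢j → vanish (suc k) (λ ()) (k≢j ∘ Fin.suc-injective)))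
  ∑-pair (suc n) (suc i) zero    i≢j vanish = trans
    (+-congˡ (∑-single n i (λ k k≢i → vanish (suc k) (k≢i ∘ Fin.suc-injective) (λ ()))))
    (+-comm _ _)
  ∑-pair (suc n) (suc i) (suc j) i≢j vanish = trans
    (+-cong (vanish zero (λ ()) (λ ()))
      (∑-pair n i j (i≢j ∘ ≡.cong suc) (λ k k≢i k≢j → vanish (suc k) (k≢i ∘ Fin.suc-injective) (k≢j ∘ Fin.suc-injective))))
    (+-identityˡ _)

  ∑< : ℕ → (ℕ → Carrier) → Carrier
  ∑< zero    f = 0#
  ∑< (suc n) f = f 0 + ∑< n (f ∘ suc)

  ∑<-cong : ∀ n {f g} → (∀ i → i ℕ.< n → f i ≈ g i) → ∑< n f ≈ ∑< n g
  ∑<-cong zero    eq = refl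
  ∑<-cong (suc n) eq = +-cong (eq 0 (s≤s z≤n)) (∑<-cong n (λ i i<n → eq (suc i) (s≤s i<n)))

  ∑<-+ : ∀ n f g → ∑< n (λ i → f i + g i) ≈ ∑< n f + ∑< n g
  ∑<-+ zero    f g = sym (+-identityˡ 0#)
  ∑<-+ (suc n) f g = trans (+-congˡ (∑<-+ n _ _)) (interchange _ _ _ _)

  ∑<-* : ∀ n k f → ∑< n (λ i → k * f i) ≈ k * ∑< n f
  ∑<-* zero    k f = sym (zeroʳ k)
  ∑<-* (suc n) k f = trans (+-congˡ (∑<-* n k _)) (sym (distribˡ _ _ _))

  ∑<-zero : ∀ n {f} → (∀ i → i ℕ.< n → f i ≈ 0#) → ∑< n f ≈ 0#
  ∑<-zero zero    eq = refl
  ∑<-zero (suc n) eq = trans (+-cong (eq 0 (s≤s z≤n)) (∑<-zero n (λ i i<n → eq (suc i) (s≤s i<n)))) (+-identityˡ 0#)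

  ∑<-neg : ∀ n f → ∑< n (λ i → - f i) ≈ - ∑< n f
  ∑<-neg zero    f = solve 0 (con (+ 0) := :- con (+ 0)) refl
  ∑<-neg (suc n) f = trans (+-congˡ (∑<-neg n _)) (solve 2 (λ a b → (:- a) :+ (:- b) := :- (a :+ b)) refl _ _)

  ∑<-const : ∀ n x → ∑< n (λ _ → x) ≈ nat n * x
  ∑<-const zero    x = sym (zeroˡ x)
  ∑<-const (suc n) x = trans (+-cong (sym (*-identityˡ x)) (∑<-const n x)) (sym (distribʳ x 1# (nat n)))

  ∑<-swap : ∀ m n (f : ℕ → ℕ → Carrier) →
            ∑< m (λ i → ∑< n (f i)) ≈ ∑< n (λ j → ∑< m (λ i → f i j))
  ∑<-swap zero    n f = sym (∑<-zero n (λ _ _ → refl))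
  ∑<-swap (suc m) n f = trans (+-congˡ (∑<-swap m n (f ∘ suc))) (sym (∑<-+ n _ _))

  -- Both sides run over the pairs `(j , i)` with `j + i ≤ n`; on the right `s = j + i`.
  ∑<-triangle : ∀ n (h : ℕ → ℕ → Carrier) →
                ∑< (suc n) (λ j → ∑< (suc (n ℕ.∸ j)) (h j)) ≈ ∑< (suc n) (λ s → ∑< (suc s) (λ j → h j (s ℕ.∸ j)))
  ∑<-triangle zero    h = refl
  ∑<-triangle (suc n) h = begin
    ∑< (suc (suc n)) (h 0) + ∑< (suc n) (λ j → ∑< (suc (n ℕ.∸ j)) (h (suc j)))
      ≈⟨ +-congˡ (∑<-triangle n (h ∘ suc)) ⟩
    (h 0 0 + ∑< (suc n) (λ s → h 0 (suc s))) + ∑< (suc n) (λ s → ∑< (suc s) (λ j → h (suc j) (s ℕ.∸ j)))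
      ≈⟨ trans (+-assoc _ _ _) (+-congˡ (sym (∑<-+ (suc n) (λ s → h 0 (suc s)) (λ s → ∑< (suc s) (λ j → h (suc j) (s ℕ.∸ j)))))) ⟩
    h 0 0 + ∑< (suc n) (λ s → h 0 (suc s) + ∑< (suc s) (λ j → h (suc j) (s ℕ.∸ j)))
      ≈⟨ +-congʳ (+-identityʳ (h 0 0)) ⟨
    ∑< (suc (suc n)) (λ s → ∑< (suc s) (λ j → h j (s ℕ.∸ j))) ∎

  ∑<-∑-swap : ∀ m n (f : ℕ → Fin n → Carrier) →
              ∑< m (λ i → ∑ n (f i)) ≈ ∑ n (λ j → ∑< m (λ i → f i j))
  ∑<-∑-swap zero    n f = sym (∑-zero n (λ _ → refl))
  ∑<-∑-swap (suc m) n f = trans (+-congˡ (∑<-∑-swap m n (f ∘ suc))) (sym (∑-+ n _ _))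

  ∑<-last : ∀ n f → ∑< (suc n) f ≈ ∑< n f + f n
  ∑<-last zero    f = trans (+-identityʳ _) (sym (+-identityˡ _))
  ∑<-last (suc n) f = trans (+-congˡ (∑<-last n (f ∘ suc))) (sym (+-assoc _ _ _))

  ∑<-split : ∀ m n f → ∑< (m ℕ.+ n) f ≈ ∑< m f + ∑< n (f ∘ (m ℕ.+_))
  ∑<-split zero    n f = sym (+-identityˡ _)
  ∑<-split (suc m) n f = trans (+-congˡ (∑<-split m n (f ∘ suc))) (sym (+-assoc _ _ _))

  ∑<-extend : ∀ {m n} {f} → m ℕ.≤ n → (∀ i → m ℕ.≤ i → i ℕ.< n → f i ≈ 0#) → ∑< n f ≈ ∑< m f
  ∑<-extend {m} {n} {f} m≤n vanish = begin
    ∑< n f                                  ≡⟨ ≡.cong (λ n → ∑< n f) (≡.sym (ℕ.m+[n∸m]≡n m≤n)) ⟩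
    ∑< (m ℕ.+ (n ℕ.∸ m)) f                  ≈⟨ ∑<-split m (n ℕ.∸ m) f ⟩
    ∑< m f + ∑< (n ℕ.∸ m) (f ∘ (m ℕ.+_))    ≈⟨ +-congˡ (∑<-zero (n ℕ.∸ m) λ i i< → vanish (m ℕ.+ i) (ℕ.m≤m+n m i)
                                                  (≡.subst (m ℕ.+ i ℕ.<_) (ℕ.m+[n∸m]≡n m≤n) (ℕ.+-monoʳ-< m i<))) ⟩
    ∑< m f + 0#                             ≈⟨ +-identityʳ _ ⟩
    ∑< m f                                  ∎

  ∑<-reverse : ∀ n f → ∑< (suc n) f ≈ ∑< (suc n) (λ i → f (n ℕ.∸ i))
  ∑<-reverse zero    f = refl
  ∑<-reverse (suc n) f = begin
    ∑< (suc (suc n)) f                              ≈⟨ ∑<-last (suc n) f ⟩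
    ∑< (suc n) f + f (suc n)                        ≈⟨ +-comm _ _ ⟩
    f (suc n) + ∑< (suc n) f                        ≈⟨ +-congˡ (∑<-reverse n f) ⟩
    f (suc n) + ∑< (suc n) (λ i → f (n ℕ.∸ i))      ∎

  ∑<-single : ∀ n {f} i → i ℕ.< n → (∀ j → j ≢ i → f j ≈ 0#) → ∑< n f ≈ f i
  ∑<-single (suc n) zero    i<n vanish =
    trans (+-congˡ (∑<-zero n (λ j _ → vanish (suc j) λ ()))) (+-identityʳ _)
  ∑<-single (suc n) (suc i) i<n vanish = trans
    (+-cong (vanish 0 λ ()) (∑<-single n i (ℕ.s≤s⁻¹ i<n) (λ j j≢i → vanish (suc j) (j≢i ∘ ℕ.suc-injective))))
    (+-identityˡ _)

  ⟦_⟧ : ∀ {p} {P : Set p} → Dec P → Carrier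
  ⟦ yes _ ⟧ = 1#
  ⟦ no  _ ⟧ = 0#

  ⟦⟧-yes : ∀ {p} {P : Set p} (d : Dec P) → P → ⟦ d ⟧ ≈ 1#
  ⟦⟧-yes (yes _) p = refl
  ⟦⟧-yes (no ¬p) p = contradiction p ¬p

  ⟦⟧-no : ∀ {p} {P : Set p} (d : Dec P) → ¬ P → ⟦ d ⟧ ≈ 0#
  ⟦⟧-no (yes p) ¬p = contradiction p ¬p
  ⟦⟧-no (no _)  ¬p = refl

  ⟦⟧-⇔ : ∀ {p q} {P : Set p} {Q : Set q} (d : Dec P) (e : Dec Q) → (P → Q) → (Q → P) → ⟦ d ⟧ ≈ ⟦ e ⟧
  ⟦⟧-⇔ (yes p) e f g = sym (⟦⟧-yes e (f p))
  ⟦⟧-⇔ (no ¬p) e f g = sym (⟦⟧-no e (¬p ∘ g))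

module OrderedField {c ℓ₁ ℓ₂} (F : CompleteOrderedField c ℓ₁ ℓ₂) where
  open CompleteOrderedField F hiding (zero)
  open IntegerSolver commutativeRing
  open IsStrictTotalOrder isStrictTotalOrder public
    using (compare; <-respʳ-≈; <-respˡ-≈; _≟_)
    renaming (trans to <-trans; irrefl to <-irrefl)
  open SetoidReasoning setoid

  ≤-refl : ∀ {x} → x ≤ x
  ≤-refl = inj₂ refl

  ≤-respʳ : ∀ {x y z} → y ≈ z → x ≤ y → x ≤ z
  ≤-respʳ y≈z (inj₁ x<y) = inj₁ (<-respʳ-≈ y≈z x<y)
  ≤-respʳ y≈z (inj₂ x≈y) = inj₂ (trans x≈y y≈z)

  ≤-respˡ : ∀ {x y z} → x ≈ y → x ≤ z → y ≤ z
  ≤-respˡ x≈y (inj₁ x<z) = inj₁ (<-respˡ-≈ x≈y x<z)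
  ≤-respˡ x≈y (inj₂ x≈z) = inj₂ (trans (sym x≈y) x≈z)

  ≤-<-trans : ∀ {x y z} → x ≤ y → y < z → x < z
  ≤-<-trans (inj₁ x<y) y<z = <-trans x<y y<z
  ≤-<-trans (inj₂ x≈y) y<z = <-respˡ-≈ (sym x≈y) y<z

  <-≤-trans : ∀ {x y z} → x < y → y ≤ z → x < z
  <-≤-trans x<y (inj₁ y<z) = <-trans x<y y<z
  <-≤-trans x<y (inj₂ y≈z) = <-respʳ-≈ y≈z x<y

  ≤-trans : ∀ {x y z} → x ≤ y → y ≤ z → x ≤ z
  ≤-trans (inj₁ x<y) y≤z = inj₁ (<-≤-trans x<y y≤z)
  ≤-trans (inj₂ x≈y) y≤z = ≤-respˡ (sym x≈y) y≤z

  ≤⇒≯ : ∀ {x y} → x ≤ y → ¬ (y < x)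
  ≤⇒≯ x≤y y<x = <-irrefl refl (≤-<-trans x≤y y<x)

  ≮⇒≥ : ∀ {x y} → ¬ (x < y) → y ≤ x
  ≮⇒≥ {x} {y} x≮y with compare x y
  ... | tri< x<y _ _ = contradiction x<y x≮y
  ... | tri≈ _ x≈y _ = inj₂ (sym x≈y)
  ... | tri> _ _ y<x = inj₁ y<x

  ≤-antisym : ∀ {x y} → x ≤ y → y ≤ x → x ≈ y
  ≤-antisym (inj₂ x≈y) _   = x≈y
  ≤-antisym (inj₁ x<y) y≤x = contradiction x<y (≤⇒≯ y≤x)

  ≤-total : ∀ x y → x ≤ y ⊎ y ≤ x
  ≤-total x y with compare x y
  ... | tri< x<y _ _ = inj₁ (inj₁ x<y)
  ... | tri≈ _ x≈y _ = inj₁ (inj₂ x≈y)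
  ... | tri> _ _ y<x = inj₂ (inj₁ y<x)

  +-mono-≤ : ∀ {x y u v} → x ≤ y → u ≤ v → x + u ≤ y + v
  +-mono-≤ {x} {y} {u} {v} x≤y u≤v = ≤-trans (right x≤y) (≤-respʳ (+-comm v y) (≤-respˡ (+-comm u y) (right u≤v)))
    where
    right : ∀ {x y z} → x ≤ y → x + z ≤ y + z
    right (inj₁ x<y) = inj₁ (+-monoˡ-< _ x<y)
    right (inj₂ x≈y) = inj₂ (+-congʳ x≈y)

  +-mono-<-≤ : ∀ {x y u v} → x < y → u ≤ v → x + u < y + v
  +-mono-<-≤ x<y u≤v = <-≤-trans (+-monoˡ-< _ x<y) (+-mono-≤ ≤-refl u≤v)

  0≤+ : ∀ {x y} → 0# ≤ x → 0# ≤ y → 0# ≤ x + y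
  0≤+ 0≤x 0≤y = ≤-respˡ (+-identityˡ 0#) (+-mono-≤ 0≤x 0≤y)

  0<+ : ∀ {x y} → 0# < x → 0# ≤ y → 0# < x + y
  0<+ 0<x 0≤y = <-respˡ-≈ (+-identityˡ 0#) (+-mono-<-≤ 0<x 0≤y)

  0≤* : ∀ {x y} → 0# ≤ x → 0# ≤ y → 0# ≤ x * y
  0≤* (inj₁ 0<x) (inj₁ 0<y) = inj₁ (*-pos 0<x 0<y)
  0≤* {x} _ (inj₂ 0≈y) = inj₂ (sym (trans (*-congˡ (sym 0≈y)) (zeroʳ x)))
  0≤* {x} {y} (inj₂ 0≈x) _ = inj₂ (sym (trans (*-congʳ (sym 0≈x)) (zeroˡ y)))

  -- Inequalities are proved by exhibiting the difference as a nonnegative expression.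
  ≤-by : ∀ {x y d} → 0# ≤ d → x + d ≈ y → x ≤ y
  ≤-by {x} 0≤d x+d≈y = ≤-respʳ x+d≈y (≤-respˡ (+-identityʳ x) (+-mono-≤ ≤-refl 0≤d))

  <-by : ∀ {x y d} → 0# < d → x + d ≈ y → x < y
  <-by {x} {d = d} 0<d x+d≈y = <-respʳ-≈ (trans (+-comm d x) x+d≈y)
    (<-respˡ-≈ (+-identityˡ x) (+-monoˡ-< x 0<d))

  ≤-diff : ∀ {x y} → x ≤ y → 0# ≤ y - x
  ≤-diff {x} x≤y = ≤-respˡ (-‿inverseʳ x) (+-mono-≤ x≤y ≤-refl)

  <-diff : ∀ {x y} → x < y → 0# < y - x
  <-diff {x} x<y = <-respˡ-≈ (-‿inverseʳ x) (+-monoˡ-< (- x) x<y)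

  *-monoˡ-≤ : ∀ {x y z} → 0# ≤ z → x ≤ y → z * x ≤ z * y
  *-monoˡ-≤ {x} {y} {z} 0≤z x≤y = ≤-by (0≤* 0≤z (≤-diff x≤y))
    (solve 3 (λ x y z → z :* x :+ z :* (y :- x) := z :* y) refl x y z)

  *-monoˡ-< : ∀ {x y z} → 0# < z → x < y → z * x < z * y
  *-monoˡ-< {x} {y} {z} 0<z x<y = <-by (*-pos 0<z (<-diff x<y))
    (solve 3 (λ x y z → z :* x :+ z :* (y :- x) := z :* y) refl x y z)

  <⇒≉ : ∀ {x y} → x < y → x ≉ y
  <⇒≉ x<y x≈y = <-irrefl x≈y x<y

  >⇒≉ : ∀ {x y} → y < x → x ≉ y
  >⇒≉ y<x x≈y = <-irrefl (sym x≈y) y<x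

  0<1 : 0# < 1#
  0<1 with compare 0# 1#
  ... | tri< 0<1 _ _ = 0<1
  ... | tri≈ _ 0≈1 _ = contradiction 0≈1 0≉1
  ... | tri> _ _ 1<0 = contradiction
    (<-by (*-pos (<-diff 1<0) (<-diff 1<0)) (solve 1 (λ z → con (+ 0) :+ (con (+ 0) :- con (+ 1)) :* (con (+ 0) :- con (+ 1)) := con (+ 1)) refl 0#))
    (λ 0<1 → <-irrefl refl (<-trans 0<1 1<0))

  0≤nat : ∀ n → 0# ≤ nat n
  0≤nat zero    = ≤-refl
  0≤nat (suc n) = 0≤+ (inj₁ 0<1) (0≤nat n)

  0<nat : ∀ n → 0# < nat (suc n)
  0<nat n = 0<+ 0<1 (0≤nat n)

  nat-mono-≤ : ∀ {m n} → m ℕ.≤ n → nat m ≤ nat n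
  nat-mono-≤ {m} {n} m≤n = ≤-by (0≤nat (n ℕ.∸ m))
    (trans (sym (nat-+ m (n ℕ.∸ m))) (nat-cong (ℕ.m+[n∸m]≡n m≤n)))

  nat-mono-< : ∀ {m n} → m ℕ.< n → nat m < nat n
  nat-mono-< {m} m<n = <-≤-trans (<-by 0<1 (+-comm (nat m) 1#)) (nat-mono-≤ m<n)

  nat-injective : ∀ {m n} → nat m ≈ nat n → m ≡ n
  nat-injective {m} {n} eq with ℕ.<-cmp m n
  ... | tri< m<n _ _ = contradiction eq (<⇒≉ (nat-mono-< m<n))
  ... | tri≈ _ m≡n _ = m≡n
  ... | tri> _ _ n<m = contradiction eq (>⇒≉ (nat-mono-< n<m))

  inv-unique : ∀ {x y} → x * y ≈ 1# → x ⁻¹ ≈ y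
  inv-unique {x} {y} xy≈1 = begin
    x ⁻¹             ≈⟨ *-identityʳ _ ⟨
    x ⁻¹ * 1#        ≈⟨ *-congˡ xy≈1 ⟨
    x ⁻¹ * (x * y)   ≈⟨ solve 3 (λ i x y → i :* (x :* y) := (x :* i) :* y) refl _ _ _ ⟩
    (x * x ⁻¹) * y   ≈⟨ *-congʳ (⁻¹-inverseʳ x x≉0) ⟩
    1# * y           ≈⟨ *-identityˡ y ⟩
    y                ∎
    where
    x≉0 : x ≉ 0#
    x≉0 x≈0 = 0≉1 (trans (sym (zeroˡ y)) (trans (*-congʳ (sym x≈0)) xy≈1))

  -- As `_⁻¹` is a bare function on representatives, congruence has to come from the uniqueness of
  -- inverses, which holds only away from zero.
  inv-cong : ∀ {x y} → y ≉ 0# → x ≈ y → x ⁻¹ ≈ y ⁻¹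
  inv-cong {x} {y} y≉0 x≈y = inv-unique (trans (*-congʳ x≈y) (⁻¹-inverseʳ y y≉0))

  inv-cancel : ∀ {x} → x ≉ 0# → ∀ y → x * y * x ⁻¹ ≈ y
  inv-cancel {x} x≉0 y = trans (solve 3 (λ x y i → x :* y :* i := (x :* i) :* y) refl x y _)
    (trans (*-congʳ (⁻¹-inverseʳ x x≉0)) (*-identityˡ y))

  *-cancelˡ : ∀ {x y z} → x ≉ 0# → x * y ≈ x * z → y ≈ z
  *-cancelˡ {x} {y} {z} x≉0 xy≈xz =
    trans (sym (inv-cancel x≉0 y)) (trans (*-congʳ xy≈xz) (inv-cancel x≉0 z))

  *-zero-cancel : ∀ {x y} → x ≉ 0# → x * y ≈ 0# → y ≈ 0#
  *-zero-cancel {x} x≉0 xy≈0 = *-cancelˡ x≉0 (trans xy≈0 (sym (zeroʳ x)))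

  *-≉0 : ∀ {x y} → x ≉ 0# → y ≉ 0# → x * y ≉ 0#
  *-≉0 x≉0 y≉0 xy≈0 = y≉0 (*-zero-cancel x≉0 xy≈0)

  -‿≉0 : ∀ {x y} → x ≉ y → x - y ≉ 0#
  -‿≉0 {x} {y} x≉y x-y≈0 = x≉y (begin
    x             ≈⟨ solve 2 (λ x y → x := (x :- y) :+ y) refl x y ⟩
    (x - y) + y   ≈⟨ +-congʳ x-y≈0 ⟩
    0# + y        ≈⟨ +-identityˡ y ⟩
    y             ∎)

  inv-pos : ∀ {x} → 0# < x → 0# < x ⁻¹
  inv-pos {x} 0<x with compare 0# (x ⁻¹)
  ... | tri< 0<i _ _ = 0<i
  ... | tri≈ _ 0≈i _ = contradiction (trans (sym (zeroʳ x)) (trans (*-congˡ 0≈i) (⁻¹-inverseʳ x (>⇒≉ 0<x)))) 0≉1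
  ... | tri> _ _ i<0 = contradiction 0<1 (≤⇒≯ (inj₁
    (<-respˡ-≈ (⁻¹-inverseʳ x (>⇒≉ 0<x)) (<-respʳ-≈ (zeroʳ x) (*-monoˡ-< 0<x i<0)))))

  self-neg⇒0 : ∀ {x} → x ≈ - x → x ≈ 0#
  self-neg⇒0 {x} x≈-x = *-zero-cancel (>⇒≉ (0<nat 1)) (begin
    nat 2 * x   ≈⟨ solve 1 (λ x → con (+ 2) :* x := x :+ x) refl x ⟩
    x + x       ≈⟨ +-congˡ x≈-x ⟩
    x - x       ≈⟨ -‿inverseʳ x ⟩
    0#          ∎)

  -1≉0 : - 1# ≉ 0#
  -1≉0 -1≈0 = 0≉1 (sym (begin
    1#      ≈⟨ solve 0 (con (+ 1) := :- (:- con (+ 1))) refl ⟩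
    - - 1#  ≈⟨ -‿cong -1≈0 ⟩
    - 0#    ≈⟨ solve 0 (:- con (+ 0) := con (+ 0)) refl ⟩
    0#      ∎))

module Products {c ℓ} (R : CommutativeRing c ℓ) where
  open CommutativeRing R hiding (zero)
  open IntegerSolver R
  open SetoidReasoning setoid

  prod : ∀ {N} → (ℕ → Carrier) → Vec ℕ N → Carrier
  prod φ []      = 1#
  prod φ (a ∷ l) = φ a * prod φ l

  prodOmit : ∀ {N} → (ℕ → Carrier) → Vec ℕ N → Fin N → Carrier
  prodOmit φ (a ∷ l) zero    = prod φ l
  prodOmit φ (a ∷ l) (suc i) = φ a * prodOmit φ l i

  prod-cong : ∀ {N} {φ χ : ℕ → Carrier} → (∀ a → φ a ≈ χ a) → (l : Vec ℕ N) → prod φ l ≈ prod χ l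
  prod-cong φ≈χ []      = refl
  prod-cong φ≈χ (a ∷ l) = *-cong (φ≈χ a) (prod-cong φ≈χ l)

  prodOmit-cong : ∀ {N} {φ χ : ℕ → Carrier} → (∀ a → φ a ≈ χ a) →
                  (l : Vec ℕ N) → ∀ i → prodOmit φ l i ≈ prodOmit χ l i
  prodOmit-cong φ≈χ (a ∷ l) zero    = prod-cong φ≈χ l
  prodOmit-cong φ≈χ (a ∷ l) (suc i) = *-cong (φ≈χ a) (prodOmit-cong φ≈χ l i)

  private
    interchange : ∀ a b c d → (a * b) * (c * d) ≈ (a * c) * (b * d)
    interchange = solve 4 (λ a b c d → (a :* b) :* (c :* d) := (a :* c) :* (b :* d)) refl

    swapˡ : ∀ a b c → a * (b * c) ≈ b * (a * c)
    swapˡ = solve 3 (λ a b c → a :* (b :* c) := b :* (a :* c)) refl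

  prod-* : ∀ {N} (φ χ : ℕ → Carrier) (l : Vec ℕ N) → prod (λ a → φ a * χ a) l ≈ prod φ l * prod χ l
  prod-* φ χ []      = sym (*-identityˡ _)
  prod-* φ χ (a ∷ l) = trans (*-congˡ (prod-* φ χ l)) (interchange _ _ _ _)

  prodOmit-* : ∀ {N} (φ χ : ℕ → Carrier) (l : Vec ℕ N) → ∀ i →
               prodOmit (λ a → φ a * χ a) l i ≈ prodOmit φ l i * prodOmit χ l i
  prodOmit-* φ χ (a ∷ l) zero    = prod-* φ χ l
  prodOmit-* φ χ (a ∷ l) (suc i) = trans (*-congˡ (prodOmit-* φ χ l i)) (interchange _ _ _ _)

  prod-1 : ∀ {N} {φ : ℕ → Carrier} → (∀ a → φ a ≈ 1#) → (l : Vec ℕ N) → prod φ l ≈ 1#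
  prod-1 φ≈1 []      = refl
  prod-1 φ≈1 (a ∷ l) = trans (*-cong (φ≈1 a) (prod-1 φ≈1 l)) (*-identityˡ _)

  prod-split : ∀ {N} (φ : ℕ → Carrier) (l : Vec ℕ N) i → prod φ l ≈ φ (lookup l i) * prodOmit φ l i
  prod-split φ (a ∷ l) zero    = refl
  prod-split φ (a ∷ l) (suc i) = trans (*-congˡ (prod-split φ l i)) (swapˡ _ _ _)

  prod-update : ∀ {N} (φ : ℕ → Carrier) (l : Vec ℕ N) i a → prod φ (l [ i ]≔ a) ≈ φ a * prodOmit φ l i
  prod-update φ (x ∷ l) zero    a = refl
  prod-update φ (x ∷ l) (suc i) a = trans (*-congˡ (prod-update φ l i a)) (swapˡ _ _ _)

  prod-zero : ∀ {N} (φ : ℕ → Carrier) (l : Vec ℕ N) i → φ (lookup l i) ≈ 0# → prod φ l ≈ 0#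
  prod-zero φ l i φ≈0 = trans (prod-split φ l i) (trans (*-congʳ φ≈0) (zeroˡ _))

  prod-swap : ∀ {M N} (φ : ℕ → ℕ → Carrier) (l : Vec ℕ M) (l′ : Vec ℕ N) →
              prod (λ a → prod (φ a) l′) l ≈ prod (λ b → prod (λ a → φ a b) l) l′
  prod-swap φ []      l′ = sym (prod-1 (λ _ → refl) l′)
  prod-swap φ (a ∷ l) l′ = trans (*-congˡ (prod-swap φ l l′)) (sym (prod-* (φ a) _ l′))

  diffs : ∀ {N} → Carrier → Vec ℕ N → Carrier
  diffs u = prod (λ b → u - nat b)

  diffsOmit : ∀ {N} → Carrier → Vec ℕ N → Fin N → Carrier
  diffsOmit u = prodOmit (λ b → u - nat b)

  Δ : ∀ {N} → Vec ℕ N → Carrier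
  Δ []      = 1#
  Δ (a ∷ l) = diffs (nat a) l * Δ l

  -- It does not depend on the i-th entry of l.
  cofactor : ∀ {N} → Vec ℕ N → Fin N → Carrier
  cofactor (a ∷ l) zero    = Δ l
  cofactor (a ∷ l) (suc i) = - (diffsOmit (nat a) l i * cofactor l i)

  -- The sign from moving the `i`-th entry past the earlier ones is hidden in `cofactor`, so the
  -- dependence on that entry is a plain product over all the others.
  Δ-update : ∀ {N} (l : Vec ℕ N) i a → Δ (l [ i ]≔ a) ≈ cofactor l i * diffsOmit (nat a) l i
  Δ-update (x ∷ l) zero    a = *-comm _ _
  Δ-update (x ∷ l) (suc i) a = begin
    diffs (nat x) (l [ i ]≔ a) * Δ (l [ i ]≔ a)
      ≈⟨ *-cong (prod-update _ l i a) (Δ-update l i a) ⟩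
    ((nat x - nat a) * diffsOmit (nat x) l i) * (cofactor l i * diffsOmit (nat a) l i)
      ≈⟨ solve 5 (λ x a p q r → ((x :- a) :* p) :* (q :* r) := (:- (p :* q)) :* ((a :- x) :* r)) refl _ _ _ _ _ ⟩
    - (diffsOmit (nat x) l i * cofactor l i) * ((nat a - nat x) * diffsOmit (nat a) l i) ∎

  Δ-lookup : ∀ {N} (l : Vec ℕ N) i → Δ l ≈ cofactor l i * diffsOmit (nat (lookup l i)) l i
  Δ-lookup l i = trans (reflexive (≡.cong Δ (≡.sym (Vec.[]≔-lookup l i)))) (Δ-update l i (lookup l i))

  -- By Vandermonde this is the determinant of `ψ(aᵢ) aᵢʲ`, up to a sign depending on `N` only.
  alt : ∀ {N} → (ℕ → Carrier) → Vec ℕ N → Carrier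
  alt ψ l = Δ l * prod ψ l

  alt-update : ∀ {N} (ψ : ℕ → Carrier) (l : Vec ℕ N) i a →
               alt ψ (l [ i ]≔ a) ≈ (cofactor l i * prodOmit ψ l i) * (diffsOmit (nat a) l i * ψ a)
  alt-update ψ l i a = trans (*-cong (Δ-update l i a) (prod-update ψ l i a))
    (solve 4 (λ a b c d → (a :* b) :* (c :* d) := (a :* d) :* (b :* c)) refl _ _ _ _)

  alt-lookup : ∀ {N} (ψ : ℕ → Carrier) (l : Vec ℕ N) i →
               alt ψ l ≈ (cofactor l i * prodOmit ψ l i) * (diffsOmit (nat (lookup l i)) l i * ψ (lookup l i))
  alt-lookup ψ l i = trans (*-cong (Δ-lookup l i) (prod-split ψ l i))
    (solve 4 (λ a b c d → (a :* b) :* (c :* d) := (a :* d) :* (b :* c)) refl _ _ _ _)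

  prod-update₂ : ∀ {N} (ψ : ℕ → Carrier) (l : Vec ℕ N) i j → i ≢ j → ∀ a b →
                 prod ψ (l [ i ]≔ a [ j ]≔ b) ≈ prod ψ (l [ i ]≔ b [ j ]≔ a)
  prod-update₂ ψ (x ∷ l) zero    zero    i≢j a b = contradiction ≡.refl i≢j
  prod-update₂ ψ (x ∷ l) zero    (suc j) i≢j a b = begin
    ψ a * prod ψ (l [ j ]≔ b)     ≈⟨ *-congˡ (prod-update ψ l j b) ⟩
    ψ a * (ψ b * prodOmit ψ l j)  ≈⟨ swapˡ _ _ _ ⟩
    ψ b * (ψ a * prodOmit ψ l j)  ≈⟨ *-congˡ (prod-update ψ l j a) ⟨
    ψ b * prod ψ (l [ j ]≔ a)     ∎
  prod-update₂ ψ (x ∷ l) (suc i) zero    i≢j a b = begin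
    ψ b * prod ψ (l [ i ]≔ a)     ≈⟨ *-congˡ (prod-update ψ l i a) ⟩
    ψ b * (ψ a * prodOmit ψ l i)  ≈⟨ swapˡ _ _ _ ⟩
    ψ a * (ψ b * prodOmit ψ l i)  ≈⟨ *-congˡ (prod-update ψ l i b) ⟨
    ψ a * prod ψ (l [ i ]≔ b)     ∎
  prod-update₂ ψ (x ∷ l) (suc i) (suc j) i≢j a b =
    *-congˡ (prod-update₂ ψ l i j (λ i≡j → i≢j (≡.cong suc i≡j)) a b)

  private
    Δ-head-swap : ∀ {N} (l : Vec ℕ N) j a b → Δ (a ∷ l [ j ]≔ b) ≈ - Δ (b ∷ l [ j ]≔ a)
    Δ-head-swap l j a b = begin
      diffs (nat a) (l [ j ]≔ b) * Δ (l [ j ]≔ b)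
        ≈⟨ *-cong (prod-update _ l j b) (Δ-update l j b) ⟩
      ((nat a - nat b) * diffsOmit (nat a) l j) * (cofactor l j * diffsOmit (nat b) l j)
        ≈⟨ solve 5 (λ a b p q r → ((a :- b) :* p) :* (q :* r) := :- (((b :- a) :* r) :* (q :* p))) refl _ _ _ _ _ ⟩
      - (((nat b - nat a) * diffsOmit (nat b) l j) * (cofactor l j * diffsOmit (nat a) l j))
        ≈⟨ -‿cong (*-cong (prod-update _ l j a) (Δ-update l j a)) ⟨
      - (diffs (nat b) (l [ j ]≔ a) * Δ (l [ j ]≔ a)) ∎

  Δ-antisym : ∀ {N} (l : Vec ℕ N) i j → i ≢ j → ∀ a b →
              Δ (l [ i ]≔ a [ j ]≔ b) ≈ - Δ (l [ i ]≔ b [ j ]≔ a)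
  Δ-antisym (x ∷ l) zero    zero    i≢j a b = contradiction ≡.refl i≢j
  Δ-antisym (x ∷ l) zero    (suc j) i≢j a b = Δ-head-swap l j a b
  Δ-antisym (x ∷ l) (suc i) zero    i≢j a b = Δ-head-swap l i b a
  Δ-antisym (x ∷ l) (suc i) (suc j) i≢j a b = begin
    diffs (nat x) (l [ i ]≔ a [ j ]≔ b) * Δ (l [ i ]≔ a [ j ]≔ b)
      ≈⟨ *-cong (prod-update₂ _ l i j i≢j′ a b) (Δ-antisym l i j i≢j′ a b) ⟩
    diffs (nat x) (l [ i ]≔ b [ j ]≔ a) * - Δ (l [ i ]≔ b [ j ]≔ a)
      ≈⟨ solve 2 (λ p q → p :* (:- q) := :- (p :* q)) refl _ _ ⟩
    - (diffs (nat x) (l [ i ]≔ b [ j ]≔ a) * Δ (l [ i ]≔ b [ j ]≔ a)) ∎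
    where i≢j′ = λ i≡j → i≢j (≡.cong suc i≡j)

  alt-antisym : ∀ {N} (ψ : ℕ → Carrier) (l : Vec ℕ N) i j → i ≢ j → ∀ a b →
                alt ψ (l [ i ]≔ a [ j ]≔ b) ≈ - alt ψ (l [ i ]≔ b [ j ]≔ a)
  alt-antisym ψ l i j i≢j a b = trans
    (*-cong (Δ-antisym l i j i≢j a b) (prod-update₂ ψ l i j i≢j a b))
    (solve 2 (λ p q → (:- p) :* q := :- (p :* q)) refl _ _)

-- The kernel V and its residues

module Lagrange {c ℓ₁ ℓ₂} (F : CompleteOrderedField c ℓ₁ ℓ₂) where
  open CompleteOrderedField F hiding (zero)
  open IntegerSolver commutativeRing
  open OrderedField F using (inv-cancel; *-cancelˡ; -‿≉0)
  open Products commutativeRing using (prodOmit; prod)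
  open Sums commutativeRing using (∑; ∑-cong)
  open SetoidReasoning setoid

  rootProd : List Carrier → Carrier → Carrier
  rootProd []      u = 1#
  rootProd (x ∷ b) u = (u - x) * rootProd b u

  invProd : List Carrier → Carrier → Carrier
  invProd []      u = 1#
  invProd (x ∷ b) u = (u - x) ⁻¹ * invProd b u

  -- The divided difference Σ_i f(b_i) / Π_{j≠i} (b_i - b_j).
  dd : List Carrier → (Carrier → Carrier) → Carrier
  dd []      f = 0#
  dd (x ∷ b) f = f x * invProd b x + dd b (λ u → f u * (u - x) ⁻¹)

  total : List Carrier → Carrier
  total []      = 0#
  total (x ∷ b) = x + total b

  Distinct : List Carrier → Set _
  Distinct = AllPairs _≉_

  dd-cong : ∀ b {f g} → All (λ u → f u ≈ g u) b → dd b f ≈ dd b g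
  dd-cong []      []         = refl
  dd-cong (x ∷ b) (eq ∷ eqs) = +-cong (*-congʳ eq) (dd-cong b (All.map *-congʳ eqs))

  dd-cong′ : ∀ b {f g} → (∀ u → f u ≈ g u) → dd b f ≈ dd b g
  dd-cong′ b eq = dd-cong b (All.universal eq b)

  dd-+ : ∀ b f g → dd b (λ u → f u + g u) ≈ dd b f + dd b g
  dd-+ []      f g = sym (+-identityˡ 0#)
  dd-+ (x ∷ b) f g = trans (+-congˡ (trans (dd-cong′ b (λ u → distribʳ _ _ _)) (dd-+ b _ _)))
    (solve 5 (λ f g p d e → (f :+ g) :* p :+ (d :+ e) := (f :* p :+ d) :+ (g :* p :+ e)) refl _ _ _ _ _)

  dd-* : ∀ b k f → dd b (λ u → k * f u) ≈ k * dd b f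
  dd-* []      k f = sym (zeroʳ k)
  dd-* (x ∷ b) k f = trans (+-congˡ (trans (dd-cong′ b (λ u → *-assoc _ _ _)) (dd-* b k _)))
    (solve 4 (λ k f p d → k :* f :* p :+ k :* d := k :* (f :* p :+ d)) refl _ _ _ _)

  -- The factor `u - x` kills the term of `x` and cancels the pole at `x` in all the others.
  dd-root : ∀ x b g → All (x ≉_) b → dd (x ∷ b) (λ u → (u - x) * g u) ≈ dd b g
  dd-root x b g x∉b = begin
    (x - x) * g x * invProd b x + dd b (λ u → (u - x) * g u * (u - x) ⁻¹)
      ≈⟨ +-cong (solve 3 (λ x g p → (x :- x) :* g :* p := (x :- x)) refl x (g x) _)
                (dd-cong b (All.map (λ x≉u → inv-cancel (-‿≉0 (λ u≈x → x≉u (sym u≈x))) _) x∉b)) ⟩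
    (x - x) + dd b g
      ≈⟨ solve 2 (λ x d → (x :- x) :+ d := d) refl x _ ⟩
    dd b g ∎

  dd-root₂ : ∀ x y b g → x ≉ y → All (y ≉_) b →
             dd (x ∷ y ∷ b) (λ u → (u - y) * g u) ≈ dd (x ∷ b) g
  dd-root₂ x y b g x≉y y∉b = +-cong
    (begin
      (x - y) * g x * ((x - y) ⁻¹ * invProd b x)
        ≈⟨ *-assoc _ _ _ ⟨
      (x - y) * g x * (x - y) ⁻¹ * invProd b x
        ≈⟨ *-congʳ (inv-cancel (-‿≉0 x≉y) _) ⟩
      g x * invProd b x ∎)
    (trans (dd-cong′ (y ∷ b) (λ u → *-assoc _ _ _)) (dd-root y b _ y∉b))

  private
    split-root : ∀ u a x p → (u - a) * p ≈ (u - x) * p + (x - a) * p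
    split-root = solve 4 (λ u a x p → (u :- a) :* p := (u :- x) :* p :+ (x :- a) :* p) refl

    -- From `u - a = (u - x) + (x - a)`: the first summand removes a node, the second lowers the
    -- degree. The evaluations of `dd` on products of linear factors are inductions along this step.
    dd-step : ∀ x b a g → All (x ≉_) b →
              dd (x ∷ b) (λ u → (u - a) * g u) ≈ dd b g + (x - a) * dd (x ∷ b) g
    dd-step x b a g x∉b = begin
      dd (x ∷ b) (λ u → (u - a) * g u)
        ≈⟨ dd-cong′ (x ∷ b) (λ u → split-root u a x (g u)) ⟩
      dd (x ∷ b) (λ u → (u - x) * g u + (x - a) * g u)
        ≈⟨ dd-+ (x ∷ b) _ _ ⟩
      dd (x ∷ b) (λ u → (u - x) * g u) + dd (x ∷ b) (λ u → (x - a) * g u)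
        ≈⟨ +-cong (dd-root x b g x∉b) (dd-* (x ∷ b) (x - a) g) ⟩
      dd b g + (x - a) * dd (x ∷ b) g ∎

  -- Multiply by `x - y = (u - y) - (u - x)`: each summand cancels one pole, and the divided
  -- differences at `x ∷ b` and `y ∷ b` are either both 1 or, by induction, both zero.
  dd-one : ∀ b → Distinct b → 2 ℕ.≤ length b → dd b (λ _ → 1#) ≈ 0#
  dd-one []      _ ()
  dd-one (x ∷ []) _ (s≤s ())
  dd-one (x ∷ y ∷ b) ((x≉y ∷ x∉b) ∷ (y∉b ∷ db)) _ = *-cancelˡ (-‿≉0 x≉y) (begin
    (x - y) * D                      ≈⟨ dd-* (x ∷ y ∷ b) (x - y) _ ⟨
    dd (x ∷ y ∷ b) (λ u → (x - y) * 1#)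
      ≈⟨ dd-cong′ (x ∷ y ∷ b) (λ u → solve 4 (λ u x y e → (x :- y) :* e := (u :- y) :* e :+ (:- con (+ 1)) :* ((u :- x) :* e)) refl u x y 1#) ⟩
    dd (x ∷ y ∷ b) (λ u → (u - y) * 1# + - 1# * ((u - x) * 1#))
      ≈⟨ dd-+ (x ∷ y ∷ b) _ _ ⟩
    dd (x ∷ y ∷ b) (λ u → (u - y) * 1#) + dd (x ∷ y ∷ b) (λ u → - 1# * ((u - x) * 1#))
      ≈⟨ +-cong (dd-root₂ x y b _ x≉y y∉b) (trans (dd-* (x ∷ y ∷ b) _ _) (*-congˡ (dd-root x (y ∷ b) _ (x≉y ∷ x∉b)))) ⟩
    dd (x ∷ b) (λ _ → 1#) + - 1# * dd (y ∷ b) (λ _ → 1#)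
      ≈⟨ same b (x∉b ∷ db) (y∉b ∷ db) ⟩
    0#                               ≈⟨ zeroʳ _ ⟨
    (x - y) * 0#                     ∎)
    where
    D = dd (x ∷ y ∷ b) (λ _ → 1#)
    same : ∀ b → Distinct (x ∷ b) → Distinct (y ∷ b) →
           dd (x ∷ b) (λ _ → 1#) + - 1# * dd (y ∷ b) (λ _ → 1#) ≈ 0#
    same []      _   _   = solve 1 (λ e → (e :* e :+ con (+ 0)) :+ (:- con (+ 1)) :* (e :* e :+ con (+ 0)) := con (+ 0)) refl 1#
    same (z ∷ b) dxb dyb = trans (+-cong (dd-one (x ∷ z ∷ b) dxb (s≤s (s≤s z≤n))) (*-congˡ (dd-one (y ∷ z ∷ b) dyb (s≤s (s≤s z≤n)))))
      (solve 1 (λ e → con (+ 0) :+ e :* con (+ 0) := con (+ 0)) refl (- 1#))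

  dd-low : ∀ b a → Distinct b → suc (length a) ℕ.< length b → dd b (rootProd a) ≈ 0#
  dd-low []      _       _        ()
  dd-low b       []      db       lt = dd-one b db lt
  dd-low (x ∷ b) (a ∷ as) (x∉b ∷ db) (s≤s lt) = trans (dd-step x b a (rootProd as) x∉b)
    (trans (+-cong (dd-low b as db lt) (*-congˡ (dd-low (x ∷ b) as (x∉b ∷ db) (ℕ.m<n⇒m<1+n lt))))
      (trans (+-identityˡ _) (zeroʳ _)))

  dd-monic : ∀ b a → Distinct b → suc (length a) ≡ length b → dd b (rootProd a) ≈ 1#
  dd-monic (x ∷ []) [] _ _ = trans (+-identityʳ _) (*-identityˡ _)
  dd-monic (x ∷ b) (a ∷ as) (x∉b ∷ db) eq = trans (dd-step x b a (rootProd as) x∉b)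
    (trans (+-cong (dd-monic b as db (ℕ.suc-injective eq))
                   (*-congˡ (dd-low (x ∷ b) as (x∉b ∷ db) (ℕ.≤-reflexive eq))))
      (trans (+-congˡ (zeroʳ _)) (+-identityʳ _)))

  -- The residue theorem for a quotient with as many zeros as poles: at infinity it is
  -- `1 + (total b - total a) / u + …`, and the coefficient of `1 / u` is the sum of the residues.
  dd-subleading : ∀ b a → Distinct b → length a ≡ length b → dd b (rootProd a) ≈ total b - total a
  dd-subleading []      []       _ _ = sym (-‿inverseʳ 0#)
  dd-subleading (x ∷ b) (a ∷ as) (x∉b ∷ db) eq = trans (dd-step x b a (rootProd as) x∉b)
    (trans (+-cong (dd-subleading b as db (ℕ.suc-injective eq))
                   (*-congˡ (dd-monic (x ∷ b) as (x∉b ∷ db) eq)))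
      (solve 4 (λ x a s t → (s :- t) :+ (x :- a) :* con (+ 1) := (x :+ s) :- (a :+ t)) refl x a _ _))

  rootProd-++ : ∀ a b u → rootProd (a ++ b) u ≈ rootProd a u * rootProd b u
  rootProd-++ []      b u = sym (*-identityˡ _)
  rootProd-++ (x ∷ a) b u = trans (*-congˡ (rootProd-++ a b u)) (sym (*-assoc _ _ _))

  invProd-++ : ∀ a b u → invProd (a ++ b) u ≈ invProd a u * invProd b u
  invProd-++ []      b u = sym (*-identityˡ _)
  invProd-++ (x ∷ a) b u = trans (*-congˡ (invProd-++ a b u)) (sym (*-assoc _ _ _))

  total-++ : ∀ a b → total (a ++ b) ≈ total a + total b
  total-++ []      b = sym (+-identityˡ _)
  total-++ (x ∷ a) b = trans (+-congˡ (total-++ a b)) (sym (+-assoc _ _ _))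

  dd-++ : ∀ a b f → dd (a ++ b) f ≈ dd a (λ u → f u * invProd b u) + dd b (λ u → f u * invProd a u)
  dd-++ []      b f = trans (dd-cong′ b (λ u → sym (*-identityʳ _))) (sym (+-identityˡ _))
  dd-++ (x ∷ a) b f = begin
    f x * invProd (a ++ b) x + dd (a ++ b) (λ u → f u * (u - x) ⁻¹)
      ≈⟨ +-cong (*-congˡ (invProd-++ a b x)) (dd-++ a b _) ⟩
    f x * (invProd a x * invProd b x) +
      (dd a (λ u → f u * (u - x) ⁻¹ * invProd b u) + dd b (λ u → f u * (u - x) ⁻¹ * invProd a u))
      ≈⟨ +-congˡ (+-cong (dd-cong′ a (λ u → swapʳ _ _ _)) (dd-cong′ b (λ u → *-assoc _ _ _))) ⟩
    f x * (invProd a x * invProd b x) +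
      (dd a (λ u → f u * invProd b u * (u - x) ⁻¹) + dd b (λ u → f u * ((u - x) ⁻¹ * invProd a u)))
      ≈⟨ solve 5 (λ f p q d e → f :* (p :* q) :+ (d :+ e) := (f :* q :* p :+ d) :+ e) refl _ _ _ _ _ ⟩
    (f x * invProd b x * invProd a x + dd a (λ u → f u * invProd b u * (u - x) ⁻¹)) + _ ∎
    where
    swapʳ : ∀ x y z → x * y * z ≈ x * z * y
    swapʳ = solve 3 (λ x y z → x :* y :* z := x :* z :* y) refl

  nodes : ∀ {N} → (ℕ → Carrier) → Vec ℕ N → List Carrier
  nodes τ []      = []
  nodes τ (a ∷ l) = τ a ∷ nodes τ l

  invProd-nodes : ∀ {N} (τ : ℕ → Carrier) (l : Vec ℕ N) u →
                  invProd (nodes τ l) u ≈ prod (λ b → (u - τ b) ⁻¹) l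
  invProd-nodes τ []      u = refl
  invProd-nodes τ (a ∷ l) u = *-congˡ (invProd-nodes τ l u)

  rootProd-nodes : ∀ {N} (τ : ℕ → Carrier) (l : Vec ℕ N) u →
                   rootProd (nodes τ l) u ≈ prod (λ b → u - τ b) l
  rootProd-nodes τ []      u = refl
  rootProd-nodes τ (a ∷ l) u = *-congˡ (rootProd-nodes τ l u)

  length-nodes : ∀ {N} (τ : ℕ → Carrier) (l : Vec ℕ N) → length (nodes τ l) ≡ N
  length-nodes τ []      = ≡.refl
  length-nodes τ (a ∷ l) = ≡.cong suc (length-nodes τ l)

  dd-nodes : ∀ {N} (τ : ℕ → Carrier) (l : Vec ℕ N) f →
             dd (nodes τ l) f ≈
             ∑ N (λ i → f (τ (lookup l i)) * prodOmit (λ b → (τ (lookup l i) - τ b) ⁻¹) l i)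
  dd-nodes τ []      f = refl
  dd-nodes {suc N} τ (a ∷ l) f = +-cong (*-congˡ (invProd-nodes τ l (τ a)))
    (trans (dd-nodes τ l _) (∑-cong N (λ i → *-assoc _ _ _)))

Injective : ∀ {N} → Vec ℕ N → Set
Injective l = ∀ i j → lookup l i ≡ lookup l j → i ≡ j

Repeats : ∀ {N} → Vec ℕ N → Set
Repeats l = ∃₂ λ i j → i ≢ j × lookup l i ≡ lookup l j

Contains : ∀ {N} → Vec ℕ N → ℕ → Set
Contains l v = ∃ λ i → lookup l i ≡ v

contains? : ∀ {N} (l : Vec ℕ N) v → Dec (Contains l v)
contains? l v = Fin.any? (λ i → lookup l i ℕ.≟ v)

injective⊎repeats : ∀ {N} (l : Vec ℕ N) → Injective l ⊎ Repeats l
injective⊎repeats []      = inj₁ λ ()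
injective⊎repeats (a ∷ l) with contains? l a | injective⊎repeats l
... | yes (j , eq) | _                       = inj₂ (zero , suc j , (λ ()) , ≡.sym eq)
... | no  a∉l      | inj₂ (i , j , i≢j , eq) = inj₂ (suc i , suc j , (λ eq → i≢j (Fin.suc-injective eq)) , eq)
... | no  a∉l      | inj₁ inj                = inj₁ λ where
  zero    zero    eq → ≡.refl
  zero    (suc j) eq → contradiction (j , ≡.sym eq) a∉l
  (suc i) zero    eq → contradiction (i , eq) a∉l
  (suc i) (suc j) eq → ≡.cong suc (inj i j eq)

seg : ∀ k → Vec ℕ k
seg zero    = []
seg (suc k) = 0 ∷ Vec.map suc (seg k)

seg-lookup : ∀ k i → lookup (seg k) i ≡ Fin.toℕ i
seg-lookup (suc k) zero    = ≡.refl
seg-lookup (suc k) (suc i) = ≡.trans (Vec.lookup-map i suc (seg k)) (≡.cong suc (seg-lookup k i))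

module Vertex {c ℓ₁ ℓ₂} (F : CompleteOrderedField c ℓ₁ ℓ₂) where
  open CompleteOrderedField F hiding (zero)
  open IntegerSolver commutativeRing
  open OrderedField F
  open Products commutativeRing
  open Sums commutativeRing
  open Lagrange F
  open SetoidReasoning setoid

  NonInteger : Carrier → Set _
  NonInteger m = ∀ a b → m + nat a - nat b ≉ 0#

  NonInteger-neg : ∀ {m} → NonInteger m → NonInteger (- m)
  NonInteger-neg {m} ni a b eq = ni b a (begin
    m + nat b - nat a         ≈⟨ solve 3 (λ m a b → m :+ b :- a := :- ((:- m) :+ a :- b)) refl m (nat a) (nat b) ⟩
    - (- m + nat a - nat b)   ≈⟨ -‿cong eq ⟩
    - 0#                      ≈⟨ solve 0 (:- con (+ 0) := con (+ 0)) refl ⟩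
    0#                        ∎)

  -- The binomial coefficient `m + a` over `a`.
  binom : Carrier → ℕ → Carrier
  binom m zero    = 1#
  binom m (suc a) = binom m a * ((nat (suc a) + m) * nat (suc a) ⁻¹)

  kernel : Carrier → ℕ → ℕ → Carrier
  kernel m a b = (m + nat a - nat b) ⁻¹

  -- By Cauchy's formula this is, up to a sign depending on `N` only, the determinant of
  -- `binom m a * binom (- m) b * kernel m a b` with `a` in `l` and `b` in `l′`, as Wick's theorem
  -- gives for a vertex operator between states of `N` fermions.
  V : ∀ {N} → Carrier → Vec ℕ N → Vec ℕ N → Carrier
  V m l l′ = alt (binom m) l * alt (binom (- m)) l′ * prod (λ a → prod (kernel m a) l′) l

  weightˡ weightʳ : ∀ {N} → Carrier → Vec ℕ N → ℕ → Carrier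
  weightˡ m l′ a = binom m a * prod (kernel m a) l′
  weightʳ m l  b = binom (- m) b * prod (λ a → kernel m a b) l

  -- With `l′` fixed, `V` is an alternant in `l`; antisymmetry and the effect of changing one entry
  -- then follow from the facts on alternants.
  V-left : ∀ {N} m (l l′ : Vec ℕ N) → V m l l′ ≈ alt (binom (- m)) l′ * alt (weightˡ m l′) l
  V-left m l l′ = begin
    (Δ l * prod (binom m) l) * C′ * K       ≈⟨ solve 4 (λ d p c k → (d :* p) :* c :* k := c :* (d :* (p :* k))) refl _ _ _ _ ⟩
    C′ * (Δ l * (prod (binom m) l * K))     ≈⟨ *-congˡ (*-congˡ (prod-* (binom m) _ l)) ⟨
    C′ * alt (weightˡ m l′) l               ∎
    where
    C′ = alt (binom (- m)) l′
    K  = prod (λ a → prod (kernel m a) l′) l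

  V-right : ∀ {N} m (l l′ : Vec ℕ N) → V m l l′ ≈ alt (binom m) l * alt (weightʳ m l) l′
  V-right m l l′ = begin
    C * (Δ l′ * prod (binom (- m)) l′) * prod (λ a → prod (kernel m a) l′) l
      ≈⟨ *-congˡ (prod-swap (kernel m) l l′) ⟩
    C * (Δ l′ * prod (binom (- m)) l′) * K  ≈⟨ solve 4 (λ c d p k → c :* (d :* p) :* k := c :* (d :* (p :* k))) refl _ _ _ _ ⟩
    C * (Δ l′ * (prod (binom (- m)) l′ * K)) ≈⟨ *-congˡ (*-congˡ (prod-* (binom (- m)) _ l′)) ⟨
    C * alt (weightʳ m l) l′                ∎
    where
    C = alt (binom m) l
    K = prod (λ b → prod (λ a → kernel m a b) l) l′

  V-left-update : ∀ {N} m (l l′ : Vec ℕ N) i a → V m (l [ i ]≔ a) l′ ≈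
    alt (binom (- m)) l′ * ((cofactor l i * prodOmit (weightˡ m l′) l i) * (diffsOmit (nat a) l i * weightˡ m l′ a))
  V-left-update m l l′ i a = trans (V-left m (l [ i ]≔ a) l′) (*-congˡ (alt-update (weightˡ m l′) l i a))

  V-right-update : ∀ {N} m (l l′ : Vec ℕ N) j b → V m l (l′ [ j ]≔ b) ≈
    alt (binom m) l * ((cofactor l′ j * prodOmit (weightʳ m l) l′ j) * (diffsOmit (nat b) l′ j * weightʳ m l b))
  V-right-update m l l′ j b = trans (V-right m l (l′ [ j ]≔ b)) (*-congˡ (alt-update (weightʳ m l) l′ j b))

  V-antisymˡ : ∀ {N} m (l l′ : Vec ℕ N) i j → i ≢ j → ∀ a b →
               V m (l [ i ]≔ a [ j ]≔ b) l′ ≈ - V m (l [ i ]≔ b [ j ]≔ a) l′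
  V-antisymˡ m l l′ i j i≢j a b = begin
    V m (l [ i ]≔ a [ j ]≔ b) l′            ≈⟨ V-left m (l [ i ]≔ a [ j ]≔ b) l′ ⟩
    C′ * alt ψ (l [ i ]≔ a [ j ]≔ b)        ≈⟨ *-congˡ (alt-antisym ψ l i j i≢j a b) ⟩
    C′ * - alt ψ (l [ i ]≔ b [ j ]≔ a)      ≈⟨ solve 2 (λ c x → c :* (:- x) := :- (c :* x)) refl _ _ ⟩
    - (C′ * alt ψ (l [ i ]≔ b [ j ]≔ a))    ≈⟨ -‿cong (V-left m (l [ i ]≔ b [ j ]≔ a) l′) ⟨
    - V m (l [ i ]≔ b [ j ]≔ a) l′          ∎
    where
    C′ = alt (binom (- m)) l′
    ψ  = weightˡ m l′

  -- V with its arguments exchanged, up to a sign depending on N only.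
  V-swap : ∀ {N} {m} → NonInteger m → (l l′ : Vec ℕ N) →
           V (- m) l′ l ≈ prod (λ _ → prod (λ _ → - 1#) l) l * V m l l′
  V-swap {N} {m} ni l l′ = begin
    alt (binom (- m)) l′ * alt (binom (- - m)) l * prod (λ b → prod (kernel (- m) b) l) l′
      ≈⟨ *-cong (*-congˡ (*-congˡ (prod-cong binom-neg-neg l))) (begin
           prod (λ b → prod (λ a → kernel (- m) b a) l) l′    ≈⟨ prod-cong (λ b → prod-cong (λ a → kernel-neg a b) l) l′ ⟩
           prod (λ b → prod (λ a → - 1# * kernel m a b) l) l′ ≈⟨ prod-swap (λ a b → - 1# * kernel m a b) l l′ ⟨
           prod (λ a → prod (λ b → - 1# * kernel m a b) l′) l ≈⟨ prod-cong (λ a → prod-* _ (kernel m a) l′) l ⟩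
           prod (λ a → prod (λ _ → - 1#) l′ * prod (kernel m a) l′) l ≈⟨ prod-* _ _ l ⟩
           prod (λ _ → prod (λ _ → - 1#) l′) l * K            ≈⟨ *-congʳ (prod-cong (λ _ → const l l′) l) ⟨
           prod (λ _ → prod (λ _ → - 1#) l) l * K             ∎) ⟩
    alt (binom (- m)) l′ * alt (binom m) l * (prod (λ _ → prod (λ _ → - 1#) l) l * K)
      ≈⟨ solve 4 (λ a b s k → a :* b :* (s :* k) := s :* (b :* a :* k)) refl _ _ _ _ ⟩
    prod (λ _ → prod (λ _ → - 1#) l) l * (alt (binom m) l * alt (binom (- m)) l′ * K) ∎
    where
    K = prod (λ a → prod (kernel m a) l′) l
    const : ∀ {M x} (l l′ : Vec ℕ M) → prod (λ _ → x) l ≈ prod (λ _ → x) l′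
    const []      []       = refl
    const (_ ∷ l) (_ ∷ l′) = *-congˡ (const l l′)
    binom-neg-neg : ∀ a → binom (- - m) a ≈ binom m a
    binom-neg-neg zero    = refl
    binom-neg-neg (suc a) = *-cong (binom-neg-neg a) (*-congʳ (+-congˡ (solve 1 (λ m → :- (:- m) := m) refl m)))
    kernel-neg : ∀ a b → kernel (- m) b a ≈ - 1# * kernel m a b
    kernel-neg a b = inv-unique (trans
      (solve 4 (λ m a b i → ((:- m) :+ b :- a) :* ((:- con (+ 1)) :* i) := (m :+ a :- b) :* i) refl m (nat a) (nat b) _)
      (⁻¹-inverseʳ _ (ni a b)))

  all-nodes : ∀ {p} {P : Carrier → Set p} {N} τ (l : Vec ℕ N) → (∀ j → P (τ (lookup l j))) → All P (nodes τ l)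
  all-nodes τ []      h = []
  all-nodes τ (a ∷ l) h = h zero ∷ all-nodes τ l (h ∘ suc)

  distinct-nodes : ∀ {N} τ → (∀ {a b} → τ a ≈ τ b → a ≡ b) → (l : Vec ℕ N) → Injective l → Distinct (nodes τ l)
  distinct-nodes τ τ-inj []      inj = []
  distinct-nodes τ τ-inj (a ∷ l) inj =
    all-nodes τ l (λ j eq → contradiction (inj zero (suc j) (τ-inj eq)) λ ()) ∷
    distinct-nodes τ τ-inj l (λ i j eq → Fin.suc-injective (inj (suc i) (suc j) eq))

  total-nodes-+ : ∀ {N} τ t (l : Vec ℕ N) → total (nodes (λ a → τ a + t) l) ≈ total (nodes τ l) + nat N * t
  total-nodes-+ τ t []      = sym (trans (+-identityˡ _) (zeroˡ t))
  total-nodes-+ {suc N} τ t (a ∷ l) = trans (+-congˡ (total-nodes-+ τ t l))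
    (solve 4 (λ x t s n → (x :+ t) :+ (s :+ n :* t) := (x :+ s) :+ (con (+ 1) :+ n) :* t) refl _ _ _ _)

  prodOmit-1 : ∀ {N} {φ : ℕ → Carrier} (l : Vec ℕ N) i →
               (∀ j → i ≢ j → φ (lookup l j) ≈ 1#) → prodOmit φ l i ≈ 1#
  prodOmit-1 {φ = φ} (a ∷ l) zero h = go l (λ j → h (suc j) (λ ()))
    where
    go : ∀ {M} (l : Vec ℕ M) → (∀ j → φ (lookup l j) ≈ 1#) → prod φ l ≈ 1#
    go []      h = refl
    go (b ∷ l) h = trans (*-cong (h zero) (go l (h ∘ suc))) (*-identityˡ _)
  prodOmit-1 (a ∷ l) (suc i) h =
    trans (*-cong (h zero λ ()) (prodOmit-1 l i (λ j i≢j → h (suc j) (i≢j ∘ Fin.suc-injective)))) (*-identityˡ _)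

  prod-map : ∀ {N} φ (h : ℕ → ℕ) (l : Vec ℕ N) → prod φ (Vec.map h l) ≈ prod (φ ∘ h) l
  prod-map φ h []      = refl
  prod-map φ h (a ∷ l) = *-congˡ (prod-map φ h l)

  -- The quotient of `binom m (k + a)` by `binom m a` is the product of
  -- `(k + a - s + m) / (k + a - s)` over `s < k`, here with the denominators cleared. It is what
  -- the factors indexed by `s` in the residue computation account for.
  binom-shift : ∀ m k a → binom m (k ℕ.+ a) * prod (λ s → nat (k ℕ.+ a) - nat s) (seg k) ≈
                          binom m a * prod (λ s → nat (k ℕ.+ a) - (nat s - m)) (seg k)
  binom-shift m zero    a = refl
  binom-shift m (suc k) a = begin
    binom m n * ((nat (suc n) + m) * i) * ((nat (suc n) - 0#) * prod (λ s → nat (suc n) - nat s) (Vec.map suc (seg k)))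
      ≈⟨ *-congˡ (*-congˡ (trans (prod-map _ suc (seg k))
           (prod-cong (λ s → solve 3 (λ e x y → (e :+ x) :- (e :+ y) := x :- y) refl 1# (nat n) (nat s)) (seg k)))) ⟩
    binom m n * ((nat (suc n) + m) * i) * ((nat (suc n) - 0#) * p)
      ≈⟨ solve 5 (λ b x m i p → b :* ((x :+ m) :* i) :* ((x :- con (+ 0)) :* p) := (b :* p) :* ((x :* i) :* (x :- (con (+ 0) :- m)))) refl _ _ _ _ _ ⟩
    (binom m n * p) * ((nat (suc n) * i) * (nat (suc n) - (0# - m)))
      ≈⟨ *-cong (binom-shift m k a) (trans (*-congʳ (⁻¹-inverseʳ _ (>⇒≉ (0<nat n)))) (*-identityˡ _)) ⟩
    (binom m a * q) * (nat (suc n) - (0# - m))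
      ≈⟨ solve 3 (λ a q x → (a :* q) :* x := a :* (x :* q)) refl _ _ _ ⟩
    binom m a * ((nat (suc n) - (0# - m)) * q)
      ≈⟨ *-congˡ (*-congˡ (trans (prod-map _ suc (seg k))
           (prod-cong (λ s → solve 4 (λ e x y m → (e :+ x) :- ((e :+ y) :- m) := x :- (y :- m)) refl 1# (nat n) (nat s) m) (seg k)))) ⟨
    binom m a * ((nat (suc n) - (0# - m)) * prod (λ s → nat (suc n) - (nat s - m)) (Vec.map suc (seg k))) ∎
    where
    n = k ℕ.+ a
    i = nat (suc n) ⁻¹
    p = prod (λ s → nat n - nat s) (seg k)
    q = prod (λ s → nat n - (nat s - m)) (seg k)

  prod-inverse : ∀ {N} (φ : ℕ → Carrier) (l : Vec ℕ N) → (∀ i → φ (lookup l i) ≉ 0#) →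
                 prod φ l * prod (λ a → φ a ⁻¹) l ≈ 1#
  prod-inverse φ []      h = *-identityˡ _
  prod-inverse φ (a ∷ l) h = trans
    (solve 4 (λ a b c d → (a :* b) :* (c :* d) := (a :* c) :* (b :* d)) refl _ _ _ _)
    (trans (*-cong (⁻¹-inverseʳ _ (h zero)) (prod-inverse φ l (h ∘ suc))) (*-identityˡ _))

  binom-shift-inverse : ∀ {m} → NonInteger m → ∀ k a →
    binom m (k ℕ.+ a) * (prod (λ s → nat (k ℕ.+ a) - nat s) (seg k) *
                         prod (λ s → (nat (k ℕ.+ a) - (nat s - m)) ⁻¹) (seg k)) ≈ binom m a
  binom-shift-inverse {m} ni k a = begin
    binom m (k ℕ.+ a) * (P * Q⁻¹) ≈⟨ *-assoc _ _ _ ⟨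
    binom m (k ℕ.+ a) * P * Q⁻¹   ≈⟨ *-congʳ (binom-shift m k a) ⟩
    binom m a * Q * Q⁻¹           ≈⟨ *-assoc _ _ _ ⟩
    binom m a * (Q * Q⁻¹)         ≈⟨ *-congˡ (prod-inverse _ (seg k) (λ i eq → ni (k ℕ.+ a) (lookup (seg k) i) (trans
                                       (solve 3 (λ m x s → m :+ x :- s := x :- (s :- m)) refl m _ _) eq))) ⟩
    binom m a * 1#                ≈⟨ *-identityʳ _ ⟩
    binom m a                     ∎
    where
    P = prod (λ s → nat (k ℕ.+ a) - nat s) (seg k)
    Q = prod (λ s → nat (k ℕ.+ a) - (nat s - m)) (seg k)
    Q⁻¹ = prod (λ s → (nat (k ℕ.+ a) - (nat s - m)) ⁻¹) (seg k)

  -- The bracket discards the moves to negative entries, which `∸` would send to 0.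
  lowered : ∀ {N} → (Vec ℕ N → Carrier) → ℕ → Vec ℕ N → Fin N → Carrier
  lowered f k l i = ⟦ k ℕ.≤? lookup l i ⟧ * f (l [ i ]≔ (lookup l i ℕ.∸ k))

  raise : ∀ {N} → ℕ → Vec ℕ N → Fin N → Vec ℕ N
  raise k l i = l [ i ]≔ (lookup l i ℕ.+ k)

  -- Residue theorem for
  -- Π_s (u - s)/(u - s + m) Π_a (u - a - k)/(u - a) Π_b (u + m - b)/(u + m - b - k),
  -- where s < k, a ranges over l and b over l′.
  module Residues {N} (m : Carrier) (ni : NonInteger m) (k : ℕ) (l l′ : Vec ℕ N)
                  (inj : Injective l) (inj′ : Injective l′)
                  (full : ∀ s → s ℕ.< k → Contains l′ s) where

    σ τ : ℕ → Carrier
    σ s = nat s - m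
    τ b = (nat b - m) + nat k

    A S B A₀ S₀ B₀ poles zeros : List Carrier
    A = nodes nat l
    S = nodes σ (seg k)
    B = nodes τ l′
    A₀ = nodes (λ a → nat a + nat k) l
    S₀ = nodes nat (seg k)
    B₀ = nodes σ l′
    poles = A ++ (S ++ B)
    zeros = A₀ ++ (S₀ ++ B₀)

    f : Carrier → Carrier
    f = rootProd zeros

    f-expand : ∀ u → f u ≈ prod (λ a → u - (nat a + nat k)) l *
                           (prod (λ s → u - nat s) (seg k) * prod (λ b → u - σ b) l′)
    f-expand u = trans (rootProd-++ A₀ _ u) (*-cong (rootProd-nodes _ l u)
      (trans (rootProd-++ S₀ _ u) (*-cong (rootProd-nodes _ (seg k) u) (rootProd-nodes _ l′ u))))

    private
      lengths : length zeros ≡ length poles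
      lengths = ≡.trans (len A₀ S₀ B₀) (≡.trans
        (≡.cong₂ ℕ._+_ (≡.trans (length-nodes _ l) (≡.sym (length-nodes nat l)))
          (≡.cong₂ ℕ._+_ (≡.trans (length-nodes _ (seg k)) (≡.sym (length-nodes σ (seg k))))
                         (≡.trans (length-nodes _ l′) (≡.sym (length-nodes τ l′)))))
        (≡.sym (len A S B)))
        where
        len : ∀ (x y z : List Carrier) → length (x ++ (y ++ z)) ≡ length x ℕ.+ (length y ℕ.+ length z)
        len x y z = ≡.trans (List.length-++ x) (≡.cong (length x ℕ.+_) (List.length-++ y))

      -- The shifts by `k` of the `N` nodes in `A₀` and of the `N` nodes in `B` cancel, which leaves
      -- `- m` for each of the `k` nodes of `S`.
      totals : total poles - total zeros ≈ - (nat k * m)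
      totals = begin
        total poles - total zeros
          ≈⟨ +-cong (tot A S B) (-‿cong (tot A₀ S₀ B₀)) ⟩
        (total A + (total S + total B)) - (total A₀ + (total S₀ + total B₀))
          ≈⟨ +-cong (+-congˡ (+-cong (total-nodes-+ nat (- m) (seg k)) (total-nodes-+ σ (nat k) l′)))
                    (-‿cong (+-congʳ (total-nodes-+ nat (nat k) l))) ⟩
        (total A + ((total S₀ + nat k * - m) + (total B₀ + nat N * nat k))) -
          ((total A + nat N * nat k) + (total S₀ + total B₀))
          ≈⟨ solve 6 (λ a s b k m n → (a :+ ((s :+ k :* (:- m)) :+ (b :+ n :* k))) :- ((a :+ n :* k) :+ (s :+ b)) := :- (k :* m))
               refl _ _ _ _ _ _ ⟩
        - (nat k * m) ∎
        where
        tot : ∀ (x y z : List Carrier) → total (x ++ (y ++ z)) ≈ total x + (total y + total z)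
        tot x y z = trans (total-++ x (y ++ z)) (+-congˡ (total-++ y z))

      A#S : ∀ a s → nat a ≉ σ s
      A#S a s eq = ni a s (trans (solve 3 (λ m a s → m :+ a :- s := a :- (s :- m)) refl m _ _)
        (trans (+-congʳ eq) (-‿inverseʳ _)))

      A#B : ∀ a b → nat a ≉ τ b
      A#B a b eq = ni a (b ℕ.+ k) (trans (+-congˡ (-‿cong (nat-+ b k)))
        (trans (solve 4 (λ m a b k → m :+ a :- (b :+ k) := a :- ((b :- m) :+ k)) refl m _ _ _)
        (trans (+-congʳ eq) (-‿inverseʳ _))))

      S#B : ∀ s b → s ℕ.< k → σ s ≉ τ b
      S#B s b s<k eq = ℕ.<⇒≢ (ℕ.<-≤-trans s<k (ℕ.m≤n+m k b)) (nat-injective (begin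
        nat s                    ≈⟨ solve 2 (λ s m → s := (s :- m) :+ m) refl _ m ⟩
        σ s + m                  ≈⟨ +-congʳ eq ⟩
        τ b + m                  ≈⟨ solve 3 (λ b m k → ((b :- m) :+ k) :+ m := b :+ k) refl _ m _ ⟩
        nat b + nat k            ≈⟨ nat-+ b k ⟨
        nat (b ℕ.+ k)            ∎))

      σ-injective : ∀ {a b} → σ a ≈ σ b → a ≡ b
      σ-injective {a} {b} eq = nat-injective (begin
        nat a      ≈⟨ solve 2 (λ s m → s := (s :- m) :+ m) refl _ m ⟩
        σ a + m    ≈⟨ +-congʳ eq ⟩
        σ b + m    ≈⟨ solve 2 (λ s m → s := (s :- m) :+ m) refl _ m ⟨
        nat b      ∎)

      τ-injective : ∀ {a b} → τ a ≈ τ b → a ≡ b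
      τ-injective {a} {b} eq = σ-injective (begin
        σ a               ≈⟨ solve 2 (λ s k → s := (s :+ k) :- k) refl _ (nat k) ⟩
        τ a - nat k       ≈⟨ +-congʳ eq ⟩
        τ b - nat k       ≈⟨ solve 2 (λ s k → s := (s :+ k) :- k) refl _ (nat k) ⟨
        σ b               ∎)

      seg-< : ∀ i → lookup (seg k) i ℕ.< k
      seg-< i = ≡.subst (ℕ._< k) (≡.sym (seg-lookup k i)) (Fin.toℕ<n i)

      poles-distinct : Distinct poles
      poles-distinct = AllPairs.++⁺ (distinct-nodes nat nat-injective l inj)
        (AllPairs.++⁺
          (distinct-nodes σ σ-injective (seg k) (λ i j eq →
            Fin.toℕ-injective (≡.trans (≡.sym (seg-lookup k i)) (≡.trans eq (seg-lookup k j)))))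
          (distinct-nodes τ τ-injective l′ inj′)
          (all-nodes σ (seg k) (λ i → all-nodes τ l′ (λ j → S#B (lookup (seg k) i) (lookup l′ j) (seg-< i)))))
        (all-nodes nat l (λ i → All.++⁺ (all-nodes σ (seg k) (λ j → A#S (lookup l i) (lookup (seg k) j))) (all-nodes τ l′ (λ j → A#B (lookup l i) (lookup l′ j)))))

    residue-sum : dd A (λ u → f u * invProd (S ++ B) u) +
                  (dd S (λ u → f u * invProd A u * invProd B u) + dd B (λ u → f u * invProd A u * invProd S u))
                  ≈ - (nat k * m)
    residue-sum = begin
      _ ≈⟨ +-congˡ (dd-++ S B _) ⟨
      dd A (λ u → f u * invProd (S ++ B) u) + dd (S ++ B) (λ u → f u * invProd A u)
        ≈⟨ dd-++ A (S ++ B) f ⟨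
      dd poles f ≈⟨ dd-subleading poles zeros poles-distinct lengths ⟩
      total poles - total zeros ≈⟨ totals ⟩
      - (nat k * m) ∎

    -- This is where `full` enters: every `s < k` is an entry of `l′`, so the pole `s - m` is also
    -- one of the zeros in `B₀`.
    residue-S : dd S (λ u → f u * invProd A u * invProd B u) ≈ 0#
    residue-S = trans (dd-nodes σ (seg k) _) (∑-zero k (λ i → trans (*-congʳ (trans (*-congʳ (trans (*-congʳ (vanish i)) (zeroˡ _))) (zeroˡ _))) (zeroˡ _)))
      where
      vanish : ∀ i → f (σ (lookup (seg k) i)) ≈ 0#
      vanish i with full _ (seg-< i)
      ... | j , eq = trans (f-expand _) (trans (*-congˡ (trans (*-congˡ (prod-zero _ l′ j
        (trans (+-congˡ (-‿cong (reflexive (≡.cong σ eq)))) (-‿inverseʳ _)))) (zeroʳ _))) (zeroʳ _))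

    -- Multiplied by the residue at an entry `a` of `l`, `V` becomes `- k` times its value with `a`
    -- replaced by `a - k`; the factor is `a - (a + k)`. For `a < k` the residue vanishes through a
    -- zero in `S₀`, in accordance with the bracket in `lowered`.
    residue-A : V m l l′ * dd A (λ u → f u * invProd (S ++ B) u) ≈ - nat k * ∑ N (lowered (λ l → V m l l′) k l)
    residue-A = trans (*-congˡ (dd-nodes nat l _))
      (trans (sym (∑-* N _ _)) (trans (∑-cong N term) (∑-* N _ _)))
      where
      PO : Fin N → Carrier
      PO i = prodOmit (λ b → (nat (lookup l i) - nat b) ⁻¹) l i

      weights : ∀ k₀ a₀ → k₀ ≡ k → weightˡ m l′ (k₀ ℕ.+ a₀) *
        ((prod (λ s → nat (k₀ ℕ.+ a₀) - nat s) (seg k) * prod (λ b → nat (k₀ ℕ.+ a₀) - σ b) l′) *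
         invProd (S ++ B) (nat (k₀ ℕ.+ a₀))) ≈ weightˡ m l′ a₀
      weights _ a₀ ≡.refl = begin
        (g * K) * ((P * Q) * invProd (S ++ B) (nat a))
          ≈⟨ *-congˡ (*-congˡ (trans (invProd-++ S B _) (*-cong (invProd-nodes σ (seg k) _) (invProd-nodes τ l′ _)))) ⟩
        (g * K) * ((P * Q) * (P′ * Q′))
          ≈⟨ solve 6 (λ g K P Q P′ Q′ → (g :* K) :* ((P :* Q) :* (P′ :* Q′)) := (g :* (P :* P′)) :* (K :* Q :* Q′)) refl _ _ _ _ _ _ ⟩
        (g * (P * P′)) * (K * Q * Q′)
          ≈⟨ *-cong (binom-shift-inverse ni k a₀) (trans (*-congʳ (sym (prod-* _ _ l′))) (trans (sym (prod-* _ _ l′)) (prod-cong kern l′))) ⟩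
        weightˡ m l′ a₀ ∎
        where
        a = k ℕ.+ a₀
        g = binom m a
        K = prod (kernel m a) l′
        P = prod (λ s → nat a - nat s) (seg k)
        Q = prod (λ b → nat a - σ b) l′
        P′ = prod (λ s → (nat a - σ s) ⁻¹) (seg k)
        Q′ = prod (λ b → (nat a - τ b) ⁻¹) l′
        kern : ∀ b → kernel m a b * (nat a - σ b) * (nat a - τ b) ⁻¹ ≈ kernel m a₀ b
        kern b = trans (*-cong
          (trans (solve 4 (λ i a b m → i :* (a :- (b :- m)) := (m :+ a :- b) :* i) refl _ _ _ m) (⁻¹-inverseʳ _ (ni a b)))
          (inv-cong (ni a₀ b) (trans (+-congʳ (nat-+ k a₀))
            (solve 4 (λ k a b m → (k :+ a) :- ((b :- m) :+ k) := m :+ a :- b) refl _ _ _ m))))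
          (*-identityˡ _)

      term : ∀ i → V m l l′ * (f (nat (lookup l i)) * invProd (S ++ B) (nat (lookup l i)) * PO i) ≈
                   - nat k * lowered (λ l → V m l l′) k l i
      term i with k ℕ.≤? lookup l i
      ... | no k≰a = begin
        _ ≈⟨ *-congˡ (*-congʳ (*-congʳ (trans (f-expand _) (*-congˡ (trans (*-congʳ (prod-zero _ (seg k) (Fin.fromℕ< a<k)
               (trans (+-congˡ (-‿cong (nat-cong (≡.trans (seg-lookup k _) (Fin.toℕ-fromℕ< a<k))))) (-‿inverseʳ _)))) (zeroˡ _)))))) ⟩
        V m l l′ * (_ * 0# * _ * PO i)
          ≈⟨ solve 6 (λ v x y z k w → v :* (x :* con (+ 0) :* y :* z) := (:- k) :* (con (+ 0) :* w)) refl _ _ _ _ _ _ ⟩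
        - nat k * (0# * _) ∎
        where a<k = ℕ.≰⇒> k≰a
      ... | yes k≤a = begin
        V m l l′ * (f (nat a) * IP * PO i)
          ≈⟨ *-cong (trans (V-left m l l′) (*-congˡ (alt-lookup _ l i)))
               (*-congʳ (*-congʳ (trans (f-expand (nat a)) (*-congʳ (prod-split _ l i))))) ⟩
        (C′ * ((cofactor l i * Ω) * (δ * ψ))) * (((nat a - (nat a + nat k)) * prodOmit (λ b → nat a - (nat b + nat k)) l i) * Y * IP * PO i)
          ≈⟨ solve 11 (λ c e o d w a k p y i q → (c :* ((e :* o) :* (d :* w))) :* (((a :- (a :+ k)) :* p) :* y :* i :* q) :=
                        (:- k) :* ((c :* (e :* o)) :* (p :* (w :* (y :* i)) :* (d :* q))))
               refl _ _ _ _ _ _ _ _ _ _ _ ⟩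
        - nat k * ((C′ * (cofactor l i * Ω)) * (prodOmit (λ b → nat a - (nat b + nat k)) l i * (ψ * (Y * IP)) * (δ * PO i)))
          ≈⟨ *-congˡ (*-congˡ (*-cong (*-cong
               (prodOmit-cong (λ b → trans (+-congʳ natsum) (solve 3 (λ x k b → (k :+ x) :- (b :+ k) := x :- b) refl _ _ _)) l i)
               (trans (reflexive (≡.cong (λ a → weightˡ m l′ a * ((prod (λ s → nat a - nat s) (seg k) * prod (λ b → nat a - σ b) l′) * invProd (S ++ B) (nat a))) (≡.sym a≡)))
                 (weights k a₀ ≡.refl)))
               (trans (sym (prodOmit-* _ _ l i)) (prodOmit-1 l i (λ j i≢j → ⁻¹-inverseʳ _ (-‿≉0 (λ eq → i≢j (inj i j (nat-injective eq))))))))) ⟩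
        - nat k * ((C′ * (cofactor l i * Ω)) * (diffsOmit (nat a₀) l i * weightˡ m l′ a₀ * 1#))
          ≈⟨ *-congˡ (solve 5 (λ c e o d w → (c :* (e :* o)) :* (d :* w :* con (+ 1)) := con (+ 1) :* (c :* ((e :* o) :* (d :* w)))) refl _ _ _ _ _) ⟩
        - nat k * (1# * (C′ * ((cofactor l i * Ω) * (diffsOmit (nat a₀) l i * weightˡ m l′ a₀))))
          ≈⟨ *-congˡ (*-congˡ (V-left-update m l l′ i a₀)) ⟨
        - nat k * (1# * V m (l [ i ]≔ a₀) l′) ∎
        where
        a = lookup l i
        a₀ = a ℕ.∸ k
        a≡ : k ℕ.+ a₀ ≡ a
        a≡ = ℕ.m+[n∸m]≡n k≤a
        natsum : nat a ≈ nat k + nat a₀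
        natsum = trans (nat-cong (≡.sym a≡)) (nat-+ k a₀)
        C′ = alt (binom (- m)) l′
        Ω = prodOmit (weightˡ m l′) l i
        δ = diffsOmit (nat a) l i
        ψ = weightˡ m l′ a
        IP = invProd (S ++ B) (nat a)
        Y = prod (λ s → nat a - nat s) (seg k) * prod (λ b → nat a - σ b) l′

    -- The same for the entries `b` of `l′`, which are raised to `b + k`; the factor `k` is
    -- `τ b - σ b`.
    residue-B : V m l l′ * dd B (λ u → f u * invProd A u * invProd S u) ≈ nat k * ∑ N (λ j → V m l (raise k l′ j))
    residue-B = trans (*-congˡ (dd-nodes τ l′ _))
      (trans (sym (∑-* N _ _)) (trans (∑-cong N term) (∑-* N _ _)))
      where
      term : ∀ j → V m l l′ * (f (τ (lookup l′ j)) * invProd A (τ (lookup l′ j)) * invProd S (τ (lookup l′ j)) *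
                     prodOmit (λ b → (τ (lookup l′ j) - τ b) ⁻¹) l′ j) ≈ nat k * V m l (raise k l′ j)
      term j = begin
        V m l l′ * (f v * invProd A v * invProd S v * PO)
          ≈⟨ *-cong (trans (V-right m l l′) (*-congˡ (alt-lookup _ l′ j)))
               (*-congʳ (*-cong (*-cong (trans (f-expand v) (*-congˡ (*-congˡ (prod-split _ l′ j)))) (invProd-nodes nat l v)) (invProd-nodes σ (seg k) v))) ⟩
        (C * ((cofactor l′ j * Ω) * (δ * (g * K)))) * (P * (Q * ((v - σ b) * R)) * P′ * Q′ * PO)
          ≈⟨ solve 14 (λ c e o d g K P Q v s R P′ Q′ q →
                 (c :* ((e :* o) :* (d :* (g :* K)))) :* (P :* (Q :* ((v :- s) :* R)) :* P′ :* Q′ :* q) :=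
                 (v :- s) :* (c :* ((e :* o) :* (R :* ((g :* (Q :* Q′)) :* (K :* P :* P′)) :* (d :* q)))))
               refl _ _ _ _ _ _ _ _ _ _ _ _ _ _ ⟩
        (v - σ b) * (C * ((cofactor l′ j * Ω) * (R * ((g * (Q * Q′)) * (K * P * P′)) * (δ * PO))))
          ≈⟨ *-cong (solve 2 (λ s k → (s :+ k) :- s := k) refl _ _)
              (*-congˡ (*-congˡ (*-cong (*-cong R≈ (*-cong gQ KP)) δPO))) ⟩
        nat k * (C * ((cofactor l′ j * Ω) * (diffsOmit (nat (b ℕ.+ k)) l′ j * weightʳ m l (b ℕ.+ k) * 1#)))
          ≈⟨ *-congˡ (*-congˡ (*-congˡ (*-identityʳ _))) ⟩
        nat k * (C * ((cofactor l′ j * Ω) * (diffsOmit (nat (b ℕ.+ k)) l′ j * weightʳ m l (b ℕ.+ k))))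
          ≈⟨ *-congˡ (V-right-update m l l′ j (b ℕ.+ k)) ⟨
        nat k * V m l (raise k l′ j) ∎
        where
        b = lookup l′ j
        v = τ b
        C = alt (binom m) l
        Ω = prodOmit (weightʳ m l) l′ j
        δ = diffsOmit (nat b) l′ j
        g = binom (- m) b
        K = prod (λ a → kernel m a b) l
        P = prod (λ a → v - (nat a + nat k)) l
        Q = prod (λ s → v - nat s) (seg k)
        P′ = prod (λ a → (v - nat a) ⁻¹) l
        Q′ = prod (λ s → (v - σ s) ⁻¹) (seg k)
        R = prodOmit (λ b′ → v - σ b′) l′ j
        PO = prodOmit (λ b′ → (v - τ b′) ⁻¹) l′ j
        n = k ℕ.+ b
        v≈ : v ≈ nat n - m
        v≈ = trans (solve 3 (λ b m k → (b :- m) :+ k := (k :+ b) :- m) refl _ m _) (+-congʳ (sym (nat-+ k b)))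
        R≈ : R ≈ diffsOmit (nat (b ℕ.+ k)) l′ j
        R≈ = prodOmit-cong (λ b′ → trans (solve 4 (λ b m k x → ((b :- m) :+ k) :- (x :- m) := (b :+ k) :- x) refl _ m _ _)
          (+-congʳ (sym (nat-+ b k)))) l′ j
        gQ : g * (Q * Q′) ≈ binom (- m) (b ℕ.+ k)
        gQ = begin
          g * (Q * Q′)
            ≈⟨ *-congˡ (*-cong (prod-cong (λ s → trans (+-congʳ v≈) (solve 3 (λ n m s → (n :- m) :- s := n :- (s :- (:- m))) refl _ m _)) (seg k))
                               (prod-inv-cong (seg k) (λ i → nonzero i) (λ s → trans (+-congʳ v≈) (solve 3 (λ n m s → (n :- m) :- (s :- m) := n :- s) refl _ m _)))) ⟩
          g * (prod (λ s → nat n - (nat s - - m)) (seg k) * prod (λ s → (nat n - nat s) ⁻¹) (seg k))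
            ≈⟨ *-assoc _ _ _ ⟨
          g * prod (λ s → nat n - (nat s - - m)) (seg k) * prod (λ s → (nat n - nat s) ⁻¹) (seg k)
            ≈⟨ *-congʳ (binom-shift (- m) k b) ⟨
          binom (- m) n * prod (λ s → nat n - nat s) (seg k) * prod (λ s → (nat n - nat s) ⁻¹) (seg k)
            ≈⟨ trans (*-assoc _ _ _) (trans (*-congˡ (prod-inverse _ (seg k) nonzero)) (*-identityʳ _)) ⟩
          binom (- m) n ≡⟨ ≡.cong (binom (- m)) (ℕ.+-comm k b) ⟩
          binom (- m) (b ℕ.+ k) ∎
          where
          nonzero : ∀ i → nat n - nat (lookup (seg k) i) ≉ 0#
          nonzero i = -‿≉0 (>⇒≉ (nat-mono-< (ℕ.<-≤-trans (seg-< i) (ℕ.m≤m+n k b))))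
          prod-inv-cong : ∀ {M} {φ χ : ℕ → Carrier} (l : Vec ℕ M) → (∀ i → χ (lookup l i) ≉ 0#) → (∀ a → φ a ≈ χ a) →
                          prod (λ a → φ a ⁻¹) l ≈ prod (λ a → χ a ⁻¹) l
          prod-inv-cong []      ne eq = refl
          prod-inv-cong (a ∷ l) ne eq = *-cong (inv-cong (ne zero) (eq a)) (prod-inv-cong l (ne ∘ suc) eq)
        KP : K * P * P′ ≈ prod (λ a → kernel m a (b ℕ.+ k)) l
        KP = trans (*-congʳ (sym (prod-* _ _ l))) (trans (sym (prod-* _ _ l)) (prod-cong (λ a → sym (inv-unique (begin
          (m + nat a - nat (b ℕ.+ k)) * (kernel m a b * (v - (nat a + nat k)) * (v - nat a) ⁻¹)
            ≈⟨ *-congʳ (+-congˡ (-‿cong (nat-+ b k))) ⟩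
          (m + nat a - (nat b + nat k)) * (kernel m a b * (v - (nat a + nat k)) * (v - nat a) ⁻¹)
            ≈⟨ solve 6 (λ m a b k i j → (m :+ a :- (b :+ k)) :* (i :* ((b :- m :+ k) :- (a :+ k)) :* j) :=
                 ((m :+ a :- b) :* i) :* (((b :- m :+ k) :- a) :* j)) refl m _ _ _ _ _ ⟩
          ((m + nat a - nat b) * kernel m a b) * ((v - nat a) * (v - nat a) ⁻¹)
            ≈⟨ *-cong (⁻¹-inverseʳ _ (ni a b)) (⁻¹-inverseʳ _ (-‿≉0 (λ eq → A#B a b (sym eq)))) ⟩
          1# * 1# ≈⟨ *-identityˡ 1# ⟩
          1# ∎))) l))
        δPO : δ * PO ≈ 1#
        δPO = trans (sym (prodOmit-* _ _ l′ j)) (prodOmit-1 l′ j (λ j′ j≢j′ → trans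
          (*-congʳ (solve 4 (λ b x m k → b :- x := ((b :- m) :+ k) :- ((x :- m) :+ k)) refl _ _ m (nat k)))
          (⁻¹-inverseʳ _ (-‿≉0 (λ eq → j≢j′ (inj′ j j′ (τ-injective eq)))))))

  -- `residue-sum` times `V m l l′`, with the residues inserted, carries the common factor `suc k`,
  -- which is cancelled.
  relation-injective : ∀ {N} {m} → NonInteger m → ∀ k (l l′ : Vec ℕ N) → Injective l → Injective l′ →
    (∀ s → s ℕ.< suc k → Contains l′ s) →
    ∑ N (lowered (λ l → V m l l′) (suc k) l) ≈ ∑ N (λ j → V m l (raise (suc k) l′ j)) + m * V m l l′
  relation-injective {N} {m} ni k l l′ inj inj′ full = *-cancelˡ (>⇒≉ (0<nat k)) (begin
    κ * X     ≈⟨ solve 3 (λ κ x z → κ :* x := z :- ((:- κ) :* x :+ (z :- con (+ 0)))) refl κ X _ ⟩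
    κ * Y - (- κ * X + (κ * Y - 0#))
              ≈⟨ +-congˡ (-‿cong (begin
                 - κ * X + (κ * Y - 0#)        ≈⟨ +-cong (sym residue-A) (trans (solve 1 (λ y → y :- con (+ 0) := con (+ 0) :+ y) refl _)
                                                    (+-cong (sym (trans (*-congˡ residue-S) (zeroʳ v))) (sym residue-B))) ⟩
                 v * dA + (v * dS + v * dB)    ≈⟨ solve 4 (λ v a b c → v :* a :+ (v :* b :+ v :* c) := v :* (a :+ (b :+ c))) refl v dA dS dB ⟩
                 v * (dA + (dS + dB))          ≈⟨ *-congˡ residue-sum ⟩
                 v * - (κ * m)                 ∎)) ⟩
    κ * Y - v * - (κ * m)
              ≈⟨ solve 4 (λ κ y v m → κ :* y :- v :* (:- (κ :* m)) := κ :* (y :+ m :* v)) refl κ Y v m ⟩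
    κ * (Y + m * v) ∎)
    where
    open Residues m ni (suc k) l l′ inj inj′ full
    κ = nat (suc k)
    v = V m l l′
    X = ∑ N (lowered (λ l → V m l l′) (suc k) l)
    Y = ∑ N (λ j → V m l (raise (suc k) l′ j))
    dA = dd A (λ u → f u * invProd (S ++ B) u)
    dS = dd S (λ u → f u * invProd A u * invProd B u)
    dB = dd B (λ u → f u * invProd A u * invProd S u)

-- Injective tuples of small sum

module TupleCombinatorics where
  open import Data.Nat.Base as ℕ using (ℕ; zero; suc; z≤n; _+_; _*_; _≤_; _<_)
  open import Data.Vec.Base as Vec using (Vec; _∷_; lookup; _[_]≔_; sum; removeAt)
  open +-*-Solver using (solve; _:+_; _:*_; _:=_; con)

  sum-removeAt : ∀ {N} (l : Vec ℕ (suc N)) i → sum l ≡ lookup l i + sum (removeAt l i)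
  sum-removeAt (a ∷ l)     zero    = ≡.refl
  sum-removeAt (a ∷ b ∷ l) (suc i) = ≡.trans (≡.cong (_+_ a) (sum-removeAt (b ∷ l) i))
    (solve 3 (λ a x y → a :+ (x :+ y) := x :+ (a :+ y)) ≡.refl a (lookup (b ∷ l) i) (sum (removeAt (b ∷ l) i)))

  removeAt-lookup : ∀ {N} (l : Vec ℕ (suc N)) i j → lookup (removeAt l i) j ≡ lookup l (punchIn i j)
  removeAt-lookup (a ∷ l)     zero    j       = ≡.refl
  removeAt-lookup (a ∷ b ∷ l) (suc i) zero    = ≡.refl
  removeAt-lookup (a ∷ b ∷ l) (suc i) (suc j) = removeAt-lookup (b ∷ l) i j

  removeAt-injective : ∀ {N} (l : Vec ℕ (suc N)) i → Injective l → Injective (removeAt l i)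
  removeAt-injective l i inj j k eq = Fin.punchIn-injective i j k (inj _ _
    (≡.trans (≡.sym (removeAt-lookup l i j)) (≡.trans eq (removeAt-lookup l i k))))

  large-entry : ∀ {N} (l : Vec ℕ (suc N)) → Injective l → ∃ λ i → N ≤ lookup l i
  large-entry {N} l inj with Fin.any? (λ i → N ℕ.≤? lookup l i)
  ... | yes large = large
  ... | no  small with Fin.pigeonhole (ℕ.n<1+n N) (λ i → fromℕ< (ℕ.≰⇒> (λ N≤ → small (i , N≤))))
  ...   | i , j , i<j , eq = contradiction
    (inj i j (≡.trans (≡.sym (Fin.toℕ-fromℕ< _)) (≡.trans (≡.cong toℕ eq) (Fin.toℕ-fromℕ< _))))
    (Fin.<⇒≢ i<j)

  -- `N` distinct naturals have sum at least `N (N - 1) / 2`, written without division or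
  -- subtraction. By the pigeonhole principle some entry is at least `N - 1`; it is removed.
  injective-sum : ∀ {N} (l : Vec ℕ N) → Injective l → N * N ≤ 2 * sum l + N
  injective-sum {zero}  l inj = z≤n
  injective-sum {suc N} l inj with large-entry l inj
  ... | i , N≤a = begin
    suc N * suc N                            ≡⟨ solve 1 (λ n → (con 1 :+ n) :* (con 1 :+ n) := n :* n :+ (n :+ (con 1 :+ n))) ≡.refl N ⟩
    N * N + (N + suc N)                      ≤⟨ ℕ.+-mono-≤ (injective-sum (removeAt l i) (removeAt-injective l i inj)) (ℕ.+-monoˡ-≤ (suc N) N≤a) ⟩
    2 * r + N + (a + suc N)                  ≤⟨ ℕ.+-monoˡ-≤ (a + suc N) (ℕ.+-monoʳ-≤ (2 * r) N≤a) ⟩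
    2 * r + a + (a + suc N)                  ≡⟨ solve 3 (λ r a n → con 2 :* r :+ a :+ (a :+ n) := con 2 :* (a :+ r) :+ n) ≡.refl r a (suc N) ⟩
    2 * (a + r) + suc N                      ≡⟨ ≡.cong (λ s → 2 * s + suc N) (sum-removeAt l i) ⟨
    2 * sum l + suc N                        ∎
    where
    open ℕ.≤-Reasoning
    a = lookup l i
    r = sum (removeAt l i)

  -- If v were missing, injective-sum for v ∷ l would be violated.
  small-sum⇒contains : ∀ {N} (l : Vec ℕ N) → Injective l → ∀ v →
                       2 * sum l + (2 * v + 1) ≤ N * N + N → Contains l v
  small-sum⇒contains {N} l inj v small with contains? l v
  ... | yes v∈l = v∈l
  ... | no  v∉l = contradiction bound (ℕ.<⇒≱ (begin-strict
    2 * (v + sum l) + suc N                <⟨ ℕ.n<1+n _ ⟩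
    suc (2 * (v + sum l) + suc N)          ≡⟨ solve 3 (λ v s n → con 1 :+ (con 2 :* (v :+ s) :+ (con 1 :+ n)) := (con 2 :* s :+ (con 2 :* v :+ con 1)) :+ (con 1 :+ n)) ≡.refl v (sum l) N ⟩
    2 * sum l + (2 * v + 1) + suc N        ≤⟨ ℕ.+-monoˡ-≤ (suc N) small ⟩
    N * N + N + suc N                      ≡⟨ solve 1 (λ n → n :* n :+ n :+ (con 1 :+ n) := (con 1 :+ n) :* (con 1 :+ n)) ≡.refl N ⟩
    suc N * suc N                          ∎))
    where
    open ℕ.≤-Reasoning
    inj′ : Injective (v ∷ l)
    inj′ zero    zero    eq = ≡.refl
    inj′ zero    (suc j) eq = contradiction (j , ≡.sym eq) v∉l
    inj′ (suc i) zero    eq = contradiction (i , eq) v∉l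
    inj′ (suc i) (suc j) eq = ≡.cong suc (inj i j eq)
    bound : suc N * suc N ≤ 2 * (v + sum l) + suc N
    bound = injective-sum (v ∷ l) inj′

  sum-update : ∀ {N} (l : Vec ℕ N) i a → sum (l [ i ]≔ a) + lookup l i ≡ sum l + a
  sum-update (x ∷ l) zero    a = solve 3 (λ a s x → a :+ s :+ x := x :+ s :+ a) ≡.refl a (sum l) x
  sum-update (x ∷ l) (suc i) a = ≡.trans (ℕ.+-assoc x _ _) (≡.trans (≡.cong (_+_ x) (sum-update l i a)) (≡.sym (ℕ.+-assoc x _ a)))

  lookup≤sum : ∀ {N} (l : Vec ℕ N) i → lookup l i ≤ sum l
  lookup≤sum (a ∷ l) zero    = ℕ.m≤m+n a _
  lookup≤sum (a ∷ l) (suc i) = ℕ.≤-trans (lookup≤sum l i) (ℕ.m≤n+m _ a)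

  packing-bound : ∀ N s k S v → v < k → s + k ≤ S → 2 * S ≤ N * N + N → 2 * s + (2 * v + 1) ≤ N * N + N
  packing-bound N s k S v v<k fits small = begin
    2 * s + (2 * v + 1)   ≤⟨ ℕ.+-monoʳ-≤ (2 * s) (ℕ.n≤1+n _) ⟩
    2 * s + suc (2 * v + 1) ≡⟨ solve 2 (λ s v → con 2 :* s :+ (con 1 :+ (con 2 :* v :+ con 1)) := con 2 :* (s :+ (con 1 :+ v))) ≡.refl s v ⟩
    2 * (s + suc v)       ≤⟨ ℕ.*-monoʳ-≤ 2 (ℕ.≤-trans (ℕ.+-monoʳ-≤ s v<k) fits) ⟩
    2 * S                 ≤⟨ small ⟩
    N * N + N             ∎
    where open ℕ.≤-Reasoning

open TupleCombinatorics

-- Antisymmetric functions of tuples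

module Antisymmetric {c ℓ₁ ℓ₂} (F : CompleteOrderedField c ℓ₁ ℓ₂) where
  open CompleteOrderedField F hiding (zero)
  open IntegerSolver commutativeRing
  open OrderedField F
  open Sums commutativeRing
  open Vertex F using (raise)
  open SetoidReasoning setoid

  Antisym : ∀ {N} → (Vec ℕ N → Carrier) → Set _
  Antisym f = ∀ l i j → i ≢ j → ∀ a b → f (l [ i ]≔ a [ j ]≔ b) ≈ - f (l [ i ]≔ b [ j ]≔ a)

  module _ {N} (f : Vec ℕ N → Carrier) (antisym : Antisym f) where

    private
      update-self : ∀ (l : Vec ℕ N) i {a} → lookup l i ≡ a → l [ i ]≔ a ≡ l
      update-self l i ≡.refl = Vec.[]≔-lookup l i

    repeats⇒0 : ∀ l → Repeats l → f l ≈ 0#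
    repeats⇒0 l (i , j , i≢j , eq) = self-neg⇒0 (begin
      f l                                          ≡⟨ ≡.cong f self ⟨
      f (l [ i ]≔ lookup l i [ j ]≔ lookup l i)    ≈⟨ antisym l i j i≢j _ _ ⟩
      - f (l [ i ]≔ lookup l i [ j ]≔ lookup l i)  ≡⟨ ≡.cong (λ l → - f l) self ⟩
      - f l                                        ∎)
      where
      self : l [ i ]≔ lookup l i [ j ]≔ lookup l i ≡ l
      self = ≡.trans (≡.cong (_[ j ]≔ lookup l i) (Vec.[]≔-lookup l i)) (update-self l j (≡.sym eq))

    -- Let `i` and `j` hold the repeated value. Moving any other entry preserves the repetition, and
    -- the moves of `i` and of `j` lead to tuples that differ by an exchange, so they cancel.
    moves-vanish : ∀ (w : ℕ → Carrier) (h : ℕ → ℕ) l → Repeats l →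
                   ∑ N (λ i → w (lookup l i) * f (l [ i ]≔ h (lookup l i))) ≈ 0#
    moves-vanish w h l (i , j , i≢j , eq) = trans (∑-pair N i j i≢j rest) (begin
      w (lookup l i) * f (l [ i ]≔ h (lookup l i)) + w (lookup l j) * f (l [ j ]≔ h (lookup l j))
        ≡⟨ ≡.cong (λ a → w (lookup l i) * f (l [ i ]≔ h (lookup l i)) + w a * f (l [ j ]≔ h a)) (≡.sym eq) ⟩
      w a * f (l [ i ]≔ h a) + w a * f (l [ j ]≔ h a)
        ≈⟨ +-congʳ (*-congˡ (begin
          f (l [ i ]≔ h a)             ≡⟨ ≡.cong f (update-self (l [ i ]≔ h a) j (≡.trans (Vec.lookup∘update′ (i≢j ∘ ≡.sym) l _) (≡.sym eq))) ⟨
          f (l [ i ]≔ h a [ j ]≔ a)    ≈⟨ antisym l i j i≢j _ _ ⟩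
          - f (l [ i ]≔ a [ j ]≔ h a)  ≡⟨ ≡.cong (λ l → - f (l [ j ]≔ h a)) (Vec.[]≔-lookup l i) ⟩
          - f (l [ j ]≔ h a)           ∎)) ⟩
      w a * - f (l [ j ]≔ h a) + w a * f (l [ j ]≔ h a)
        ≈⟨ solve 2 (λ w x → w :* (:- x) :+ w :* x := con (+ 0)) refl _ _ ⟩
      0# ∎)
      where
      a = lookup l i
      rest : ∀ k → k ≢ i → k ≢ j → w (lookup l k) * f (l [ k ]≔ h (lookup l k)) ≈ 0#
      rest k k≢i k≢j = trans (*-congˡ (repeats⇒0 (l [ k ]≔ h (lookup l k)) (i , j , i≢j ,
        ≡.trans (Vec.lookup∘update′ (k≢i ∘ ≡.sym) l _) (≡.trans eq (≡.sym (Vec.lookup∘update′ (k≢j ∘ ≡.sym) l _)))))) (zeroʳ _)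

  private
    -- Reversing the antidiagonal negates the sum.
    reverse-antisym : ∀ n (g : ℕ → ℕ → Carrier) → (∀ a b → g a b ≈ - g b a) →
                      ∑< (suc n) (λ i → g i (n ℕ.∸ i)) ≈ 0#
    reverse-antisym n g anti = self-neg⇒0 (begin
      ∑< (suc n) (λ i → g i (n ℕ.∸ i))                     ≈⟨ ∑<-reverse n (λ i → g i (n ℕ.∸ i)) ⟩
      ∑< (suc n) (λ i → g (n ℕ.∸ i) (n ℕ.∸ (n ℕ.∸ i)))     ≈⟨ ∑<-cong (suc n) (λ i i≤n → trans (anti _ _)
                                                               (reflexive (≡.cong (λ j → - g j (n ℕ.∸ i)) (ℕ.m∸[m∸n]≡n (ℕ.s≤s⁻¹ i≤n))))) ⟩
      ∑< (suc n) (λ i → - g i (n ℕ.∸ i))                   ≈⟨ ∑<-neg (suc n) (λ i → g i (n ℕ.∸ i)) ⟩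
      - ∑< (suc n) (λ i → g i (n ℕ.∸ i))                   ∎)

  bracket-sum : ∀ K a → a ℕ.≤ K → ∀ φ → ∑< K (λ k → ⟦ suc k ℕ.≤? a ⟧ * φ k) ≈ ∑< a φ
  bracket-sum K a a≤K φ = trans
    (∑<-extend a≤K (λ k a≤k _ → trans (*-congʳ (⟦⟧-no (suc k ℕ.≤? a) (ℕ.≤⇒≯ a≤k))) (zeroˡ _)))
    (∑<-cong a (λ k k<a → trans (*-congʳ (⟦⟧-yes (suc k ℕ.≤? a) k<a)) (*-identityˡ _)))

  -- On an antidiagonal everything cancels; the terms away from (a , b) are the exchanges.
  exchanges : ∀ (g : ℕ → ℕ → Carrier) → (∀ a b → g a b ≈ - g b a) → ∀ K a b → a ℕ.≤ K → b ℕ.≤ K →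
    ∑< K (λ k → ⟦ suc k ℕ.≤? a ⟧ * g (a ℕ.∸ suc k) (b ℕ.+ suc k)) +
    ∑< K (λ k → ⟦ suc k ℕ.≤? b ⟧ * g (a ℕ.+ suc k) (b ℕ.∸ suc k)) ≈ - g a b
  exchanges g anti K a b a≤K b≤K = begin
    _ ≈⟨ +-cong (bracket-sum K a a≤K _) (bracket-sum K b b≤K _) ⟩
    ∑< a down + ∑< b up
      ≈⟨ +-cong (below a ≡.refl) (∑<-cong b (λ k k<b → reflexive (≡.cong (g (a ℕ.+ suc k))
           (≡.sym (ℕ.[m+n]∸[m+o]≡n∸o a b (suc k)))))) ⟩
    ∑< a φ + ∑< b (λ k → φ (a ℕ.+ suc k))
      ≈⟨ solve 3 (λ x y z → x :+ y := (x :+ (z :+ y)) :- z) refl _ _ (φ (a ℕ.+ 0)) ⟩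
    (∑< a φ + ∑< (suc b) (λ k → φ (a ℕ.+ k))) - φ (a ℕ.+ 0)
      ≈⟨ +-congʳ (trans (sym (∑<-split a (suc b) φ)) (trans (reflexive (≡.cong (λ n → ∑< n φ) (ℕ.+-suc a b)))
           (reverse-antisym (a ℕ.+ b) g anti))) ⟩
    0# - φ (a ℕ.+ 0)
      ≈⟨ +-identityˡ _ ⟩
    - φ (a ℕ.+ 0)
      ≡⟨ ≡.cong₂ (λ x y → - g x y) (ℕ.+-identityʳ a) (≡.trans (ℕ.[m+n]∸[m+o]≡n∸o a b 0) ≡.refl) ⟩
    - g a b ∎
    where
    φ down up : ℕ → Carrier
    φ c = g c (a ℕ.+ b ℕ.∸ c)
    down k = g (a ℕ.∸ suc k) (b ℕ.+ suc k)
    up k = g (a ℕ.+ suc k) (b ℕ.∸ suc k)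
    below : ∀ a′ → a′ ≡ a → ∑< a down ≈ ∑< a φ
    below zero     ≡.refl = refl
    below (suc a′) ≡.refl = sym (trans (∑<-reverse a′ φ) (∑<-cong (suc a′) (λ k k<a →
      reflexive (≡.cong (g (a′ ℕ.∸ k)) (index k (ℕ.s≤s⁻¹ k<a))))))
      where
      index : ∀ k → k ℕ.≤ a′ → suc a′ ℕ.+ b ℕ.∸ (a′ ℕ.∸ k) ≡ b ℕ.+ suc k
      index k k≤a′ = ≡.trans (≡.cong (ℕ._∸ (a′ ℕ.∸ k)) (≡.trans (≡.cong (λ x → suc x ℕ.+ b) (≡.sym (ℕ.m+[n∸m]≡n k≤a′)))
          (≡.trans (≡.cong (ℕ._+ b) (≡.cong suc (ℕ.+-comm k _))) (≡.trans (≡.cong (ℕ._+ b) (≡.sym (ℕ.+-suc (a′ ℕ.∸ k) k)))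
            (≡.trans (ℕ.+-assoc (a′ ℕ.∸ k) (suc k) b) ≡.refl)))))
        (≡.trans (ℕ.m+n∸m≡n (a′ ℕ.∸ k) (suc k ℕ.+ b)) (ℕ.+-comm (suc k) b))

  -- The sum of the entries as the normal-ordered energy Σ_k α₋ₖ αₖ of bosonic modes.
  module _ {N} (f : Vec ℕ N → Carrier) (antisym : Antisym f) where

    hop : Vec ℕ N → Fin N → Fin N → ℕ → Carrier
    hop l i j k = ⟦ k ℕ.≤? lookup l i ⟧ * f (raise k (l [ i ]≔ (lookup l i ℕ.∸ k)) j)

    hop-self : ∀ l i k → hop l i i k ≈ ⟦ k ℕ.≤? lookup l i ⟧ * f l
    hop-self l i k with k ℕ.≤? lookup l i
    ... | no _    = trans (zeroˡ _) (sym (zeroˡ _))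
    ... | yes k≤a = *-congˡ (reflexive (≡.cong f (≡.trans (Vec.[]≔-idempotent l i)
      (≡.trans (≡.cong (λ x → l [ i ]≔ (x ℕ.+ k)) (Vec.lookup∘update i l _))
        (≡.trans (≡.cong (l [ i ]≔_) (ℕ.m∸n+n≡m k≤a)) (Vec.[]≔-lookup l i))))))

    private
      diagonal : ∀ l K i → lookup l i ℕ.≤ K → ∑< K (λ k → hop l i i (suc k)) ≈ nat (lookup l i) * f l
      diagonal l K i a≤K = trans (∑<-cong K (λ k _ → hop-self l i (suc k)))
        (trans (bracket-sum K (lookup l i) a≤K (λ _ → f l)) (∑<-const (lookup l i) (f l)))

      off-diagonal : ∀ l K i j → i ≢ j → lookup l i ℕ.≤ K → lookup l j ℕ.≤ K →
                     ∑< K (λ k → hop l i j (suc k)) + ∑< K (λ k → hop l j i (suc k)) ≈ - f l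
      off-diagonal l K i j i≢j a≤K b≤K = begin
        _ ≈⟨ +-cong (∑<-cong K (λ k _ → *-congˡ (reflexive (≡.cong (λ x → f (l [ i ]≔ (a ℕ.∸ suc k) [ j ]≔ (x ℕ.+ suc k)))
               (Vec.lookup∘update′ (i≢j ∘ ≡.sym) l _)))))
             (∑<-cong K (λ k _ → *-congˡ (reflexive (≡.trans
               (≡.cong (λ x → f (l [ j ]≔ (b ℕ.∸ suc k) [ i ]≔ (x ℕ.+ suc k))) (Vec.lookup∘update′ i≢j l _))
               (≡.cong f (Vec.[]≔-commutes l j i (i≢j ∘ ≡.sym))))))) ⟩
        _ ≈⟨ exchanges g (λ a b → antisym l i j i≢j a b) K a b a≤K b≤K ⟩
        - g a b ≡⟨ ≡.cong (λ l → - f l) (≡.trans (≡.cong (_[ j ]≔ b) (Vec.[]≔-lookup l i)) (Vec.[]≔-lookup l j)) ⟩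
        - f l ∎
        where
        a = lookup l i
        b = lookup l j
        g : ℕ → ℕ → Carrier
        g x y = f (l [ i ]≔ x [ j ]≔ y)

      ∑-nat : ∀ {M} (l : Vec ℕ M) → ∑ M (λ i → nat (lookup l i)) ≈ nat (Vec.sum l)
      ∑-nat []      = refl
      ∑-nat (a ∷ l) = trans (+-congˡ (∑-nat l)) (sym (nat-+ a _))

    -- Each pair `i = j` contributes the entry itself, and each unordered pair of distinct indices
    -- contributes `- f l` by `exchanges`. So the hops amount to `sum l - N (N - 1) / 2`, the excess
    -- over the minimal sum; the statement doubles this and moves `N * N` to the left to stay free
    -- of halves.
    energy : ∀ l K → (∀ i → lookup l i ℕ.≤ K) →
      nat 2 * ∑< K (λ k → ∑ N (λ i → ∑ N (λ j → hop l i j (suc k)))) + nat N * nat N * f l ≈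
      (nat 2 * nat (Vec.sum l) + nat N) * f l
    energy l K bound = begin
      nat 2 * ∑< K (λ k → ∑ N (λ i → ∑ N (λ j → hop l i j (suc k)))) + nat N * nat N * f l
        ≈⟨ +-congʳ (*-congˡ (trans (∑<-∑-swap K N _) (∑-cong N (λ i → ∑<-∑-swap K N _)))) ⟩
      nat 2 * S + nat N * nat N * f l
        ≈⟨ +-congʳ (solve 1 (λ s → con (+ 2) :* s := s :+ s) refl S) ⟩
      (S + S) + nat N * nat N * f l
        ≈⟨ +-congʳ (+-congˡ (∑-swap N N H)) ⟩
      (S + ∑ N (λ i → ∑ N (λ j → H j i))) + nat N * nat N * f l
        ≈⟨ +-congʳ (trans (sym (∑-+ N _ _)) (∑-cong N (λ i → trans (sym (∑-+ N _ _)) (row i)))) ⟩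
      ∑ N (λ i → (nat 2 * nat (lookup l i) + 1#) * f l - nat N * f l) + nat N * nat N * f l
        ≈⟨ +-congʳ (∑-cong N (λ i → solve 3 (λ a n f → (con (+ 2) :* a :+ con (+ 1)) :* f :- n :* f := con (+ 2) :* f :* a :+ (f :- n :* f)) refl _ (nat N) (f l))) ⟩
      ∑ N (λ i → nat 2 * f l * nat (lookup l i) + (f l - nat N * f l)) + nat N * nat N * f l
        ≈⟨ +-congʳ (trans (∑-+ N _ _) (+-cong (trans (∑-* N _ _) (*-congˡ (∑-nat l))) (∑-const N _))) ⟩
      (nat 2 * f l * nat (Vec.sum l) + nat N * (f l - nat N * f l)) + nat N * nat N * f l
        ≈⟨ solve 3 (λ f s n → (con (+ 2) :* f :* s :+ n :* (f :- n :* f)) :+ n :* n :* f := (con (+ 2) :* s :+ n) :* f) refl _ _ _ ⟩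
      (nat 2 * nat (Vec.sum l) + nat N) * f l ∎
      where
      H : Fin N → Fin N → Carrier
      H i j = ∑< K (λ k → hop l i j (suc k))
      S = ∑ N (λ i → ∑ N (H i))
      row : ∀ i → ∑ N (λ j → H i j + H j i) ≈ (nat 2 * nat (lookup l i) + 1#) * f l - nat N * f l
      row i = begin
        ∑ N (λ j → H i j + H j i)
          ≈⟨ ∑-cong N (λ j → solve 2 (λ x f → x := (x :+ f) :+ (:- f)) refl _ (f l)) ⟩
        ∑ N (λ j → (H i j + H j i + f l) + - f l)
          ≈⟨ ∑-+ N _ _ ⟩
        ∑ N (λ j → H i j + H j i + f l) + ∑ N (λ _ → - f l)
          ≈⟨ +-cong (∑-single N i (λ j j≢i → trans (+-congʳ (off-diagonal l K i j (j≢i ∘ ≡.sym) (bound i) (bound j))) (-‿inverseˡ _)))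
                    (∑-const N _) ⟩
        (H i i + H i i + f l) + nat N * - f l
          ≈⟨ +-congʳ (+-congʳ (+-cong (diagonal l K i (bound i)) (diagonal l K i (bound i)))) ⟩
        (nat (lookup l i) * f l + nat (lookup l i) * f l + f l) + nat N * - f l
          ≈⟨ solve 3 (λ a n f → (a :* f :+ a :* f :+ f) :+ n :* (:- f) := (con (+ 2) :* a :+ con (+ 1)) :* f :- n :* f) refl _ _ _ ⟩
        (nat 2 * nat (lookup l i) + 1#) * f l - nat N * f l ∎

-- Traces of the kernel

module WordSums {c ℓ} (R : CommutativeRing c ℓ) (B : ℕ) where
  open CommutativeRing R hiding (zero)
  open Sums R
  open SetoidReasoning setoid

  W : ∀ N → (Vec ℕ N → Carrier) → Carrier
  W zero    f = f []
  W (suc N) f = ∑< B (λ a → W N (λ l → f (a ∷ l)))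

  W-cong : ∀ N {f g} → (∀ l → f l ≈ g l) → W N f ≈ W N g
  W-cong zero    eq = eq []
  W-cong (suc N) eq = ∑<-cong B (λ a _ → W-cong N (λ l → eq (a ∷ l)))

  W-+ : ∀ N f g → W N (λ l → f l + g l) ≈ W N f + W N g
  W-+ zero    f g = refl
  W-+ (suc N) f g = trans (∑<-cong B (λ a _ → W-+ N _ _)) (∑<-+ B _ _)

  W-* : ∀ N k f → W N (λ l → k * f l) ≈ k * W N f
  W-* zero    k f = refl
  W-* (suc N) k f = trans (∑<-cong B (λ a _ → W-* N k _)) (∑<-* B k _)

  W-zero : ∀ N {f} → (∀ l → f l ≈ 0#) → W N f ≈ 0#
  W-zero zero    eq = eq []
  W-zero (suc N) eq = ∑<-zero B (λ a _ → W-zero N (λ l → eq (a ∷ l)))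

  W-∑ : ∀ N n (f : Vec ℕ N → Fin n → Carrier) → W N (λ l → ∑ n (f l)) ≈ ∑ n (λ i → W N (λ l → f l i))
  W-∑ N zero    f = W-zero N (λ _ → refl)
  W-∑ N (suc n) f = trans (W-+ N _ _) (+-congˡ (W-∑ N n (λ l i → f l (suc i))))

  W-∑< : ∀ N n (f : Vec ℕ N → ℕ → Carrier) → W N (λ l → ∑< n (f l)) ≈ ∑< n (λ i → W N (λ l → f l i))
  W-∑< N zero    f = W-zero N (λ _ → refl)
  W-∑< N (suc n) f = trans (W-+ N _ _) (+-congˡ (W-∑< N n (λ l i → f l (suc i))))

  private
    shift : ∀ k (φ : ℕ → Carrier) → (∀ a → B ℕ.≤ a ℕ.+ k → φ a ≈ 0#) →
            ∑< B (λ a → ⟦ k ℕ.≤? a ⟧ * φ (a ℕ.∸ k)) ≈ ∑< B φ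
    shift k φ vanish with k ℕ.≤? B
    ... | no  k≰B = trans
      (∑<-zero B (λ a a<B → trans (*-congʳ (⟦⟧-no (k ℕ.≤? a) (λ k≤a → k≰B (ℕ.≤-trans k≤a (ℕ.<⇒≤ a<B))))) (zeroˡ _)))
      (sym (∑<-zero B (λ a _ → vanish a (ℕ.≤-trans (ℕ.≰⇒≥ k≰B) (ℕ.m≤n+m k a)))))
    ... | yes k≤B = begin
      ∑< B ψ                                           ≡⟨ ≡.cong (λ B → ∑< B ψ) (≡.sym (ℕ.m+[n∸m]≡n k≤B)) ⟩
      ∑< (k ℕ.+ B′) ψ                                  ≈⟨ ∑<-split k B′ ψ ⟩
      ∑< k ψ + ∑< B′ (ψ ∘ (k ℕ.+_))                    ≈⟨ +-cong
        (∑<-zero k (λ a a<k → trans (*-congʳ (⟦⟧-no (k ℕ.≤? a) (ℕ.<⇒≱ a<k))) (zeroˡ _)))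
        (∑<-cong B′ (λ a _ → trans (*-cong (⟦⟧-yes (k ℕ.≤? k ℕ.+ a) (ℕ.m≤m+n k a)) (reflexive (≡.cong φ (ℕ.m+n∸m≡n k a)))) (*-identityˡ _))) ⟩
      0# + ∑< B′ φ                                     ≈⟨ +-identityˡ _ ⟩
      ∑< B′ φ                                          ≈⟨ ∑<-extend (ℕ.m∸n≤m B k) (λ a B′≤a _ → vanish a
                                                            (≡.subst (ℕ._≤ a ℕ.+ k) (ℕ.m∸n+n≡m k≤B) (ℕ.+-monoˡ-≤ k B′≤a))) ⟨
      ∑< B φ                                           ∎
      where
      B′ = B ℕ.∸ k
      ψ : ℕ → Carrier
      ψ a = ⟦ k ℕ.≤? a ⟧ * φ (a ℕ.∸ k)

  -- Reindexing by `p = l - k eᵢ` reaches exactly the words whose raised entry stays below `B`; the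
  -- hypothesis disposes of the rest.
  W-shift : ∀ N i k (G : Vec ℕ N → Carrier) → (∀ p → B ℕ.≤ lookup p i ℕ.+ k → G p ≈ 0#) →
            W N (λ l → ⟦ k ℕ.≤? lookup l i ⟧ * G (l [ i ]≔ (lookup l i ℕ.∸ k))) ≈ W N G
  W-shift (suc N) zero    k G vanish = trans (∑<-cong B (λ a _ → W-* N _ _))
    (shift k (λ a → W N (λ l → G (a ∷ l))) (λ a B≤ → W-zero N (λ l → vanish (a ∷ l) B≤)))
  W-shift (suc N) (suc i) k G vanish =
    ∑<-cong B (λ a _ → W-shift N i k (λ l → G (a ∷ l)) (λ p B≤ → vanish (a ∷ p) B≤))

module Trace {c ℓ₁ ℓ₂} (F : CompleteOrderedField c ℓ₁ ℓ₂) where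
  open CompleteOrderedField F hiding (zero)
  open IntegerSolver commutativeRing
  open OrderedField F
  open Products commutativeRing
  open Sums commutativeRing
  open Vertex F
  open Antisymmetric F
  open SetoidReasoning setoid

  V-antisymʳ : ∀ {N} m (l : Vec ℕ N) → Antisym (V m l)
  V-antisymʳ m l l′ i j i≢j a b = begin
    V m l (l′ [ i ]≔ a [ j ]≔ b)          ≈⟨ V-right m l (l′ [ i ]≔ a [ j ]≔ b) ⟩
    C * alt ψ (l′ [ i ]≔ a [ j ]≔ b)      ≈⟨ *-congˡ (alt-antisym ψ l′ i j i≢j a b) ⟩
    C * - alt ψ (l′ [ i ]≔ b [ j ]≔ a)    ≈⟨ solve 2 (λ c x → c :* (:- x) := :- (c :* x)) refl _ _ ⟩
    - (C * alt ψ (l′ [ i ]≔ b [ j ]≔ a))  ≈⟨ -‿cong (V-right m l (l′ [ i ]≔ b [ j ]≔ a)) ⟨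
    - V m l (l′ [ i ]≔ b [ j ]≔ a)        ∎
    where
    C = alt (binom m) l
    ψ = weightʳ m l

  -- Degenerate tuples are those for which V vanishes; the others must be tightly packed.
  Packed : ∀ {N} → ℕ → Vec ℕ N → Set
  Packed k l = Repeats l ⊎ (Injective l × (∀ v → v ℕ.< k → Contains l v))

  -- If one of the tuples repeats an entry, `V` vanishes there and the moves of that tuple cancel in
  -- pairs; the residue computation covers the rest.
  relation : ∀ {N} {m} → NonInteger m → ∀ k (l l′ : Vec ℕ N) → Packed (suc k) l′ →
    ∑ N (lowered (λ l → V m l l′) (suc k) l) ≈ ∑ N (λ j → V m l (raise (suc k) l′ j)) + m * V m l l′
  relation {N} {m} ni k l l′ (inj₁ rep) = trans
    (∑-zero N (λ i → trans (*-congˡ (repeats⇒0 (V m (l [ i ]≔ (lookup l i ℕ.∸ suc k))) (V-antisymʳ m (l [ i ]≔ (lookup l i ℕ.∸ suc k))) l′ rep)) (zeroʳ _)))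
    (sym (trans (+-cong
      (trans (∑-cong N (λ j → sym (*-identityˡ _))) (moves-vanish (V m l) (V-antisymʳ m l) (λ _ → 1#) (ℕ._+ suc k) l′ rep))
      (trans (*-congˡ (repeats⇒0 (V m l) (V-antisymʳ m l) l′ rep)) (zeroʳ _))) (+-identityˡ _)))
  relation {N} {m} ni k l l′ (inj₂ (inj′ , full)) with injective⊎repeats l
  ... | inj₁ inj = relation-injective ni k l l′ inj inj′ full
  ... | inj₂ rep = trans
    (moves-vanish (λ l → V m l l′) (λ l → V-antisymˡ m l l′) (λ a → ⟦ suc k ℕ.≤? a ⟧) (ℕ._∸ suc k) l rep)
    (sym (trans (+-cong
      (∑-zero N (λ j → repeats⇒0 (λ l → V m l (raise (suc k) l′ j)) (λ l → V-antisymˡ m l (raise (suc k) l′ j)) l rep))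
      (trans (*-congˡ (repeats⇒0 (λ l → V m l l′) (λ l → V-antisymˡ m l l′) l rep)) (zeroʳ _))) (+-identityˡ _)))

  private
    sgn : ∀ {N} → Vec ℕ N → Carrier
    sgn l = prod (λ _ → prod (λ _ → - 1#) l) l

    prod-const : ∀ {M x y} (l l′ : Vec ℕ M) → x ≈ y → prod (λ _ → x) l ≈ prod (λ _ → y) l′
    prod-const []      []       eq = refl
    prod-const (_ ∷ l) (_ ∷ l′) eq = *-cong eq (prod-const l l′ eq)

    sgn-const : ∀ {N} (l l′ : Vec ℕ N) → sgn l ≈ sgn l′
    sgn-const l l′ = prod-const l l′ (prod-const l l′ refl)

    prod-≉0 : ∀ {M x} (l : Vec ℕ M) → x ≉ 0# → prod (λ _ → x) l ≉ 0#
    prod-≉0 []      x≉0 = >⇒≉ 0<1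
    prod-≉0 (_ ∷ l) x≉0 = *-≉0 x≉0 (prod-≉0 l x≉0)

    sgn≉0 : ∀ {N} (l : Vec ℕ N) → sgn l ≉ 0#
    sgn≉0 l = prod-≉0 l (prod-≉0 l -1≉0)

  -- `relation` for `- m`, read through `V-swap`, lowers the right argument instead of the left one.
  -- The sign of `V-swap` is the same in all terms and drops out.
  relation-swapped : ∀ {N} {m} → NonInteger m → ∀ k (l : Vec ℕ N) → Packed (suc k) l →
    ∑ N (lowered (V m l) (suc k) l) ≈ ∑ N (λ j → V m (raise (suc k) l j) l) - m * V m l l
  relation-swapped {N} {m} ni k l packed = *-cancelˡ (sgn≉0 l) (begin
    sgn l * ∑ N (lowered (V m l) (suc k) l)
      ≈⟨ trans (sym (∑-* N _ _)) (∑-cong N (λ i → solve 3 (λ s b v → s :* (b :* v) := b :* (s :* v)) refl _ _ _)) ⟩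
    ∑ N (λ i → ⟦ suc k ℕ.≤? lookup l i ⟧ * (sgn l * V m l (l [ i ]≔ (lookup l i ℕ.∸ suc k))))
      ≈⟨ ∑-cong N (λ i → *-congˡ (V-swap ni l (l [ i ]≔ (lookup l i ℕ.∸ suc k)))) ⟨
    ∑ N (lowered (λ l′ → V (- m) l′ l) (suc k) l)
      ≈⟨ relation (NonInteger-neg ni) k l l packed ⟩
    ∑ N (λ j → V (- m) l (raise (suc k) l j)) + - m * V (- m) l l
      ≈⟨ +-cong (∑-cong N (λ j → trans (V-swap ni (raise (suc k) l j) l) (*-congʳ (sgn-const (raise (suc k) l j) l)))) (*-congˡ (V-swap ni l l)) ⟩
    ∑ N (λ j → sgn l * V m (raise (suc k) l j) l) + - m * (sgn l * V m l l)
      ≈⟨ +-congʳ (∑-* N _ _) ⟩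
    sgn l * ∑ N (λ j → V m (raise (suc k) l j) l) + - m * (sgn l * V m l l)
      ≈⟨ solve 4 (λ s x m v → s :* x :+ (:- m) :* (s :* v) := s :* (x :- m :* v)) refl _ _ _ _ ⟩
    sgn l * (∑ N (λ j → V m (raise (suc k) l j) l) - m * V m l l) ∎)

  -- By `S-small`, an injective tuple of sum at most `S - k` contains `0, …, k - 1`, so the
  -- relations are available wherever the recursion applies them. By `S<B`, all tuples of sum at
  -- most `S` are among the words summed over.
  module Recursion {m} (ni : NonInteger m) (N S B : ℕ) (S<B : S ℕ.< B) (S-small : 2 ℕ.* S ℕ.≤ N ℕ.* N ℕ.+ N) where
    open WordSums commutativeRing B

    weight : ℕ → (Vec ℕ N → Carrier) → Carrier
    weight s f = W N (λ l → ⟦ Vec.sum l ℕ.≟ s ⟧ * f l)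

    weight-cong : ∀ s {f g} → (∀ l → Vec.sum l ≡ s → f l ≈ g l) → weight s f ≈ weight s g
    weight-cong s {f} {g} eq = W-cong N pointwise
      where
      pointwise : ∀ l → ⟦ Vec.sum l ℕ.≟ s ⟧ * f l ≈ ⟦ Vec.sum l ℕ.≟ s ⟧ * g l
      pointwise l with Vec.sum l ℕ.≟ s
      ... | yes ≡s = *-congˡ (eq l ≡s)
      ... | no  _  = trans (zeroˡ _) (sym (zeroˡ _))

    weight-+ : ∀ s f g → weight s (λ l → f l + g l) ≈ weight s f + weight s g
    weight-+ s f g = trans (W-cong N (λ l → distribˡ _ _ _)) (W-+ N _ _)

    weight-* : ∀ s k f → weight s (λ l → k * f l) ≈ k * weight s f
    weight-* s k f = trans (W-cong N (λ l → solve 3 (λ b k f → b :* (k :* f) := k :* (b :* f)) refl _ _ _)) (W-* N _ _)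

    weight-∑< : ∀ s n (f : Vec ℕ N → ℕ → Carrier) → weight s (λ l → ∑< n (f l)) ≈ ∑< n (λ i → weight s (λ l → f l i))
    weight-∑< s n f = trans (W-cong N (λ l → sym (∑<-* n _ _))) (W-∑< N n _)

    T : ℕ → Carrier
    T s = weight s (λ l → V m l l)

    -- With raising and lowering of one entry by `k` read as modes `α₋ₖ` and `αₖ`, these are the
    -- graded traces of `V` combined with `α₋ₖ` and with the product `α₋ₖ αₖ` that occurs in
    -- `energy`.
    Y X : ℕ → ℕ → Carrier
    Y k s = weight s (λ l → ∑ N (λ j → V m (raise k l j) l))
    X k s = weight s (λ l → ∑ N (λ i → ∑ N (λ j → hop (λ p → V m p l) (λ p → V-antisymˡ m p l) l i j k)))

    private
      -- Substituting l = p + k eᵢ.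
      substitute : ∀ k s → s ℕ.< B → (H : Fin N → Vec ℕ N → Vec ℕ N → Carrier) →
        weight s (λ l → ∑ N (λ i → ⟦ k ℕ.≤? lookup l i ⟧ * H i (l [ i ]≔ (lookup l i ℕ.∸ k)) l)) ≈
        W N (λ p → ⟦ Vec.sum p ℕ.+ k ℕ.≟ s ⟧ * ∑ N (λ i → H i p (raise k p i)))
      substitute k s s<B H = begin
        _ ≈⟨ W-cong N (λ l → trans (sym (∑-* N _ _)) (∑-cong N (pointwise l))) ⟩
        W N (λ l → ∑ N (λ i → ⟦ k ℕ.≤? lookup l i ⟧ * G i (l [ i ]≔ (lookup l i ℕ.∸ k))))
          ≈⟨ W-∑ N N _ ⟩
        ∑ N (λ i → W N (λ l → ⟦ k ℕ.≤? lookup l i ⟧ * G i (l [ i ]≔ (lookup l i ℕ.∸ k))))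
          ≈⟨ ∑-cong N (λ i → W-shift N i k (G i) (vanish i)) ⟩
        ∑ N (λ i → W N (G i))
          ≈⟨ W-∑ N N _ ⟨
        W N (λ p → ∑ N (λ i → G i p))
          ≈⟨ W-cong N (λ p → ∑-* N _ _) ⟩
        W N (λ p → ⟦ Vec.sum p ℕ.+ k ℕ.≟ s ⟧ * ∑ N (λ i → H i p (raise k p i))) ∎
        where
        G : Fin N → Vec ℕ N → Carrier
        G i p = ⟦ Vec.sum p ℕ.+ k ℕ.≟ s ⟧ * H i p (raise k p i)
        vanish : ∀ i p → B ℕ.≤ lookup p i ℕ.+ k → G i p ≈ 0#
        vanish i p B≤ = trans (*-congʳ (⟦⟧-no (Vec.sum p ℕ.+ k ℕ.≟ s) (λ eq → ℕ.<⇒≱ s<B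
          (ℕ.≤-trans B≤ (ℕ.≤-trans (ℕ.+-monoˡ-≤ k (lookup≤sum p i)) (ℕ.≤-reflexive eq)))))) (zeroˡ _)
        pointwise : ∀ l i → ⟦ Vec.sum l ℕ.≟ s ⟧ * (⟦ k ℕ.≤? lookup l i ⟧ * H i (l [ i ]≔ (lookup l i ℕ.∸ k)) l) ≈
                            ⟦ k ℕ.≤? lookup l i ⟧ * G i (l [ i ]≔ (lookup l i ℕ.∸ k))
        pointwise l i with k ℕ.≤? lookup l i
        ... | no  _   = trans (*-congˡ (zeroˡ _)) (trans (zeroʳ _) (sym (zeroˡ _)))
        ... | yes k≤a = begin
          ⟦ Vec.sum l ℕ.≟ s ⟧ * (1# * H i p l)
            ≈⟨ solve 2 (λ b h → b :* (con (+ 1) :* h) := con (+ 1) :* (b :* h)) refl _ _ ⟩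
          1# * (⟦ Vec.sum l ℕ.≟ s ⟧ * H i p l)
            ≡⟨ ≡.cong₂ (λ x y → 1# * (⟦ x ℕ.≟ s ⟧ * H i p y)) (≡.sym total) (≡.sym restore) ⟩
          1# * (⟦ Vec.sum p ℕ.+ k ℕ.≟ s ⟧ * H i p (raise k p i)) ∎
          where
          p = l [ i ]≔ (lookup l i ℕ.∸ k)
          restore : raise k p i ≡ l
          restore = ≡.trans (Vec.[]≔-idempotent l i) (≡.trans (≡.cong (λ x → l [ i ]≔ (x ℕ.+ k)) (Vec.lookup∘update i l _))
            (≡.trans (≡.cong (l [ i ]≔_) (ℕ.m∸n+n≡m k≤a)) (Vec.[]≔-lookup l i)))
          total : Vec.sum p ℕ.+ k ≡ Vec.sum l
          total = ℕ.+-cancelʳ-≡ (lookup l i) _ _ (≡.trans (ℕ.+-assoc (Vec.sum p) k _) (≡.trans (≡.cong (Vec.sum p ℕ.+_) (ℕ.+-comm k _))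
            (≡.trans (≡.sym (ℕ.+-assoc (Vec.sum p) _ k)) (≡.trans (≡.cong (ℕ._+ k) (sum-update l i _))
              (≡.trans (ℕ.+-assoc (Vec.sum l) _ k) (≡.cong (Vec.sum l ℕ.+_) (ℕ.m∸n+n≡m k≤a)))))))

      unshift : ∀ k s (f : Vec ℕ N → Carrier) → W N (λ p → ⟦ Vec.sum p ℕ.+ k ℕ.≟ s ℕ.+ k ⟧ * f p) ≈ weight s f
      unshift k s f = W-cong N (λ p → *-congʳ (⟦⟧-⇔ (Vec.sum p ℕ.+ k ℕ.≟ s ℕ.+ k) (Vec.sum p ℕ.≟ s)
        (ℕ.+-cancelʳ-≡ k _ _) (≡.cong (ℕ._+ k))))

      unshift-0 : ∀ k s (f : Vec ℕ N → Carrier) → s ℕ.< k → W N (λ p → ⟦ Vec.sum p ℕ.+ k ℕ.≟ s ⟧ * f p) ≈ 0#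
      unshift-0 k s f s<k = W-zero N (λ p → trans (*-congʳ (⟦⟧-no (Vec.sum p ℕ.+ k ℕ.≟ s)
        (λ eq → ℕ.<⇒≱ s<k (ℕ.≤-trans (ℕ.m≤n+m k _) (ℕ.≤-reflexive eq))))) (zeroˡ _))

      packed : ∀ k (l : Vec ℕ N) → Vec.sum l ℕ.+ k ℕ.≤ S → Packed k l
      packed k l fits with injective⊎repeats l
      ... | inj₂ rep = inj₁ rep
      ... | inj₁ inj = inj₂ (inj , λ v v<k → small-sum⇒contains l inj v (packing-bound N _ k S v v<k fits S-small))

      -- The entries below `k` of a packed tuple are `0, …, k - 1`, once each. Their number is the
      -- central term `k` of the commutator of `αₖ` and `α₋ₖ`, which a finite tuple sees only
      -- through packing.
      count : ∀ k (l : Vec ℕ N) → Packed k l → ∑ N (λ j → 1# - ⟦ k ℕ.≤? lookup l j ⟧) * V m l l ≈ nat k * V m l l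
      count k l (inj₁ rep) = trans (*-congˡ V≈0) (trans (zeroʳ _) (sym (trans (*-congˡ V≈0) (zeroʳ _))))
        where V≈0 = repeats⇒0 (V m l) (V-antisymʳ m l) l rep
      count k l (inj₂ (inj , full)) = *-congʳ (begin
        ∑ N (λ j → 1# - ⟦ k ℕ.≤? lookup l j ⟧)
          ≈⟨ ∑-cong N (λ j → below (lookup l j)) ⟩
        ∑ N (λ j → ∑< k (λ v → ⟦ v ℕ.≟ lookup l j ⟧))
          ≈⟨ ∑<-∑-swap k N (λ v j → ⟦ v ℕ.≟ lookup l j ⟧) ⟨
        ∑< k (λ v → ∑ N (λ j → ⟦ v ℕ.≟ lookup l j ⟧))
          ≈⟨ ∑<-cong k (λ v v<k → once v (full v v<k)) ⟩
        ∑< k (λ _ → 1#)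
          ≈⟨ trans (∑<-const k 1#) (*-identityʳ _) ⟩
        nat k ∎)
        where
        below : ∀ a → 1# - ⟦ k ℕ.≤? a ⟧ ≈ ∑< k (λ v → ⟦ v ℕ.≟ a ⟧)
        below a with k ℕ.≤? a
        ... | yes k≤a = trans (-‿inverseʳ 1#) (sym (∑<-zero k (λ v v<k → ⟦⟧-no (v ℕ.≟ a) (ℕ.<⇒≢ (ℕ.<-≤-trans v<k k≤a)))))
        ... | no  k≰a = trans (solve 0 (con (+ 1) :- con (+ 0) := con (+ 1)) refl)
          (sym (trans (∑<-single k a (ℕ.≰⇒> k≰a) (λ v v≢a → ⟦⟧-no (v ℕ.≟ a) v≢a)) (⟦⟧-yes (a ℕ.≟ a) ≡.refl)))
        once : ∀ v → Contains l v → ∑ N (λ j → ⟦ v ℕ.≟ lookup l j ⟧) ≈ 1#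
        once v (i , eq) = trans (∑-single N i (λ j j≢i → ⟦⟧-no (v ℕ.≟ lookup l j) (λ v≡ → j≢i (inj j i (≡.trans (≡.sym v≡) (≡.sym eq))))))
          (⟦⟧-yes (v ℕ.≟ lookup l i) (≡.sym eq))

      hopV : Vec ℕ N → ℕ → Fin N → Fin N → Carrier
      hopV l k i j = hop (λ p → V m p l) (λ p → V-antisymˡ m p l) l i j k

      -- Lowering after raising differs from raising after lowering only on the diagonal.
      commute : ∀ k (p : Vec ℕ N) j → ∑ N (lowered (λ l → V m l p) k (raise k p j)) ≈
                          ∑ N (λ i → hopV p k i j) + (1# - ⟦ k ℕ.≤? lookup p j ⟧) * V m p p
      commute k p j = begin
        ∑ N low   ≈⟨ ∑-cong N (λ i → solve 2 (λ x h → x := h :+ (x :- h)) refl (low i) (hopV p k i j)) ⟩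
        ∑ N (λ i → hopV p k i j + (low i - hopV p k i j))
                  ≈⟨ ∑-+ N _ _ ⟩
        ∑ N (λ i → hopV p k i j) + ∑ N (λ i → low i - hopV p k i j)
                  ≈⟨ +-congˡ (trans (∑-single N j (λ i i≢j → trans (+-congʳ (off i i≢j)) (-‿inverseʳ _))) diag) ⟩
        ∑ N (λ i → hopV p k i j) + (1# - ⟦ k ℕ.≤? lookup p j ⟧) * V m p p ∎
        where
        low : Fin N → Carrier
        low = lowered (λ l → V m l p) k (raise k p j)
        off : ∀ i → i ≢ j → low i ≈ hopV p k i j
        off i i≢j = reflexive (≡.cong₂ (λ x l → ⟦ k ℕ.≤? x ⟧ * V m l p) (Vec.lookup∘update′ i≢j p _)
          (≡.trans (≡.cong (λ x → p [ j ]≔ (lookup p j ℕ.+ k) [ i ]≔ (x ℕ.∸ k)) (Vec.lookup∘update′ i≢j p _))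
            (≡.trans (Vec.[]≔-commutes p j i (i≢j ∘ ≡.sym))
              (≡.cong (λ x → p [ i ]≔ (lookup p i ℕ.∸ k) [ j ]≔ (x ℕ.+ k)) (≡.sym (Vec.lookup∘update′ (i≢j ∘ ≡.sym) p _))))))
        low-diag : low j ≈ V m p p
        low-diag = trans (*-cong (⟦⟧-yes (k ℕ.≤? lookup (raise k p j) j) (ℕ.≤-trans (ℕ.m≤n+m k _) (ℕ.≤-reflexive (≡.sym (Vec.lookup∘update j p _)))))
          (reflexive (≡.cong (λ l → V m l p) (≡.trans (Vec.[]≔-idempotent p j)
            (≡.trans (≡.cong (λ x → p [ j ]≔ (x ℕ.∸ k)) (Vec.lookup∘update j p _))
              (≡.trans (≡.cong (p [ j ]≔_) (ℕ.m+n∸n≡m _ k)) (Vec.[]≔-lookup p j))))))) (*-identityˡ _)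
        diag : low j - hopV p k j j ≈ (1# - ⟦ k ℕ.≤? lookup p j ⟧) * V m p p
        diag = trans (+-cong low-diag (-‿cong (hop-self (λ l → V m l p) (λ l → V-antisymˡ m l p) p j k)))
          (solve 2 (λ v b → v :- b :* v := (con (+ 1) :- b) :* v) refl _ _)

      -- `relation` with left argument `raise (suc k) p j` trades the raising of the right argument
      -- for a lowering of the left one, and `commute` moves this lowering past the raising at `j`.
      raised-pairs : ∀ k (p : Vec ℕ N) → Packed (suc k) p →
        ∑ N (λ i → ∑ N (λ j → V m (raise (suc k) p j) (raise (suc k) p i))) ≈
        (∑ N (λ i → ∑ N (hopV p (suc k) i)) + nat (suc k) * V m p p) + - m * ∑ N (λ j → V m (raise (suc k) p j) p)
      raised-pairs k p pk = begin
        ∑ N (λ i → ∑ N (λ j → V m (raise (suc k) p j) (raise (suc k) p i)))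
          ≈⟨ ∑-swap N N _ ⟩
        ∑ N (λ j → ∑ N (λ i → V m (raise (suc k) p j) (raise (suc k) p i)))
          ≈⟨ ∑-cong N (λ j → begin
               _ ≈⟨ solve 3 (λ x m v → x := (x :+ m :* v) :+ (:- m) :* v) refl _ m (V m (raise (suc k) p j) p) ⟩
               (_ + m * V m (raise (suc k) p j) p) + - m * V m (raise (suc k) p j) p
                 ≈⟨ +-congʳ (trans (sym (relation ni k (raise (suc k) p j) p pk)) (commute (suc k) p j)) ⟩
               (∑ N (λ i → hopV p (suc k) i j) + (1# - ⟦ suc k ℕ.≤? lookup p j ⟧) * V m p p) + - m * V m (raise (suc k) p j) p ∎) ⟩
        ∑ N (λ j → (∑ N (λ i → hopV p (suc k) i j) + (1# - ⟦ suc k ℕ.≤? lookup p j ⟧) * V m p p) + - m * V m (raise (suc k) p j) p)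
          ≈⟨ trans (∑-+ N _ _) (+-cong (∑-+ N _ _) (∑-* N _ _)) ⟩
        (∑ N (λ j → ∑ N (λ i → hopV p (suc k) i j)) + ∑ N (λ j → (1# - ⟦ suc k ℕ.≤? lookup p j ⟧) * V m p p)) + - m * ∑ N (λ j → V m (raise (suc k) p j) p)
          ≈⟨ +-congʳ (+-cong (∑-swap N N _) (trans (∑-cong N (λ j → *-comm _ _)) (trans (∑-* N _ _) (trans (*-comm _ _) (count (suc k) p pk))))) ⟩
        (∑ N (λ i → ∑ N (hopV p (suc k) i)) + nat (suc k) * V m p p) + - m * ∑ N (λ j → V m (raise (suc k) p j) p) ∎

      X-substitute : ∀ k s → s ℕ.< B → X k s ≈
        W N (λ p → ⟦ Vec.sum p ℕ.+ k ℕ.≟ s ⟧ * ∑ N (λ i → ∑ N (λ j → V m (raise k p j) (raise k p i))))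
      X-substitute k s s<B = trans
        (W-cong N (λ l → *-congˡ (∑-cong N (λ i → ∑-* N _ _))))
        (substitute k s s<B (λ i p l → ∑ N (λ j → V m (raise k p j) l)))

      Y-substitute : ∀ k s → s ℕ.< B →
        weight s (λ l → ∑ N (lowered (V m l) k l)) ≈
        W N (λ p → ⟦ Vec.sum p ℕ.+ k ℕ.≟ s ⟧ * ∑ N (λ i → V m (raise k p i) p))
      Y-substitute k s s<B = substitute k s s<B (λ i p l → V m l p)

    -- Cyclicity of the trace: the substitution `l = p + (suc k) eᵢ` turns the lowering in the left
    -- argument into a raising in the right one, at total sum `s`.
    X-step : ∀ k s → s ℕ.+ suc k ℕ.≤ S → X (suc k) (s ℕ.+ suc k) ≈ (X (suc k) s + nat (suc k) * T s) + - m * Y (suc k) s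
    X-step k s fits = begin
      X (suc k) (s ℕ.+ suc k)  ≈⟨ X-substitute (suc k) (s ℕ.+ suc k) (ℕ.≤-<-trans fits S<B) ⟩
      _                        ≈⟨ unshift (suc k) s _ ⟩
      weight s (λ p → ∑ N (λ i → ∑ N (λ j → V m (raise (suc k) p j) (raise (suc k) p i))))
        ≈⟨ weight-cong s (λ p eq → raised-pairs k p (packed (suc k) p (ℕ.≤-trans (ℕ.≤-reflexive (≡.cong (ℕ._+ suc k) eq)) fits))) ⟩
      _ ≈⟨ trans (weight-+ s _ _) (+-cong (trans (weight-+ s _ _) (+-congˡ (weight-* s _ _))) (weight-* s _ _)) ⟩
      (X (suc k) s + nat (suc k) * T s) + - m * Y (suc k) s ∎

    X-0 : ∀ k s → s ℕ.≤ S → s ℕ.< k → X k s ≈ 0#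
    X-0 k s s≤S s<k = trans (X-substitute k s (ℕ.≤-<-trans s≤S S<B)) (unshift-0 k s _ s<k)

    private
      Y-relation : ∀ k s → s ℕ.+ suc k ℕ.≤ S → weight s (λ l → ∑ N (lowered (V m l) (suc k) l)) ≈ Y (suc k) s + - m * T s
      Y-relation k s fits = trans
        (weight-cong s (λ l eq → trans (relation-swapped ni k l (packed (suc k) l (ℕ.≤-trans (ℕ.≤-reflexive (≡.cong (ℕ._+ suc k) eq)) fits)))
          (+-congˡ (solve 2 (λ m v → :- (m :* v) := (:- m) :* v) refl _ _))))
        (trans (weight-+ s _ _) (+-congˡ (weight-* s _ _)))

      solve-Y : ∀ {x} k s → weight s (λ l → ∑ N (lowered (V m l) (suc k) l)) ≈ x → s ℕ.+ suc k ℕ.≤ S → Y (suc k) s ≈ x + m * T s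
      solve-Y {x} k s eq fits = begin
        Y (suc k) s                            ≈⟨ solve 3 (λ y m t → y := (y :+ (:- m) :* t) :+ m :* t) refl _ m (T s) ⟩
        (Y (suc k) s + - m * T s) + m * T s    ≈⟨ +-congʳ (trans (sym (Y-relation k s fits)) eq) ⟩
        x + m * T s                            ∎

    -- The sum of `V m l (l - (suc k) eᵢ)` is evaluated twice, by `relation-swapped` and by the
    -- substitution `l = p + (suc k) eᵢ`.
    Y-step : ∀ k s → s ℕ.+ suc k ℕ.+ suc k ℕ.≤ S → Y (suc k) (s ℕ.+ suc k) ≈ Y (suc k) s + m * T (s ℕ.+ suc k)
    Y-step k s fits = solve-Y k (s ℕ.+ suc k) (trans
      (Y-substitute (suc k) (s ℕ.+ suc k) (ℕ.≤-<-trans (ℕ.≤-trans (ℕ.m≤m+n _ (suc k)) fits) S<B))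
      (unshift (suc k) s _)) fits

    Y-0 : ∀ k s → s ℕ.+ suc k ℕ.≤ S → s ℕ.< suc k → Y (suc k) s ≈ m * T s
    Y-0 k s fits s<k = trans (solve-Y k s (trans
      (Y-substitute (suc k) s (ℕ.≤-<-trans (ℕ.≤-trans (ℕ.m≤m+n s (suc k)) fits) S<B)) (unshift-0 (suc k) s _ s<k)) fits) (+-identityˡ _)

    T↓ : ℕ → ℕ → Carrier
    T↓ s d = ⟦ d ℕ.≤? s ⟧ * T (s ℕ.∸ d)

    T↓-0 : ∀ s → T↓ s 0 ≈ T s
    T↓-0 s = *-identityˡ _

    T↓-large : ∀ {s d} → s ℕ.< d → T↓ s d ≈ 0#
    T↓-large {s} {d} s<d = trans (*-congʳ (⟦⟧-no (d ℕ.≤? s) (ℕ.<⇒≱ s<d))) (zeroˡ _)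

    T↓-shift : ∀ s k d → T↓ (s ℕ.+ k) (k ℕ.+ d) ≈ T↓ s d
    T↓-shift s k d = *-cong (⟦⟧-⇔ (k ℕ.+ d ℕ.≤? s ℕ.+ k) (d ℕ.≤? s)
        (λ le → ℕ.+-cancelˡ-≤ k d s (ℕ.≤-trans le (ℕ.≤-reflexive (ℕ.+-comm s k))))
        (λ le → ℕ.≤-trans (ℕ.+-monoʳ-≤ k le) (ℕ.≤-reflexive (ℕ.+-comm k s))))
      (reflexive (≡.cong T (≡.trans (≡.cong (ℕ._∸ (k ℕ.+ d)) (ℕ.+-comm s k)) (ℕ.[m+n]∸[m+o]≡n∸o k s d))))

    Y-closed : ∀ k K s → s ℕ.< K → s ℕ.+ suc k ℕ.≤ S → Y (suc k) s ≈ m * ∑< K (λ r → T↓ s (r ℕ.* suc k))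
    Y-closed k (suc K) s s<K fits with suc k ℕ.≤? s
    ... | no  k≰s = trans (Y-0 k s fits (ℕ.≰⇒> k≰s)) (*-congˡ (sym (trans
      (+-cong (T↓-0 s) (∑<-zero K (λ r _ → T↓-large (ℕ.<-≤-trans (ℕ.≰⇒> k≰s) (ℕ.m≤m+n (suc k) _))))) (+-identityʳ _))))
    ... | yes k≤s = ≡.subst (λ s → s ℕ.< suc K → s ℕ.+ suc k ℕ.≤ S → Y (suc k) s ≈ m * ∑< (suc K) (λ r → T↓ s (r ℕ.* suc k)))
      (ℕ.m∸n+n≡m k≤s) (step (s ℕ.∸ suc k)) s<K fits
      where
      step : ∀ s → s ℕ.+ suc k ℕ.< suc K → s ℕ.+ suc k ℕ.+ suc k ℕ.≤ S →
             Y (suc k) (s ℕ.+ suc k) ≈ m * ∑< (suc K) (λ r → T↓ (s ℕ.+ suc k) (r ℕ.* suc k))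
      step s s<K fits = begin
        Y (suc k) (s ℕ.+ suc k)
          ≈⟨ Y-step k s fits ⟩
        Y (suc k) s + m * T (s ℕ.+ suc k)
          ≈⟨ +-congʳ (Y-closed k K s (ℕ.≤-trans (ℕ.≤-trans (ℕ.≤-reflexive (≡.sym (ℕ.+-comm s 1))) (ℕ.+-monoʳ-≤ s (s≤s z≤n))) (ℕ.s≤s⁻¹ s<K)) (ℕ.≤-trans (ℕ.m≤m+n _ (suc k)) fits)) ⟩
        m * ∑< K (λ r → T↓ s (r ℕ.* suc k)) + m * T (s ℕ.+ suc k)
          ≈⟨ solve 3 (λ m x t → m :* x :+ m :* t := m :* (t :+ x)) refl _ _ _ ⟩
        m * (T (s ℕ.+ suc k) + ∑< K (λ r → T↓ s (r ℕ.* suc k)))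
          ≈⟨ *-congˡ (+-cong (T↓-0 _) (∑<-cong K (λ r _ → T↓-shift s (suc k) (r ℕ.* suc k)))) ⟨
        m * ∑< (suc K) (λ r → T↓ (s ℕ.+ suc k) (r ℕ.* suc k)) ∎

    -- Each step of `X-step` adds one term `suc k` at the current sum and, through `Y-closed`, a
    -- further `- m²` at that sum and at all lower ones; hence the coefficient `- m²` occurs `suc r`
    -- times.
    X-closed : ∀ k K s → s ℕ.< K → s ℕ.≤ S →
               X (suc k) s ≈ ∑< K (λ r → (nat (suc k) - m * m * nat (suc r)) * T↓ s (suc r ℕ.* suc k))
    X-closed k (suc K) s s<K fits with suc k ℕ.≤? s
    ... | no  k≰s = trans (X-0 (suc k) s fits (ℕ.≰⇒> k≰s)) (sym (∑<-zero (suc K) (λ r _ → vanish r)))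
      where
      vanish : ∀ r → (nat (suc k) - m * m * nat (suc r)) * T↓ s (suc r ℕ.* suc k) ≈ 0#
      vanish r = trans (*-congˡ (T↓-large (ℕ.<-≤-trans (ℕ.≰⇒> k≰s) (ℕ.m≤m+n (suc k) _)))) (zeroʳ _)
    ... | yes k≤s = ≡.subst (λ s → s ℕ.< suc K → s ℕ.≤ S → X (suc k) s ≈ ∑< (suc K) (λ r → (nat (suc k) - m * m * nat (suc r)) * T↓ s (suc r ℕ.* suc k)))
      (ℕ.m∸n+n≡m k≤s) (step (s ℕ.∸ suc k)) s<K fits
      where
      step : ∀ s → s ℕ.+ suc k ℕ.< suc K → s ℕ.+ suc k ℕ.≤ S →
             X (suc k) (s ℕ.+ suc k) ≈ ∑< (suc K) (λ r → (nat (suc k) - m * m * nat (suc r)) * T↓ (s ℕ.+ suc k) (suc r ℕ.* suc k))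
      step s s<K fits = begin
        X (suc k) (s ℕ.+ suc k)
          ≈⟨ X-step k s fits ⟩
        (X (suc k) s + κ * T s) + - m * Y (suc k) s
          ≈⟨ +-cong (+-congʳ (X-closed k K s s<K′ (ℕ.≤-trans (ℕ.m≤m+n s _) fits))) (*-congˡ (Y-closed k (suc K) s (ℕ.m<n⇒m<1+n s<K′) fits)) ⟩
        (∑< K A + κ * T s) + - m * (m * (t 0 + ∑< K (λ r → t (suc r))))
          ≈⟨ +-congʳ (+-congˡ (*-congˡ (T↓-0 s))) ⟨
        (∑< K A + κ * t 0) + - m * (m * (t 0 + ∑< K (λ r → t (suc r))))
          ≈⟨ solve 5 (λ a κ t m y → (a :+ κ :* t) :+ (:- m) :* (m :* (t :+ y)) :=
               (κ :- m :* m :* (con (+ 1) :+ con (+ 0))) :* t :+ (a :+ (:- (m :* m)) :* y)) refl _ κ _ m _ ⟩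
        (κ - m * m * nat 1) * t 0 + (∑< K A + - (m * m) * ∑< K (λ r → t (suc r)))
          ≈⟨ +-congˡ (trans (+-congˡ (sym (∑<-* K _ _))) (sym (∑<-+ K _ _))) ⟩
        (κ - m * m * nat 1) * t 0 + ∑< K (λ r → A r + - (m * m) * t (suc r))
          ≈⟨ +-congˡ (∑<-cong K (λ r _ → solve 4 (λ κ m n t → (κ :- m :* m :* n) :* t :+ (:- (m :* m)) :* t :=
               (κ :- m :* m :* (con (+ 1) :+ n)) :* t) refl κ m (nat (suc r)) (t (suc r)))) ⟩
        (κ - m * m * nat 1) * t 0 + ∑< K (λ r → (κ - m * m * nat (suc (suc r))) * t (suc r))
          ≈⟨ +-cong (*-congˡ (T↓-shift s (suc k) 0)) (∑<-cong K (λ r _ → *-congˡ (T↓-shift s (suc k) (suc r ℕ.* suc k)))) ⟨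
        ∑< (suc K) (λ r → (κ - m * m * nat (suc r)) * T↓ (s ℕ.+ suc k) (suc r ℕ.* suc k)) ∎
        where
        κ = nat (suc k)
        t : ℕ → Carrier
        t r = T↓ s (r ℕ.* suc k)
        A : ℕ → Carrier
        A r = (κ - m * m * nat (suc r)) * t (suc r)
        s<K′ : s ℕ.< K
        s<K′ = ℕ.≤-trans (ℕ.≤-trans (ℕ.≤-reflexive (≡.sym (ℕ.+-comm s 1))) (ℕ.+-monoʳ-≤ s (s≤s z≤n))) (ℕ.s≤s⁻¹ s<K)

    -- `energy` under the trace, with `X-closed` inserted. The sum over `k` and `r` runs over a
    -- symmetric range and `T↓` sees only their product, so the weight `r` may be exchanged for `k`,
    -- and `1 - m²` factors out.
    T-recursion : ∀ K s → s ℕ.< K → s ℕ.≤ S →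
      nat 2 * ((1# - m * m) * ∑< K (λ k → ∑< K (λ r → nat (suc k) * T↓ s (suc r ℕ.* suc k)))) + nat N * nat N * T s ≈
      (nat 2 * nat s + nat N) * T s
    T-recursion K s s<K s≤S = begin
      nat 2 * ((1# - m * m) * D) + nat N * nat N * T s
        ≈⟨ +-congʳ (*-congˡ (begin
          (1# - m * m) * D
            ≈⟨ solve 2 (λ m d → (con (+ 1) :- m :* m) :* d := d :+ (:- (m :* m)) :* d) refl m D ⟩
          D + - (m * m) * D
            ≈⟨ +-congˡ (*-congˡ flip) ⟩
          D + - (m * m) * D′
            ≈⟨ +-congˡ (trans (∑<-cong K (λ k _ → ∑<-* K _ _)) (∑<-* K _ _)) ⟨
          D + ∑< K (λ k → ∑< K (λ r → - (m * m) * (nat (suc r) * T↓ s (suc r ℕ.* suc k))))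
            ≈⟨ ∑<-+ K _ _ ⟨
          ∑< K (λ k → ∑< K (λ r → nat (suc k) * T↓ s (suc r ℕ.* suc k)) + ∑< K (λ r → - (m * m) * (nat (suc r) * T↓ s (suc r ℕ.* suc k))))
            ≈⟨ ∑<-cong K (λ k _ → trans (sym (∑<-+ K _ _)) (∑<-cong K (λ r _ →
                 solve 4 (λ k m r t → k :* t :+ (:- (m :* m)) :* (r :* t) := (k :- m :* m :* r) :* t) refl (nat (suc k)) m (nat (suc r)) (T↓ s (suc r ℕ.* suc k))))) ⟩
          ∑< K (λ k → ∑< K (λ r → (nat (suc k) - m * m * nat (suc r)) * T↓ s (suc r ℕ.* suc k)))
            ≈⟨ ∑<-cong K (λ k _ → X-closed k K s s<K s≤S) ⟨
          ∑< K (λ k → X (suc k) s) ∎)) ⟩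
      nat 2 * ∑< K (λ k → X (suc k) s) + nat N * nat N * T s
        ≈⟨ +-cong (*-congˡ (weight-∑< s K _)) (weight-* s _ _) ⟨
      nat 2 * weight s (λ l → ∑< K (λ k → ∑ N (λ i → ∑ N (hopV l (suc k) i)))) + weight s (λ l → nat N * nat N * V m l l)
        ≈⟨ trans (weight-+ s _ _) (+-congʳ (weight-* s _ _)) ⟨
      weight s (λ l → nat 2 * ∑< K (λ k → ∑ N (λ i → ∑ N (hopV l (suc k) i))) + nat N * nat N * V m l l)
        ≈⟨ weight-cong s (λ l eq → trans
             (energy (λ p → V m p l) (λ p → V-antisymˡ m p l) l K (λ i → ℕ.≤-trans (ℕ.≤-trans (lookup≤sum l i) (ℕ.≤-reflexive eq)) (ℕ.<⇒≤ s<K)))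
             (*-congʳ (+-congʳ (*-congˡ (nat-cong eq))))) ⟩
      weight s (λ l → (nat 2 * nat s + nat N) * V m l l)
        ≈⟨ weight-* s _ _ ⟩
      (nat 2 * nat s + nat N) * T s ∎
      where
      D D′ : Carrier
      D  = ∑< K (λ k → ∑< K (λ r → nat (suc k) * T↓ s (suc r ℕ.* suc k)))
      D′ = ∑< K (λ k → ∑< K (λ r → nat (suc r) * T↓ s (suc r ℕ.* suc k)))
      flip : D ≈ D′
      flip = trans (∑<-swap K K _) (∑<-cong K (λ r _ → ∑<-cong K (λ k _ →
        *-congˡ (reflexive (≡.cong (T↓ s) (ℕ.*-comm (suc r) (suc k)))))))

-- Partitions, beta numbers and hook lengths

-- Carrying the bound on the first part makes the tail of a partition an instance of the same
-- predicate, as the inductions on rows require.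
Partition≤ : ℕ → List ℕ → Set
Partition≤ c []      = ⊤
Partition≤ c (a ∷ μ) = (1 ℕ.≤ a × a ℕ.≤ c) × Partition≤ a μ

partition≤? : ∀ c μ → Dec (Partition≤ c μ)
partition≤? c []      = yes tt
partition≤? c (a ∷ μ) = ((1 ℕ.≤? a) ×-dec (a ℕ.≤? c)) ×-dec partition≤? a μ

⊢⇒partition≤ : ∀ {c μ n} → n ℕ.≤ c → μ ⊢ n → Partition≤ c μ
⊢⇒partition≤ {μ = []}        n≤c _ = tt
⊢⇒partition≤ {μ = a ∷ []}    n≤c (_ , 1≤a ∷ _ , ≡.refl) = (1≤a , ℕ.≤-trans (ℕ.m≤m+n a 0) n≤c) , tt
⊢⇒partition≤ {μ = a ∷ b ∷ μ} n≤c (a≥b ∷ linked , 1≤a ∷ 1≤b ∷ all , ≡.refl) =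
  (1≤a , ℕ.≤-trans (ℕ.m≤m+n a _) n≤c) , go a≥b linked (1≤b ∷ all)
  where
  go : ∀ {a b μ} → a ≥ b → Linked _≥_ (b ∷ μ) → All (_≥ 1) (b ∷ μ) → Partition≤ a (b ∷ μ)
  go {μ = []}    a≥b _           (1≤b ∷ _)   = (1≤b , a≥b) , tt
  go {μ = _ ∷ _} a≥b (b≥c ∷ lnk) (1≤b ∷ all) = (1≤b , a≥b) , go b≥c lnk all

partition≤⇒linked : ∀ {c} μ → Partition≤ c μ → Linked _≥_ μ × All (_≥ 1) μ
partition≤⇒linked []          _ = [] , []
partition≤⇒linked (a ∷ [])    ((1≤a , _) , _) = [-] , 1≤a ∷ []
partition≤⇒linked (a ∷ b ∷ μ) ((1≤a , _) , p@((_ , b≤a) , _)) =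
  b≤a ∷ proj₁ (partition≤⇒linked (b ∷ μ) p) , 1≤a ∷ proj₂ (partition≤⇒linked (b ∷ μ) p)

length≤sum : ∀ {c} μ → Partition≤ c μ → length μ ℕ.≤ ℕ.sum μ
length≤sum []      _ = z≤n
length≤sum (a ∷ μ) ((1≤a , _) , p) = ℕ.+-mono-≤ 1≤a (length≤sum μ p)

-- The strictly decreasing sequence μᵢ + (N - i), with μ padded by zeros.
beta : ∀ N → List ℕ → Vec ℕ N
beta zero    _       = []
beta (suc N) []      = N ∷ beta N []
beta (suc N) (r ∷ μ) = (r ℕ.+ N) ∷ beta N μ

sum-beta : ∀ N μ → length μ ℕ.≤ N → Vec.sum (beta N μ) ≡ Vec.sum (beta N []) ℕ.+ ℕ.sum μ
sum-beta zero    []      _       = ≡.refl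
sum-beta (suc N) []      _       = ≡.sym (ℕ.+-identityʳ _)
sum-beta (suc N) (r ∷ μ) (s≤s p) = ≡.trans (≡.cong ((r ℕ.+ N) ℕ.+_) (sum-beta N μ p))
  (solve 4 (λ r n s m → (r :+ n) :+ (s :+ m) := (n :+ s) :+ (r :+ m)) ≡.refl r N (Vec.sum (beta N [])) (ℕ.sum μ))
  where open +-*-Solver

sum-beta-[] : ∀ N → 2 ℕ.* Vec.sum (beta N []) ℕ.+ N ≡ N ℕ.* N
sum-beta-[] zero    = ≡.refl
sum-beta-[] (suc N) = ≡.trans
  (solve 2 (λ n s → con 2 :* (n :+ s) :+ (con 1 :+ n) := (con 2 :* s :+ n) :+ (con 1 :+ (con 2 :* n))) ≡.refl N (Vec.sum (beta N [])))
  (≡.trans (≡.cong (ℕ._+ (1 ℕ.+ 2 ℕ.* N)) (sum-beta-[] N))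
    (solve 1 (λ n → n :* n :+ (con 1 :+ con 2 :* n) := (con 1 :+ n) :* (con 1 :+ n)) ≡.refl N))
  where open +-*-Solver

beta-bound : ∀ N {c} μ → Partition≤ c μ → ∀ i → lookup (beta N μ) i ℕ.< c ℕ.+ N
beta-bound (suc N) {c} []      _ zero    = ℕ.m≤n+m (suc N) c
beta-bound (suc N) {c} []      p (suc i) = ℕ.≤-trans (beta-bound N {c} [] p i) (ℕ.+-monoʳ-≤ c (ℕ.n≤1+n N))
beta-bound (suc N) {c} (r ∷ μ) ((_ , r≤c) , p) zero    = ℕ.≤-trans (ℕ.≤-reflexive (≡.sym (ℕ.+-suc r N))) (ℕ.+-monoˡ-≤ (suc N) r≤c)
beta-bound (suc N) {c} (r ∷ μ) ((_ , r≤c) , p) (suc i) = ℕ.≤-trans (beta-bound N μ p i) (ℕ.+-mono-≤ r≤c (ℕ.n≤1+n N))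

module PartitionSums {c ℓ} (R : CommutativeRing c ℓ) where
  open CommutativeRing R hiding (zero)
  open IntegerSolver R
  open Sums R
  open SetoidReasoning setoid

  ⟦×⟧ : ∀ {p q} {P : Set p} {Q : Set q} (d : Dec P) (e : Dec Q) → ⟦ d ×-dec e ⟧ ≈ ⟦ d ⟧ * ⟦ e ⟧
  ⟦×⟧ (yes _) (yes _) = sym (*-identityˡ _)
  ⟦×⟧ (yes _) (no _)  = sym (*-identityˡ _)
  ⟦×⟧ (no _)  e       = sym (zeroˡ _)

  sumOver : ∀ {a} {A : Set a} → List A → (A → Carrier) → Carrier
  sumOver []       f = 0#
  sumOver (x ∷ xs) f = f x + sumOver xs f

  sumOver-cong : ∀ {a} {A : Set a} (xs : List A) {f g} → (∀ x → f x ≈ g x) → sumOver xs f ≈ sumOver xs g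
  sumOver-cong []       eq = refl
  sumOver-cong (x ∷ xs) eq = +-cong (eq x) (sumOver-cong xs eq)

  sumOver-++ : ∀ {a} {A : Set a} (xs ys : List A) f → sumOver (xs ++ ys) f ≈ sumOver xs f + sumOver ys f
  sumOver-++ []       ys f = sym (+-identityˡ _)
  sumOver-++ (x ∷ xs) ys f = trans (+-congˡ (sumOver-++ xs ys f)) (sym (+-assoc _ _ _))

  sumOver-map : ∀ {a b} {A : Set a} {B : Set b} (h : A → B) (xs : List A) f → sumOver (map h xs) f ≈ sumOver xs (f ∘ h)
  sumOver-map h []       f = refl
  sumOver-map h (x ∷ xs) f = +-congˡ (sumOver-map h xs f)

  sumOver-concatMap : ∀ {a b} {A : Set a} {B : Set b} (h : A → List B) (xs : List A) f →
                      sumOver (concatMap h xs) f ≈ sumOver xs (λ x → sumOver (h x) f)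
  sumOver-concatMap h []       f = refl
  sumOver-concatMap h (x ∷ xs) f = trans (sumOver-++ (h x) _ f) (+-congˡ (sumOver-concatMap h xs f))

  sumOver-filter : ∀ {a p} {A : Set a} {P : A → Set p} (P? : Decidable P) (xs : List A) f →
                   sumOver (filter P? xs) f ≈ sumOver xs (λ x → ⟦ P? x ⟧ * f x)
  sumOver-filter P? []       f = refl
  sumOver-filter P? (x ∷ xs) f with P? x
  ... | yes _ = +-cong (sym (*-identityˡ _)) (sumOver-filter P? xs f)
  ... | no  _ = trans (sumOver-filter P? xs f) (sym (trans (+-congʳ (zeroˡ _)) (+-identityˡ _)))

  sumOver-applyUpTo : ∀ {a} {A : Set a} (h : ℕ → A) n f → sumOver (applyUpTo h n) f ≈ ∑< n (f ∘ h)
  sumOver-applyUpTo h zero    f = refl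
  sumOver-applyUpTo h (suc n) f = +-congˡ (sumOver-applyUpTo (h ∘ suc) n f)

  sumOver-cartesian : ∀ (as : List ℕ) (ws : List (List ℕ)) f →
                      sumOver (cartesianProductWith _∷_ as ws) f ≈ sumOver as (λ a → sumOver ws (λ w → f (a ∷ w)))
  sumOver-cartesian []       ws f = refl
  sumOver-cartesian (a ∷ as) ws f = trans (sumOver-++ (map (a ∷_) ws) _ f)
    (+-cong (sumOver-map (a ∷_) ws f) (sumOver-cartesian as ws f))

  -- Sum over the partitions with exactly L parts, all at most c.
  exact : ℕ → ℕ → (List ℕ → Carrier) → Carrier
  exact zero    c g = g []
  exact (suc L) c g = ∑< c (λ a → exact L (suc a) (λ μ → g (suc a ∷ μ)))

  exact-cong : ∀ L c {g h} → (∀ μ → length μ ≡ L → Partition≤ c μ → g μ ≈ h μ) → exact L c g ≈ exact L c h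
  exact-cong zero    c eq = eq [] ≡.refl tt
  exact-cong (suc L) c eq = ∑<-cong c (λ a a<c → exact-cong L (suc a) (λ μ len p →
    eq (suc a ∷ μ) (≡.cong suc len) ((s≤s z≤n , a<c) , p)))

  exact-zero : ∀ L c {g} → (∀ μ → length μ ≡ L → Partition≤ c μ → g μ ≈ 0#) → exact L c g ≈ 0#
  exact-zero zero    c eq = eq [] ≡.refl tt
  exact-zero (suc L) c eq = ∑<-zero c (λ a a<c → exact-zero L (suc a) (λ μ len p →
    eq (suc a ∷ μ) (≡.cong suc len) ((s≤s z≤n , a<c) , p)))

  private
    bracket-sum : ∀ K a → a ℕ.≤ K → ∀ φ → ∑< K (λ k → ⟦ suc k ℕ.≤? a ⟧ * φ k) ≈ ∑< a φ
    bracket-sum K a a≤K φ = trans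
      (∑<-extend a≤K (λ k a≤k _ → trans (*-congʳ (⟦⟧-no (suc k ℕ.≤? a) (ℕ.≤⇒≯ a≤k))) (zeroˡ _)))
      (∑<-cong a (λ k k<a → trans (*-congʳ (⟦⟧-yes (suc k ℕ.≤? a) k<a)) (*-identityˡ _)))

  sumOver-* : ∀ {a} {A : Set a} (xs : List A) k f → sumOver xs (λ x → k * f x) ≈ k * sumOver xs f
  sumOver-* []       k f = sym (zeroʳ k)
  sumOver-* (x ∷ xs) k f = trans (+-congˡ (sumOver-* xs k f)) (sym (distribˡ _ _ _))

  words-exact : ∀ n L c g → c ℕ.≤ n →
                sumOver (words (upTo (suc n)) L) (λ w → ⟦ partition≤? c w ⟧ * g w) ≈ exact L c g
  words-exact n zero    c g c≤n = trans (+-identityʳ _) (*-identityˡ _)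
  words-exact n (suc L) c g c≤n = begin
    sumOver (words (upTo (suc n)) (suc L)) (λ w → ⟦ partition≤? c w ⟧ * g w)
      ≈⟨ sumOver-cartesian (upTo (suc n)) ws _ ⟩
    sumOver (upTo (suc n)) (λ a → sumOver ws (λ w → ⟦ partition≤? c (a ∷ w) ⟧ * g (a ∷ w)))
      ≈⟨ sumOver-applyUpTo id (suc n) _ ⟩
    sumOver ws (λ w → ⟦ partition≤? c (0 ∷ w) ⟧ * g (0 ∷ w)) +
      ∑< n (λ a → sumOver ws (λ w → ⟦ partition≤? c (suc a ∷ w) ⟧ * g (suc a ∷ w)))
      ≈⟨ +-cong (trans (sumOver-cong ws (λ w → trans (*-congʳ (⟦⟧-no (partition≤? c (0 ∷ w)) (λ { ((() , _) , _) }))) (trans (zeroˡ _) (sym (zeroˡ 0#)))))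
                  (trans (sumOver-* ws 0# (λ _ → 0#)) (zeroˡ _)))
           (∑<-cong n (λ a a<n → trans (sumOver-cong ws (λ w → trans
             (*-congʳ (trans (⟦×⟧ ((1 ℕ.≤? suc a) ×-dec (suc a ℕ.≤? c)) (partition≤? (suc a) w))
               (*-congʳ (⟦⟧-⇔ ((1 ℕ.≤? suc a) ×-dec (suc a ℕ.≤? c)) (suc a ℕ.≤? c) proj₂ (s≤s z≤n ,_))))) (*-assoc _ _ _)))
             (trans (sumOver-* ws _ _) (*-congˡ (words-exact n L (suc a) (λ μ → g (suc a ∷ μ)) a<n))))) ⟩
    0# + ∑< n (λ a → ⟦ suc a ℕ.≤? c ⟧ * exact L (suc a) (λ μ → g (suc a ∷ μ)))
      ≈⟨ trans (+-identityˡ _) (bracket-sum n c c≤n _) ⟩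
    exact (suc L) c g ∎
    where ws = words (upTo (suc n)) L

  -- Sum over the partitions with at most N parts, all at most b.
  box : ℕ → ℕ → (List ℕ → Carrier) → Carrier
  box zero    b       g = g []
  box (suc N) zero    g = g []
  box (suc N) (suc b) g = box (suc N) b g + box N (suc b) (λ μ → g (suc b ∷ μ))

  -- The partitions whose first part equals `suc b` are the last summand in the definition of
  -- `exact`, so the recursion of `box` becomes `∑<-last`.
  box≈exact : ∀ N b g → box N b g ≈ ∑< (suc N) (λ L → exact L b g)
  box≈exact zero    b       g = sym (+-identityʳ _)
  box≈exact (suc N) zero    g = sym (trans (+-congˡ (∑<-zero (suc N) (λ L _ → refl))) (+-identityʳ _))
  box≈exact (suc N) (suc b) g = begin
    box (suc N) b g + box N (suc b) (λ μ → g (suc b ∷ μ))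
      ≈⟨ +-cong (box≈exact (suc N) b g) (box≈exact N (suc b) _) ⟩
    (g [] + ∑< (suc N) (λ L → exact (suc L) b g)) + ∑< (suc N) (λ L → exact L (suc b) (λ μ → g (suc b ∷ μ)))
      ≈⟨ trans (+-assoc _ _ _) (+-congˡ (sym (∑<-+ (suc N) (λ L → exact (suc L) b g) (λ L → exact L (suc b) (λ μ → g (suc b ∷ μ)))))) ⟩
    g [] + ∑< (suc N) (λ L → exact (suc L) b g + exact L (suc b) (λ μ → g (suc b ∷ μ)))
      ≈⟨ +-congˡ (∑<-cong (suc N) (λ L _ → sym (∑<-last b (λ a → exact L (suc a) (λ μ → g (suc a ∷ μ)))))) ⟩
    ∑< (suc (suc N)) (λ L → exact L (suc b) g) ∎

  box-cong : ∀ N b {g h} → (∀ μ → length μ ℕ.≤ N → Partition≤ b μ → g μ ≈ h μ) → box N b g ≈ box N b h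
  box-cong N b {g} {h} eq = trans (box≈exact N b g) (trans
    (∑<-cong (suc N) (λ L L≤N → exact-cong L b (λ μ len p → eq μ (ℕ.≤-trans (ℕ.≤-reflexive len) (ℕ.s≤s⁻¹ L≤N)) p)))
    (sym (box≈exact N b h)))

  -- A partition of `n` has at most `n` parts, each at most `n`; enlarging the box to `N` and `b`
  -- only adds terms that the bracket kills. This allows one box for all sums in the recursion.
  partitions-box : ∀ n N b g → n ℕ.≤ N → n ℕ.≤ b →
                   sumOver (partitions n) g ≈ box N b (λ μ → ⟦ ℕ.sum μ ℕ.≟ n ⟧ * g μ)
  partitions-box n N b g n≤N n≤b = begin
    sumOver (partitions n) g
      ≈⟨ sumOver-filter (_⊢? n) (concatMap (words (upTo (suc n))) (upTo (suc n))) g ⟩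
    sumOver (concatMap (words (upTo (suc n))) (upTo (suc n))) (λ w → ⟦ w ⊢? n ⟧ * g w)
      ≈⟨ sumOver-concatMap (words (upTo (suc n))) (upTo (suc n)) _ ⟩
    sumOver (upTo (suc n)) (λ L → sumOver (words (upTo (suc n)) L) (λ w → ⟦ w ⊢? n ⟧ * g w))
      ≈⟨ sumOver-applyUpTo id (suc n) _ ⟩
    ∑< (suc n) (λ L → sumOver (words (upTo (suc n)) L) (λ w → ⟦ w ⊢? n ⟧ * g w))
      ≈⟨ ∑<-cong (suc n) (λ L _ → trans (sumOver-cong (words (upTo (suc n)) L) (λ w → trans
           (*-congʳ (trans (⟦⟧-⇔ (w ⊢? n) (partition≤? n w ×-dec (ℕ.sum w ℕ.≟ n)) (λ w⊢n → ⊢⇒partition≤ ℕ.≤-refl w⊢n , proj₂ (proj₂ w⊢n))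
             (λ { (p , eq) → proj₁ (partition≤⇒linked w p) , proj₂ (partition≤⇒linked w p) , eq })) (⟦×⟧ (partition≤? n w) (ℕ.sum w ℕ.≟ n))))
           (*-assoc _ _ _)))
         (words-exact n L n G ℕ.≤-refl)) ⟩
    ∑< (suc n) (λ L → exact L n G)
      ≈⟨ ∑<-cong (suc n) (λ L _ → widen L) ⟩
    ∑< (suc n) (λ L → exact L b G)
      ≈⟨ ∑<-extend (s≤s n≤N) (λ L n<L _ → exact-zero L b (λ μ len p → vanish μ (λ eq →
           ℕ.<⇒≱ n<L (ℕ.≤-trans (ℕ.≤-reflexive (≡.sym len)) (ℕ.≤-trans (length≤sum μ p) (ℕ.≤-reflexive eq)))))) ⟨
    ∑< (suc N) (λ L → exact L b G)
      ≈⟨ box≈exact N b G ⟨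
    box N b G ∎
    where
    G : List ℕ → Carrier
    G μ = ⟦ ℕ.sum μ ℕ.≟ n ⟧ * g μ
    vanish : ∀ μ → ℕ.sum μ ≢ n → G μ ≈ 0#
    vanish μ ne = trans (*-congʳ (⟦⟧-no (ℕ.sum μ ℕ.≟ n) ne)) (zeroˡ _)
    widen : ∀ L → exact L n G ≈ exact L b G
    widen zero    = refl
    widen (suc L) = sym (∑<-extend n≤b (λ a n≤a _ → exact-zero L (suc a) (λ μ _ _ → vanish (suc a ∷ μ) (λ eq →
      ℕ.<⇒≱ (s≤s n≤a) (ℕ.≤-trans (ℕ.m≤m+n (suc a) _) (ℕ.≤-reflexive eq))))))

  -- Sum over the strictly decreasing words in 0, …, B ∸ 1.
  dec : ℕ → ∀ N → (Vec ℕ N → Carrier) → Carrier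
  dec B       zero    f = f []
  dec zero    (suc N) f = 0#
  dec (suc B) (suc N) f = dec B (suc N) f + dec B N (λ l → f (B ∷ l))

  dec-0 : ∀ B N f → B ℕ.< N → dec B N f ≈ 0#
  dec-0 zero    (suc N) f lt       = refl
  dec-0 (suc B) (suc N) f (s≤s lt) =
    trans (+-cong (dec-0 B (suc N) f (ℕ.m<n⇒m<1+n lt)) (dec-0 B N _ lt)) (+-identityˡ _)

  -- Both recursions split off the case of a maximal first entry, and a first part `suc b` followed
  -- by at most `N` parts has the leading beta number `N + suc b`.
  dec≈box : ∀ N b f → dec (N ℕ.+ b) N f ≈ box N b (f ∘ beta N)
  dec≈box zero    b       f = refl
  dec≈box (suc N) zero    f = trans (+-cong (dec-0 (N ℕ.+ 0) (suc N) f (s≤s (ℕ.≤-reflexive (ℕ.+-identityʳ N)))) (dec≈box N 0 _))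
    (trans (+-identityˡ _) (trans (only N _) (reflexive (≡.cong (λ x → f (x ∷ beta N [])) (ℕ.+-identityʳ N)))))
    where
    only : ∀ N g → box N 0 g ≈ g []
    only zero    g = refl
    only (suc N) g = refl
  dec≈box (suc N) (suc b) f = +-cong
    (trans (reflexive (≡.cong (λ B → dec B (suc N) f) (ℕ.+-suc N b))) (dec≈box (suc N) b f))
    (trans (dec≈box N (suc b) _) (box-cong N (suc b) (λ μ _ _ → reflexive (≡.cong (λ x → f (x ∷ beta N μ)) (ℕ.+-comm N (suc b))))))

  module Symmetrise (χ : ℕ → ℕ → Carrier) (χ-sym : ∀ a b → χ a b ≈ χ b a) (χ-diag : ∀ a → χ a a ≈ 0#) (s : ℕ) where

    twist : (ℕ → Carrier) → ℕ → ℕ → Carrier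
    twist ψ a b = ψ b * χ a b

    -- The pair factors of a chosen entry are absorbed into the weight `ψ` of the later ones, and
    -- `o` collects the sum so far. Thus the tail is again of the same form, and the inductions run
    -- over all `o` and `ψ`.
    term : ∀ {N} → ℕ → (ℕ → Carrier) → Vec ℕ N → Carrier
    term o ψ []      = ⟦ o ℕ.≟ s ⟧
    term o ψ (a ∷ l) = ψ a * term (o ℕ.+ a) (twist ψ a) l

    term-cong : ∀ {N} {o o′} {ψ ψ′ : ℕ → Carrier} → o ≡ o′ → (∀ a → ψ a ≈ ψ′ a) → (l : Vec ℕ N) → term o ψ l ≈ term o′ ψ′ l
    term-cong ≡.refl eq []      = refl
    term-cong ≡.refl eq (a ∷ l) = *-cong (eq a) (term-cong ≡.refl (λ b → *-congʳ (eq b)) l)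

    module _ (B : ℕ) where
      open WordSums R B public using (W; W-cong; W-*)

    private
      -- A word in which `B` occurs contributes only if it occurs once, since `χ B B` vanishes; the
      -- symmetry of `χ` lets it be moved to the front from any of the `suc N` places. In
      -- `symmetrise` these factors multiply up to `N !`.
      all-suc : ∀ B N o ψ → W (suc B) (suc N) (term o ψ) ≈
                W B (suc N) (term o ψ) + nat (suc N) * (ψ B * W B N (term (o ℕ.+ B) (twist ψ B)))
      all-suc B zero    o ψ = trans (∑<-last B (λ a → ψ a * ⟦ o ℕ.+ a ℕ.≟ s ⟧)) (+-congˡ (solve 1 (λ x → x := (con (+ 1) :+ con (+ 0)) :* x) refl _))
      all-suc B (suc N) o ψ = begin
        ∑< (suc B) (λ a → W (suc B) (suc N) (λ l → ψ a * term (o ℕ.+ a) (twist ψ a) l))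
          ≈⟨ ∑<-cong (suc B) (λ a _ → W-* (suc B) (suc N) (ψ a) (term (o ℕ.+ a) (twist ψ a))) ⟩
        ∑< (suc B) (λ a → ψ a * W (suc B) (suc N) (term (o ℕ.+ a) (twist ψ a)))
          ≈⟨ ∑<-last B (λ a → ψ a * W (suc B) (suc N) (term (o ℕ.+ a) (twist ψ a))) ⟩
        ∑< B (λ a → ψ a * W (suc B) (suc N) (term (o ℕ.+ a) (twist ψ a))) + ψ B * W (suc B) (suc N) (term (o ℕ.+ B) (twist ψ B))
          ≈⟨ +-cong (∑<-cong B (λ a _ → *-congˡ (all-suc B N _ _))) (*-congˡ last) ⟩
        ∑< B (λ a → ψ a * (W B (suc N) (term (o ℕ.+ a) (twist ψ a)) + nat (suc N) * (twist ψ a B * W B N (term (o ℕ.+ a ℕ.+ B) (twist (twist ψ a) B))))) + ψ B * Z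
          ≈⟨ +-congʳ (∑<-cong B (λ a _ → trans (distribˡ _ _ _) (+-cong (sym (W-* B (suc N) (ψ a) (term (o ℕ.+ a) (twist ψ a)))) (exchange a)))) ⟩
        ∑< B (λ a → W B (suc N) (λ l → ψ a * term (o ℕ.+ a) (twist ψ a) l) + nat (suc N) * ψ B * W B N (λ l → twist ψ B a * term (o ℕ.+ B ℕ.+ a) (twist (twist ψ B) a) l)) + ψ B * Z
          ≈⟨ +-congʳ (trans (∑<-+ B _ _) (+-congˡ (∑<-* B _ _))) ⟩
        (W B (suc (suc N)) (term o ψ) + nat (suc N) * ψ B * Z) + ψ B * Z
          ≈⟨ solve 4 (λ w n p z → (w :+ n :* p :* z) :+ p :* z := w :+ (con (+ 1) :+ n) :* (p :* z)) refl _ _ _ _ ⟩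
        W B (suc (suc N)) (term o ψ) + nat (suc (suc N)) * (ψ B * Z) ∎
        where
        Z = W B (suc N) (term (o ℕ.+ B) (twist ψ B))
        last : W (suc B) (suc N) (term (o ℕ.+ B) (twist ψ B)) ≈ Z
        last = trans (all-suc B N _ _) (trans (+-congˡ (trans (*-congˡ (trans (*-congʳ (trans (*-congˡ (χ-diag B)) (zeroʳ _))) (zeroˡ _))) (zeroʳ _))) (+-identityʳ _))
        exchange : ∀ a → ψ a * (nat (suc N) * (twist ψ a B * W B N (term (o ℕ.+ a ℕ.+ B) (twist (twist ψ a) B)))) ≈
                   nat (suc N) * ψ B * W B N (λ l → twist ψ B a * term (o ℕ.+ B ℕ.+ a) (twist (twist ψ B) a) l)
        exchange a = begin
          ψ a * (nat (suc N) * (ψ B * χ a B * w))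
            ≈⟨ *-congˡ (*-congˡ (*-cong (*-congˡ (χ-sym a B)) (W-cong B N (term-cong
                 (≡.trans (ℕ.+-assoc o a B) (≡.trans (≡.cong (o ℕ.+_) (ℕ.+-comm a B)) (≡.sym (ℕ.+-assoc o B a))))
                 (λ b → solve 3 (λ p x y → p :* x :* y := p :* y :* x) refl _ _ _))))) ⟩
          ψ a * (nat (suc N) * (ψ B * χ B a * w′))
            ≈⟨ solve 5 (λ a n b x w → a :* (n :* (b :* x :* w)) := n :* b :* ((a :* x) :* w)) refl _ _ _ _ _ ⟩
          nat (suc N) * ψ B * (twist ψ B a * w′)
            ≈⟨ *-congˡ (W-* B N _ (term (o ℕ.+ B ℕ.+ a) (twist (twist ψ B) a))) ⟨
          nat (suc N) * ψ B * W B N (λ l → twist ψ B a * term (o ℕ.+ B ℕ.+ a) (twist (twist ψ B) a) l) ∎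
          where
          w = W B N (term (o ℕ.+ a ℕ.+ B) (twist (twist ψ a) B))
          w′ = W B N (term (o ℕ.+ B ℕ.+ a) (twist (twist ψ B) a))

    dec-* : ∀ B N k f → dec B N (λ l → k * f l) ≈ k * dec B N f
    dec-* B       zero    k f = refl
    dec-* zero    (suc N) k f = sym (zeroʳ k)
    dec-* (suc B) (suc N) k f = trans (+-cong (dec-* B (suc N) k f) (dec-* B N k _)) (sym (distribˡ _ _ _))

    symmetrise : ∀ B N o ψ → W B N (term o ψ) ≈ nat (N !) * dec B N (term o ψ)
    symmetrise B       zero    o ψ = solve 1 (λ x → x := (con (+ 1) :+ con (+ 0)) :* x) refl _
    symmetrise zero    (suc N) o ψ = sym (zeroʳ _)
    symmetrise (suc B) (suc N) o ψ = begin
      W (suc B) (suc N) (term o ψ)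
        ≈⟨ all-suc B N o ψ ⟩
      W B (suc N) (term o ψ) + nat (suc N) * (ψ B * W B N (term (o ℕ.+ B) (twist ψ B)))
        ≈⟨ +-cong (symmetrise B (suc N) o ψ) (*-congˡ (*-congˡ (symmetrise B N _ _))) ⟩
      nat (suc N !) * d + nat (suc N) * (ψ B * (nat (N !) * e))
        ≈⟨ +-congˡ (solve 4 (λ n p f e → n :* (p :* (f :* e)) := (n :* f) :* (p :* e)) refl _ _ _ _) ⟩
      nat (suc N !) * d + (nat (suc N) * nat (N !)) * (ψ B * e)
        ≈⟨ +-congˡ (*-cong (sym (nat-* (suc N) (N !))) (sym (dec-* B N _ _))) ⟩
      nat (suc N !) * d + nat (suc N !) * dec B N (λ l → ψ B * term (o ℕ.+ B) (twist ψ B) l)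
        ≈⟨ distribˡ _ _ _ ⟨
      nat (suc N !) * dec (suc B) (suc N) (term o ψ) ∎
      where
      d = dec B (suc N) (term o ψ)
      e = dec B N (term (o ℕ.+ B) (twist ψ B))

longer : ℕ → List ℕ → ℕ
longer j rs = length (filter (j ℕ.<?_) rs)

longer-suc : ∀ {j s} rs → j ℕ.< s → longer j (s ∷ rs) ≡ suc (longer j rs)
longer-suc {j} rs j<s = ≡.cong length (List.filter-accept (j ℕ.<?_) {xs = rs} j<s)

longer-0 : ∀ {j c} rs → Partition≤ c rs → c ℕ.≤ j → longer j rs ≡ 0
longer-0 []       _ _ = ≡.refl
longer-0 {j} (s ∷ rs) ((_ , s≤c) , p) c≤j = ≡.trans
  (≡.cong length (List.filter-reject (j ℕ.<?_) {xs = rs} (ℕ.≤⇒≯ s≤j)))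
  (longer-0 rs p s≤j)
  where s≤j = ℕ.≤-trans s≤c c≤j

-- Hook lengths against differences of beta numbers

module HookProducts {c ℓ} (R : CommutativeRing c ℓ) where
  open CommutativeRing R hiding (zero)
  open IntegerSolver R
  open Products R
  open SetoidReasoning setoid

  ∏< : ℕ → (ℕ → Carrier) → Carrier
  ∏< zero    f = 1#
  ∏< (suc n) f = f 0 * ∏< n (f ∘ suc)

  ∏<-cong : ∀ n {f g} → (∀ i → i ℕ.< n → f i ≈ g i) → ∏< n f ≈ ∏< n g
  ∏<-cong zero    eq = refl
  ∏<-cong (suc n) eq = *-cong (eq 0 (s≤s z≤n)) (∏<-cong n (λ i i<n → eq (suc i) (s≤s i<n)))

  ∏<-split : ∀ m n f → ∏< (m ℕ.+ n) f ≈ ∏< m f * ∏< n (f ∘ (m ℕ.+_))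
  ∏<-split zero    n f = sym (*-identityˡ _)
  ∏<-split (suc m) n f = trans (*-congˡ (∏<-split m n (f ∘ suc))) (sym (*-assoc _ _ _))

  ∏<-last : ∀ n f → ∏< (suc n) f ≈ ∏< n f * f n
  ∏<-last zero    f = trans (*-identityʳ _) (sym (*-identityˡ _))
  ∏<-last (suc n) f = trans (*-congˡ (∏<-last n (f ∘ suc))) (sym (*-assoc _ _ _))

  ∏<-reverse : ∀ n f → ∏< n (λ i → f (n ℕ.∸ suc i)) ≈ ∏< n f
  ∏<-reverse zero    f = refl
  ∏<-reverse (suc n) f = begin
    f n * ∏< n (λ i → f (n ℕ.∸ suc i))  ≈⟨ *-congˡ (∏<-reverse n f) ⟩
    f n * ∏< n f                        ≈⟨ *-comm _ _ ⟩
    ∏< n f * f n                        ≈⟨ ∏<-last n f ⟨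
    ∏< (suc n) f                        ∎

  prodOver : List ℕ → (ℕ → Carrier) → Carrier
  prodOver []       f = 1#
  prodOver (x ∷ xs) f = f x * prodOver xs f

  prodOver-++ : ∀ xs ys f → prodOver (xs ++ ys) f ≈ prodOver xs f * prodOver ys f
  prodOver-++ []       ys f = sym (*-identityˡ _)
  prodOver-++ (x ∷ xs) ys f = trans (*-congˡ (prodOver-++ xs ys f)) (sym (*-assoc _ _ _))

  prodOver-upTo : ∀ (h : ℕ → ℕ) (g : ℕ → ℕ) n f → prodOver (map h (applyUpTo g n)) f ≈ ∏< n (f ∘ h ∘ g)
  prodOver-upTo h g zero    f = refl
  prodOver-upTo h g (suc n) f = *-congˡ (prodOver-upTo h (g ∘ suc) n f)

  prod-cong-lookup : ∀ {N} {φ χ : ℕ → Carrier} (l : Vec ℕ N) → (∀ i → φ (lookup l i) ≈ χ (lookup l i)) → prod φ l ≈ prod χ l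
  prod-cong-lookup []      eq = refl
  prod-cong-lookup (a ∷ l) eq = *-cong (eq zero) (prod-cong-lookup l (eq ∘ suc))

  rowHooks : (ℕ → Carrier) → ℕ → List ℕ → Carrier
  rowHooks φ r rs = ∏< r (λ j → φ (suc ((r ℕ.∸ suc j) ℕ.+ longer j rs)))

  -- The hook lengths of the first row together with the differences from the
  -- leading beta number are exactly 1, …, r + N.
  row : ∀ N φ r rs → Partition≤ r rs → length rs ℕ.≤ N →
        rowHooks φ r rs * prod (λ b → φ (r ℕ.+ N ℕ.∸ b)) (beta N rs) ≈ ∏< (r ℕ.+ N) (φ ∘ suc)

  private
    -- Put `d = r - s`. The last `d` columns of the row have hooks `1, …, d`; the difference to the
    -- beta number of `s` is `d + 1`; and in the first `s` columns the hooks, like the remaining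
    -- differences, are those of the row `s` over `rs` increased by `d + 1`. The shift is absorbed
    -- into `φ′`.
    row-step : ∀ N φ r s rs → s ℕ.≤ r → Partition≤ s rs → length rs ℕ.≤ N →
      rowHooks φ r (s ∷ rs) * (φ (r ℕ.+ suc N ℕ.∸ (s ℕ.+ N)) * prod (λ b → φ (r ℕ.+ suc N ℕ.∸ b)) (beta N rs)) ≈
      ∏< (r ℕ.+ suc N) (φ ∘ suc)
    row-step N φ r s rs s≤r p len = begin
      rowHooks φ r (s ∷ rs) * (φ (r ℕ.+ suc N ℕ.∸ (s ℕ.+ N)) * prod (λ b → φ (r ℕ.+ suc N ℕ.∸ b)) (beta N rs))
        ≈⟨ *-cong split (*-cong (reflexive (≡.cong φ head-index)) (prod-cong-lookup (beta N rs) (λ i →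
             reflexive (≡.cong φ (tail-index _ (ℕ.<⇒≤ (beta-bound N rs p i))))))) ⟩
      (rowHooks φ′ s rs * ∏< d (φ ∘ suc)) * (φ (suc d) * prod (λ b → φ′ (s ℕ.+ N ℕ.∸ b)) (beta N rs))
        ≈⟨ solve 4 (λ a b c e → (a :* b) :* (c :* e) := (b :* c) :* (a :* e)) refl _ _ _ _ ⟩
      (∏< d (φ ∘ suc) * φ (suc d)) * (rowHooks φ′ s rs * prod (λ b → φ′ (s ℕ.+ N ℕ.∸ b)) (beta N rs))
        ≈⟨ *-cong (sym (∏<-last d (φ ∘ suc))) (row N φ′ s rs p len) ⟩
      ∏< (suc d) (φ ∘ suc) * ∏< (s ℕ.+ N) (φ′ ∘ suc)
        ≈⟨ *-congˡ (∏<-cong (s ℕ.+ N) (λ h _ → reflexive (≡.cong φ (≡.cong suc (ℕ.+-comm h (suc d)))))) ⟩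
      ∏< (suc d) (φ ∘ suc) * ∏< (s ℕ.+ N) (λ h → φ (suc (suc d ℕ.+ h)))
        ≈⟨ ∏<-split (suc d) (s ℕ.+ N) (φ ∘ suc) ⟨
      ∏< (suc d ℕ.+ (s ℕ.+ N)) (φ ∘ suc)
        ≡⟨ ≡.cong (λ n → ∏< n (φ ∘ suc)) size ⟩
      ∏< (r ℕ.+ suc N) (φ ∘ suc) ∎
      where
      d = r ℕ.∸ s
      s+d : s ℕ.+ d ≡ r
      s+d = ℕ.m+[n∸m]≡n s≤r
      φ′ : ℕ → Carrier
      φ′ x = φ (x ℕ.+ suc d)
      size : suc d ℕ.+ (s ℕ.+ N) ≡ r ℕ.+ suc N
      size = ≡.trans (Solver.solve 3 (λ d s n → Solver.con 1 Solver.:+ d Solver.:+ (s Solver.:+ n) Solver.:= (s Solver.:+ d) Solver.:+ (Solver.con 1 Solver.:+ n)) ≡.refl d s N)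
        (≡.cong (ℕ._+ suc N) s+d)
        where module Solver = +-*-Solver
      head-index : r ℕ.+ suc N ℕ.∸ (s ℕ.+ N) ≡ suc d
      head-index = ≡.trans (≡.cong (ℕ._∸ (s ℕ.+ N)) (≡.sym size)) (ℕ.m+n∸n≡m (suc d) (s ℕ.+ N))
      tail-index : ∀ b → b ℕ.≤ s ℕ.+ N → r ℕ.+ suc N ℕ.∸ b ≡ (s ℕ.+ N ℕ.∸ b) ℕ.+ suc d
      tail-index b b≤ = ≡.trans (≡.cong (ℕ._∸ b) (≡.sym size)) (≡.trans (ℕ.+-∸-assoc (suc d) b≤) (ℕ.+-comm (suc d) _))
      split : rowHooks φ r (s ∷ rs) ≈ rowHooks φ′ s rs * ∏< d (φ ∘ suc)
      split = begin
        rowHooks φ r (s ∷ rs)        ≡⟨ ≡.cong (λ n → ∏< n f) (≡.sym s+d) ⟩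
        ∏< (s ℕ.+ d) f               ≈⟨ ∏<-split s d f ⟩
        ∏< s f * ∏< d (f ∘ (s ℕ.+_))
          ≈⟨ *-cong (∏<-cong s (λ j j<s → reflexive (≡.cong φ (inside j j<s))))
               (trans (∏<-cong d (λ i i<d → reflexive (≡.cong φ (outside i))))
                 (∏<-reverse d (φ ∘ suc))) ⟩
        rowHooks φ′ s rs * ∏< d (φ ∘ suc) ∎
        where
        f : ℕ → Carrier
        f j = φ (suc ((r ℕ.∸ suc j) ℕ.+ longer j (s ∷ rs)))
        inside : ∀ j → j ℕ.< s → suc ((r ℕ.∸ suc j) ℕ.+ longer j (s ∷ rs)) ≡ suc ((s ℕ.∸ suc j) ℕ.+ longer j rs) ℕ.+ suc d
        inside j j<s = ≡.cong suc (≡.trans (≡.cong₂ ℕ._+_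
          (≡.trans (≡.cong (ℕ._∸ suc j) (≡.trans (≡.sym s+d) (ℕ.+-comm s d))) (ℕ.+-∸-assoc d j<s)) (longer-suc rs j<s))
          (Solver.solve 3 (λ d x y → (d Solver.:+ x) Solver.:+ (Solver.con 1 Solver.:+ y) Solver.:= (x Solver.:+ y) Solver.:+ (Solver.con 1 Solver.:+ d)) ≡.refl d (s ℕ.∸ suc j) (longer j rs)))
          where module Solver = +-*-Solver
        outside : ∀ i → suc ((r ℕ.∸ suc (s ℕ.+ i)) ℕ.+ longer (s ℕ.+ i) (s ∷ rs)) ≡ suc (d ℕ.∸ suc i)
        outside i = ≡.cong suc (≡.trans (≡.cong₂ ℕ._+_
          (≡.trans (≡.cong₂ ℕ._∸_ (≡.sym s+d) (≡.sym (ℕ.+-suc s i))) (ℕ.[m+n]∸[m+o]≡n∸o s d (suc i)))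
          (≡.trans (≡.cong length (List.filter-reject (s ℕ.+ i ℕ.<?_) {xs = rs} (ℕ.≤⇒≯ (ℕ.m≤m+n s i)))) (longer-0 rs p (ℕ.m≤m+n s i))))
          (ℕ.+-identityʳ _))

  row zero    φ r []       p len = trans (*-identityʳ _) (trans
    (∏<-cong r (λ j _ → reflexive (≡.cong (φ ∘ suc) (ℕ.+-identityʳ _))))
    (trans (∏<-reverse r (φ ∘ suc)) (reflexive (≡.cong (λ n → ∏< n (φ ∘ suc)) (≡.sym (ℕ.+-identityʳ r))))))
  -- An added part 0 changes neither the hook lengths nor the beta numbers.
  row (suc N) φ r []       p len = row-step N φ r 0 [] z≤n tt z≤n
  row (suc N) φ r (s ∷ rs) ((_ , s≤r) , p) (s≤s len) = row-step N φ r s rs s≤r p len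

-- The diagonal of the kernel as a hook product

module HookFormula {c ℓ₁ ℓ₂} (F : CompleteOrderedField c ℓ₁ ℓ₂) where
  open CompleteOrderedField F hiding (zero)
  open IntegerSolver commutativeRing
  open OrderedField F
  open Products commutativeRing
  open Sums commutativeRing
  open Vertex F
  open PartitionSums commutativeRing
  open HookProducts commutativeRing
  open SetoidReasoning setoid

  hookTerm : Carrier → ℕ → Carrier
  hookTerm z h = 1# + z * (nat h * nat h) ⁻¹

  hookSum : Carrier → ℕ → Carrier
  hookSum z n = sumOver (partitions n) (λ μ → prodOver (hookLengths μ) (hookTerm z))

  module _ {m} (ni : NonInteger m) where
    private
      φ : ℕ → Carrier
      φ = hookTerm (- (m * m))

      ψ : ℕ → Carrier
      ψ a = binom m a * binom (- m) a * kernel m a a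

      χ : ℕ → ℕ → Carrier
      χ a b = (nat a - nat b) * (nat a - nat b) * (kernel m a b * kernel m b a)

      χ-sym : ∀ a b → χ a b ≈ χ b a
      χ-sym a b = solve 4 (λ a b x y → (a :- b) :* (a :- b) :* (x :* y) := (b :- a) :* (b :- a) :* (y :* x)) refl _ _ _ _

      χ-diag : ∀ a → χ a a ≈ 0#
      χ-diag a = solve 2 (λ a x → (a :- a) :* (a :- a) :* x := con (+ 0)) refl _ _

      m≉0 : m ≉ 0#
      m≉0 m≈0 = ni 0 0 (trans (solve 1 (λ m → m :+ con (+ 0) :- con (+ 0) := m) refl m) m≈0)

      φ-factor : ∀ a → (nat (suc a) + m) * nat (suc a) ⁻¹ * ((nat (suc a) + - m) * nat (suc a) ⁻¹) ≈ φ (suc a)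
      φ-factor a = begin
        (x + m) * i * ((x + - m) * i)
          ≈⟨ solve 3 (λ x m i → (x :+ m) :* i :* ((x :+ :- m) :* i) := (x :* i) :* (x :* i) :+ (:- (m :* m)) :* (i :* i)) refl x m i ⟩
        (x * i) * (x * i) + - (m * m) * (i * i)
          ≈⟨ +-cong (trans (*-cong xi xi) (*-identityˡ 1#)) (*-congˡ (sym (inv-unique (trans
               (solve 2 (λ x i → (x :* x) :* (i :* i) := (x :* i) :* (x :* i)) refl x i) (trans (*-cong xi xi) (*-identityˡ 1#)))))) ⟩
        φ (suc a) ∎
        where
        x = nat (suc a)
        i = x ⁻¹
        xi : x * i ≈ 1#
        xi = ⁻¹-inverseʳ x (>⇒≉ (0<nat a))

      ψ-product : ∀ a → ψ a ≈ m ⁻¹ * ∏< a (φ ∘ suc)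
      ψ-product a = trans (*-cong (binoms a) (inv-cong m≉0 (solve 2 (λ m a → m :+ a :- a := m) refl m _))) (*-comm _ _)
        where
        binoms : ∀ a → binom m a * binom (- m) a ≈ ∏< a (φ ∘ suc)
        binoms zero    = *-identityˡ 1#
        binoms (suc a) = trans (solve 4 (λ b x c y → (b :* x) :* (c :* y) := (b :* c) :* (x :* y)) refl _ _ _ _)
          (trans (*-cong (binoms a) (φ-factor a)) (sym (∏<-last a (φ ∘ suc))))

      -- For `x = a - b`, the two kernels give `(m + x) (m - x) = - x² (1 - m² / x²)`, so `χ a b` is
      -- minus the reciprocal of `φ x`.
      χφ : ∀ {a b} → b ℕ.< a → χ a b * φ (a ℕ.∸ b) ≈ - 1#
      χφ {a} {b} b<a = begin
        χ a b * φ d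
          ≈⟨ *-congʳ (*-cong (*-cong diff diff) (*-cong kab kba)) ⟩
        (x * x) * (p ⁻¹ * q ⁻¹) * (1# + - (m * m) * (x * x) ⁻¹)
          ≈⟨ solve 5 (λ x p q m i → (x :* x) :* (p :* q) :* (con (+ 1) :+ (:- (m :* m)) :* i) :=
               (x :* x) :* (p :* q) :+ (:- (m :* m)) :* (p :* q) :* ((x :* x) :* i)) refl x (p ⁻¹) (q ⁻¹) m ((x * x) ⁻¹) ⟩
        (x * x) * (p ⁻¹ * q ⁻¹) + - (m * m) * (p ⁻¹ * q ⁻¹) * ((x * x) * (x * x) ⁻¹)
          ≈⟨ +-congˡ (*-congˡ (⁻¹-inverseʳ _ (*-≉0 x≉0 x≉0))) ⟩
        (x * x) * (p ⁻¹ * q ⁻¹) + - (m * m) * (p ⁻¹ * q ⁻¹) * 1#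
          ≈⟨ solve 4 (λ x m i j → (x :* x) :* (i :* j) :+ (:- (m :* m)) :* (i :* j) :* con (+ 1) := :- (((m :+ x) :* i) :* ((m :- x) :* j))) refl x m _ _ ⟩
        - ((p * p ⁻¹) * (q * q ⁻¹))
          ≈⟨ -‿cong (trans (*-cong (⁻¹-inverseʳ p p≉0) (⁻¹-inverseʳ q q≉0)) (*-identityˡ 1#)) ⟩
        - 1# ∎
        where
        d = a ℕ.∸ b
        x = nat d
        p = m + x
        q = m - x
        a≡ : b ℕ.+ d ≡ a
        a≡ = ℕ.m+[n∸m]≡n (ℕ.<⇒≤ b<a)
        diff : nat a - nat b ≈ x
        diff = trans (+-congʳ (trans (nat-cong (≡.sym a≡)) (nat-+ b d))) (solve 2 (λ b d → b :+ d :- b := d) refl _ _)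
        pab : m + nat a - nat b ≈ p
        pab = trans (+-assoc m _ _) (+-congˡ diff)
        qba : m + nat b - nat a ≈ q
        qba = trans (solve 3 (λ m a b → m :+ b :- a := m :- (a :- b)) refl m _ _) (+-congˡ (-‿cong diff))
        p≉0 : p ≉ 0#
        p≉0 p≈0 = ni a b (trans pab p≈0)
        q≉0 : q ≉ 0#
        q≉0 q≈0 = ni b a (trans qba q≈0)
        kab : kernel m a b ≈ p ⁻¹
        kab = inv-cong p≉0 pab
        kba : kernel m b a ≈ q ⁻¹
        kba = inv-cong q≉0 qba
        x≉0 : x ≉ 0#
        x≉0 = >⇒≉ (nat-mono-< (ℕ.m<n⇒0<n∸m b<a))

      pairs : ∀ {N} → Vec ℕ N → Carrier
      pairs []      = 1#
      pairs (a ∷ l) = prod (χ a) l * pairs l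

      V-pairs : ∀ {N} (l : Vec ℕ N) → V m l l ≈ prod ψ l * pairs l
      V-pairs []      = solve 0 ((con (+ 1) :* con (+ 1)) :* (con (+ 1) :* con (+ 1)) :* con (+ 1) := con (+ 1) :* con (+ 1)) refl
      V-pairs (a ∷ l) = begin
        (D * Δ l) * (g * G) * ((D * Δ l) * (h * H)) * ((k * K₁) * prod (λ x → kernel m x a * prod (kernel m x) l) l)
          ≈⟨ *-congˡ (*-congˡ (prod-* (λ x → kernel m x a) _ l)) ⟩
        (D * Δ l) * (g * G) * ((D * Δ l) * (h * H)) * ((k * K₁) * (K₂ * K))
          ≈⟨ solve 10 (λ D e g G h H k K₁ K₂ K → (D :* e) :* (g :* G) :* ((D :* e) :* (h :* H)) :* ((k :* K₁) :* (K₂ :* K)) :=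
               (g :* h :* k) :* (((D :* D) :* (K₁ :* K₂)) :* ((e :* G) :* (e :* H) :* K))) refl _ _ _ _ _ _ _ _ _ _ ⟩
        ψ a * (((D * D) * (K₁ * K₂)) * V m l l)
          ≈⟨ *-congˡ (*-cong (trans (*-cong (sym (prod-* _ _ l)) (sym (prod-* _ _ l))) (sym (prod-* _ _ l))) (V-pairs l)) ⟩
        ψ a * (prod (χ a) l * (prod ψ l * pairs l))
          ≈⟨ solve 4 (λ a b c d → a :* (b :* (c :* d)) := (a :* c) :* (b :* d)) refl _ _ _ _ ⟩
        prod ψ (a ∷ l) * pairs (a ∷ l) ∎
        where
        D = diffs (nat a) l
        g = binom m a
        h = binom (- m) a
        G = prod (binom m) l
        H = prod (binom (- m)) l
        k = kernel m a a
        K₁ = prod (kernel m a) l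
        K₂ = prod (λ x → kernel m x a) l
        K = prod (λ x → prod (kernel m x) l) l

      sgn : ∀ {N} → Vec ℕ N → Carrier
      sgn l = prod (λ _ → - 1#) l

      -- The value of `V` at the beta numbers of the empty partition, by which the diagonal is to be
      -- normalised.
      normal : ℕ → Carrier
      normal zero    = 1#
      normal (suc N) = m ⁻¹ * sgn (beta N []) * normal N

      sgn-const : ∀ {N} (l l′ : Vec ℕ N) → sgn l ≈ sgn l′
      sgn-const []      []       = refl
      sgn-const (_ ∷ l) (_ ∷ l′) = *-congˡ (sgn-const l l′)

      sgn≉0 : ∀ {N} (l : Vec ℕ N) → sgn l ≉ 0#
      sgn≉0 []      = >⇒≉ 0<1
      sgn≉0 (_ ∷ l) = *-≉0 -1≉0 (sgn≉0 l)

      m⁻¹≉0 : m ⁻¹ ≉ 0#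
      m⁻¹≉0 eq = 0≉1 (trans (sym (zeroʳ m)) (trans (*-congˡ (sym eq)) (⁻¹-inverseʳ m m≉0)))

      normal≉0 : ∀ N → normal N ≉ 0#
      normal≉0 zero    = >⇒≉ 0<1
      normal≉0 (suc N) = *-≉0 (*-≉0 m⁻¹≉0 (sgn≉0 (beta N []))) (normal≉0 N)

      -- `ψ` supplies `φ` at `1, …, r + N` and each `χ` divides by `φ` at a difference, up to sign;
      -- by `row` the hooks of the first row remain.
      row-value : ∀ N r rs → Partition≤ r rs → length rs ℕ.≤ N →
                  ψ (r ℕ.+ N) * prod (χ (r ℕ.+ N)) (beta N rs) ≈ m ⁻¹ * sgn (beta N []) * rowHooks φ r rs
      row-value N r rs p len = begin
        ψ a * X                       ≈⟨ *-congʳ (ψ-product a) ⟩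
        m ⁻¹ * ∏< a (φ ∘ suc) * X     ≈⟨ *-congʳ (*-congˡ (row N φ r rs p len)) ⟨
        m ⁻¹ * (rowHooks φ r rs * P) * X  ≈⟨ solve 4 (λ i r p x → i :* (r :* p) :* x := i :* (x :* p) :* r) refl _ _ _ _ ⟩
        m ⁻¹ * (X * P) * rowHooks φ r rs  ≈⟨ *-congʳ (*-congˡ (trans (sym (prod-* _ _ (beta N rs)))
                                             (trans (prod-cong-lookup (beta N rs) (λ i → χφ (beta-bound N rs p i))) (sgn-const (beta N rs) (beta N []))))) ⟩
        m ⁻¹ * sgn (beta N []) * rowHooks φ r rs ∎
        where
        a = r ℕ.+ N
        X = prod (χ a) (beta N rs)
        P = prod (λ b → φ (a ℕ.∸ b)) (beta N rs)

      value : ∀ N {c} μ → Partition≤ c μ → length μ ℕ.≤ N →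
              prod ψ (beta N μ) * pairs (beta N μ) ≈ normal N * prodOver (hookLengths μ) φ
      value-step : ∀ N r rs → Partition≤ r rs → length rs ℕ.≤ N →
        (ψ (r ℕ.+ N) * prod ψ (beta N rs)) * (prod (χ (r ℕ.+ N)) (beta N rs) * pairs (beta N rs)) ≈
        normal (suc N) * (rowHooks φ r rs * prodOver (hookLengths rs) φ)
      value-step N r rs p len = begin
        _ ≈⟨ solve 4 (λ a b c d → (a :* b) :* (c :* d) := (a :* c) :* (b :* d)) refl _ _ _ _ ⟩
        _ ≈⟨ *-cong (row-value N r rs p len) (value N rs p len) ⟩
        _ ≈⟨ solve 4 (λ x r n h → x :* r :* (n :* h) := x :* n :* (r :* h)) refl _ _ _ _ ⟩
        _ ∎
      value zero    []       p len = refl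
      value (suc N) []       p len = trans (value-step N 0 [] tt z≤n) (*-congˡ (*-identityˡ _))
      value (suc N) (r ∷ rs) (_ , p) (s≤s len) = trans (value-step N r rs p len)
        (*-congˡ (sym (trans (prodOver-++ (map _ (upTo r)) (hookLengths rs) φ) (*-congʳ (prodOver-upTo _ id r φ)))))

    module Evaluate (n : ℕ) where
      private
        N base S b B : ℕ
        -- `N = n` entries accommodate all partitions of `n`, and `2 S ≤ N² + N` then holds with
        -- equality. The bound `b` is chosen so that `B` exceeds `S`.
        N = n
        base = Vec.sum (beta N [])
        S = base ℕ.+ n
        b = suc S
        B = N ℕ.+ b
        S<B : S ℕ.< B
        S<B = ℕ.m≤n+m (suc S) N
        S-small : 2 ℕ.* S ℕ.≤ N ℕ.* N ℕ.+ N
        S-small = ℕ.≤-reflexive (≡.trans (solve′ 2 (λ s n → con′ 2 :*′ (s :+′ n) :=′ (con′ 2 :*′ s :+′ n) :+′ n) ≡.refl base n)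
          (≡.cong (ℕ._+ n) (sum-beta-[] N)))
          where open +-*-Solver renaming (solve to solve′; con to con′; _:*_ to _:*′_; _:+_ to _:+′_; _:=_ to _:=′_)

      open Trace.Recursion F ni N S B S<B S-small

      private
        C : Carrier
        C = nat (N !) * normal N

        C≉0 : C ≉ 0#
        C≉0 = *-≉0 (>⇒≉ (nat-mono-< (ℕ.1≤n! N))) (normal≉0 N)

        P : ℕ → Carrier
        P = hookSum (- (m * m))

        T-value : ∀ k → k ℕ.≤ n → T (base ℕ.+ k) ≈ C * P k
        T-value k k≤n = begin
          T (base ℕ.+ k)
            ≈⟨ W-cong B N (λ l → trans (*-congˡ (V-pairs l)) (sym (term-value 0 ψ l))) ⟩
          W B N (term 0 ψ)
            ≈⟨ symmetrise B N 0 ψ ⟩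
          nat (N !) * dec B N (term 0 ψ)
            ≈⟨ *-congˡ (dec≈box N b (term 0 ψ)) ⟩
          nat (N !) * box N b (λ μ → term 0 ψ (beta N μ))
            ≈⟨ *-congˡ (box-cong N b (λ μ len p → begin
                 term 0 ψ (beta N μ)  ≈⟨ term-value 0 ψ (beta N μ) ⟩
                 ⟦ Vec.sum (beta N μ) ℕ.≟ base ℕ.+ k ⟧ * (prod ψ (beta N μ) * pairs (beta N μ))
                   ≈⟨ *-cong (⟦⟧-⇔ (Vec.sum (beta N μ) ℕ.≟ base ℕ.+ k) (ℕ.sum μ ℕ.≟ k)
                        (λ eq → ℕ.+-cancelˡ-≡ base _ _ (≡.trans (≡.sym (sum-beta N μ len)) eq))
                        (λ eq → ≡.trans (sum-beta N μ len) (≡.cong (base ℕ.+_) eq))) (value N μ p len) ⟩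
                 ⟦ ℕ.sum μ ℕ.≟ k ⟧ * (normal N * prodOver (hookLengths μ) φ) ∎)) ⟩
          nat (N !) * box N b (λ μ → ⟦ ℕ.sum μ ℕ.≟ k ⟧ * (normal N * prodOver (hookLengths μ) φ))
            ≈⟨ *-congˡ (partitions-box k N b _ k≤n (ℕ.≤-trans k≤n (ℕ.≤-trans (ℕ.m≤n+m n base) (ℕ.n≤1+n S)))) ⟨
          nat (N !) * sumOver (partitions k) (λ μ → normal N * prodOver (hookLengths μ) φ)
            ≈⟨ trans (*-congˡ (sumOver-* (partitions k) _ _)) (sym (*-assoc _ _ _)) ⟩
          C * P k ∎
          where
          open Symmetrise χ χ-sym χ-diag (base ℕ.+ k)
          term-value : ∀ {M} o ψ (l : Vec ℕ M) → term o ψ l ≈ ⟦ o ℕ.+ Vec.sum l ℕ.≟ base ℕ.+ k ⟧ * (prod ψ l * pairs l)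
          term-value o ψ [] = trans (reflexive (≡.cong (λ x → ⟦ x ℕ.≟ base ℕ.+ k ⟧) (≡.sym (ℕ.+-identityʳ o))))
            (solve 1 (λ x → x := x :* (con (+ 1) :* con (+ 1))) refl _)
          term-value o ψ (a ∷ l) = begin
            ψ a * term (o ℕ.+ a) (twist ψ a) l
              ≈⟨ *-congˡ (term-value (o ℕ.+ a) (twist ψ a) l) ⟩
            ψ a * (⟦ o ℕ.+ a ℕ.+ Vec.sum l ℕ.≟ base ℕ.+ k ⟧ * (prod (twist ψ a) l * pairs l))
              ≈⟨ *-congˡ (*-cong (reflexive (≡.cong (λ x → ⟦ x ℕ.≟ base ℕ.+ k ⟧) (ℕ.+-assoc o a _))) (*-congʳ (prod-* ψ (χ a) l))) ⟩
            ψ a * (⟦ o ℕ.+ (a ℕ.+ Vec.sum l) ℕ.≟ base ℕ.+ k ⟧ * ((prod ψ l * prod (χ a) l) * pairs l))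
              ≈⟨ solve 5 (λ a b p c q → a :* (b :* ((p :* c) :* q)) := b :* ((a :* p) :* (c :* q))) refl _ _ _ _ _ ⟩
            ⟦ o ℕ.+ (a ℕ.+ Vec.sum l) ℕ.≟ base ℕ.+ k ⟧ * (prod ψ (a ∷ l) * pairs (a ∷ l)) ∎

        -- Injective tuples have sum at least `base`, and `V` vanishes on the diagonal at all
        -- others. This ends the recursion at the empty partition.
        T-low : ∀ s → s ℕ.< base → T s ≈ 0#
        T-low s s<base = trans (weight-cong s {g = λ _ → 0#} vanish) (trans (weight-cong s (λ l _ → sym (zeroˡ 0#))) (trans (weight-* s 0# (λ _ → 0#)) (zeroˡ _)))
          where
          vanish : ∀ l → Vec.sum l ≡ s → V m l l ≈ 0#
          vanish l eq with injective⊎repeats l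
          ... | inj₂ rep = Antisymmetric.repeats⇒0 F (V m l) (Trace.V-antisymʳ F m l) l rep
          ... | inj₁ inj = contradiction
            (ℕ.*-cancelˡ-≤ 2 (ℕ.+-cancelʳ-≤ N _ _ (ℕ.≤-trans (ℕ.≤-reflexive (sum-beta-[] N)) (injective-sum l inj))))
            (ℕ.<⇒≱ (≡.subst (ℕ._< base) (≡.sym eq) s<base))

      P↓ : ℕ → ℕ → Carrier
      P↓ k d = ⟦ d ℕ.≤? k ⟧ * hookSum (- (m * m)) (k ℕ.∸ d)

      private
        T↓-value : ∀ d → T↓ S d ≈ C * P↓ n d
        T↓-value d with d ℕ.≤? n | d ℕ.≤? S
        ... | yes d≤n | yes _   = trans (*-congˡ (trans (reflexive (≡.cong T (ℕ.+-∸-assoc base d≤n))) (T-value (n ℕ.∸ d) (ℕ.m∸n≤m n d))))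
          (solve 2 (λ c p → con (+ 1) :* (c :* p) := c :* (con (+ 1) :* p)) refl _ _)
        ... | yes d≤n | no  d≰S = contradiction (ℕ.≤-trans d≤n (ℕ.m≤n+m n base)) d≰S
        ... | no  d≰n | no  _   = solve 3 (λ t c p → con (+ 0) :* t := c :* (con (+ 0) :* p)) refl _ _ _
        ... | no  d≰n | yes d≤S = trans (*-congˡ (T-low (S ℕ.∸ d) (ℕ.+-cancelʳ-< n (S ℕ.∸ d) base
            (ℕ.<-≤-trans (ℕ.+-monoʳ-< (S ℕ.∸ d) (ℕ.≰⇒> d≰n)) (ℕ.≤-reflexive (ℕ.m∸n+n≡m d≤S))))))
          (solve 2 (λ c p → con (+ 1) :* con (+ 0) := c :* (con (+ 0) :* p)) refl _ _)

      -- `2 base + N = N²` turns the factor `2 S + N - N²` of `T-recursion` into `2 n`; the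
      -- normalisation `C` is common to all terms and cancels.
      double-sum : ∃ λ K → n ℕ.≤ K × (nat n * hookSum (- (m * m)) n ≈
        (1# - m * m) * ∑< K (λ k → ∑< K (λ r → nat (suc k) * P↓ n (suc r ℕ.* suc k))))
      double-sum = K , ℕ.≤-trans (ℕ.m≤n+m n base) (ℕ.n≤1+n S) , *-cancelˡ (*-≉0 (>⇒≉ (0<nat 1)) C≉0) (begin
        nat 2 * C * (nat n * P n)
          ≈⟨ solve 5 (λ c n p b k → con (+ 2) :* c :* (n :* p) := (con (+ 2) :* (b :+ n) :+ n) :* (c :* p) :- (con (+ 2) :* b :+ n) :* (c :* p)) refl C (nat n) (P n) (nat base) C ⟩
        (nat 2 * (nat base + nat n) + nat n) * (C * P n) - (nat 2 * nat base + nat n) * (C * P n)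
          ≈⟨ +-cong (*-cong (+-congʳ (*-congˡ (sym (nat-+ base n)))) (sym (T-value n ℕ.≤-refl)))
               (-‿cong (*-cong (trans (+-congʳ (sym (nat-* 2 base))) (trans (sym (nat-+ (2 ℕ.* base) n))
                 (trans (nat-cong (sum-beta-[] N)) (nat-* n n)))) (sym (T-value n ℕ.≤-refl)))) ⟩
        (nat 2 * nat S + nat N) * T S - nat N * nat N * T S
          ≈⟨ +-congʳ (T-recursion K S (ℕ.n<1+n S) ℕ.≤-refl) ⟨
        (nat 2 * ((1# - m * m) * D) + nat N * nat N * T S) - nat N * nat N * T S
          ≈⟨ solve 2 (λ x y → (x :+ y) :- y := x) refl _ _ ⟩
        nat 2 * ((1# - m * m) * D)
          ≈⟨ *-congˡ (*-congˡ (trans (∑<-cong K (λ k _ → trans (∑<-cong K (λ r _ → trans (*-congˡ (T↓-value (suc r ℕ.* suc k)))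
               (solve 3 (λ k c p → k :* (c :* p) := c :* (k :* p)) refl (nat (suc k)) C (P↓ n (suc r ℕ.* suc k))))) (∑<-* K C (λ r → nat (suc k) * P↓ n (suc r ℕ.* suc k))))) (∑<-* K C (λ k → ∑< K (λ r → nat (suc k) * P↓ n (suc r ℕ.* suc k)))))) ⟩
        nat 2 * ((1# - m * m) * (C * E))
          ≈⟨ solve 3 (λ c x e → con (+ 2) :* (x :* (c :* e)) := con (+ 2) :* c :* (x :* e)) refl C _ E ⟩
        nat 2 * C * ((1# - m * m) * E) ∎)
        where
        K = suc S
        D E : Carrier
        D = ∑< K (λ k → ∑< K (λ r → nat (suc k) * T↓ S (suc r ℕ.* suc k)))
        E = ∑< K (λ k → ∑< K (λ r → nat (suc k) * P↓ n (suc r ℕ.* suc k)))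

-- The reciprocal of Σ σ(n + 1) (-q)ⁿ

module DivisorSums where
  open import Data.Integer.Base as ℤ using (ℤ; +_; -[1+_]; _+_; _*_; -_; _-_)
  open ℤSolver.+-*-Solver using (solve; con; _:+_; _:*_; _:-_; :-_; _:=_)

  sumℕ : ℕ → (ℕ → ℕ) → ℕ
  sumℕ zero    f = 0
  sumℕ (suc n) f = f 0 ℕ.+ sumℕ n (λ i → f (suc i))

  pick : ∀ {p} {P : Set p} → Dec P → ℕ → ℕ
  pick (yes _) n = n
  pick (no _)  n = 0

  σ : ℕ → ℕ
  σ n = sumℕ n (λ k → pick (suc k ∣? n) (suc k))

  sumℕ-bound : ∀ n f b → (∀ i → i ℕ.< n → f i ℕ.≤ b) → sumℕ n f ℕ.≤ n ℕ.* b
  sumℕ-bound zero    f b h = z≤n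
  sumℕ-bound (suc n) f b h = ℕ.+-mono-≤ (h 0 (s≤s z≤n)) (sumℕ-bound n _ b (λ i i<n → h (suc i) (s≤s i<n)))

  σ≤square : ∀ n → σ n ℕ.≤ n ℕ.* n
  σ≤square n = sumℕ-bound n _ n bound
    where
    bound : ∀ i → i ℕ.< n → pick (suc i ∣? n) (suc i) ℕ.≤ n
    bound i i<n with suc i ∣? n
    ... | yes _ = i<n
    ... | no  _ = z≤n

  alternating : ℕ → ℤ
  alternating zero    = + 1
  alternating (suc i) = - alternating i

  signedσ : ℕ → ℤ
  signedσ i = alternating i * + σ (suc i)

  convolve : (ℕ → ℤ) → ℕ → List ℤ → ℤ
  convolve f i []       = + 0
  convolve f i (x ∷ xs) = f i * x + convolve f (suc i) xs

  -- inverses n lists t n, …, t 0, where Σ t n qⁿ is the reciprocal of Σ signedσ n qⁿ.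
  inverses : ℕ → List ℤ
  t : ℕ → ℤ
  inverses zero    = + 1 ∷ []
  inverses (suc n) = t (suc n) ∷ inverses n
  t zero    = + 1
  t (suc n) = - convolve signedσ 1 (inverses n)

  convolve-inverses : ∀ n → convolve signedσ 0 (inverses (suc n)) ≡ + 0
  convolve-inverses n = solve 1 (λ x → con (+ 1) :* (:- x) :+ x := con (+ 0)) ≡.refl (convolve signedσ 1 (inverses n))

  IsNat : ℤ → Set
  IsNat x = ∃ λ n → x ≡ + n

  isNat : ∀ n → IsNat (+ n)
  isNat n = n , ≡.refl

  nat-+ : ∀ {x y} → IsNat x → IsNat y → IsNat (x + y)
  nat-+ (m , ≡.refl) (n , ≡.refl) = m ℕ.+ n , ≡.refl

  nat-* : ∀ {x y} → IsNat x → IsNat y → IsNat (x * y)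
  nat-* (m , ≡.refl) (n , ≡.refl) = m ℕ.* n , ≡.sym (ℤ.pos-* m n)

  nat-by : ∀ {x y} → IsNat x → x ≡ y → IsNat y
  nat-by x ≡.refl = x

  nat-∸ : ∀ {m n} → m ℕ.≤ n → IsNat (+ n - + m)
  nat-∸ {m} {n} m≤n = n ℕ.∸ m , ≡.trans (ℤ.m-n≡m⊖n n m) (ℤ.⊖-≥ m≤n)

  squares : ℕ → List ℤ → ℤ
  squares i []       = + 0
  squares i (x ∷ xs) = (+ suc i * + suc i) * x + squares (suc i) xs

  -- ∣ f i ∣ ≤ k (i + 1)²
  record Dominated (k : ℕ) (f : ℕ → ℤ) : Set where
    constructor dominated
    field at : ∀ i → IsNat (+ k * (+ suc i * + suc i) - f i) × IsNat (+ k * (+ suc i * + suc i) + f i)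

  open Dominated

  signedσ-dominated : Dominated 1 signedσ
  signedσ-dominated = dominated (λ i → go i (σ (suc i)) _ (σ≤square (suc i)))
    where
    go : ∀ i n m → n ℕ.≤ m → IsNat (+ 1 * + m - alternating i * + n) × IsNat (+ 1 * + m + alternating i * + n)
    go zero    n m n≤m = nat-by (nat-∸ n≤m) (≡.cong₂ _-_ (≡.sym (ℤ.*-identityˡ (+ m))) (≡.sym (ℤ.*-identityˡ (+ n)))) ,
      nat-by (nat-+ (isNat m) (isNat n)) (≡.cong₂ _+_ (≡.sym (ℤ.*-identityˡ (+ m))) (≡.sym (ℤ.*-identityˡ (+ n))))
    go (suc i) n m n≤m with go i n m n≤m
    ... | p , q = nat-by q (solve 3 (λ m a n → m :+ a :* n := m :- (:- a) :* n) ≡.refl (+ 1 * + m) (alternating i) (+ n)) ,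
                  nat-by p (solve 3 (λ m a n → m :- a :* n := m :+ (:- a) :* n) ≡.refl (+ 1 * + m) (alternating i) (+ n))

  delay : (ℕ → ℤ) → ℕ → ℤ
  delay f zero    = + 0
  delay f (suc i) = f i

  delay-dominated : ∀ {k f} → Dominated k f → Dominated k (delay f)
  delay-dominated {k} {f} df = dominated go
    where
    go : ∀ i → IsNat (+ k * (+ suc i * + suc i) - delay f i) × IsNat (+ k * (+ suc i * + suc i) + delay f i)
    go zero = nat-by (nat-* (isNat k) (isNat 1)) (solve 1 (λ x → x := x :- con (+ 0)) ≡.refl (+ k * + 1)) ,
              nat-by (nat-* (isNat k) (isNat 1)) (solve 1 (λ x → x := x :+ con (+ 0)) ≡.refl (+ k * + 1))
    go (suc i) = nat-by (nat-+ (proj₁ (at df i)) extra) (solve 3 (λ k x f → (k :* (x :* x) :- f) :+ k :* (con (+ 2) :* x :+ con (+ 1)) :=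
                   k :* ((con (+ 1) :+ x) :* (con (+ 1) :+ x)) :- f) ≡.refl (+ k) (+ suc i) (f i)) ,
                 nat-by (nat-+ (proj₂ (at df i)) extra) (solve 3 (λ k x f → (k :* (x :* x) :+ f) :+ k :* (con (+ 2) :* x :+ con (+ 1)) :=
                   k :* ((con (+ 1) :+ x) :* (con (+ 1) :+ x)) :+ f) ≡.refl (+ k) (+ suc i) (f i))
      where
      extra : IsNat (+ k * (+ 2 * + suc i + + 1))
      extra = nat-* (isNat k) (nat-+ (nat-* (isNat 2) (isNat (suc i))) (isNat 1))

  +-dominated : ∀ {k l f g} → Dominated k f → Dominated l g → Dominated (k ℕ.+ l) (λ i → f i + g i)
  +-dominated {k} {l} {f} {g} df dg = dominated (λ i →
    nat-by (nat-+ (proj₁ (at df i)) (proj₁ (at dg i))) (solve 5 (λ k l b f g → (k :* b :- f) :+ (l :* b :- g) := (k :+ l) :* b :- (f :+ g)) ≡.refl (+ k) (+ l) (+ suc i * + suc i) (f i) (g i)) ,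
    nat-by (nat-+ (proj₂ (at df i)) (proj₂ (at dg i))) (solve 5 (λ k l b f g → (k :* b :+ f) :+ (l :* b :+ g) := (k :+ l) :* b :+ (f :+ g)) ≡.refl (+ k) (+ l) (+ suc i * + suc i) (f i) (g i)))

  neg-dominated : ∀ {k f} → Dominated k f → Dominated k (λ i → - f i)
  neg-dominated {k} {f} df = dominated (λ i →
    nat-by (proj₂ (at df i)) (solve 2 (λ b f → b :+ f := b :- (:- f)) ≡.refl (+ k * (+ suc i * + suc i)) (f i)) , proj₁ (at df i))

  data AllNat : List ℤ → Set where
    []  : AllNat []
    _∷_ : ∀ {x xs} → IsNat x → AllNat xs → AllNat (x ∷ xs)

  convolve-bound : ∀ {k f} → Dominated k f → ∀ i {xs} → AllNat xs → IsNat (+ k * squares i xs - convolve f i xs)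
  convolve-bound {k} df i [] = nat-by (nat-* (isNat k) (isNat 0)) (≡.sym (ℤ.+-identityʳ _))
  convolve-bound {k} {f} df i {x ∷ xs} (px ∷ ps) = nat-by (nat-+ (nat-* (proj₁ (at df i)) px) (convolve-bound df (suc i) ps))
    (solve 6 (λ k a b x c d → (k :* a :- b) :* x :+ (k :* c :- d) := k :* (a :* x :+ c) :- (b :* x :+ d)) ≡.refl
      (+ k) (+ suc i * + suc i) (f i) x (squares (suc i) xs) (convolve f (suc i) xs))

  convolve-+ : ∀ f g i xs → convolve (λ j → f j + g j) i xs ≡ convolve f i xs + convolve g i xs
  convolve-+ f g i []       = ≡.refl
  convolve-+ f g i (x ∷ xs) = ≡.trans (≡.cong (λ c → (f i + g i) * x + c) (convolve-+ f g (suc i) xs))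
    (solve 5 (λ f g x c d → (f :+ g) :* x :+ (c :+ d) := (f :* x :+ c) :+ (g :* x :+ d)) ≡.refl (f i) (g i) x _ _)

  convolve-neg : ∀ f i xs → convolve (λ j → - f j) i xs ≡ - convolve f i xs
  convolve-neg f i []       = ≡.refl
  convolve-neg f i (x ∷ xs) = ≡.trans (≡.cong (λ c → - f i * x + c) (convolve-neg f (suc i) xs))
    (solve 3 (λ f x c → (:- f) :* x :+ (:- c) := :- (f :* x :+ c)) ≡.refl (f i) x _)

  convolve-delay : ∀ f i xs → convolve (delay f) (suc i) xs ≡ convolve f i xs
  convolve-delay f i []       = ≡.refl
  convolve-delay f i (x ∷ xs) = ≡.cong (λ c → f i * x + c) (convolve-delay f (suc i) xs)

  convolve-delay₀ : ∀ f x xs → convolve (delay f) 0 (x ∷ xs) ≡ convolve f 0 xs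
  convolve-delay₀ f x xs = ≡.trans (ℤ.+-identityˡ _) (convolve-delay f 0 xs)

  -- Coefficients of (1 - q²) Σ signedσ n qⁿ and (1 + q)(1 - q²) Σ signedσ n qⁿ; the factors make the
  -- first twelve coefficients so small that the estimate of certificate succeeds.
  smoothed₁ smoothed : ℕ → ℤ
  smoothed₁ i = signedσ i + - delay (delay signedσ) i
  smoothed  i = smoothed₁ i + delay smoothed₁ i

  smoothed-dominated : Dominated 4 smoothed
  smoothed-dominated = +-dominated dom₁ (delay-dominated dom₁)
    where
    dom₁ : Dominated 2 smoothed₁
    dom₁ = +-dominated signedσ-dominated (neg-dominated (delay-dominated (delay-dominated signedσ-dominated)))

  -- For x = i + 1, c(x) = 2x² + 4x + 6 satisfies x² + c(x + 1)/2 = c(x), so it bounds Σ_j (x + j)² / 2ʲ.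
  tailBound : ℕ → ℤ
  tailBound i = + 2 * (+ suc i * + suc i) + + 4 * + suc i + + 6

  private
    -- Lets the coefficients `1, -2, 0, -1, …` of the smoothed series be checked one at a time by
    -- evaluation at a literal index, while the list stays symbolic.
    convolve-step : ∀ i c x xs {r} → smoothed i ≡ c → convolve smoothed (suc i) xs ≡ r → convolve smoothed i (x ∷ xs) ≡ c * x + r
    convolve-step i c x xs ≡.refl ≡.refl = ≡.refl

    leading : ∀ a1 a2 a3 a4 a5 a6 a7 a8 a9 a10 a11 a12 xs → convolve smoothed 0 (a12 ∷ a11 ∷ a10 ∷ a9 ∷ a8 ∷ a7 ∷ a6 ∷ a5 ∷ a4 ∷ a3 ∷ a2 ∷ a1 ∷ xs) ≡
      + 1 * a12 + (-[1+ 1 ] * a11 + (+ 0 * a10 + (-[1+ 0 ] * a9 + (-[1+ 1 ] * a8 + (-[1+ 2 ] * a7 + (-[1+ 2 ] * a6 + (-[1+ 0 ] * a5 + (+ 2 * a4 + (+ 2 * a3 + (-[1+ 3 ] * a2 + (-[1+ 10 ] * a1 + (convolve smoothed 12 xs))))))))))))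
    leading a1 a2 a3 a4 a5 a6 a7 a8 a9 a10 a11 a12 xs =
      (convolve-step 0 (+ 1) a12 (a11 ∷ a10 ∷ a9 ∷ a8 ∷ a7 ∷ a6 ∷ a5 ∷ a4 ∷ a3 ∷ a2 ∷ a1 ∷ xs) ≡.refl
      (convolve-step 1 (-[1+ 1 ]) a11 (a10 ∷ a9 ∷ a8 ∷ a7 ∷ a6 ∷ a5 ∷ a4 ∷ a3 ∷ a2 ∷ a1 ∷ xs) ≡.refl
      (convolve-step 2 (+ 0) a10 (a9 ∷ a8 ∷ a7 ∷ a6 ∷ a5 ∷ a4 ∷ a3 ∷ a2 ∷ a1 ∷ xs) ≡.refl
      (convolve-step 3 (-[1+ 0 ]) a9 (a8 ∷ a7 ∷ a6 ∷ a5 ∷ a4 ∷ a3 ∷ a2 ∷ a1 ∷ xs) ≡.refl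
      (convolve-step 4 (-[1+ 1 ]) a8 (a7 ∷ a6 ∷ a5 ∷ a4 ∷ a3 ∷ a2 ∷ a1 ∷ xs) ≡.refl
      (convolve-step 5 (-[1+ 2 ]) a7 (a6 ∷ a5 ∷ a4 ∷ a3 ∷ a2 ∷ a1 ∷ xs) ≡.refl
      (convolve-step 6 (-[1+ 2 ]) a6 (a5 ∷ a4 ∷ a3 ∷ a2 ∷ a1 ∷ xs) ≡.refl
      (convolve-step 7 (-[1+ 0 ]) a5 (a4 ∷ a3 ∷ a2 ∷ a1 ∷ xs) ≡.refl
      (convolve-step 8 (+ 2) a4 (a3 ∷ a2 ∷ a1 ∷ xs) ≡.refl
      (convolve-step 9 (+ 2) a3 (a2 ∷ a1 ∷ xs) ≡.refl
      (convolve-step 10 (-[1+ 3 ]) a2 (a1 ∷ xs) ≡.refl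
      (convolve-step 11 (-[1+ 10 ]) a1 (xs) ≡.refl
      ≡.refl))))))))))))

    isolate : ∀ a1 a2 a3 a4 a5 a6 a7 a8 a9 a10 a11 a12 c → _
    isolate = solve 13 (λ a1 a2 a3 a4 a5 a6 a7 a8 a9 a10 a11 a12 c →
      (a9 :+ con (+ 2) :* a8 :+ con (+ 3) :* a7 :+ con (+ 3) :* a6 :+ a5 :- con (+ 2) :* a4 :- con (+ 2) :* a3 :+ con (+ 4) :* a2 :+ con (+ 11) :* a1 :- c) :+
      (con (+ 1) :* a12 :+ (con (-[1+ 1 ]) :* a11 :+ (con (+ 0) :* a10 :+ (con (-[1+ 0 ]) :* a9 :+ (con (-[1+ 1 ]) :* a8 :+ (con (-[1+ 2 ]) :* a7 :+ (con (-[1+ 2 ]) :* a6 :+ (con (-[1+ 0 ]) :* a5 :+ (con (+ 2) :* a4 :+ (con (+ 2) :* a3 :+ (con (-[1+ 3 ]) :* a2 :+ (con (-[1+ 10 ]) :* a1 :+ (c)))))))))))))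
      := a12 :- con (+ 2) :* a11) ≡.refl

    -- `1584` is `4 * 396`, where `396 = tailBound 12` bounds the weighted tail and `4` comes from
    -- `smoothed-dominated`. Eliminating `a1` last leaves `- 1622` at `a0`, so the estimate succeeds
    -- with a margin of `38 * a0`.
    telescope : ∀ a0 a1 a2 a3 a4 a5 a6 a7 a8 a9 → _
    telescope = solve 10 (λ a0 a1 a2 a3 a4 a5 a6 a7 a8 a9 →
      con (+ 1) :* (a9 :- con (+ 2) :* a8) :+ con (+ 4) :* (a8 :- con (+ 2) :* a7) :+ con (+ 11) :* (a7 :- con (+ 2) :* a6) :+ con (+ 25) :* (a6 :- con (+ 2) :* a5) :+ con (+ 51) :* (a5 :- con (+ 2) :* a4) :+ con (+ 100) :* (a4 :- con (+ 2) :* a3) :+ con (+ 198) :* (a3 :- con (+ 2) :* a2) :+ con (+ 400) :* (a2 :- con (+ 2) :* a1) :+ con (+ 811) :* (a1 :- con (+ 2) :* a0) :+ con (+ 38) :* a0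
      := a9 :+ con (+ 2) :* a8 :+ con (+ 3) :* a7 :+ con (+ 3) :* a6 :+ a5 :- con (+ 2) :* a4 :- con (+ 2) :* a3 :+ con (+ 4) :* a2 :+ con (+ 11) :* a1
        :- con (+ 1584) :* a0) ≡.refl

    slack : ∀ x a s c → _
    slack = solve 4 (λ x a s c →
      (x :- con (+ 1584) :* a) :+ (con (+ 4) :* (con (+ 396) :* a :- s) :+ (con (+ 4) :* s :- c)) := x :- c) ≡.refl

    cancel : ∀ {x e y : ℤ} → x + e ≡ y → e ≡ + 0 → x ≡ y
    cancel {x} eq ≡.refl = ≡.trans (≡.sym (ℤ.+-identityʳ x)) eq

    -- The weights 1, 4, 11, …, 811 eliminate a 9, a 8, …, a 1 in turn in favour of the δ i.
    certificate : ∀ (a : ℕ → ℤ) xs S → (∀ i → i ℕ.≤ 8 → IsNat (a (suc i) - + 2 * a i)) → IsNat (a 0) →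
      IsNat (+ 396 * a 0 - S) → IsNat (+ 4 * S - convolve smoothed 12 xs) →
      convolve smoothed 0 (a 12 ∷ a 11 ∷ a 10 ∷ a 9 ∷ a 8 ∷ a 7 ∷ a 6 ∷ a 5 ∷ a 4 ∷ a 3 ∷ a 2 ∷ a 1 ∷ xs) ≡ + 0 →
      IsNat (a 12 - + 2 * a 11)
    certificate a xs S δ a₀ S-bound C-bound row = nat-by positive
      (cancel (isolate (a 1) (a 2) (a 3) (a 4) (a 5) (a 6) (a 7) (a 8) (a 9) (a 10) (a 11) (a 12) C)
        (≡.trans (≡.sym (leading (a 1) (a 2) (a 3) (a 4) (a 5) (a 6) (a 7) (a 8) (a 9) (a 10) (a 11) (a 12) xs)) row))
      where
      C X : ℤ
      C = convolve smoothed 12 xs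
      X = a 9 + + 2 * a 8 + + 3 * a 7 + + 3 * a 6 + a 5 - + 2 * a 4 - + 2 * a 3 + + 4 * a 2 + + 11 * a 1
      infixl 6 _⊞_
      infixl 7 _⊡_
      _⊞_ : ∀ {x y} → IsNat x → IsNat y → IsNat (x + y)
      _⊞_ = nat-+
      _⊡_ : ∀ k {x} → IsNat x → IsNat (+ k * x)
      k ⊡ p = nat-* (isNat k) p
      d : ∀ i → {_ : True (i ℕ.≤? 8)} → IsNat (a (suc i) - + 2 * a i)
      d i {i≤} = δ i (toWitness i≤)
      positive : IsNat (X - C)
      positive = nat-by
        (nat-by (1 ⊡ d 8 ⊞ 4 ⊡ d 7 ⊞ 11 ⊡ d 6 ⊞ 25 ⊡ d 5 ⊞ 51 ⊡ d 4 ⊞ 100 ⊡ d 3 ⊞ 198 ⊡ d 2 ⊞ 400 ⊡ d 1 ⊞ 811 ⊡ d 0 ⊞ 38 ⊡ a₀)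
          (telescope (a 0) (a 1) (a 2) (a 3) (a 4) (a 5) (a 6) (a 7) (a 8) (a 9))
         ⊞ (4 ⊡ S-bound ⊞ C-bound))
        (slack X (a 0) S C)

  history : (ℕ → ℤ) → ℕ → List ℤ
  history a zero    = a 0 ∷ []
  history a (suc n) = a (suc n) ∷ history a n

  -- Working with a variable a instead of t keeps t from being unfolded.
  module Growth (a : ℕ → ℤ) (a₀ : a 0 ≡ + 1) (a₁ : a 1 ≡ + 3) (a₂ : a 2 ≡ + 5)
                (small : ∀ k → 3 ℕ.≤ k → k ℕ.≤ 13 → IsNat (a k - + 2 * a (ℕ.pred k)))
                (recursion : ∀ n → convolve signedσ 0 (history a (suc n)) ≡ + 0) where

    convolve-smoothed₁ : ∀ n → convolve smoothed₁ 0 (history a (3 ℕ.+ n)) ≡ + 0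
    convolve-smoothed₁ n = ≡.trans (convolve-+ signedσ (λ i → - delay (delay signedσ) i) 0 (history a (3 ℕ.+ n)))
      (≡.cong₂ _+_ (recursion (2 ℕ.+ n)) (≡.trans (convolve-neg (delay (delay signedσ)) 0 (history a (3 ℕ.+ n)))
        (≡.cong -_ (≡.trans (convolve-delay₀ (delay signedσ) (a (3 ℕ.+ n)) (history a (2 ℕ.+ n)))
          (≡.trans (convolve-delay₀ signedσ (a (2 ℕ.+ n)) (history a (1 ℕ.+ n))) (recursion n))))))

    convolve-smoothed : ∀ n → convolve smoothed 0 (history a (4 ℕ.+ n)) ≡ + 0
    convolve-smoothed n = ≡.trans (convolve-+ smoothed₁ (delay smoothed₁) 0 (history a (4 ℕ.+ n)))
      (≡.cong₂ _+_ (convolve-smoothed₁ (1 ℕ.+ n)) (≡.trans (convolve-delay₀ smoothed₁ (a (4 ℕ.+ n)) (history a (3 ℕ.+ n))) (convolve-smoothed₁ n)))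

    Doubling : ℕ → Set
    Doubling n = ∀ k → 3 ℕ.≤ k → k ℕ.≤ n → IsNat (a k - + 2 * a (ℕ.pred k))

    doubling⇒nat : ∀ n → Doubling n → IsNat (a n)
    doubling⇒nat 0 d = 1 , a₀
    doubling⇒nat 1 d = 3 , a₁
    doubling⇒nat 2 d = 5 , a₂
    doubling⇒nat (suc n@(suc (suc _))) d =
      nat-by (nat-+ (d (suc n) (s≤s (s≤s (s≤s z≤n))) ℕ.≤-refl) (nat-* (isNat 2) (doubling⇒nat n (λ k 3≤k k≤n → d k 3≤k (ℕ.m≤n⇒m≤1+n k≤n)))))
        (solve 2 (λ a b → (a :- con (+ 2) :* b) :+ con (+ 2) :* b := a) ≡.refl (a (suc n)) (a n))

    doubling-pred : ∀ {n} → Doubling (suc n) → Doubling n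
    doubling-pred d k 3≤k k≤n = d k 3≤k (ℕ.m≤n⇒m≤1+n k≤n)

    allNat : ∀ n → Doubling n → AllNat (history a n)
    allNat zero    d = (1 , a₀) ∷ []
    allNat (suc n) d = doubling⇒nat (suc n) d ∷ allNat n (doubling-pred d)

    -- Since the entries at least halve from each index to the preceding one down to index 2, the
    -- identity of `tailBound` carries the induction. Doubling fails at index 2, where `5 < 2 * 3`,
    -- so the lists ending there are bounded explicitly.
    squares-bound : ∀ i n → Doubling n → IsNat (tailBound i * a n - squares i (history a n))
    squares-bound i 0 d rewrite a₀ = nat-by {+ suc i * + suc i + + 4 * + suc i + + 6} (_ , ≡.refl)
      (solve 1 (λ x → x :* x :+ con (+ 4) :* x :+ con (+ 6) :=
         (con (+ 2) :* (x :* x) :+ con (+ 4) :* x :+ con (+ 6)) :* con (+ 1) :- ((x :* x) :* con (+ 1) :+ con (+ 0))) ≡.refl (+ suc i))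
    squares-bound i 1 d rewrite a₀ | a₁ = nat-by {+ 2 * (+ suc i * + suc i) + + 10 * + suc i + + 17} (_ , ≡.refl)
      (solve 1 (λ x → con (+ 2) :* (x :* x) :+ con (+ 10) :* x :+ con (+ 17) :=
         (con (+ 2) :* (x :* x) :+ con (+ 4) :* x :+ con (+ 6)) :* con (+ 3) :-
           ((x :* x) :* con (+ 3) :+ (((con (+ 1) :+ x) :* (con (+ 1) :+ x)) :* con (+ 1) :+ con (+ 0)))) ≡.refl (+ suc i))
    squares-bound i 2 d rewrite a₀ | a₁ | a₂ = nat-by {+ suc i * + suc i + + 10 * + suc i + + 23} (_ , ≡.refl)
      (solve 1 (λ x → x :* x :+ con (+ 10) :* x :+ con (+ 23) :=
         (con (+ 2) :* (x :* x) :+ con (+ 4) :* x :+ con (+ 6)) :* con (+ 5) :-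
           ((x :* x) :* con (+ 5) :+ (((con (+ 1) :+ x) :* (con (+ 1) :+ x)) :* con (+ 3) :+
             (((con (+ 2) :+ x) :* (con (+ 2) :+ x)) :* con (+ 1) :+ con (+ 0))))) ≡.refl (+ suc i))
    squares-bound i (suc n@(suc (suc _))) d = nat-by
      (nat-+ (nat-* {+ suc i * + suc i + + 4 * + suc i + + 6} (_ , ≡.refl) (d (suc n) (s≤s (s≤s (s≤s z≤n))) ℕ.≤-refl))
             (squares-bound (suc i) n (doubling-pred d)))
      (solve 4 (λ x a b s →
         (x :* x :+ con (+ 4) :* x :+ con (+ 6)) :* (a :- con (+ 2) :* b) :+
           ((con (+ 2) :* ((con (+ 1) :+ x) :* (con (+ 1) :+ x)) :+ con (+ 4) :* (con (+ 1) :+ x) :+ con (+ 6)) :* b :- s) :=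
         (con (+ 2) :* (x :* x) :+ con (+ 4) :* x :+ con (+ 6)) :* a :- ((x :* x) :* a :+ s)) ≡.refl (+ suc i) (a (suc n)) (a n) (squares (suc i) (history a n)))

    -- The estimate uses doubling at the indices `n + 1, …, n + 9`, and doubling begins at 3; hence
    -- `2 ≤ n`, and hence `small` has to reach up to 13.
    doubling-step : ∀ n → 2 ℕ.≤ n → Doubling (11 ℕ.+ n) → IsNat (a (12 ℕ.+ n) - + 2 * a (11 ℕ.+ n))
    doubling-step n 2≤n d = certificate (λ i → a (i ℕ.+ n)) (history a n) (squares 12 (history a n)) δ (doubling⇒nat n dₙ)
      (squares-bound 12 n dₙ) (convolve-bound smoothed-dominated 12 (allNat n dₙ)) (convolve-smoothed (8 ℕ.+ n))
      where
      dₙ : Doubling n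
      dₙ k 3≤k k≤ = d k 3≤k (ℕ.≤-trans k≤ (ℕ.m≤n+m n 11))
      δ : ∀ i → i ℕ.≤ 8 → IsNat (a (suc i ℕ.+ n) - + 2 * a (i ℕ.+ n))
      δ i i≤ = d (suc i ℕ.+ n) (s≤s (ℕ.≤-trans 2≤n (ℕ.m≤n+m n i))) (ℕ.+-monoˡ-≤ n (ℕ.≤-trans (s≤s i≤) (ℕ.m≤n+m 9 2)))

    doubling : ∀ n → Doubling n
    doubling zero    k 3≤k k≤n = contradiction (ℕ.≤-trans 3≤k k≤n) λ ()
    doubling (suc n) k 3≤k k≤n with k ℕ.≤? n | k ℕ.≤? 13
    ... | yes k≤n′ | _        = doubling n k 3≤k k≤n′
    ... | no  k≰n  | yes k≤13 = small k 3≤k k≤13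
    ... | no  k≰n  | no  k≰13 = ≡.subst (λ k → IsNat (a k - + 2 * a (ℕ.pred k))) 12+k≡k
      (doubling-step (k ℕ.∸ 12) (ℕ.m+n≤o⇒m≤o∸n 2 (ℕ.≰⇒> k≰13)) (≡.subst Doubling (ℕ.suc-injective (≡.trans (≡.sym k≡) (≡.sym 12+k≡k))) (doubling n)))
      where
      k≡ : k ≡ suc n
      k≡ = ℕ.≤-antisym k≤n (ℕ.≰⇒> k≰n)
      12+k≡k : 12 ℕ.+ (k ℕ.∸ 12) ≡ k
      12+k≡k = ℕ.m+[n∸m]≡n (ℕ.≤-trans (ℕ.m≤n+m 12 2) (ℕ.≰⇒> k≰13))

  private
    history-inverses : ∀ n → history t n ≡ inverses n
    history-inverses zero    = ≡.refl
    history-inverses (suc n) = ≡.cong (t (suc n) ∷_) (history-inverses n)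

    doubling-small : ∀ k → 3 ℕ.≤ k → k ℕ.≤ 13 → IsNat (t k - + 2 * t (ℕ.pred k))
    doubling-small 3  _ _ = _ , ≡.refl
    doubling-small 4  _ _ = _ , ≡.refl
    doubling-small 5  _ _ = _ , ≡.refl
    doubling-small 6  _ _ = _ , ≡.refl
    doubling-small 7  _ _ = _ , ≡.refl
    doubling-small 8  _ _ = _ , ≡.refl
    doubling-small 9  _ _ = _ , ≡.refl
    doubling-small 10 _ _ = _ , ≡.refl
    doubling-small 11 _ _ = _ , ≡.refl
    doubling-small 12 _ _ = _ , ≡.refl
    doubling-small 13 _ _ = _ , ≡.refl
    doubling-small 1 (s≤s ()) _
    doubling-small 2 (s≤s (s≤s ())) _
    doubling-small (suc (suc (suc (suc (suc (suc (suc (suc (suc (suc (suc (suc (suc (suc k)))))))))))))) _ k≤ =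
      contradiction (ℕ.m≤m+n 14 k) (ℕ.<⇒≱ (s≤s k≤))

  t-isNat : ∀ n → IsNat (t n)
  t-isNat n = doubling⇒nat n (doubling n)
    where open Growth t ≡.refl ≡.refl ≡.refl doubling-small
            (λ n → ≡.trans (≡.cong (convolve signedσ 0) (history-inverses (suc n))) (convolve-inverses n))

open DivisorSums using (sumℕ; pick; σ; alternating; signedσ; convolve; inverses; t; convolve-inverses; t-isNat)

-- Polynomial identities

record RingHom {c₁ ℓ₁ c₂ ℓ₂} (R : CommutativeRing c₁ ℓ₁) (A : CommutativeRing c₂ ℓ₂) : Set (c₁ ⊔ ℓ₁ ⊔ c₂ ⊔ ℓ₂) where
  private
    module R = CommutativeRing R
    module A = CommutativeRing A
  field
    ι      : R.Carrier → A.Carrier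
    ι-cong : ∀ {x y} → x R.≈ y → ι x A.≈ ι y
    ι-+    : ∀ x y → ι (x R.+ y) A.≈ ι x A.+ ι y
    ι-*    : ∀ x y → ι (x R.* y) A.≈ ι x A.* ι y
    ι-0    : ι R.0# A.≈ A.0#
    ι-1    : ι R.1# A.≈ A.1#

idHom : ∀ {c ℓ} (R : CommutativeRing c ℓ) → RingHom R R
idHom R = record { ι = id ; ι-cong = id ; ι-+ = λ _ _ → refl ; ι-* = λ _ _ → refl ; ι-0 = refl ; ι-1 = refl }
  where open CommutativeRing R

-- Values lie in an arbitrary algebra `A`, so that real, complex and dual numbers receive the same
-- identities from one proof about coefficients.
module Evaluation {c₁ ℓ₁ c₂ ℓ₂} {R : CommutativeRing c₁ ℓ₁} {A : CommutativeRing c₂ ℓ₂} (hom : RingHom R A) where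
  private
    module R = CommutativeRing R
  open CommutativeRing A hiding (zero)
  open IntegerSolver A
  open RingHom hom
  open Polynomials R.rawRing using (Poly; _⊕_; _·_; _⊗_; ∑; ∏; coeff; _≋_)
  open PartitionSums A using (sumOver)
  open SetoidReasoning setoid

  evalAt : Poly → Carrier → Carrier
  evalAt []      x = 0#
  evalAt (a ∷ p) x = ι a + x * evalAt p x

  evalAt-cong : ∀ p {x y} → x ≈ y → evalAt p x ≈ evalAt p y
  evalAt-cong []      eq = refl
  evalAt-cong (a ∷ p) eq = +-congˡ (*-cong eq (evalAt-cong p eq))

  evalAt-⊕ : ∀ p q x → evalAt (p ⊕ q) x ≈ evalAt p x + evalAt q x
  evalAt-⊕ []      q       x = sym (+-identityˡ _)
  evalAt-⊕ (a ∷ p) []      x = sym (+-identityʳ _)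
  evalAt-⊕ (a ∷ p) (b ∷ q) x = trans (+-cong (ι-+ a b) (*-congˡ (evalAt-⊕ p q x)))
    (solve 5 (λ a b x p q → a :+ b :+ x :* (p :+ q) := (a :+ x :* p) :+ (b :+ x :* q)) refl _ _ _ _ _)

  evalAt-· : ∀ a p x → evalAt (a · p) x ≈ ι a * evalAt p x
  evalAt-· a []      x = sym (zeroʳ _)
  evalAt-· a (b ∷ p) x = trans (+-cong (ι-* a b) (*-congˡ (evalAt-· a p x)))
    (solve 4 (λ a b x p → a :* b :+ x :* (a :* p) := a :* (b :+ x :* p)) refl _ _ _ _)

  evalAt-⊗ : ∀ p q x → evalAt (p ⊗ q) x ≈ evalAt p x * evalAt q x
  evalAt-⊗ []      q x = sym (zeroˡ _)
  evalAt-⊗ (a ∷ p) q x = begin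
    evalAt (a · q ⊕ (R.0# ∷ p ⊗ q)) x            ≈⟨ evalAt-⊕ (a · q) (R.0# ∷ p ⊗ q) x ⟩
    evalAt (a · q) x + (ι R.0# + x * evalAt (p ⊗ q) x)
      ≈⟨ +-cong (evalAt-· a q x) (+-cong ι-0 (*-congˡ (evalAt-⊗ p q x))) ⟩
    ι a * evalAt q x + (0# + x * (evalAt p x * evalAt q x))
      ≈⟨ solve 4 (λ a x p q → a :* q :+ (con (+ 0) :+ x :* (p :* q)) := (a :+ x :* p) :* q) refl _ _ _ _ ⟩
    (ι a + x * evalAt p x) * evalAt q x          ∎

  evalAt-∑ : ∀ {a} {B : Set a} (f : B → Poly) (xs : List B) x → evalAt (∑ (map f xs)) x ≈ sumOver xs (λ y → evalAt (f y) x)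
  evalAt-∑ f []       x = refl
  evalAt-∑ f (y ∷ ys) x = trans (evalAt-⊕ (f y) _ x) (+-congˡ (evalAt-∑ f ys x))

  open HookProducts A using (prodOver)

  prodOver-cong : ∀ xs {f g} → (∀ x → f x ≈ g x) → prodOver xs f ≈ prodOver xs g
  prodOver-cong []       eq = refl
  prodOver-cong (x ∷ xs) eq = *-cong (eq x) (prodOver-cong xs eq)

  evalAt-∏ : ∀ (f : ℕ → Poly) xs x → evalAt (∏ (map f xs)) x ≈ prodOver xs (λ y → evalAt (f y) x)
  evalAt-∏ f []       x = trans (+-cong ι-1 (zeroʳ x)) (+-identityʳ 1#)
  evalAt-∏ f (y ∷ ys) x = trans (evalAt-⊗ (f y) _ x) (*-congˡ (evalAt-∏ f ys x))

  evalAt-0 : ∀ p x → All (R._≈ R.0#) p → evalAt p x ≈ 0#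
  evalAt-0 []      x []         = refl
  evalAt-0 (a ∷ p) x (a≈0 ∷ p≈0) = trans (+-cong (trans (ι-cong a≈0) ι-0) (trans (*-congˡ (evalAt-0 p x p≈0)) (zeroʳ x))) (+-identityˡ 0#)

  evalAt-≋ : ∀ p q x → p ≋ q → evalAt p x ≈ evalAt q x
  evalAt-≋ []      q x eq = sym (evalAt-0 q x (zeros q eq))
    where
    zeros : ∀ q → [] ≋ q → All (R._≈ R.0#) q
    zeros []      eq = []
    zeros (b ∷ q) eq = R.sym (eq 0) ∷ zeros q (eq ∘ suc)
  evalAt-≋ (a ∷ p) []      x eq = evalAt-0 (a ∷ p) x (zeros (a ∷ p) eq)
    where
    zeros : ∀ q → q ≋ [] → All (R._≈ R.0#) q
    zeros []      eq = []
    zeros (b ∷ q) eq = eq 0 ∷ zeros q (eq ∘ suc)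
  evalAt-≋ (a ∷ p) (b ∷ q) x eq = +-cong (ι-cong (eq 0)) (*-congˡ (evalAt-≋ p q x (eq ∘ suc)))

  ι-nat : ∀ n → ι (IntegerSolver.nat R n) ≈ nat n
  ι-nat zero    = ι-0
  ι-nat (suc n) = trans (ι-+ _ _) (+-cong ι-1 (ι-nat n))

-- Synthetic division by X - α, dropping the constant term of the dividend.
module Division {c ℓ} (R : CommutativeRing c ℓ) where
  open CommutativeRing R hiding (zero)
  open IntegerSolver R
  open Polynomials rawRing using (Poly; eval; coeff)
  open SetoidReasoning setoid

  eval≡evalAt : ∀ p x → eval p x ≡ Evaluation.evalAt (idHom R) p x
  eval≡evalAt []      x = ≡.refl
  eval≡evalAt (a ∷ p) x = ≡.cong (λ e → a + x * e) (eval≡evalAt p x)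

  eval-0 : ∀ p x → All (_≈ 0#) p → eval p x ≈ 0#
  eval-0 p x p≈0 = trans (reflexive (eval≡evalAt p x)) (Evaluation.evalAt-0 (idHom R) p x p≈0)

  quotient : Poly → Carrier → Poly
  quotient []      α = []
  quotient (b ∷ p) α = eval (b ∷ p) α ∷ quotient p α

  quotient-eval : ∀ a p α x → eval (a ∷ p) x ≈ eval (a ∷ p) α + (x - α) * eval (quotient p α) x
  quotient-eval a []      α x = solve 3 (λ a x α → a :+ x :* con (+ 0) := a :+ α :* con (+ 0) :+ (x :- α) :* con (+ 0)) refl a x α
  quotient-eval a (b ∷ p) α x = begin
    a + x * eval (b ∷ p) x
      ≈⟨ +-congˡ (*-congˡ (quotient-eval b p α x)) ⟩
    a + x * (e + (x - α) * q)
      ≈⟨ solve 5 (λ a x α e q → a :+ x :* (e :+ (x :- α) :* q) := (a :+ α :* e) :+ (x :- α) :* (e :+ x :* q)) refl a x α e q ⟩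
    (a + α * e) + (x - α) * (e + x * q) ∎
    where
    e = eval (b ∷ p) α
    q = eval (quotient p α) x

  quotient-coeff : ∀ p α k → coeff p k ≈ coeff (quotient p α) k - α * coeff (quotient p α) (suc k)
  quotient-coeff []      α k = solve 1 (λ α → con (+ 0) := con (+ 0) :- α :* con (+ 0)) refl α
  quotient-coeff (b ∷ p) α (suc k) = quotient-coeff p α k
  quotient-coeff (b ∷ []) α zero = solve 2 (λ b α → b := (b :+ α :* con (+ 0)) :- α :* con (+ 0)) refl b α
  quotient-coeff (b ∷ d ∷ p) α zero = solve 3 (λ b α e → b := (b :+ α :* e) :- α :* e) refl b α _

  length-quotient : ∀ p α → length (quotient p α) ≡ length p
  length-quotient []      α = ≡.refl
  length-quotient (b ∷ p) α = ≡.cong suc (length-quotient p α)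

  quotient-0 : ∀ p α → All (_≈ 0#) (quotient p α) → All (_≈ 0#) p
  quotient-0 []      α _          = []
  quotient-0 (b ∷ p) α (e≈0 ∷ q≈0) = trans (sym (trans (+-congˡ (trans (*-congˡ (eval-0 p α zeros)) (zeroʳ α))) (+-identityʳ b))) e≈0 ∷ zeros
    where zeros = quotient-0 p α q≈0

module Identity {c ℓ₁ ℓ₂} (F : CompleteOrderedField c ℓ₁ ℓ₂) where
  open CompleteOrderedField F hiding (zero)
  open IntegerSolver commutativeRing
  open OrderedField F
  open Sums commutativeRing
  open Vertex F using (NonInteger)
  open HookFormula F using (hookSum; hookTerm; module Evaluate)
  open Polynomials rawRing using (Poly; eval; _⊕_; _·_; _⊗_) renaming (∑ to ∑ᵖ; ∏ to ∏ᵖ)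
  open Division commutativeRing
  open SetoidReasoning setoid

  -- At the points other than `x 0` the factor `x i - x 0` cancels, so they are roots of the
  -- quotient, which has one coefficient fewer.
  many-roots : ∀ n p → length p ≡ n → (x : ℕ → Carrier) → (∀ {i j} → i ≢ j → x i ≉ x j) →
               (∀ i → eval p (x i) ≈ 0#) → All (_≈ 0#) p
  many-roots zero    []      _   x distinct root = []
  many-roots (suc n) (a ∷ p) len x distinct root =
    trans (sym (trans (+-congˡ (trans (*-congˡ (eval-0 p (x 0) tail-0)) (zeroʳ _))) (+-identityʳ a))) (root 0) ∷ tail-0
    where
    tail-0 : All (_≈ 0#) p
    tail-0 = quotient-0 p (x 0) (many-roots n (quotient p (x 0)) (≡.trans (length-quotient p (x 0)) (ℕ.suc-injective len))
      (x ∘ suc) (λ i≢j → distinct (i≢j ∘ ℕ.suc-injective)) (λ i → *-zero-cancel (-‿≉0 (distinct {suc i} {0} λ ())) (begin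
        (x (suc i) - x 0) * eval (quotient p (x 0)) (x (suc i))
          ≈⟨ solve 2 (λ e q → q := (e :+ q) :- e) refl (eval (a ∷ p) (x 0)) _ ⟩
        eval (a ∷ p) (x 0) + (x (suc i) - x 0) * eval (quotient p (x 0)) (x (suc i)) - eval (a ∷ p) (x 0)
          ≈⟨ +-cong (trans (sym (quotient-eval a p (x 0) (x (suc i)))) (root (suc i))) (-‿cong (root 0)) ⟩
        0# - 0# ≈⟨ -‿inverseʳ 0# ⟩
        0# ∎)))

  private
    σ-fibre : ∀ K k j → j ℕ.< K → ∑< K (λ r → ⟦ suc r ℕ.* suc k ℕ.≟ suc j ⟧) ≈ ⟦ suc k ∣? suc j ⟧
    σ-fibre K k j j<K with suc k ∣? suc j
    ... | no  k∤j = ∑<-zero K (λ r _ → ⟦⟧-no (suc r ℕ.* suc k ℕ.≟ suc j) (λ eq → k∤j (divides (suc r) (≡.sym eq))))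
    ... | yes (divides (suc q) eq) = trans
      (∑<-single K q q<K (λ r r≢q → ⟦⟧-no (suc r ℕ.* suc k ℕ.≟ suc j) (λ eq′ →
        r≢q (ℕ.suc-injective (ℕ.*-cancelʳ-≡ (suc r) (suc q) (suc k) (≡.trans eq′ eq))))))
      (⟦⟧-yes (suc q ℕ.* suc k ℕ.≟ suc j) (≡.sym eq))
      where
      q<K : q ℕ.< K
      q<K = ℕ.≤-trans (ℕ.m≤m*n (suc q) (suc k)) (ℕ.≤-trans (ℕ.≤-reflexive (≡.sym eq)) j<K)

    nat-sum : ∀ n f → nat (sumℕ n f) ≈ ∑< n (nat ∘ f)
    nat-sum zero    f = refl
    nat-sum (suc n) f = trans (nat-+ (f 0) _) (+-congˡ (nat-sum n _))

    nat-pick : ∀ {p} {P : Set p} (d : Dec P) n → nat (pick d n) ≈ ⟦ d ⟧ * nat n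
    nat-pick (yes _) n = sym (*-identityˡ _)
    nat-pick (no _)  n = sym (zeroˡ _)

    σ-sum : ∀ K j → j ℕ.< K → ∑< K (λ k → ⟦ suc k ∣? suc j ⟧ * nat (suc k)) ≈ nat (σ (suc j))
    σ-sum K j j<K = begin
      ∑< K (λ k → ⟦ suc k ∣? suc j ⟧ * nat (suc k))
        ≈⟨ ∑<-extend j<K (λ k j<k _ → trans (*-congʳ (⟦⟧-no (suc k ∣? suc j) (λ k∣j → ℕ.<⇒≱ (s≤s j<k) (∣⇒≤ k∣j)))) (zeroˡ _)) ⟩
      ∑< (suc j) (λ k → ⟦ suc k ∣? suc j ⟧ * nat (suc k))
        ≈⟨ ∑<-cong (suc j) (λ k _ → nat-pick (suc k ∣? suc j) (suc k)) ⟨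
      ∑< (suc j) (λ k → nat (pick (suc k ∣? suc j) (suc k)))
        ≈⟨ nat-sum (suc j) (λ k → pick (suc k ∣? suc j) (suc k)) ⟨
      nat (σ (suc j)) ∎

    -- Sort the pairs of `k` and `r` by their product: those with product `j` correspond to the
    -- divisors `k` of `j`, and their weights add up to `σ j`.
    collect : ∀ K n (f : ℕ → Carrier) → n ℕ.≤ K → (∀ d → n ℕ.< d → f d ≈ 0#) →
              ∑< K (λ k → ∑< K (λ r → nat (suc k) * f (suc r ℕ.* suc k))) ≈ ∑< n (λ j → nat (σ (suc j)) * f (suc j))
    collect K n f n≤K vanish = begin
      ∑< K (λ k → ∑< K (λ r → nat (suc k) * f (suc r ℕ.* suc k)))
        ≈⟨ ∑<-cong K (λ k _ → trans (∑<-cong K (λ r _ → trans (*-congˡ (spread (r ℕ.* suc k ℕ.+ k) (suc r ℕ.* suc k) (≡.cong suc (ℕ.+-comm k _)))) (sym (∑<-* n _ _)))) (∑<-swap K n _)) ⟩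
      ∑< K (λ k → ∑< n (λ j → ∑< K (λ r → nat (suc k) * (⟦ suc r ℕ.* suc k ℕ.≟ suc j ⟧ * f (suc j)))))
        ≈⟨ ∑<-cong K (λ k _ → ∑<-cong n (λ j j<n → trans (∑<-cong K (λ r _ →
             solve 3 (λ k b f → k :* (b :* f) := (f :* k) :* b) refl (nat (suc k)) ⟦ suc r ℕ.* suc k ℕ.≟ suc j ⟧ (f (suc j))))
             (trans (∑<-* K _ _) (*-congˡ (σ-fibre K k j (ℕ.<-≤-trans j<n n≤K)))))) ⟩
      ∑< K (λ k → ∑< n (λ j → f (suc j) * nat (suc k) * ⟦ suc k ∣? suc j ⟧))
        ≈⟨ ∑<-swap K n _ ⟩
      ∑< n (λ j → ∑< K (λ k → f (suc j) * nat (suc k) * ⟦ suc k ∣? suc j ⟧))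
        ≈⟨ ∑<-cong n (λ j j<n → trans (∑<-cong K (λ k _ → solve 3 (λ f k b → f :* k :* b := f :* (b :* k)) refl (f (suc j)) (nat (suc k)) ⟦ suc k ∣? suc j ⟧))
             (trans (∑<-* K _ _) (trans (*-comm _ _) (*-congʳ (σ-sum K j (ℕ.<-≤-trans j<n n≤K)))))) ⟩
      ∑< n (λ j → nat (σ (suc j)) * f (suc j)) ∎
      where
      spread : ∀ e d → d ≡ suc e → f d ≈ ∑< n (λ j → ⟦ d ℕ.≟ suc j ⟧ * f (suc j))
      spread e _ ≡.refl with e ℕ.<? n
      ... | yes e<n = sym (trans (∑<-single n e e<n (λ j j≢e → trans (*-congʳ (⟦⟧-no (suc e ℕ.≟ suc j) (λ eq → j≢e (≡.sym (ℕ.suc-injective eq))))) (zeroˡ _)))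
                        (trans (*-congʳ (⟦⟧-yes (suc e ℕ.≟ suc e) ≡.refl)) (*-identityˡ _)))
      ... | no  e≮n = trans (vanish (suc e) (s≤s (ℕ.≮⇒≥ e≮n))) (sym (∑<-zero n (λ j j<n →
                        trans (*-congʳ (⟦⟧-no (suc e ℕ.≟ suc j) (λ eq → e≮n (≡.subst (ℕ._< n) (≡.sym (ℕ.suc-injective eq)) j<n)))) (zeroˡ _))))

  hookSum-recursion : ∀ {m} → NonInteger m → ∀ n →
    nat n * hookSum (- (m * m)) n ≈ (1# - m * m) * ∑< n (λ j → nat (σ (suc j)) * hookSum (- (m * m)) (n ℕ.∸ suc j))
  hookSum-recursion {m} ni n = trans (proj₂ (proj₂ double-sum)) (*-congˡ (trans
    (collect (proj₁ double-sum) n (P↓ n) (proj₁ (proj₂ double-sum)) (λ d n<d → trans (*-congʳ (⟦⟧-no (d ℕ.≤? n) (ℕ.<⇒≱ n<d))) (zeroˡ _)))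
    (∑<-cong n (λ j j<n → *-congˡ (trans (*-congʳ (⟦⟧-yes (suc j ℕ.≤? n) j<n)) (*-identityˡ _))))))
    where open Evaluate ni n using (P↓; double-sum)

  hookPoly : ℕ → Poly
  hookPoly h = 1# ∷ (nat h * nat h) ⁻¹ ∷ []

  hookSumPoly : ℕ → Poly
  hookSumPoly n = ∑ᵖ (map (λ μ → ∏ᵖ (map hookPoly (hookLengths μ))) (partitions n))

  -- A supply of non-integral `m` whose squares are pairwise distinct, which is enough to determine
  -- a polynomial in `z = - m²`.
  halfOdd : ℕ → Carrier
  halfOdd i = nat (suc (2 ℕ.* i)) * nat 2 ⁻¹

  2≉0 : nat 2 ≉ 0#
  2≉0 = >⇒≉ (0<nat 1)

  double-halfOdd : ∀ i → nat 2 * halfOdd i ≈ nat (suc (2 ℕ.* i))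
  double-halfOdd i = trans (solve 3 (λ x t u → t :* (x :* u) := (t :* x) :* u) refl _ (nat 2) _) (inv-cancel 2≉0 _)

  halfOdd-nonInteger : ∀ i → NonInteger (halfOdd i)
  halfOdd-nonInteger i a b eq = odd≢even (i ℕ.+ a) b (nat-injective (begin
    nat (suc (2 ℕ.* (i ℕ.+ a)))
      ≈⟨ nat-cong (≡.cong suc (ℕ.*-distribˡ-+ 2 i a)) ⟩
    nat (suc (2 ℕ.* i) ℕ.+ 2 ℕ.* a)
      ≈⟨ trans (nat-+ (suc (2 ℕ.* i)) (2 ℕ.* a)) (+-cong (sym (double-halfOdd i)) (nat-* 2 a)) ⟩
    nat 2 * halfOdd i + nat 2 * nat a
      ≈⟨ solve 4 (λ t h a b → t :* h :+ t :* a := t :* (h :+ a :- b) :+ t :* b) refl (nat 2) (halfOdd i) (nat a) (nat b) ⟩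
    nat 2 * (halfOdd i + nat a - nat b) + nat 2 * nat b
      ≈⟨ trans (+-congʳ (trans (*-congˡ eq) (zeroʳ _))) (+-identityˡ _) ⟩
    nat 2 * nat b ≈⟨ nat-* 2 b ⟨
    nat (2 ℕ.* b) ∎))
    where
    odd≢even : ∀ a b → suc (2 ℕ.* a) ≢ 2 ℕ.* b
    odd≢even a b eq = ℕ.even≢odd b a (≡.sym eq)

  halfOdd-pos : ∀ i → 0# < halfOdd i
  halfOdd-pos i = *-pos (0<nat (2 ℕ.* i)) (inv-pos (0<nat 1))

  point : ℕ → Carrier
  point i = - (halfOdd i * halfOdd i)

  point-distinct : ∀ {i j} → i ≢ j → point i ≉ point j
  point-distinct {i} {j} i≢j eq = *-≉0 (-‿≉0 hi≉hj) (>⇒≉ (0<+ (halfOdd-pos i) (inj₁ (halfOdd-pos j)))) (begin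
    (halfOdd i - halfOdd j) * (halfOdd i + halfOdd j)
      ≈⟨ solve 2 (λ x y → (x :- y) :* (x :+ y) := (:- (y :* y)) :- (:- (x :* x))) refl _ _ ⟩
    point j - point i ≈⟨ +-congˡ (-‿cong eq) ⟩
    point j - point j ≈⟨ -‿inverseʳ _ ⟩
    0# ∎)
    where
    hi≉hj : halfOdd i ≉ halfOdd j
    hi≉hj h = i≢j (ℕ.*-cancelˡ-≡ i j 2 (ℕ.suc-injective (nat-injective
      (trans (sym (double-halfOdd i)) (trans (*-congˡ h) (double-halfOdd j))))))

  module InAlgebra {c₂ ℓ₃} {A : CommutativeRing c₂ ℓ₃} (hom : RingHom commutativeRing A) where
    private
      module A = CommutativeRing A
      module SA = IntegerSolver A
      module ΣA = Sums A
    open RingHom hom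
    open Evaluation hom

    value : ℕ → A.Carrier → A.Carrier
    value n = evalAt (hookSumPoly n)

    value-hooks : ∀ n z → value n z A.≈ PartitionSums.sumOver A (partitions n)
      (λ μ → HookProducts.prodOver A (hookLengths μ) (λ h → A.1# A.+ z A.* ι ((nat h * nat h) ⁻¹)))
    value-hooks n z = A.trans (evalAt-∑ _ (partitions n) z) (PartitionSums.sumOver-cong A (partitions n) (λ μ →
      A.trans (evalAt-∏ hookPoly (hookLengths μ) z) (prodOver-cong (hookLengths μ) (λ h →
        A.+-cong ι-1 (A.*-congˡ (A.trans (A.+-congˡ (A.zeroʳ z)) (A.+-identityʳ _)))))))

-- n N_n - (1 + X) Σ σ(j) N_{n-j}
module Defect {c ℓ} (R : CommutativeRing c ℓ) (N : ℕ → List (CommutativeRing.Carrier R)) where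
  open CommutativeRing R using (rawRing; -_; 1#; -‿inverseˡ)
  open IntegerSolver R using (nat)
  open Polynomials rawRing using (Poly; _⊕_; _·_; _⊗_)

  tail : ℕ → ℕ → Poly
  tail n zero    = []
  tail n (suc j) = tail n j ⊕ nat (σ (suc j)) · N (n ℕ.∸ suc j)

  defect : ℕ → Poly
  defect n = nat n · N n ⊕ - 1# · ((1# ∷ 1# ∷ []) ⊗ tail n n)

  module _ {c₂ ℓ₂} {A : CommutativeRing c₂ ℓ₂} (hom : RingHom R A) where
    private
      module A = CommutativeRing A
      module SA = IntegerSolver A
      module ΣA = Sums A
    open RingHom hom
    open Evaluation hom

    tail-value : ∀ n j z → evalAt (tail n j) z A.≈ ΣA.∑< j (λ i → SA.nat (σ (suc i)) A.* evalAt (N (n ℕ.∸ suc i)) z)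
    tail-value n zero    z = A.refl
    tail-value n (suc j) z = A.trans (evalAt-⊕ (tail n j) (nat (σ (suc j)) · N (n ℕ.∸ suc j)) z) (A.trans
      (A.+-cong (tail-value n j z) (A.trans (evalAt-· (nat (σ (suc j))) (N (n ℕ.∸ suc j)) z) (A.*-congʳ (ι-nat (σ (suc j))))))
      (A.sym (ΣA.∑<-last j (λ i → SA.nat (σ (suc i)) A.* evalAt (N (n ℕ.∸ suc i)) z))))

    defect-value : ∀ n z → evalAt (defect n) z A.≈
      SA.nat n A.* evalAt (N n) z A.- (A.1# A.+ z) A.* ΣA.∑< n (λ i → SA.nat (σ (suc i)) A.* evalAt (N (n ℕ.∸ suc i)) z)
    defect-value n z = A.trans (evalAt-⊕ (nat n · N n) (- 1# · ((1# ∷ 1# ∷ []) ⊗ tail n n)) z) (A.+-cong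
      (A.trans (evalAt-· (nat n) (N n) z) (A.*-congʳ (ι-nat n)))
      (A.trans (evalAt-· (- 1#) ((1# ∷ 1# ∷ []) ⊗ tail n n) z) (A.trans
        (A.*-cong ι-neg-1 (A.trans (evalAt-⊗ (1# ∷ 1# ∷ []) (tail n n) z) (A.*-cong
          (A.+-cong ι-1 (A.trans (A.*-congˡ (A.trans (A.+-cong ι-1 (A.zeroʳ z)) (A.+-identityʳ _))) (A.*-identityʳ z)))
          (tail-value n n z))))
        (SA.solve 1 (λ y → (SA.:- SA.con (+ 1)) SA.:* y SA.:= SA.:- y) A.refl _))))
      where
      ι-neg-1 : ι (- 1#) A.≈ A.- A.1#
      ι-neg-1 = A.trans (SA.solve 2 (λ x y → x SA.:= (x SA.:+ y) SA.:- y) A.refl (ι (- 1#)) (ι 1#))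
        (A.trans (A.+-congʳ (A.trans (A.sym (ι-+ _ _)) (A.trans (ι-cong (-‿inverseˡ 1#)) ι-0))) (A.trans (A.+-identityˡ _) (A.-‿cong ι-1)))

module HookRecursion {c ℓ₁ ℓ₂} (F : CompleteOrderedField c ℓ₁ ℓ₂) where
  open CompleteOrderedField F hiding (zero)
  open IntegerSolver commutativeRing
  open Sums commutativeRing
  open HookFormula F using (hookSum)
  open Identity F
  open Polynomials rawRing using (Poly; eval)
  open Division commutativeRing using (eval≡evalAt)
  open SetoidReasoning setoid
  private
    module AF = InAlgebra (idHom commutativeRing)

    -- The defect has roots at all the points `- m²` with `m` half-odd, hence has only zero
    -- coefficients.
    vanishing : (N : ℕ → Poly) (P : Carrier → ℕ → Carrier) →
      (∀ n z → Evaluation.evalAt (idHom commutativeRing) (N n) z ≈ P z n) →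
      (∀ i n → nat n * P (point i) n ≈ (1# + point i) * ∑< n (λ j → nat (σ (suc j)) * P (point i) (n ℕ.∸ suc j))) →
      ∀ n → All (_≈ 0#) (Defect.defect commutativeRing N n)
    vanishing N P value recursion n = many-roots (length (defect n)) (defect n) ≡.refl point point-distinct (λ i → begin
      eval (defect n) (point i)
        ≡⟨ eval≡evalAt (defect n) (point i) ⟩
      Evaluation.evalAt (idHom commutativeRing) (defect n) (point i)
        ≈⟨ defect-value (idHom commutativeRing) n (point i) ⟩
      nat n * v n i - (1# + point i) * ∑< n (λ j → nat (σ (suc j)) * v (n ℕ.∸ suc j) i)
        ≈⟨ +-cong (*-congˡ (value n (point i))) (-‿cong (*-congˡ (∑<-cong n (λ j _ → *-congˡ (value (n ℕ.∸ suc j) (point i)))))) ⟩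
      nat n * P (point i) n - (1# + point i) * ∑< n (λ j → nat (σ (suc j)) * P (point i) (n ℕ.∸ suc j))
        ≈⟨ +-congʳ (recursion i n) ⟩
      (1# + point i) * ∑< n (λ j → nat (σ (suc j)) * P (point i) (n ℕ.∸ suc j)) - (1# + point i) * ∑< n (λ j → nat (σ (suc j)) * P (point i) (n ℕ.∸ suc j))
        ≈⟨ -‿inverseʳ _ ⟩
      0# ∎)
      where
      open Defect commutativeRing N
      v : ℕ → ℕ → Carrier
      v n i = Evaluation.evalAt (idHom commutativeRing) (N n) (point i)

  -- Since the defect vanishes coefficientwise, the recursion passes to every algebra over the
  -- field, with no density argument.
  value-recursion : ∀ {c₂ ℓ₃} {A : CommutativeRing c₂ ℓ₃} (hom : RingHom commutativeRing A) →
    let open CommutativeRing A using () renaming (_≈_ to _≈ᴬ_; _+_ to _+ᴬ_; _*_ to _*ᴬ_; 1# to 1ᴬ)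
        open IntegerSolver A using () renaming (nat to natᴬ) in
    ∀ z n → natᴬ n *ᴬ InAlgebra.value hom n z ≈ᴬ
            (1ᴬ +ᴬ z) *ᴬ Sums.∑< A n (λ j → natᴬ (σ (suc j)) *ᴬ InAlgebra.value hom (n ℕ.∸ suc j) z)
  value-recursion {A = A} hom z n = A.trans (SA.solve 2 (λ p q → p SA.:= (p SA.:- q) SA.:+ q) A.refl p q)
    (A.trans (A.+-congʳ (A.trans (A.sym (Defect.defect-value commutativeRing hookSumPoly hom n z))
                         (Evaluation.evalAt-0 hom (Defect.defect commutativeRing hookSumPoly n) z
                           (vanishing hookSumPoly hookSum AF.value-hooks (λ i → hookSum-recursion (halfOdd-nonInteger i)) n)))) (A.+-identityˡ q))
    where
    module A = CommutativeRing A
    module SA = IntegerSolver A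
    p q : A.Carrier
    p = SA.nat n A.* InAlgebra.value hom n z
    q = (A.1# A.+ z) A.* Sums.∑< A n (λ j → SA.nat (σ (suc j)) A.* InAlgebra.value hom (n ℕ.∸ suc j) z)

SatisfiesRecursion : ∀ {c ℓ} (A : CommutativeRing c ℓ) → (ℕ → CommutativeRing.Carrier A → CommutativeRing.Carrier A) → Set (c ⊔ ℓ)
SatisfiesRecursion A value = ∀ z n → nat n * value n z ≈ (1# + z) * ∑< n (λ j → nat (σ (suc j)) * value (n ℕ.∸ suc j) z)
  where
  open CommutativeRing A
  open IntegerSolver A using (nat)
  open Sums A using (∑<)

-- The transformed recursion

module Sequence {c ℓ₁ ℓ₂} (F : CompleteOrderedField c ℓ₁ ℓ₂) {c₂ ℓ₃} {A : CommutativeRing c₂ ℓ₃}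
                (hom : RingHom (CompleteOrderedField.commutativeRing F) A)
                (value : ℕ → CommutativeRing.Carrier A → CommutativeRing.Carrier A)
                (value-0 : ∀ z → CommutativeRing._≈_ A (value 0 z) (CommutativeRing.1# A))
                (value-recursion : SatisfiesRecursion A value)
                (x : CommutativeRing.Carrier A) where
  private
    module F = CompleteOrderedField F
  open OrderedField F using (>⇒≉; 0<nat)
  open IntegerSolver F.commutativeRing using () renaming (nat to natᶠ)
  open CommutativeRing A hiding (zero)
  open IntegerSolver A
  open Sums A
  open RingHom hom
  open SetoidReasoning setoid

  -- In generating functions `Σ (k + 1) wₖ₊₁ qᵏ` is the product of `Σ γⱼ qʲ` and `Σ aₖ qᵏ`, and
  -- `Σ τⱼ qʲ` is the reciprocal of the first factor. The sign in `a` makes all `τⱼ` nonnegative.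
  γ τ a w : ℕ → Carrier
  γ j = int (signedσ j)
  τ j = int (t j)
  a k = int (alternating k) * value k (- x)
  w zero    = 0#
  w (suc k) = ι (natᶠ (suc k) F.⁻¹) * ∑< (suc k) (λ i → γ i * a (k ℕ.∸ i))

  private
    ι-inverse : ∀ k → nat (suc k) * ι (natᶠ (suc k) F.⁻¹) ≈ 1#
    ι-inverse k = trans (*-congʳ (sym (Evaluation.ι-nat hom (suc k)))) (trans (sym (ι-* _ _))
      (trans (ι-cong (F.⁻¹-inverseʳ _ (>⇒≉ (0<nat k)))) ι-1))

  nat-cancel : ∀ k {y z} → nat (suc k) * y ≈ nat (suc k) * z → y ≈ z
  nat-cancel k {y} {z} eq = trans (expand y) (trans (*-congˡ eq) (sym (expand z)))
    where
    expand : ∀ y → y ≈ ι (natᶠ (suc k) F.⁻¹) * (nat (suc k) * y)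
    expand y = sym (trans (solve 3 (λ i n y → i :* (n :* y) := (n :* i) :* y) refl _ _ y)
      (trans (*-congʳ (ι-inverse k)) (*-identityˡ y)))

  w-scaled : ∀ k → nat (suc k) * w (suc k) ≈ ∑< (suc k) (λ i → γ i * a (k ℕ.∸ i))
  w-scaled k = trans (sym (*-assoc _ _ _)) (trans (*-congʳ (ι-inverse k)) (*-identityˡ _))

  private
    alternating-+ : ∀ i j → alternating (i ℕ.+ j) ≡ alternating i ℤ.* alternating j
    alternating-+ zero    j = ≡.sym (ℤ.*-identityˡ (alternating j))
    alternating-+ (suc i) j = ≡.trans (≡.cong ℤ.-_ (alternating-+ i j)) (ℤ.neg-distribˡ-* (alternating i) (alternating j))

  -- Splitting the sign of index `k` into those of `j` and `k - j`, the divisor recursion at `- x`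
  -- has precisely the convolution that defines `w` on its right side.
  a-factor : ∀ k → a (suc k) ≈ (x - 1#) * w (suc k)
  a-factor k = nat-cancel k (begin
    nat (suc k) * (int (alternating (suc k)) * value (suc k) (- x))
      ≈⟨ solve 3 (λ n s v → n :* (s :* v) := s :* (n :* v)) refl _ _ _ ⟩
    int (alternating (suc k)) * (nat (suc k) * value (suc k) (- x))
      ≈⟨ *-cong (int-neg (alternating k)) (value-recursion (- x) (suc k)) ⟩
    - int (alternating k) * ((1# + - x) * ∑< (suc k) (λ j → nat (σ (suc j)) * value (k ℕ.∸ j) (- x)))
      ≈⟨ solve 3 (λ s x v → (:- s) :* ((con (+ 1) :+ :- x) :* v) := (x :- con (+ 1)) :* (s :* v)) refl _ _ _ ⟩
    (x - 1#) * (int (alternating k) * ∑< (suc k) (λ j → nat (σ (suc j)) * value (k ℕ.∸ j) (- x)))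
      ≈⟨ *-congˡ (trans (sym (∑<-* (suc k) _ (λ j → nat (σ (suc j)) * value (k ℕ.∸ j) (- x)))) (∑<-cong (suc k) (λ j j≤k → begin
           int (alternating k) * (nat (σ (suc j)) * value (k ℕ.∸ j) (- x))
             ≈⟨ *-congʳ (trans (int-cong (≡.trans (≡.cong alternating (≡.sym (ℕ.m+[n∸m]≡n (ℕ.s≤s⁻¹ j≤k)))) (alternating-+ j (k ℕ.∸ j)))) (int-* (alternating j) _)) ⟩
           int (alternating j) * int (alternating (k ℕ.∸ j)) * (nat (σ (suc j)) * value (k ℕ.∸ j) (- x))
             ≈⟨ solve 4 (λ p q n v → p :* q :* (n :* v) := (p :* n) :* (q :* v)) refl _ _ _ _ ⟩
           int (alternating j) * nat (σ (suc j)) * a (k ℕ.∸ j)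
             ≈⟨ *-congʳ (trans (*-congˡ (sym (int-nat (σ (suc j))))) (sym (int-* (alternating j) (+ σ (suc j))))) ⟩
           γ j * a (k ℕ.∸ j) ∎))) ⟩
    (x - 1#) * ∑< (suc k) (λ i → γ i * a (k ℕ.∸ i))
      ≈⟨ *-congˡ (w-scaled k) ⟨
    (x - 1#) * (nat (suc k) * w (suc k))
      ≈⟨ solve 3 (λ x n w → x :* (n :* w) := n :* (x :* w)) refl _ _ _ ⟩
    nat (suc k) * ((x - 1#) * w (suc k)) ∎)

  private
    convolve-sum : ∀ i n → int (convolve signedσ i (inverses n)) ≈ ∑< (suc n) (λ j → γ (i ℕ.+ j) * τ (n ℕ.∸ j))
    convolve-sum i zero    = trans (int-+ (signedσ i ℤ.* + 1) (+ 0)) (+-congʳ (trans (int-* (signedσ i) (+ 1))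
      (*-congʳ (int-cong (≡.cong signedσ (≡.sym (ℕ.+-identityʳ i)))))))
    convolve-sum i (suc n) = trans (int-+ (signedσ i ℤ.* t (suc n)) (convolve signedσ (suc i) (inverses n))) (+-cong
      (trans (int-* (signedσ i) (t (suc n))) (*-congʳ (int-cong (≡.cong signedσ (≡.sym (ℕ.+-identityʳ i))))))
      (trans (convolve-sum (suc i) n) (∑<-cong (suc n) (λ j _ → *-congʳ {τ (n ℕ.∸ j)} (int-cong (≡.cong signedσ (≡.sym (ℕ.+-suc i j))))))))

    reciprocal : ∀ s → ∑< (suc (suc s)) (λ j → τ j * γ (suc s ℕ.∸ j)) ≈ 0#
    reciprocal s = begin
      ∑< (suc (suc s)) (λ j → τ j * γ (suc s ℕ.∸ j))
        ≈⟨ ∑<-reverse (suc s) (λ j → τ j * γ (suc s ℕ.∸ j)) ⟩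
      ∑< (suc (suc s)) (λ j → τ (suc s ℕ.∸ j) * γ (suc s ℕ.∸ (suc s ℕ.∸ j)))
        ≈⟨ ∑<-cong (suc (suc s)) (λ j j≤ → trans (*-comm _ _) (*-congʳ {τ (suc s ℕ.∸ j)} (int-cong (≡.cong signedσ (ℕ.m∸[m∸n]≡n (ℕ.s≤s⁻¹ j≤)))))) ⟩
      ∑< (suc (suc s)) (λ j → γ j * τ (suc s ℕ.∸ j))
        ≈⟨ convolve-sum 0 (suc s) ⟨
      int (convolve signedσ 0 (inverses (suc s)))
        ≈⟨ int-cong (convolve-inverses s) ⟩
      0# ∎

  -- Multiplication by `Σ τⱼ qʲ` undoes the convolution with `γ`.
  deconvolve : ∀ n → ∑< (suc n) (λ j → τ j * (nat (suc n ℕ.∸ j) * w (suc n ℕ.∸ j))) ≈ a n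
  deconvolve n = begin
    ∑< (suc n) (λ j → τ j * (nat (suc n ℕ.∸ j) * w (suc n ℕ.∸ j)))
      ≈⟨ ∑<-cong (suc n) (λ j j≤n → trans (*-congˡ (trans
           (reflexive (≡.cong (λ k → nat k * w k) (ℕ.+-∸-assoc 1 (ℕ.s≤s⁻¹ j≤n)))) (w-scaled (n ℕ.∸ j))))
           (sym (∑<-* (suc (n ℕ.∸ j)) (τ j) (λ i → γ i * a (n ℕ.∸ j ℕ.∸ i))))) ⟩
    ∑< (suc n) (λ j → ∑< (suc (n ℕ.∸ j)) (λ i → τ j * (γ i * a (n ℕ.∸ j ℕ.∸ i))))
      ≈⟨ ∑<-triangle n (λ j i → τ j * (γ i * a (n ℕ.∸ j ℕ.∸ i))) ⟩
    ∑< (suc n) (λ s → ∑< (suc s) (λ j → τ j * (γ (s ℕ.∸ j) * a (n ℕ.∸ j ℕ.∸ (s ℕ.∸ j)))))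
      ≈⟨ ∑<-cong (suc n) (λ s _ → trans (∑<-cong (suc s) (λ j j≤s → trans
           (*-congˡ (*-congˡ (reflexive (≡.cong a (≡.trans (ℕ.∸-+-assoc n j (s ℕ.∸ j)) (≡.cong (n ℕ.∸_) (ℕ.m+[n∸m]≡n (ℕ.s≤s⁻¹ j≤s))))))))
           (solve 3 (λ p q r → p :* (q :* r) := r :* (p :* q)) refl (τ j) (γ (s ℕ.∸ j)) (a (n ℕ.∸ s)))))
           (∑<-* (suc s) (a (n ℕ.∸ s)) (λ j → τ j * γ (s ℕ.∸ j)))) ⟩
    ∑< (suc n) (λ s → a (n ℕ.∸ s) * ∑< (suc s) (λ j → τ j * γ (s ℕ.∸ j)))
      ≈⟨ +-cong (*-congˡ (trans (+-identityʳ _) (*-identityˡ 1#))) (∑<-zero n (λ s _ → trans (*-congˡ (reciprocal s)) (zeroʳ _))) ⟩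
    a n * 1# + 0#
      ≈⟨ trans (+-identityʳ _) (*-identityʳ _) ⟩
    a n ∎

  -- `a-factor` and `deconvolve` give two expressions for `a (suc n)`; in the second, the term
  -- `j = 0` has coefficient 1 and is split off.
  eigen : ∀ n → (x - 1#) * w (suc n) ≈
    nat (2 ℕ.+ n) * w (2 ℕ.+ n) + ∑< (suc n) (λ j → τ (suc j) * (nat (suc n ℕ.∸ j) * w (suc n ℕ.∸ j)))
  eigen n = trans (sym (a-factor n)) (trans (sym (deconvolve (suc n))) (+-congʳ (*-identityˡ _)))

  w-1 : w 1 ≈ 1#
  w-1 = nat-cancel 0 (trans (w-scaled 0) (trans (+-congʳ (*-congˡ (*-congˡ (value-0 (- x)))))
    (solve 0 (con (+ 1) :* (con (+ 1) :* con (+ 1)) :+ con (+ 0) := (con (+ 1) :+ con (+ 0)) :* con (+ 1)) refl)))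

-- Dual and complex numbers

_∘ʰ_ : ∀ {a ℓa b ℓb c ℓc} {R : CommutativeRing a ℓa} {S : CommutativeRing b ℓb} {T : CommutativeRing c ℓc} →
       RingHom S T → RingHom R S → RingHom R T
_∘ʰ_ {T = T} g f = record
  { ι      = λ x → G.ι (F.ι x)
  ; ι-cong = λ eq → G.ι-cong (F.ι-cong eq)
  ; ι-+    = λ x y → trans (G.ι-cong (F.ι-+ x y)) (G.ι-+ _ _)
  ; ι-*    = λ x y → trans (G.ι-cong (F.ι-* x y)) (G.ι-* _ _)
  ; ι-0    = trans (G.ι-cong F.ι-0) G.ι-0
  ; ι-1    = trans (G.ι-cong F.ι-1) G.ι-1
  }
  where
  module F = RingHom f
  module G = RingHom g
  open CommutativeRing T

module DualNumbers {c ℓ} (R : CommutativeRing c ℓ) where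
  open CommutativeRing R hiding (zero)
  open IntegerSolver R

  -- The pair `(x , y)` stands for `x + y ε` with `ε² = 0`.
  dualRing : CommutativeRing c ℓ
  dualRing = record
    { Carrier = Carrier × Carrier
    ; _≈_ = λ z w → (proj₁ z ≈ proj₁ w) × (proj₂ z ≈ proj₂ w)
    ; _+_ = λ z w → proj₁ z + proj₁ w , proj₂ z + proj₂ w
    ; _*_ = λ z w → proj₁ z * proj₁ w , proj₁ z * proj₂ w + proj₂ z * proj₁ w
    ; -_  = λ z → - proj₁ z , - proj₂ z
    ; 0#  = 0# , 0#
    ; 1#  = 1# , 0#
    ; isCommutativeRing = record
      { isRing = record
        { +-isAbelianGroup = record
          { isGroup = record
            { isMonoid = record
              { isSemigroup = record
                { isMagma = record
                  { isEquivalence = record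
                    { refl = refl , refl ; sym = λ (p , q) → sym p , sym q ; trans = λ (p , q) (p′ , q′) → trans p p′ , trans q q′ }
                  ; ∙-cong = λ (p , q) (p′ , q′) → +-cong p p′ , +-cong q q′ }
                ; assoc = λ x y z → +-assoc _ _ _ , +-assoc _ _ _ }
              ; identity = (λ x → +-identityˡ _ , +-identityˡ _) , (λ x → +-identityʳ _ , +-identityʳ _) }
            ; inverse = (λ x → -‿inverseˡ _ , -‿inverseˡ _) , (λ x → -‿inverseʳ _ , -‿inverseʳ _)
            ; ⁻¹-cong = λ (p , q) → -‿cong p , -‿cong q }
          ; comm = λ x y → +-comm _ _ , +-comm _ _ }
        ; *-cong = λ (p , q) (p′ , q′) → *-cong p p′ , +-cong (*-cong p q′) (*-cong q p′)
        ; *-assoc = λ x y z → *-assoc _ _ _ ,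
            solve 6 (λ a b c d e f → (a :* c) :* f :+ (a :* d :+ b :* c) :* e := a :* (c :* f :+ d :* e) :+ b :* (c :* e)) refl _ _ _ _ _ _
        ; *-identity = (λ x → *-identityˡ _ , solve 2 (λ a b → con (+ 1) :* b :+ con (+ 0) :* a := b) refl _ _) ,
                       (λ x → *-identityʳ _ , solve 2 (λ a b → a :* con (+ 0) :+ b :* con (+ 1) := b) refl _ _)
        ; distrib = (λ x y z → distribˡ _ _ _ , solve 6 (λ a b c d e f → a :* (d :+ f) :+ b :* (c :+ e) := (a :* d :+ b :* c) :+ (a :* f :+ b :* e)) refl _ _ _ _ _ _) ,
                    (λ x y z → distribʳ _ _ _ , solve 6 (λ a b c d e f → (c :+ e) :* b :+ (d :+ f) :* a := (c :* b :+ d :* a) :+ (e :* b :+ f :* a)) refl _ _ _ _ _ _) }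
      ; *-comm = λ x y → *-comm _ _ , solve 4 (λ a b c d → a :* d :+ b :* c := c :* b :+ d :* a) refl _ _ _ _ } }

  constant : RingHom R dualRing
  constant = record
    { ι      = λ x → x , 0#
    ; ι-cong = λ eq → eq , refl
    ; ι-+    = λ x y → refl , sym (+-identityˡ 0#)
    ; ι-*    = λ x y → refl , solve 2 (λ x y → con (+ 0) := x :* con (+ 0) :+ con (+ 0) :* y) refl x y
    ; ι-0    = refl , refl
    ; ι-1    = refl , refl
    }

module Complex {c ℓ₁ ℓ₂} (F : CompleteOrderedField c ℓ₁ ℓ₂) where
  open CompleteOrderedField F hiding (zero)
  open IntegerSolver commutativeRing
  open OrderedField F
  open ComplexNumbers F hiding (∣_∣)
  open SquareRoots F using (square-nonneg)
  open Sums commutativeRing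
  open SetoidReasoning setoid

  complexCommutativeRing : CommutativeRing c ℓ₁
  complexCommutativeRing = record
    { Carrier = ℂ
    ; _≈_ = λ z w → (re z ≈ re w) × (im z ≈ im w)
    ; _+_ = λ z w → (re z + re w) +i (im z + im w)
    ; _*_ = λ z w → (re z * re w + - (im z * im w)) +i (re z * im w + im z * re w)
    ; -_  = λ z → (- re z) +i (- im z)
    ; 0#  = fromReal 0#
    ; 1#  = fromReal 1#
    ; isCommutativeRing = record
      { isRing = record
        { +-isAbelianGroup = record
          { isGroup = record
            { isMonoid = record
              { isSemigroup = record
                { isMagma = record
                  { isEquivalence = record
                    { refl = refl , refl ; sym = λ (p , q) → sym p , sym q ; trans = λ (p , q) (p′ , q′) → trans p p′ , trans q q′ }
                  ; ∙-cong = λ (p , q) (p′ , q′) → +-cong p p′ , +-cong q q′ }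
                ; assoc = λ x y z → +-assoc _ _ _ , +-assoc _ _ _ }
              ; identity = (λ x → +-identityˡ _ , +-identityˡ _) , (λ x → +-identityʳ _ , +-identityʳ _) }
            ; inverse = (λ x → -‿inverseˡ _ , -‿inverseˡ _) , (λ x → -‿inverseʳ _ , -‿inverseʳ _)
            ; ⁻¹-cong = λ (p , q) → -‿cong p , -‿cong q }
          ; comm = λ x y → +-comm _ _ , +-comm _ _ }
        ; *-cong = λ (p , q) (p′ , q′) → +-cong (*-cong p p′) (-‿cong (*-cong q q′)) , +-cong (*-cong p q′) (*-cong q p′)
        ; *-assoc = λ x y z →
            solve 6 (λ a b c d e f → (a :* c :+ :- (b :* d)) :* e :+ :- ((a :* d :+ b :* c) :* f) := a :* (c :* e :+ :- (d :* f)) :+ :- (b :* (c :* f :+ d :* e))) refl _ _ _ _ _ _ ,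
            solve 6 (λ a b c d e f → (a :* c :+ :- (b :* d)) :* f :+ (a :* d :+ b :* c) :* e := a :* (c :* f :+ d :* e) :+ b :* (c :* e :+ :- (d :* f))) refl _ _ _ _ _ _
        ; *-identity = (λ x → solve 2 (λ a b → con (+ 1) :* a :+ :- (con (+ 0) :* b) := a) refl _ _ , solve 2 (λ a b → con (+ 1) :* b :+ con (+ 0) :* a := b) refl _ _) ,
                       (λ x → solve 2 (λ a b → a :* con (+ 1) :+ :- (b :* con (+ 0)) := a) refl _ _ , solve 2 (λ a b → a :* con (+ 0) :+ b :* con (+ 1) := b) refl _ _)
        ; distrib = (λ x y z → solve 6 (λ a b c d e f → a :* (c :+ e) :+ :- (b :* (d :+ f)) := (a :* c :+ :- (b :* d)) :+ (a :* e :+ :- (b :* f))) refl _ _ _ _ _ _ ,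
                               solve 6 (λ a b c d e f → a :* (d :+ f) :+ b :* (c :+ e) := (a :* d :+ b :* c) :+ (a :* f :+ b :* e)) refl _ _ _ _ _ _) ,
                    (λ x y z → solve 6 (λ a b c d e f → (c :+ e) :* a :+ :- ((d :+ f) :* b) := (c :* a :+ :- (d :* b)) :+ (e :* a :+ :- (f :* b))) refl _ _ _ _ _ _ ,
                               solve 6 (λ a b c d e f → (c :+ e) :* b :+ (d :+ f) :* a := (c :* b :+ d :* a) :+ (e :* b :+ f :* a)) refl _ _ _ _ _ _) }
      ; *-comm = λ x y → solve 4 (λ a b c d → a :* c :+ :- (b :* d) := c :* a :+ :- (d :* b)) refl _ _ _ _ ,
                         solve 4 (λ a b c d → a :* d :+ b :* c := c :* b :+ d :* a) refl _ _ _ _ } }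

  private
    module ℂR = CommutativeRing complexCommutativeRing
    module Σℂ = Sums complexCommutativeRing

  realHom : RingHom commutativeRing complexCommutativeRing
  realHom = record
    { ι      = fromReal
    ; ι-cong = λ eq → eq , refl
    ; ι-+    = λ x y → refl , sym (+-identityˡ 0#)
    ; ι-*    = λ x y → solve 2 (λ x y → x :* y := x :* y :+ :- (con (+ 0) :* con (+ 0))) refl x y ,
                       solve 2 (λ x y → con (+ 0) := x :* con (+ 0) :+ con (+ 0) :* y) refl x y
    ; ι-0    = refl , refl
    ; ι-1    = refl , refl
    }

  norm² : ℂ → Carrier
  norm² z = re z * re z + im z * im z

  square-mono-≤ : ∀ {x y} → 0# ≤ x → x ≤ y → x * x ≤ y * y
  square-mono-≤ {x} {y} 0≤x x≤y = ≤-trans (*-monoˡ-≤ 0≤x x≤y)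
    (≤-respʳ refl (≤-respˡ (*-comm y x) (*-monoˡ-≤ (≤-trans 0≤x x≤y) x≤y)))

  square-cancel-< : ∀ {x y} → 0# ≤ y → x * x < y * y → x < y
  square-cancel-< {x} {y} 0≤y x²<y² with compare x y
  ... | tri< x<y _ _ = x<y
  ... | tri≈ _ x≈y _ = contradiction x²<y² (≤⇒≯ (inj₂ (sym (*-cong x≈y x≈y))))
  ... | tri> _ _ y<x = contradiction x²<y² (≤⇒≯ (square-mono-≤ 0≤y (inj₁ y<x)))

  square-cancel-≤ : ∀ {x y} → 0# ≤ y → x * x ≤ y * y → x ≤ y
  square-cancel-≤ {x} {y} 0≤y x²≤y² with compare x y
  ... | tri< x<y _ _ = inj₁ x<y
  ... | tri≈ _ x≈y _ = inj₂ x≈y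
  ... | tri> _ _ y<x = contradiction (≤-<-trans (*-monoˡ-≤ 0≤y (inj₁ y<x)) (<-respˡ-≈ (*-comm x y) (*-monoˡ-< (≤-<-trans 0≤y y<x) y<x))) (≤⇒≯ x²≤y²)

  -- Keeping the modulus abstract prevents square roots from being unfolded.
  module Modulus (∣_∣ : ℂ → Carrier) (∣∣-nonneg : ∀ z → 0# ≤ ∣ z ∣) (∣∣-square : ∀ z → ∣ z ∣ * ∣ z ∣ ≈ norm² z) where

    ∣∣-unique : ∀ {z r} → 0# ≤ r → r * r ≈ norm² z → ∣ z ∣ ≈ r
    ∣∣-unique {z} 0≤r eq = ≤-antisym
      (square-cancel-≤ 0≤r (inj₂ (trans (∣∣-square z) (sym eq))))
      (square-cancel-≤ (∣∣-nonneg z) (inj₂ (trans eq (sym (∣∣-square z)))))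

    ∣∣-cong : ∀ {z w} → z ℂR.≈ w → ∣ z ∣ ≈ ∣ w ∣
    ∣∣-cong {z} {w} (p , q) = ∣∣-unique (∣∣-nonneg w) (trans (∣∣-square w) (sym (+-cong (*-cong p p) (*-cong q q))))

    ∣∣-real : ∀ {x} → 0# ≤ x → ∣ fromReal x ∣ ≈ x
    ∣∣-real {x} 0≤x = ∣∣-unique 0≤x (solve 1 (λ x → x :* x := x :* x :+ con (+ 0) :* con (+ 0)) refl x)

    ∣∣-neg : ∀ z → ∣ ℂR.- z ∣ ≈ ∣ z ∣
    ∣∣-neg z = ∣∣-unique (∣∣-nonneg z) (trans (∣∣-square z) (solve 2 (λ a b → a :* a :+ b :* b := (:- a) :* (:- a) :+ (:- b) :* (:- b)) refl _ _))

    ∣∣-* : ∀ z w → ∣ z ℂR.* w ∣ ≈ ∣ z ∣ * ∣ w ∣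
    ∣∣-* z w = ∣∣-unique (0≤* (∣∣-nonneg z) (∣∣-nonneg w)) (begin
      (∣ z ∣ * ∣ w ∣) * (∣ z ∣ * ∣ w ∣)  ≈⟨ solve 2 (λ x y → (x :* y) :* (x :* y) := (x :* x) :* (y :* y)) refl _ _ ⟩
      (∣ z ∣ * ∣ z ∣) * (∣ w ∣ * ∣ w ∣)  ≈⟨ *-cong (∣∣-square z) (∣∣-square w) ⟩
      norm² z * norm² w
        ≈⟨ solve 4 (λ a b c d → (a :* a :+ b :* b) :* (c :* c :+ d :* d) :=
             (a :* c :+ :- (b :* d)) :* (a :* c :+ :- (b :* d)) :+ (a :* d :+ b :* c) :* (a :* d :+ b :* c)) refl _ _ _ _ ⟩
      norm² (z ℂR.* w) ∎)

    -- Cauchy–Schwarz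
    re-bound : ∀ z w → re z * re w + im z * im w ≤ ∣ z ∣ * ∣ w ∣
    re-bound z w = square-cancel-≤ (0≤* (∣∣-nonneg z) (∣∣-nonneg w)) (≤-by (square-nonneg (re z * im w - im z * re w)) (begin
      (re z * re w + im z * im w) * (re z * re w + im z * im w) + (re z * im w - im z * re w) * (re z * im w - im z * re w)
        ≈⟨ solve 4 (λ a b c d → (a :* c :+ b :* d) :* (a :* c :+ b :* d) :+ (a :* d :- b :* c) :* (a :* d :- b :* c) :=
             (a :* a :+ b :* b) :* (c :* c :+ d :* d)) refl _ _ _ _ ⟩
      norm² z * norm² w  ≈⟨ *-cong (∣∣-square z) (∣∣-square w) ⟨
      (∣ z ∣ * ∣ z ∣) * (∣ w ∣ * ∣ w ∣)  ≈⟨ solve 2 (λ x y → (x :* x) :* (y :* y) := (x :* y) :* (x :* y)) refl _ _ ⟩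
      (∣ z ∣ * ∣ w ∣) * (∣ z ∣ * ∣ w ∣) ∎))

    ∣∣-+ : ∀ z w → ∣ z ℂR.+ w ∣ ≤ ∣ z ∣ + ∣ w ∣
    ∣∣-+ z w = square-cancel-≤ (0≤+ (∣∣-nonneg z) (∣∣-nonneg w)) (≤-by (0≤* (0≤nat 2) (≤-diff (re-bound z w))) (begin
      ∣ z ℂR.+ w ∣ * ∣ z ℂR.+ w ∣ + nat 2 * (∣ z ∣ * ∣ w ∣ - (re z * re w + im z * im w))
        ≈⟨ +-congʳ (∣∣-square (z ℂR.+ w)) ⟩
      norm² (z ℂR.+ w) + nat 2 * (∣ z ∣ * ∣ w ∣ - (re z * re w + im z * im w))
        ≈⟨ solve 6 (λ a b c d x y → ((a :+ c) :* (a :+ c) :+ (b :+ d) :* (b :+ d)) :+ con (+ 2) :* (x :* y :- (a :* c :+ b :* d)) :=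
             (a :* a :+ b :* b) :+ (c :* c :+ d :* d) :+ con (+ 2) :* (x :* y)) refl _ _ _ _ _ _ ⟩
      norm² z + norm² w + nat 2 * (∣ z ∣ * ∣ w ∣)
        ≈⟨ +-congʳ (+-cong (∣∣-square z) (∣∣-square w)) ⟨
      ∣ z ∣ * ∣ z ∣ + ∣ w ∣ * ∣ w ∣ + nat 2 * (∣ z ∣ * ∣ w ∣)
        ≈⟨ solve 2 (λ x y → x :* x :+ y :* y :+ con (+ 2) :* (x :* y) := (x :+ y) :* (x :+ y)) refl _ _ ⟩
      (∣ z ∣ + ∣ w ∣) * (∣ z ∣ + ∣ w ∣) ∎))

    ∣∣-∑ : ∀ n (f : ℕ → ℂ) → ∣ Σℂ.∑< n f ∣ ≤ ∑< n (λ i → ∣ f i ∣)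
    ∣∣-∑ zero    f = inj₂ (∣∣-real ≤-refl)
    ∣∣-∑ (suc n) f = ≤-trans (∣∣-+ (f 0) _) (+-mono-≤ ≤-refl (∣∣-∑ n (f ∘ suc)))

    ∣∣≈0⇒≈0 : ∀ z → ∣ z ∣ ≈ 0# → z ℂR.≈ ℂR.0#
    ∣∣≈0⇒≈0 z eq = component (re z) (im z) norm≈0 , component (im z) (re z) (trans (+-comm _ _) norm≈0)
      where
      norm≈0 : norm² z ≈ 0#
      norm≈0 = trans (sym (∣∣-square z)) (trans (*-congʳ eq) (zeroˡ _))
      component : ∀ x y → x * x + y * y ≈ 0# → x ≈ 0#
      component x y x²+y²≈0 with x ≟ 0#
      ... | yes x≈0 = x≈0
      ... | no  x≉0 = contradiction (*-≉0 x≉0 x≉0) (λ x²≉0 → x²≉0 (≤-antisym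
        (≤-by (square-nonneg y) x²+y²≈0) (square-nonneg x)))

    ∣∣-pos : ∀ z → ¬ (z ℂR.≈ ℂR.0#) → 0# < ∣ z ∣
    ∣∣-pos z z≉0 with ∣∣-nonneg z
    ... | inj₁ 0<z = 0<z
    ... | inj₂ 0≈z = contradiction (∣∣≈0⇒≈0 z (sym 0≈z)) z≉0

    *-zero-cancelᶜ : ∀ z w → ¬ (z ℂR.≈ ℂR.0#) → z ℂR.* w ℂR.≈ ℂR.0# → w ℂR.≈ ℂR.0#
    *-zero-cancelᶜ z w z≉0 eq = ∣∣≈0⇒≈0 w (*-zero-cancel (>⇒≉ (∣∣-pos z z≉0))
      (trans (sym (∣∣-* z w)) (trans (∣∣-cong eq) (∣∣-real ≤-refl))))

    -- The disc of radius ρ - 1 about 1 touches the circle of radius ρ only at ρ.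
    disc : ∀ z {ρ} → 1# ≤ ρ → ∣ z ℂR.- ℂR.1# ∣ ≤ ρ - 1# → ¬ (z ℂR.≈ fromReal ρ) → ∣ z ∣ < ρ
    disc z {ρ} 1≤ρ bound z≉ρ = square-cancel-< 0≤ρ (≤-<-trans (inj₂ (∣∣-square z)) (≤-<-trans (≤-by 0≤gap split) (<-by (*-pos (0<nat 1) (<-diff re<ρ))
      (solve 2 (λ ρ a → (ρ :* ρ :- con (+ 2) :* (ρ :- a)) :+ con (+ 2) :* (ρ :- a) := ρ :* ρ) refl ρ (re z)))))
      where
      0≤ρ : 0# ≤ ρ
      0≤ρ = ≤-trans (inj₁ 0<1) 1≤ρ
      gap : Carrier
      gap = (ρ - 1#) * (ρ - 1#) - norm² (z ℂR.- ℂR.1#)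
      0≤gap : 0# ≤ gap
      0≤gap = ≤-diff (≤-respˡ (∣∣-square (z ℂR.- ℂR.1#)) (square-mono-≤ (∣∣-nonneg (z ℂR.- ℂR.1#)) bound))
      -- `gap` is the slack in the squared hypothesis. Adding it to the squared modulus leaves an
      -- expression in `re z` alone, so everything reduces to `re z < ρ`.
      split : norm² z + gap ≈ ρ * ρ - nat 2 * (ρ - re z)
      split = solve 3 (λ a b ρ → (a :* a :+ b :* b) :+ ((ρ :- con (+ 1)) :* (ρ :- con (+ 1)) :- ((a :- con (+ 1)) :* (a :- con (+ 1)) :+ (b :- con (+ 0)) :* (b :- con (+ 0)))) :=
        ρ :* ρ :- con (+ 2) :* (ρ :- a)) refl (re z) (im z) ρ
      re≤ρ : re z ≤ ρ
      re≤ρ = ≤-respˡ (solve 1 (λ a → (a :- con (+ 1)) :+ con (+ 1) := a) refl (re z))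
        (≤-respʳ (solve 1 (λ a → (a :- con (+ 1)) :+ con (+ 1) := a) refl ρ)
          (+-mono-≤ (square-cancel-≤ (≤-diff 1≤ρ) (≤-by (0≤+ 0≤gap (square-nonneg (im z)))
            (solve 3 (λ a b ρ → (a :- con (+ 1)) :* (a :- con (+ 1)) :+ (((ρ :- con (+ 1)) :* (ρ :- con (+ 1)) :- ((a :- con (+ 1)) :* (a :- con (+ 1)) :+ (b :- con (+ 0)) :* (b :- con (+ 0)))) :+ b :* b) :=
              (ρ :- con (+ 1)) :* (ρ :- con (+ 1))) refl (re z) (im z) ρ))) ≤-refl))
      -- If `re z = ρ`, then `im z * im z + gap` has the factor `ρ - re z` and vanishes; both
      -- summands being nonnegative, `im z` is zero and `z` equals `ρ`.
      strict : re z ≤ ρ → re z < ρ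
      strict (inj₁ lt) = lt
      strict (inj₂ eq) = contradiction (eq , im≈0) z≉ρ
        where
        im≈0 : im z ≈ 0#
        im≈0 with im z ≟ 0#
        ... | yes p = p
        ... | no  p = contradiction (*-≉0 p p) (λ ne → ne (≤-antisym (≤-by 0≤gap (begin
          im z * im z + gap
            ≈⟨ solve 3 (λ a b ρ → b :* b :+ ((ρ :- con (+ 1)) :* (ρ :- con (+ 1)) :- ((a :- con (+ 1)) :* (a :- con (+ 1)) :+ (b :- con (+ 0)) :* (b :- con (+ 0)))) :=
                 (ρ :- a) :* (ρ :+ a :- con (+ 2))) refl (re z) (im z) ρ ⟩
          (ρ - re z) * (ρ + re z - nat 2)
            ≈⟨ *-congʳ (trans (+-congˡ (-‿cong eq)) (-‿inverseʳ ρ)) ⟩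
          0# * (ρ + re z - nat 2)
            ≈⟨ zeroˡ _ ⟩
          0# ∎)) (square-nonneg (im z))))
      re<ρ : re z < ρ
      re<ρ = strict re≤ρ

  module _ {a ℓ} {A : CommutativeRing a ℓ} (hom : RingHom complexCommutativeRing A) where
    private
      module A = CommutativeRing A
    open NekrasovOkounkov F using (NO; hookFactor)
    open RingHom hom
    open Evaluation hom

    -- `NO` has complex and `hookSumPoly` real coefficients; both are compared through the hook sum
    -- in the common algebra.
    NO-value : ∀ n z → evalAt (NO n) z A.≈ Identity.InAlgebra.value F (hom ∘ʰ realHom) n z
    NO-value n z = A.trans
      (A.trans (evalAt-∑ (λ μ → Polynomials.∏ complexRing (map hookFactor (hookLengths μ))) (partitions n) z)
        (PartitionSums.sumOver-cong A (partitions n) (λ μ →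
          A.trans (evalAt-∏ hookFactor (hookLengths μ) z) (prodOver-cong (hookLengths μ) (λ h →
            A.+-cong ι-1 (A.*-congˡ (A.trans (A.+-congˡ (A.zeroʳ z)) (A.+-identityʳ _))))))))
      (A.sym (Identity.InAlgebra.value-hooks F (hom ∘ʰ realHom) n z))

-- The largest zero

module Recurrence (κ : ℕ → ℕ → ℕ) {c ℓ} (A : CommutativeRing c ℓ) where
  open CommutativeRing A hiding (zero)
  open IntegerSolver A
  open Sums A

  rest : (ℕ → Carrier) → ℕ → Carrier
  rest u n = ∑< (suc n) (λ j → nat (κ n j) * u (n ℕ.∸ j))

  -- `u n` stands for the entry of index `n + 1` in the sequence of `Sequence`, so that the first
  -- entry is 1.
  record Solution (x : Carrier) (u : ℕ → Carrier) : Set ℓ where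
    field
      start : u 0 ≈ 1#
      step  : ∀ n → (x - 1#) * u n ≈ nat (2 ℕ.+ n) * u (suc n) + rest u n

  open Solution

  unique : (∀ k {y z} → nat (suc k) * y ≈ nat (suc k) * z → y ≈ z) →
           ∀ {x y u v} → x ≈ y → Solution x u → Solution y v → ∀ n → u n ≈ v n
  unique cancel {x} {y} {u} {v} x≈y su sv n = agree n n ℕ.≤-refl
    where
    agree : ∀ n k → k ℕ.≤ n → u k ≈ v k
    agree n       zero    _   = trans (start su) (sym (start sv))
    agree (suc n) (suc k) (s≤s k≤n) = cancel (suc k) (trans
      (trans (solve 2 (λ p r → p := (p :+ r) :- r) refl (nat (2 ℕ.+ k) * u (suc k)) (rest u k)) (+-congʳ (sym (step su k))))
      (trans (+-cong (*-cong (+-congʳ x≈y) (agree n k k≤n)) (-‿cong (∑<-cong (suc k) (λ j _ → *-congˡ {nat (κ k j)} (agree n (k ℕ.∸ j) (ℕ.≤-trans (ℕ.m∸n≤m k j) k≤n))))))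
        (trans (+-congʳ (step sv k)) (sym (solve 2 (λ p r → p := (p :+ r) :- r) refl (nat (2 ℕ.+ k) * v (suc k)) (rest v k))))))

module OrderedSums {c ℓ₁ ℓ₂} (F : CompleteOrderedField c ℓ₁ ℓ₂) where
  open CompleteOrderedField F hiding (zero)
  open IntegerSolver commutativeRing
  open OrderedField F
  open Sums commutativeRing

  ∑<-mono : ∀ n {f g} → (∀ i → i ℕ.< n → f i ≤ g i) → ∑< n f ≤ ∑< n g
  ∑<-mono zero    h = ≤-refl
  ∑<-mono (suc n) h = +-mono-≤ (h 0 (s≤s z≤n)) (∑<-mono n (λ i i<n → h (suc i) (s≤s i<n)))

  ∑<-nonneg : ∀ n {f} → (∀ i → i ℕ.< n → 0# ≤ f i) → 0# ≤ ∑< n f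
  ∑<-nonneg zero    h = ≤-refl
  ∑<-nonneg (suc n) h = 0≤+ (h 0 (s≤s z≤n)) (∑<-nonneg n (λ i i<n → h (suc i) (s≤s i<n)))

  *-cancel-≤ : ∀ {x y z} → 0# < z → z * x ≤ z * y → x ≤ y
  *-cancel-≤ 0<z zx≤zy = ≮⇒≥ (λ y<x → ≤⇒≯ zx≤zy (*-monoˡ-< 0<z y<x))

  *-cancel-neg : ∀ {x z} → 0# < z → z * x < 0# → x < 0#
  *-cancel-neg {x} {z} 0<z zx<0 with compare x 0#
  ... | tri< x<0 _ _ = x<0
  ... | tri≈ _ x≈0 _ = contradiction zx<0 (≤⇒≯ (inj₂ (sym (trans (*-congˡ x≈0) (zeroʳ z)))))
  ... | tri> _ _ 0<x = contradiction zx<0 (≤⇒≯ (inj₁ (*-pos 0<z 0<x)))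

  neg-pos : ∀ {x} → 0# < x → - x < 0#
  neg-pos {x} 0<x = <-by 0<x (-‿inverseˡ x)

  -- The Perron-Frobenius choice: the least multiple of `p` that lies above `a`, together with an
  -- index of contact.
  largest-ratio : ∀ (a p : ℕ → Carrier) n → (∀ k → k ℕ.≤ n → 0# < p k) →
                  ∃ λ C → ∃ λ k₀ → k₀ ℕ.≤ n × a k₀ ≈ C * p k₀ × (∀ k → k ℕ.≤ n → a k ≤ C * p k)
  largest-ratio a p n pos = extend (maximum n ℕ.≤-refl)
    where
    ratio : ℕ → Carrier
    ratio k = a k * p k ⁻¹
    ratio-* : ∀ k → k ℕ.≤ n → a k ≈ ratio k * p k
    ratio-* k k≤n = sym (trans (solve 3 (λ a i p → a :* i :* p := p :* a :* i) refl (a k) _ _) (inv-cancel (>⇒≉ (pos k k≤n)) (a k)))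
    maximum : ∀ m → m ℕ.≤ n → ∃ λ k₀ → k₀ ℕ.≤ m × (∀ k → k ℕ.≤ m → ratio k ≤ ratio k₀)
    maximum zero    _   = 0 , z≤n , λ { .0 z≤n → ≤-refl }
    maximum (suc m) m<n = choose (maximum m (ℕ.<⇒≤ m<n))
      where
      choose : (∃ λ k₀ → k₀ ℕ.≤ m × (∀ k → k ℕ.≤ m → ratio k ≤ ratio k₀)) →
               ∃ λ k₀ → k₀ ℕ.≤ suc m × (∀ k → k ℕ.≤ suc m → ratio k ≤ ratio k₀)
      choose (k₀ , k₀≤m , max) = larger (≤-total (ratio k₀) (ratio (suc m)))
        where
        larger : ratio k₀ ≤ ratio (suc m) ⊎ ratio (suc m) ≤ ratio k₀ → _
        larger (inj₁ le) = suc m , ℕ.≤-refl , λ k k≤ → case (ℕ.m≤n⇒m<n∨m≡n k≤)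
          where
          case : ∀ {k} → k ℕ.< suc m ⊎ k ≡ suc m → ratio k ≤ ratio (suc m)
          case (inj₁ k<) = ≤-trans (max _ (ℕ.s≤s⁻¹ k<)) le
          case (inj₂ ≡.refl) = ≤-refl
        larger (inj₂ ge) = k₀ , ℕ.m≤n⇒m≤1+n k₀≤m , λ k k≤ → case (ℕ.m≤n⇒m<n∨m≡n k≤)
          where
          case : ∀ {k} → k ℕ.< suc m ⊎ k ≡ suc m → ratio k ≤ ratio k₀
          case (inj₁ k<) = max _ (ℕ.s≤s⁻¹ k<)
          case (inj₂ ≡.refl) = ge
    extend : (∃ λ k₀ → k₀ ℕ.≤ n × (∀ k → k ℕ.≤ n → ratio k ≤ ratio k₀)) → _
    extend (k₀ , k₀≤n , max) = ratio k₀ , k₀ , k₀≤n , ratio-* k₀ k₀≤n , λ k k≤n →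
      ≤-respˡ (sym (ratio-* k k≤n)) (≤-respˡ (*-comm _ _) (≤-respʳ (*-comm _ _) (*-monoˡ-≤ (inj₁ (pos k k≤n)) (max k k≤n))))

-- The intermediate value theorem for locally Lipschitz functions.
module Roots {c ℓ₁ ℓ₂} (F : CompleteOrderedField c ℓ₁ ℓ₂) where
  open CompleteOrderedField F hiding (zero)
  open IntegerSolver commutativeRing
  open OrderedField F
  open OrderedSums F
  open Sums commutativeRing

  Within : Carrier → Carrier → Set _
  Within d b = - b ≤ d × d ≤ b

  within-cong : ∀ {d d′ b} → d ≈ d′ → Within d b → Within d′ b
  within-cong eq (p , q) = ≤-respʳ eq p , ≤-respˡ eq q

  within-+ : ∀ {d e b c} → Within d b → Within e c → Within (d + e) (b + c)
  within-+ {b = b} {c} (p , q) (p′ , q′) = ≤-respˡ (solve 2 (λ b c → (:- b) :+ (:- c) := :- (b :+ c)) refl b c) (+-mono-≤ p p′) , +-mono-≤ q q′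

  private
    halve : ∀ {x} → 0# ≤ nat 2 * x → 0# ≤ x
    halve {x} 0≤2x = *-cancel-≤ (0<nat 1) (≤-respˡ (sym (zeroʳ _)) 0≤2x)

    upper : ∀ {d b} → Within d b → 0# ≤ b - d
    upper (_ , q) = ≤-diff q

    lower : ∀ {d b} → Within d b → 0# ≤ b + d
    lower {d} {b} (p , _) = ≤-respʳ (solve 2 (λ d b → d :- (:- b) := b :+ d) refl d b) (≤-diff p)

  -- Each of `b c + d e` and `b c - d e` is half a sum of two products of nonnegative factors
  -- `b ± d` and `c ± e`.
  within-* : ∀ {d e b c} → Within d b → Within e c → Within (d * e) (b * c)
  within-* {d} {e} {b} {c} w w′ =
    ≤-by (halve (≤-respʳ (solve 4 (λ d e b c → (b :- d) :* (c :- e) :+ (b :+ d) :* (c :+ e) := con (+ 2) :* (b :* c :+ d :* e)) refl d e b c)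
      (0≤+ (0≤* (upper w) (upper w′)) (0≤* (lower w) (lower w′))))) (solve 2 (λ x y → (:- x) :+ (x :+ y) := y) refl _ _) ,
    ≤-by (halve (≤-respʳ (solve 4 (λ d e b c → (b :- d) :* (c :+ e) :+ (b :+ d) :* (c :- e) := con (+ 2) :* (b :* c :- d :* e)) refl d e b c)
      (0≤+ (0≤* (upper w) (lower w′)) (0≤* (lower w) (upper w′))))) (solve 2 (λ x y → y :+ (x :- y) := x) refl _ _)

  magnitude : ∀ k → ∃ λ K → 0# ≤ K × Within k K
  magnitude k with ≤-total 0# k
  ... | inj₁ 0≤k = k , 0≤k , ≤-trans (≤-by 0≤k (-‿inverseˡ k)) 0≤k , ≤-refl
  ... | inj₂ k≤0 = - k , 0≤-k , inj₂ (solve 1 (λ k → :- (:- k) := k) refl k) , ≤-trans k≤0 0≤-k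
    where
    0≤-k : 0# ≤ - k
    0≤-k = ≤-respʳ (+-identityˡ _) (≤-diff k≤0)

  -- The restriction to `h ≤ 1#` makes the condition stable under multiplication by `x - 1#`, which
  -- is unbounded. With sums and scalar multiples this covers all entries of the recurrence, with no
  -- reference to coefficients.
  Lipschitz : (Carrier → Carrier) → Carrier → Set _
  Lipschitz f r = ∃ λ M → 0# ≤ M × (∀ y h → 0# ≤ h → h ≤ 1# → Within y h → Within (f (r + y) - f r) (M * h))

  lipschitz-resp : ∀ {f g r} → (∀ x → f x ≈ g x) → Lipschitz f r → Lipschitz g r
  lipschitz-resp eq (M , 0≤M , lip) = M , 0≤M , λ y h 0≤h h≤1 y∈h → within-cong (+-cong (eq _) (-‿cong (eq _))) (lip y h 0≤h h≤1 y∈h)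

  lipschitz-const : ∀ k r → Lipschitz (λ _ → k) r
  lipschitz-const k r = 0# , ≤-refl , λ y h _ _ _ →
    inj₂ (solve 2 (λ k h → :- (con (+ 0) :* h) := k :- k) refl k h) , inj₂ (solve 2 (λ k h → k :- k := con (+ 0) :* h) refl k h)

  lipschitz-+ : ∀ {f g r} → Lipschitz f r → Lipschitz g r → Lipschitz (λ x → f x + g x) r
  lipschitz-+ {f} {g} {r} (M , 0≤M , lf) (N , 0≤N , lg) = M + N , 0≤+ 0≤M 0≤N , λ y h 0≤h h≤1 y∈h →
    within-cong (solve 4 (λ a b c d → (a :- b) :+ (c :- d) := (a :+ c) :- (b :+ d)) refl (f (r + y)) (f r) (g (r + y)) (g r))
      (within-resp (within-+ (lf y h 0≤h h≤1 y∈h) (lg y h 0≤h h≤1 y∈h)) (sym (distribʳ h M N)))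
    where
    within-resp : ∀ {d b b′} → Within d b → b ≈ b′ → Within d b′
    within-resp (p , q) eq = ≤-respˡ (-‿cong eq) p , ≤-respʳ eq q

  lipschitz-* : ∀ {f r} k → Lipschitz f r → Lipschitz (λ x → k * f x) r
  lipschitz-* {f} {r} k (M , 0≤M , lf) = scale (magnitude k)
    where
    scale : (∃ λ K → 0# ≤ K × Within k K) → Lipschitz (λ x → k * f x) r
    scale (K , 0≤K , k∈K) = K * M , 0≤* 0≤K 0≤M , λ y h 0≤h h≤1 y∈h →
      let p , q = within-* k∈K (lf y h 0≤h h≤1 y∈h)
          eq = solve 3 (λ k a b → k :* (a :- b) := k :* a :- k :* b) refl k (f (r + y)) (f r)
      in within-cong eq (≤-respˡ (-‿cong (sym (*-assoc K M h))) p , ≤-respʳ (sym (*-assoc K M h)) q)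

  lipschitz-∑ : ∀ n (f : ℕ → Carrier → Carrier) {r} → (∀ j → Lipschitz (f j) r) → Lipschitz (λ x → ∑< n (λ j → f j x)) r
  lipschitz-∑ zero    f {r} lf = lipschitz-const 0# r
  lipschitz-∑ (suc n) f {r} lf = lipschitz-+ {f 0} {λ x → ∑< n (λ j → f (suc j) x)} (lf 0) (lipschitz-∑ n (f ∘ suc) (lf ∘ suc))

  lipschitz-shift : ∀ {f r} → Lipschitz f r → Lipschitz (λ x → (x - 1#) * f x) r
  lipschitz-shift {f} {r} (M , 0≤M , lf) = build (magnitude (r - 1#)) (magnitude (f r))
    where
    build : (∃ λ K → 0# ≤ K × Within (r - 1#) K) → (∃ λ L → 0# ≤ L × Within (f r) L) → Lipschitz (λ x → (x - 1#) * f x) r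
    build (K , 0≤K , r∈K) (L , 0≤L , fr∈L) = (K + 1#) * M + L , 0≤+ (0≤* (0≤+ 0≤K (inj₁ 0<1)) 0≤M) 0≤L , λ y h 0≤h h≤1 y∈h →
      let y∈1 : Within y 1#
          y∈1 = ≤-trans (≤-by (≤-diff h≤1) (solve 2 (λ h o → (:- o) :+ (o :- h) := :- h) refl h 1#)) (proj₁ y∈h) , ≤-trans (proj₂ y∈h) h≤1
          p , q = within-+ (within-* (within-+ r∈K y∈1) (lf y h 0≤h h≤1 y∈h)) (within-* y∈h fr∈L)
          b≈ = solve 4 (λ K M L h → (K :+ con (+ 1)) :* (M :* h) :+ h :* L := ((K :+ con (+ 1)) :* M :+ L) :* h) refl K M L h
          d≈ = solve 4 (λ r y a b → (r :- con (+ 1) :+ y) :* (a :- b) :+ y :* b := (r :+ y :- con (+ 1)) :* a :- (r :- con (+ 1)) :* b) refl r y (f (r + y)) (f r)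
      in within-cong d≈ (≤-respˡ (-‿cong b≈) p , ≤-respʳ b≈ q)

  small-step : ∀ {M c} → 0# ≤ M → 0# < c → ∃ λ h → 0# < h × h ≤ 1# × M * h < c
  small-step {M} {c} 0≤M 0<c = h , 0<h , ≤-by (0≤* (0≤+ 0≤M (inj₁ 0<1)) (inj₁ 0<i)) sum≈1 , <-by (*-pos (0<+ 0<c (inj₁ 0<1)) 0<h) total
    where
    -- `h = c / (c + M + 1)` is at most 1, and `M h` falls short of `c` by `(c + 1) h`.
    D i h : Carrier
    D = c + (M + 1#)
    i = D ⁻¹
    h = c * i
    0<D : 0# < D
    0<D = 0<+ 0<c (0≤+ 0≤M (inj₁ 0<1))
    0<i : 0# < i
    0<i = inv-pos 0<D
    0<h : 0# < h
    0<h = *-pos 0<c 0<i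
    Di≈1 : D * i ≈ 1#
    Di≈1 = ⁻¹-inverseʳ D (>⇒≉ 0<D)
    sum≈1 : h + (M + 1#) * i ≈ 1#
    sum≈1 = trans (solve 3 (λ c i m → c :* i :+ m :* i := (c :+ m) :* i) refl c i (M + 1#)) Di≈1
    total : M * h + (c + 1#) * h ≈ c
    total = trans (solve 3 (λ c M i → M :* (c :* i) :+ (c :+ con (+ 1)) :* (c :* i) := c :* ((c :+ (M :+ con (+ 1))) :* i)) refl c M i)
      (trans (*-congˡ Di≈1) (*-identityʳ c))

  -- `ρ` is the supremum of the points from `lo` on at which `f` is at most zero. By the Lipschitz
  -- bound, a negative value at `ρ` would persist to the right of it, and a positive one would allow
  -- a smaller upper bound.
  last-root : ∀ (f : Carrier → Carrier) → (∀ {x y} → x ≈ y → f x ≈ f y) → (∀ r → Lipschitz f r) →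
              ∀ lo B → f lo < 0# → (∀ x → B ≤ x → 0# < f x) →
              ∃ λ ρ → lo < ρ × f ρ ≈ 0# × (∀ x → ρ < x → 0# < f x)
  last-root f f-cong lip lo B f-lo f-B = finish (supremum S (lo , lift (inj₁ f-lo , ≤-refl)) (B , bounded))
    where
    S : Carrier → Set (c ⊔ ℓ₁ ⊔ ℓ₂)
    S x = Lift (c ⊔ ℓ₁ ⊔ ℓ₂) (f x ≤ 0# × lo ≤ x)
    bounded : ∀ x → S x → x ≤ B
    bounded x (lift (fx≤0 , _)) = ≮⇒≥ (λ B<x → ≤⇒≯ fx≤0 (f-B x (inj₁ B<x)))
    finish : (∃ λ s → (∀ x → S x → x ≤ s) × (∀ u → (∀ x → S x → x ≤ u) → s ≤ u)) →
             ∃ λ ρ → lo < ρ × f ρ ≈ 0# × (∀ x → ρ < x → 0# < f x)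
    finish (ρ , upper-ρ , least-ρ) = ρ , lo<ρ , fρ≈0 , beyond
      where
      lo≤ρ : lo ≤ ρ
      lo≤ρ = upper-ρ lo (lift (inj₁ f-lo , ≤-refl))
      beyond : ∀ x → ρ < x → 0# < f x
      beyond x ρ<x with compare 0# (f x)
      ... | tri< 0<fx _ _ = 0<fx
      ... | tri≈ _ 0≈fx _ = contradiction ρ<x (≤⇒≯ (upper-ρ x (lift (inj₂ (sym 0≈fx) , ≤-trans lo≤ρ (inj₁ ρ<x)))))
      ... | tri> _ _ fx<0 = contradiction ρ<x (≤⇒≯ (upper-ρ x (lift (inj₁ fx<0 , ≤-trans lo≤ρ (inj₁ ρ<x)))))
      not-neg : ¬ (f ρ < 0#)
      not-neg fρ<0 = refute (lip ρ)
        where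
        0<c : 0# < - f ρ
        0<c = <-respʳ-≈ (+-identityˡ _) (<-diff fρ<0)
        refute : ¬ Lipschitz f ρ
        refute (M , 0≤M , l) = go (small-step 0≤M 0<c)
          where
          go : ¬ (∃ λ h → 0# < h × h ≤ 1# × M * h < - f ρ)
          go (h , 0<h , h≤1 , Mh<c) = ≤⇒≯ (≤-respˡ (solve 2 (λ a b → (a :- b) :+ b := a) refl (f (ρ + h)) (f ρ))
              (≤-respʳ (-‿inverseˡ (f ρ)) (+-mono-≤ (≤-trans (proj₂ (l h h (inj₁ 0<h) h≤1 (≤-trans (≤-by (inj₁ 0<h) (-‿inverseˡ h)) (inj₁ 0<h) , ≤-refl))) (inj₁ Mh<c)) ≤-refl)))
            (beyond (ρ + h) (<-by 0<h refl))
      not-pos : ¬ (0# < f ρ)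
      not-pos 0<fρ = refute (lip ρ)
        where
        refute : ¬ Lipschitz f ρ
        refute (M , 0≤M , l) = go (small-step 0≤M 0<fρ)
          where
          go : ¬ (∃ λ h → 0# < h × h ≤ 1# × M * h < f ρ)
          go (h , 0<h , h≤1 , Mh<c) = ≤⇒≯ (least-ρ (ρ - h) bound) (<-by 0<h (solve 2 (λ ρ h → (ρ :- h) :+ h := ρ) refl ρ h))
            where
            bound : ∀ x → S x → x ≤ ρ - h
            bound x Sx@(lift (fx≤0 , _)) = ≮⇒≥ (λ ρ-h<x → ≤⇒≯ fx≤0 (positive ρ-h<x (upper-ρ x Sx)))
              where
              positive : ρ - h < x → x ≤ ρ → 0# < f x
              positive ρ-h<x x≤ρ = <-≤-trans (<-diff Mh<c) (≤-respʳ (f-cong (solve 2 (λ ρ x → ρ :+ (x :- ρ) := x) refl ρ x))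
                (≤-respˡ (solve 2 (λ a b → (:- b) :+ a := a :- b) refl (f ρ) (M * h)) (≤-respʳ (solve 2 (λ a b → (a :- b) :+ b := a) refl (f (ρ + (x - ρ))) (f ρ))
                  (+-mono-≤ (proj₁ (l (x - ρ) h (inj₁ 0<h) h≤1
                    (inj₁ (<-by (<-diff ρ-h<x) (solve 3 (λ ρ h x → (:- h) :+ (x :- (ρ :- h)) := x :- ρ) refl ρ h x)) ,
                     ≤-trans (≤-by (≤-diff x≤ρ) (solve 2 (λ x ρ → (x :- ρ) :+ (ρ :- x) := con (+ 0)) refl x ρ)) (inj₁ 0<h)))) ≤-refl))))
      fρ≈0 : f ρ ≈ 0#
      fρ≈0 with compare (f ρ) 0#
      ... | tri< fρ<0 _ _ = contradiction fρ<0 not-neg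
      ... | tri≈ _ eq _   = eq
      ... | tri> _ _ 0<fρ = contradiction 0<fρ not-pos
      lo<ρ : lo < ρ
      lo<ρ = strict lo≤ρ
        where
        strict : lo ≤ ρ → lo < ρ
        strict (inj₁ lt) = lt
        strict (inj₂ eq) = contradiction f-lo (≤⇒≯ (inj₂ (sym (trans (f-cong eq) fρ≈0))))

-- Largest zero and comparison with a nonnegative recurrence

module Dominance {c ℓ₁ ℓ₂} (F : CompleteOrderedField c ℓ₁ ℓ₂) (κ : ℕ → ℕ → ℕ)
                 (κ-start : 1 ℕ.≤ κ 0 0) (κ-second : ∀ n → 1 ℕ.≤ κ (suc n) 1) where
  open CompleteOrderedField F hiding (zero)
  open IntegerSolver commutativeRing
  open OrderedField F
  open OrderedSums F
  open Roots F
  open Sums commutativeRing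
  open SetoidReasoning setoid
  open Recurrence κ commutativeRing

  nat-cancel : ∀ k {y z} → nat (suc k) * y ≈ nat (suc k) * z → y ≈ z
  nat-cancel k = *-cancelˡ (>⇒≉ (0<nat k))

  module _ (u : ℕ → Carrier → Carrier) (solution : ∀ x → Solution x (λ k → u k x)) where
    private
      module Sol x = Solution (solution x)

    u-cong : ∀ k {x y} → x ≈ y → u k x ≈ u k y
    u-cong k {x} {y} x≈y = unique nat-cancel x≈y (solution x) (solution y) k

    private
      u-next : ∀ n x → u (suc n) x ≈ nat (2 ℕ.+ n) ⁻¹ * ((x - 1#) * u n x + - 1# * rest (λ k → u k x) n)
      u-next n x = sym (begin
        i * ((x - 1#) * u n x + - 1# * r)  ≈⟨ *-congˡ (+-congʳ (Sol.step x n)) ⟩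
        i * ((d * v + r) + - 1# * r)       ≈⟨ solve 4 (λ i d v r → i :* ((d :* v :+ r) :+ (:- con (+ 1)) :* r) := d :* v :* i) refl i d v r ⟩
        d * v * i                          ≈⟨ inv-cancel (>⇒≉ (0<nat (suc n))) v ⟩
        v                                  ∎)
        where
        d = nat (2 ℕ.+ n)
        i = d ⁻¹
        v = u (suc n) x
        r = rest (λ k → u k x) n

    lipschitz : ∀ k r → Lipschitz (u k) r
    lipschitz k r = agree k k ℕ.≤-refl
      where
      agree : ∀ n k → k ℕ.≤ n → Lipschitz (u k) r
      agree n       zero    _ = lipschitz-resp {λ _ → 1#} (λ x → sym (Sol.start x)) (lipschitz-const 1# r)
      agree (suc n) (suc k) (s≤s k≤n) = lipschitz-resp {λ x → nat (2 ℕ.+ k) ⁻¹ * ((x - 1#) * u k x + - 1# * rest (λ k → u k x) k)} (λ x → sym (u-next k x))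
        (lipschitz-* {λ x → (x - 1#) * u k x + - 1# * rest (λ k → u k x) k} _
          (lipschitz-+ {λ x → (x - 1#) * u k x} {λ x → - 1# * rest (λ k → u k x) k} (lipschitz-shift {u k} (agree n k k≤n))
            (lipschitz-* {λ x → rest (λ k → u k x) k} (- 1#) (lipschitz-∑ (suc k) (λ j x → nat (κ k j) * u (k ℕ.∸ j) x)
              (λ j → lipschitz-* {u (k ℕ.∸ j)} (nat (κ k j)) (agree n (k ℕ.∸ j) (ℕ.≤-trans (ℕ.m∸n≤m k j) k≤n)))))))

    private
      Increasing : ℕ → Carrier → Set _
      Increasing n x = ∀ k → k ℕ.< n → u k x ≤ u (suc k) x

      increasing-≤ : ∀ {n x} → Increasing n x → ∀ i d → i ℕ.+ d ℕ.≤ n → u i x ≤ u (i ℕ.+ d) x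
      increasing-≤ {x = x} inc i zero    le = inj₂ (reflexive (≡.cong (λ k → u k x) (≡.sym (ℕ.+-identityʳ i))))
      increasing-≤ {n} {x} inc i (suc d) le = ≤-trans (increasing-≤ inc i d (ℕ.<⇒≤ le′)) (≤-respʳ (reflexive (≡.cong (λ k → u k x) (≡.sym (ℕ.+-suc i d)))) (inc (i ℕ.+ d) le′))
        where
        le′ : i ℕ.+ d ℕ.< n
        le′ = ≡.subst (ℕ._≤ n) (ℕ.+-suc i d) le

      increasing-pos : ∀ {n x} → Increasing n x → ∀ k → k ℕ.≤ n → 0# < u k x
      increasing-pos {x = x} inc k k≤n = <-≤-trans (<-respʳ-≈ (sym (Sol.start x)) 0<1) (increasing-≤ inc 0 k k≤n)

      large : ∀ n → ∃ λ B → 0# ≤ B × (∀ x → B ≤ x → Increasing n x)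
      large zero    = 0# , ≤-refl , λ x _ k ()
      large (suc n) = next (large n)
        where
        Σκ : Carrier
        Σκ = ∑< (suc n) (λ j → nat (κ n j))
        0≤Σκ : 0# ≤ Σκ
        0≤Σκ = ∑<-nonneg (suc n) (λ j _ → 0≤nat (κ n j))
        C : Carrier
        -- While the entries increase, `rest` is at most `Σκ * u n x`, so
        -- `(n + 2) uₙ₊₁ = (x - 1) uₙ - rest` is at least `(n + 2) uₙ` as soon as `x` is at least
        -- this constant.
        C = 1# + (Σκ + nat (2 ℕ.+ n))
        0≤C : 0# ≤ C
        0≤C = 0≤+ (inj₁ 0<1) (0≤+ 0≤Σκ (0≤nat (2 ℕ.+ n)))
        next : (∃ λ B → 0# ≤ B × (∀ x → B ≤ x → Increasing n x)) → ∃ λ B → 0# ≤ B × (∀ x → B ≤ x → Increasing (suc n) x)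
        next (B , 0≤B , inc) = B + C , 0≤+ 0≤B 0≤C , λ x B+C≤x k k≤n → case x B+C≤x (ℕ.m≤n⇒m<n∨m≡n (ℕ.s≤s⁻¹ k≤n))
          where
          case : ∀ x → B + C ≤ x → ∀ {k} → k ℕ.< n ⊎ k ≡ n → u k x ≤ u (suc k) x
          case x B+C≤x (inj₁ k<n) = inc x (≤-trans (≤-by 0≤C refl) B+C≤x) _ k<n
          case x B+C≤x (inj₂ ≡.refl) = *-cancel-≤ (0<nat (suc n)) (≤-by (0≤+ (0≤* (≤-diff C≤x) (inj₁ (pos n ℕ.≤-refl))) (≤-diff rest≤)) (begin
              d * u n x + ((x - C) * u n x + (Σκ * u n x - r))
                ≈⟨ solve 5 (λ d v x s r → d :* v :+ ((x :- (con (+ 1) :+ (s :+ d))) :* v :+ (s :* v :- r)) := (x :- con (+ 1)) :* v :- r) refl d (u n x) x Σκ r ⟩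
              (x - 1#) * u n x - r     ≈⟨ +-congʳ (Sol.step x n) ⟩
              (d * u (suc n) x + r) - r ≈⟨ solve 2 (λ a r → (a :+ r) :- r := a) refl _ r ⟩
              d * u (suc n) x ∎))
            where
            d r : Carrier
            d = nat (2 ℕ.+ n)
            r = rest (λ k → u k x) n
            C≤x : C ≤ x
            C≤x = ≤-trans (≤-by 0≤B (+-comm C B)) B+C≤x
            incx : Increasing n x
            incx = inc x (≤-trans (≤-by 0≤C refl) B+C≤x)
            pos : ∀ k → k ℕ.≤ n → 0# < u k x
            pos = increasing-pos incx
            rest≤ : r ≤ Σκ * u n x
            rest≤ = ≤-trans (∑<-mono (suc n) (λ j j≤n → *-monoˡ-≤ (0≤nat (κ n j))
                (≤-respʳ (reflexive (≡.cong (λ k → u k x) (ℕ.m∸n+n≡m (ℕ.s≤s⁻¹ j≤n)))) (increasing-≤ incx (n ℕ.∸ j) j (ℕ.≤-reflexive (ℕ.m∸n+n≡m (ℕ.s≤s⁻¹ j≤n)))))))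
              (inj₂ (trans (∑<-cong (suc n) (λ j _ → *-comm (nat (κ n j)) (u n x))) (trans (∑<-* (suc n) (u n x) (λ j → nat (κ n j))) (*-comm _ _))))

    -- A starting point for the search of the largest zero of `u (suc n)`: to its right the earlier
    -- entries are positive, and `u (suc n)` is still negative on it.
    record Barrier (n : ℕ) : Set (c ⊔ ℓ₁ ⊔ ℓ₂) where
      field
        ρ        : Carrier
        1≤ρ      : 1# ≤ ρ
        negative : u (suc n) ρ < 0#
        positive : ∀ k → k ℕ.≤ n → ∀ x → ρ < x → 0# < u k x

    record LargestRoot (n : ℕ) : Set (c ⊔ ℓ₁ ⊔ ℓ₂) where
      field
        ρ        : Carrier
        1<ρ      : 1# < ρ
        root     : u (suc n) ρ ≈ 0#
        positive : ∀ k → k ℕ.≤ n → 0# < u k ρ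
        beyond   : ∀ k → k ℕ.≤ suc n → ∀ x → ρ < x → 0# < u k x

    largestRoot : ∀ n → Barrier n → LargestRoot n
    largestRoot n b = build (large (suc n))
      where
      open Barrier b
      build : (∃ λ B → 0# ≤ B × (∀ x → B ≤ x → Increasing (suc n) x)) → LargestRoot n
      build (B , _ , inc) = conclude (last-root (u (suc n)) (u-cong (suc n)) (lipschitz (suc n)) ρ B negative (λ x B≤x → increasing-pos (inc x B≤x) (suc n) ℕ.≤-refl))
        where
        conclude : (∃ λ r → ρ < r × u (suc n) r ≈ 0# × (∀ x → r < x → 0# < u (suc n) x)) → LargestRoot n
        conclude (r , ρ<r , root , beyond) = record
          { ρ = r ; 1<ρ = ≤-<-trans 1≤ρ ρ<r ; root = root ; positive = λ k k≤n → positive k k≤n r ρ<r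
          ; beyond = λ k k≤ x r<x → case x r<x (ℕ.m≤n⇒m<n∨m≡n k≤) }
          where
          case : ∀ x → r < x → ∀ {k} → k ℕ.< suc n ⊎ k ≡ suc n → 0# < u k x
          case x r<x (inj₁ k<)      = positive _ (ℕ.s≤s⁻¹ k<) x (<-trans ρ<r r<x)
          case x r<x (inj₂ ≡.refl) = beyond x r<x

    private
      negative-step : ∀ n x → (x - 1#) * u n x ≈ 0# → 0# < rest (λ k → u k x) n → u (suc n) x < 0#
      negative-step n x eq 0<r = *-cancel-neg (0<nat (suc n)) (<-respˡ-≈ (sym (begin
        nat (2 ℕ.+ n) * u (suc n) x
          ≈⟨ solve 2 (λ a r → a := (a :+ r) :- r) refl _ (rest (λ k → u k x) n) ⟩
        (nat (2 ℕ.+ n) * u (suc n) x + rest (λ k → u k x) n) - rest (λ k → u k x) n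
          ≈⟨ +-congʳ (trans (sym (Sol.step x n)) eq) ⟩
        0# - rest (λ k → u k x) n
          ≈⟨ +-identityˡ _ ⟩
        - rest (λ k → u k x) n ∎)) (neg-pos 0<r))

      0<nat′ : ∀ {n} → 1 ℕ.≤ n → 0# < nat n
      0<nat′ {suc n} _ = 0<nat n

    -- At the largest zero of `u (suc n)` the left side of the recurrence vanishes, so `u (2 + n)`
    -- has the opposite sign of `rest`. There the term `j = 0` vanishes as well, and `j = 1` is
    -- positive by `κ-second`. Hence the largest zeros move to the right with the index, and the
    -- earlier entries are positive at the new one.
    barrier : ∀ n → Barrier n
    barrier zero = record
      { ρ        = 1#
      ; 1≤ρ      = ≤-refl
      ; negative = negative-step 0 1# (trans (*-congʳ (-‿inverseʳ 1#)) (zeroˡ _))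
                     (0<+ (*-pos (0<nat′ κ-start) (<-respʳ-≈ (sym (Sol.start 1#)) 0<1)) ≤-refl)
      ; positive = λ { .0 z≤n x _ → <-respʳ-≈ (sym (Sol.start x)) 0<1 }
      }
    barrier (suc n) = record
      { ρ        = ρ
      ; 1≤ρ      = inj₁ 1<ρ
      ; negative = negative-step (suc n) ρ (trans (*-congˡ root) (zeroʳ _)) (<-respʳ-≈ (sym (trans (+-congʳ (trans (*-congˡ root) (zeroʳ _))) (+-identityˡ _)))
                     (0<+ (*-pos (0<nat′ (κ-second n)) (positive n ℕ.≤-refl))
                       (∑<-nonneg n (λ j _ → 0≤* (0≤nat (κ (suc n) (2 ℕ.+ j))) (inj₁ (positive (n ℕ.∸ suc j) (ℕ.m∸n≤m n (suc j))))))))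
      ; positive = beyond
      }
      where open LargestRoot (largestRoot n (barrier n))

  module _ {ρ} {p : ℕ → Carrier} (sol : Solution ρ p) (1<ρ : 1# < ρ) n (root : p (suc n) ≈ 0#) (pos : ∀ k → k ℕ.≤ n → 0# < p k) where
    private
      -- As the coefficients are nonnegative, a bound by `C p` passes through the matrix, of which
      -- `p` is an eigenvector.
      compare-rest : ∀ {C} (a : ℕ → Carrier) → (∀ k → k ℕ.≤ suc n → a k ≤ C * p k) → ∀ k → k ℕ.≤ n →
                     nat (2 ℕ.+ k) * a (suc k) + rest a k ≤ C * ((ρ - 1#) * p k)
      compare-rest {C} a bound k k≤n = ≤-trans
        (+-mono-≤ (*-monoˡ-≤ (0≤nat (2 ℕ.+ k)) (bound (suc k) (s≤s k≤n)))
          (∑<-mono (suc k) (λ j _ → *-monoˡ-≤ (0≤nat (κ k j)) (bound (k ℕ.∸ j) (ℕ.≤-trans (ℕ.m∸n≤m k j) (ℕ.m≤n⇒m≤1+n k≤n))))))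
        (inj₂ (begin
          nat (2 ℕ.+ k) * (C * p (suc k)) + ∑< (suc k) (λ j → nat (κ k j) * (C * p (k ℕ.∸ j)))
            ≈⟨ +-cong (solve 3 (λ d c p → d :* (c :* p) := c :* (d :* p)) refl (nat (2 ℕ.+ k)) C (p (suc k)))
                 (trans (∑<-cong (suc k) (λ j _ → solve 3 (λ d c p → d :* (c :* p) := c :* (d :* p)) refl (nat (κ k j)) C (p (k ℕ.∸ j))))
                   (∑<-* (suc k) C (λ j → nat (κ k j) * p (k ℕ.∸ j)))) ⟩
          C * (nat (2 ℕ.+ k) * p (suc k)) + C * rest p k
            ≈⟨ distribˡ C _ _ ⟨
          C * (nat (2 ℕ.+ k) * p (suc k) + rest p k)
            ≈⟨ *-congˡ (Solution.step sol k) ⟨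
          C * ((ρ - 1#) * p k) ∎))

      all-bounds : ∀ {C} (a : ℕ → Carrier) → a (suc n) ≈ 0# → (∀ k → k ℕ.≤ n → a k ≤ C * p k) → ∀ k → k ℕ.≤ suc n → a k ≤ C * p k
      all-bounds {C} a a-root bound k k≤ = case (ℕ.m≤n⇒m<n∨m≡n k≤)
        where
        case : k ℕ.< suc n ⊎ k ≡ suc n → a k ≤ C * p k
        case (inj₁ k<)      = bound k (ℕ.s≤s⁻¹ k<)
        case (inj₂ ≡.refl) = inj₂ (trans a-root (sym (trans (*-congˡ root) (zeroʳ C))))

    -- q is the derivative of p with respect to ρ.
    no-double-root : ∀ (q : ℕ → Carrier) → (∀ k → (ρ - 1#) * q k + p k ≈ nat (2 ℕ.+ k) * q (suc k) + rest q k) → ¬ (q (suc n) ≈ 0#)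
    no-double-root q step q-root = refute (largest-ratio q p n pos)
      where
      refute : ¬ (∃ λ C → ∃ λ k₀ → k₀ ℕ.≤ n × q k₀ ≈ C * p k₀ × (∀ k → k ℕ.≤ n → q k ≤ C * p k))
      -- At the index of the largest ratio, the comparison bounds the right side of `step` by
      -- `(ρ - 1#) * q k₀`, whereas the left side exceeds this by `p k₀ > 0`.
      refute (C , k₀ , k₀≤n , eq , bound) = ≤⇒≯
        (≤-respˡ (sym (step k₀)) (compare-rest q (all-bounds q q-root bound) k₀ k₀≤n))
        (<-by (pos k₀ k₀≤n) (+-congʳ (trans (solve 3 (λ c x p → c :* (x :* p) := x :* (c :* p)) refl C (ρ - 1#) (p k₀)) (*-congˡ (sym eq)))))

    open ComplexNumbers F using (ℂ; fromReal)
    open Complex F using (complexCommutativeRing; norm²; realHom; module Modulus)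
    private
      module ℂR = CommutativeRing complexCommutativeRing
      module ℂS = IntegerSolver complexCommutativeRing
      module Recℂ = Recurrence κ complexCommutativeRing

    module _ (∣_∣ : ℂ → Carrier) (∣∣-nonneg : ∀ z → 0# ≤ ∣ z ∣) (∣∣-square : ∀ z → ∣ z ∣ * ∣ z ∣ ≈ norm² z) where
      open Modulus ∣_∣ ∣∣-nonneg ∣∣-square

      -- By the triangle inequality the moduli satisfy the recurrence as an inequality with factor
      -- `∣ z - 1 ∣`. At the index of the largest ratio to `p` this is compared with the factor
      -- `ρ - 1#`, and the positive modulus there is cancelled.
      modulus-bound : ∀ {z} {v : ℕ → ℂ} → Recℂ.Solution z v → v (suc n) ℂR.≈ ℂR.0# → ∣ z ℂR.- ℂR.1# ∣ ≤ ρ - 1#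
      modulus-bound {z} {v} sv v-root = conclude (largest-ratio (λ k → ∣ v k ∣) p n pos)
        where
        natℂ : ∀ m → ℂS.nat m ℂR.≈ fromReal (nat m)
        natℂ m = ℂR.sym (Evaluation.ι-nat realHom m)
        ∣nat∣ : ∀ m w → ∣ ℂS.nat m ℂR.* w ∣ ≈ nat m * ∣ w ∣
        ∣nat∣ m w = trans (∣∣-* (ℂS.nat m) w) (*-congʳ (trans (∣∣-cong (natℂ m)) (∣∣-real (0≤nat m))))
        recurrence : ∀ k → ∣ z ℂR.- ℂR.1# ∣ * ∣ v k ∣ ≤ nat (2 ℕ.+ k) * ∣ v (suc k) ∣ + rest (λ k → ∣ v k ∣) k
        recurrence k = ≤-respˡ (trans (∣∣-cong (ℂR.sym (Recℂ.Solution.step sv k))) (∣∣-* (z ℂR.- ℂR.1#) (v k)))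
          (≤-trans (∣∣-+ (ℂS.nat (2 ℕ.+ k) ℂR.* v (suc k)) (Recℂ.rest v k)) (+-mono-≤ (inj₂ (∣nat∣ (2 ℕ.+ k) (v (suc k))))
            (≤-trans (∣∣-∑ (suc k) (λ j → ℂS.nat (κ k j) ℂR.* v (k ℕ.∸ j))) (inj₂ (∑<-cong (suc k) (λ j _ → ∣nat∣ (κ k j) (v (k ℕ.∸ j))))))))
        conclude : (∃ λ C → ∃ λ k₀ → k₀ ℕ.≤ n × ∣ v k₀ ∣ ≈ C * p k₀ × (∀ k → k ℕ.≤ n → ∣ v k ∣ ≤ C * p k)) → ∣ z ℂR.- ℂR.1# ∣ ≤ ρ - 1#
        conclude (C , k₀ , k₀≤n , eq , bound) = *-cancel-≤ 0<v (≤-respˡ (*-comm _ _) (≤-trans (recurrence k₀)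
          (≤-trans (compare-rest (λ k → ∣ v k ∣) (all-bounds (λ k → ∣ v k ∣) (trans (∣∣-cong v-root) (∣∣-real ≤-refl)) bound) k₀ k₀≤n)
            (inj₂ (trans (solve 3 (λ c x p → c :* (x :* p) := (c :* p) :* x) refl C (ρ - 1#) (p k₀)) (*-congʳ (sym eq)))))))
          where
          -- The first entry of `v` has modulus 1, so the dominating multiple of `p` cannot be zero
          -- or negative; it makes the contact entry of `v` nonzero.
          0<C : 0# < C
          0<C with compare 0# C
          ... | tri< 0<C _ _ = 0<C
          ... | tri≈ _ 0≈C _ = contradiction (≤-trans ∣v₀∣≥1 (≤-trans (bound 0 z≤n) (inj₂ (trans (*-congʳ (sym 0≈C)) (zeroˡ _))))) (λ le → ≤⇒≯ le 0<1)
            where ∣v₀∣≥1 = inj₂ (sym (trans (∣∣-cong (Recℂ.Solution.start sv)) (∣∣-real (inj₁ 0<1))))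
          ... | tri> _ _ C<0 = contradiction (≤-trans ∣v₀∣≥1 (bound 0 z≤n)) (λ le → ≤⇒≯ le (<-trans
              (<-by (*-pos (<-respʳ-≈ (+-identityˡ _) (<-diff C<0)) (pos 0 z≤n)) (solve 2 (λ c p → c :* p :+ (:- c) :* p := con (+ 0)) refl C (p 0))) 0<1))
            where ∣v₀∣≥1 = inj₂ (sym (trans (∣∣-cong (Recℂ.Solution.start sv)) (∣∣-real (inj₁ 0<1))))
          0<v : 0# < ∣ v k₀ ∣
          0<v = <-respʳ-≈ (sym eq) (*-pos 0<C (pos k₀ k₀≤n))

module LinearFactor {c ℓ} (R : CommutativeRing c ℓ) where
  open CommutativeRing R hiding (zero)
  open IntegerSolver R
  open Polynomials rawRing
  open Division R
  open SetoidReasoning setoid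

  private
    coeff-⊕ : ∀ p q k → coeff (p ⊕ q) k ≈ coeff p k + coeff q k
    coeff-⊕ []      q       k       = sym (+-identityˡ _)
    coeff-⊕ (a ∷ p) []      k       = sym (+-identityʳ _)
    coeff-⊕ (a ∷ p) (b ∷ q) zero    = refl
    coeff-⊕ (a ∷ p) (b ∷ q) (suc k) = coeff-⊕ p q k

    coeff-· : ∀ a p k → coeff (a · p) k ≈ a * coeff p k
    coeff-· a []      k       = sym (zeroʳ a)
    coeff-· a (b ∷ p) zero    = refl
    coeff-· a (b ∷ p) (suc k) = coeff-· a p k

    coeff-linear : ∀ a b q k → coeff ((a ∷ b ∷ []) ⊗ q) k ≈ a * coeff q k + coeff (0# ∷ b · q) k
    coeff-linear a b q k = trans (coeff-⊕ (a · q) _ k) (+-cong (coeff-· a q k) (shifted k))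
      where
      shifted : ∀ k → coeff (0# ∷ (b · q ⊕ (0# ∷ []))) k ≈ coeff (0# ∷ b · q) k
      shifted zero    = refl
      shifted (suc k) = trans (coeff-⊕ (b · q) (0# ∷ []) k) (trans (+-congˡ (zeros k)) (+-identityʳ _))
        where
        zeros : ∀ k → coeff (0# ∷ []) k ≈ 0#
        zeros zero    = refl
        zeros (suc k) = refl

  -- Synthetic division provides the cofactor; the hypothesis on `α` is used for the constant
  -- coefficient, the others being `quotient-coeff`.
  factor : ∀ p α → eval p α ≈ 0# → ∃ λ q → p ≋ (X- α) ^ 1 ⊗ q
  factor []      α _    = [] , λ k → sym (trans (coeff-linear (- α * 1# + 0#) (1# * 1# + 0#) [] k) (trans (+-cong (zeroʳ _) (zeros k)) (+-identityˡ 0#)))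
    where
    zeros : ∀ k → coeff (0# ∷ []) k ≈ 0#
    zeros zero    = refl
    zeros (suc k) = refl
  factor (a ∷ p) α root = q , coefficients
    where
    q : Poly
    q = quotient p α
    coefficients : (a ∷ p) ≋ (X- α) ^ 1 ⊗ q
    coefficients zero = sym (begin
      coeff ((X- α) ^ 1 ⊗ q) 0                     ≈⟨ coeff-linear _ _ q 0 ⟩
      (- α * 1# + 0#) * coeff q 0 + 0#             ≈⟨ solve 2 (λ α q → (:- α :* con (+ 1) :+ con (+ 0)) :* q :+ con (+ 0) := :- (α :* q)) refl α (coeff q 0) ⟩
      - (α * coeff q 0)                            ≈⟨ solve 2 (λ a x → :- x := a :- (a :+ x)) refl a _ ⟩
      a - (a + α * coeff q 0)                      ≈⟨ +-congˡ (-‿cong (+-congˡ (*-congˡ (head p)))) ⟩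
      a - eval (a ∷ p) α                           ≈⟨ +-congˡ (-‿cong root) ⟩
      a - 0#                                       ≈⟨ solve 1 (λ a → a :- con (+ 0) := a) refl a ⟩
      a                                            ∎)
      where
      head : ∀ p → coeff (quotient p α) 0 ≈ eval p α
      head []      = refl
      head (b ∷ p) = refl
    coefficients (suc k) = sym (begin
      coeff ((X- α) ^ 1 ⊗ q) (suc k)               ≈⟨ coeff-linear _ _ q (suc k) ⟩
      (- α * 1# + 0#) * coeff q (suc k) + coeff ((1# * 1# + 0#) · q) k
                                                   ≈⟨ +-congˡ (coeff-· _ q k) ⟩
      (- α * 1# + 0#) * coeff q (suc k) + (1# * 1# + 0#) * coeff q k
        ≈⟨ solve 3 (λ α x y → (:- α :* con (+ 1) :+ con (+ 0)) :* x :+ (con (+ 1) :* con (+ 1) :+ con (+ 0)) :* y := y :- α :* x) refl α (coeff q (suc k)) (coeff q k) ⟩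
      coeff q k - α * coeff q (suc k)              ≈⟨ quotient-coeff p α k ⟨
      coeff p k                                    ∎)

module MapSolution (κ : ℕ → ℕ → ℕ) {a ℓa b ℓb} {A : CommutativeRing a ℓa} {B : CommutativeRing b ℓb} (hom : RingHom A B) where
  private
    module A = CommutativeRing A
    module RA = Recurrence κ A
    module RB = Recurrence κ B
    module ΣA = Sums A
    module SA = IntegerSolver A
  open CommutativeRing B hiding (zero)
  open IntegerSolver B
  open Sums B
  open RingHom hom
  open Evaluation hom using (ι-nat)

  ι-∑ : ∀ n f → ι (ΣA.∑< n f) ≈ ∑< n (ι ∘ f)
  ι-∑ zero    f = ι-0
  ι-∑ (suc n) f = trans (ι-+ _ _) (+-congˡ (ι-∑ n (f ∘ suc)))

  ι-1-minus : ∀ x → ι (x A.- A.1#) ≈ ι x - 1#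
  ι-1-minus x = trans (solve 2 (λ p q → p := (p :+ q) :- q) refl (ι (x A.- A.1#)) (ι A.1#))
    (+-cong (trans (sym (ι-+ _ _)) (ι-cong (A.trans (A.+-assoc x _ _) (A.trans (A.+-congˡ (A.-‿inverseˡ A.1#)) (A.+-identityʳ x))))) (-‿cong ι-1))

  mapSolution : ∀ {x u} → RA.Solution x u → RB.Solution (ι x) (ι ∘ u)
  mapSolution {x} {u} sol = record
    { start = trans (ι-cong (RA.Solution.start sol)) ι-1
    ; step  = λ n → trans (trans (*-congʳ (sym (ι-1-minus x))) (sym (ι-* _ _))) (trans (ι-cong (RA.Solution.step sol n))
        (trans (ι-+ _ _) (+-cong (trans (ι-* _ _) (*-congʳ (ι-nat (2 ℕ.+ n))))
          (trans (ι-∑ (suc n) (λ j → SA.nat (κ n j) A.* u (n ℕ.∸ j))) (∑<-cong (suc n) (λ j _ → trans (ι-* _ (u (n ℕ.∸ j))) (*-congʳ (ι-nat (κ n j)))))))))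
    }

κ : ℕ → ℕ → ℕ
κ n j = proj₁ (t-isNat (suc j)) ℕ.* suc (n ℕ.∸ j)

-- `t 2` evaluates to 5, so the product is visibly a successor.
κ-second : ∀ n → 1 ℕ.≤ κ (suc n) 1
κ-second n = s≤s z≤n

module HookSolution {c ℓ₁ ℓ₂} (F : CompleteOrderedField c ℓ₁ ℓ₂) {a ℓ} {A : CommutativeRing a ℓ}
                    (hom : RingHom (CompleteOrderedField.commutativeRing F) A) where
  open CommutativeRing A hiding (zero)
  open IntegerSolver A
  open Sums A
  open Recurrence κ A
  open Identity.InAlgebra F hom using (value; value-hooks) public
  open SetoidReasoning setoid

  module S x = Sequence F hom value (λ z → trans (value-hooks 0 z) (+-identityʳ 1#)) (HookRecursion.value-recursion F hom) x

  w : Carrier → ℕ → Carrier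
  w x k = S.w x (suc k)

  nat-cancel : ∀ k {y z} → nat (suc k) * y ≈ nat (suc k) * z → y ≈ z
  nat-cancel = S.nat-cancel 0#

  solution : ∀ x → Solution x (w x)
  solution x = record
    { start = S.w-1 x
    ; step  = λ n → trans (S.eigen x n) (+-congˡ (∑<-cong (suc n) (λ j j≤n → begin
        int (t (suc j)) * (nat (suc n ℕ.∸ j) * S.w x (suc n ℕ.∸ j))
          ≈⟨ *-cong (trans (int-cong (proj₂ (t-isNat (suc j)))) (int-nat (proj₁ (t-isNat (suc j)))))
               (reflexive (≡.cong (λ k → nat k * S.w x k) (ℕ.+-∸-assoc 1 (ℕ.s≤s⁻¹ j≤n)))) ⟩
        nat (proj₁ (t-isNat (suc j))) * (nat (suc (n ℕ.∸ j)) * w x (n ℕ.∸ j))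
          ≈⟨ *-assoc _ _ _ ⟨
        nat (proj₁ (t-isNat (suc j))) * nat (suc (n ℕ.∸ j)) * w x (n ℕ.∸ j)
          ≈⟨ *-congʳ (nat-* (proj₁ (t-isNat (suc j))) (suc (n ℕ.∸ j))) ⟨
        nat (κ n j) * w x (n ℕ.∸ j) ∎)))
    }

  private
    unit : ∀ k → int (alternating k) * int (alternating k) ≈ 1#
    unit zero    = *-identityˡ 1#
    unit (suc k) = trans (*-cong (int-neg (alternating k)) (int-neg (alternating k)))
      (trans (solve 1 (λ x → (:- x) :* (:- x) := x :* x) refl (int (alternating k))) (unit k))

  root⇒value : ∀ k x → (x - 1#) * w x k ≈ 0# → value (suc k) (- x) ≈ 0#
  root⇒value k x eq = begin
    v                              ≈⟨ *-identityˡ v ⟨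
    1# * v                         ≈⟨ *-congʳ (unit (suc k)) ⟨
    s * s * v                      ≈⟨ *-assoc s s v ⟩
    s * (s * v)                    ≈⟨ *-congˡ (trans (S.a-factor x k) eq) ⟩
    s * 0#                         ≈⟨ zeroʳ s ⟩
    0#                             ∎
    where
    s = int (alternating (suc k))
    v = value (suc k) (- x)

  value⇒root : ∀ k x → value (suc k) (- x) ≈ 0# → (x - 1#) * w x k ≈ 0#
  value⇒root k x eq = trans (sym (S.a-factor x k)) (trans (*-congˡ eq) (zeroʳ _))

-- The complex zeros of the Nekrasov-Okounkov polynomials

module Assembly {c ℓ₁ ℓ₂} (F : CompleteOrderedField c ℓ₁ ℓ₂) where
  open CompleteOrderedField F hiding (zero)
  open IntegerSolver commutativeRing
  open OrderedField F
  open Complex F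
  open SquareRoots F using (sqrt; sum-of-squares-nonneg)
  open NekrasovOkounkov F hiding (_≈_; _<_; 0#)
  private
    module ℂR = CommutativeRing complexCommutativeRing
    module ℂS = IntegerSolver complexCommutativeRing
    open DualNumbers complexCommutativeRing using (dualRing; constant)
    module D = CommutativeRing dualRing
    module HF = HookSolution F (idHom commutativeRing)
    module HC = HookSolution F (idHom complexCommutativeRing ∘ʰ realHom)
    module HD = HookSolution F (constant ∘ʰ realHom)
    module EvalD = Evaluation constant
    open Recurrence κ using (Solution; unique)

    ∣∣-nonneg : ∀ z → 0# ≤ ∣ z ∣
    ∣∣-nonneg z = proj₁ (proj₂ (sqrt (norm² z) (sum-of-squares-nonneg (re z) (im z))))

    ∣∣-square : ∀ z → ∣ z ∣ * ∣ z ∣ ≈ norm² z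
    ∣∣-square z = proj₂ (proj₂ (sqrt (norm² z) (sum-of-squares-nonneg (re z) (im z))))

    open Modulus ∣_∣ ∣∣-nonneg ∣∣-square

    NO-zero⇒root : ∀ m β → IsZero (NO (suc m)) β → (ℂR.- β ℂR.- ℂR.1#) ℂR.* HC.w (ℂR.- β) m ℂR.≈ ℂR.0#
    NO-zero⇒root m β zero-β = HC.value⇒root m (ℂR.- β) (ℂR.trans
      (evalAt-cong (Identity.hookSumPoly F (suc m)) (ℂS.solve 1 (λ x → ℂS.:- (ℂS.:- x) ℂS.:= x) ℂR.refl β))
      (ℂR.trans (ℂR.sym (NO-value (idHom complexCommutativeRing) (suc m) β))
        (ℂR.trans (ℂR.reflexive (≡.sym (Division.eval≡evalAt complexCommutativeRing (NO (suc m)) β))) zero-β)))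
      where open Evaluation (idHom complexCommutativeRing ∘ʰ realHom) using (evalAt-cong)

    root⇒NO-zero : ∀ m x → (x ℂR.- ℂR.1#) ℂR.* HC.w x m ℂR.≈ ℂR.0# → IsZero (NO (suc m)) (ℂR.- x)
    root⇒NO-zero m x eq = ℂR.trans (ℂR.reflexive (Division.eval≡evalAt complexCommutativeRing (NO (suc m)) (ℂR.- x)))
      (ℂR.trans (NO-value (idHom complexCommutativeRing) (suc m) (ℂR.- x)) (HC.root⇒value m x eq))

    real-solution : ∀ x k → HC.w (fromReal x) k ℂR.≈ fromReal (HF.w x k)
    real-solution x = unique complexCommutativeRing HC.nat-cancel ℂR.refl (HC.solution (fromReal x)) (MapSolution.mapSolution κ realHom (HF.solution x))

    proj₁-eval : ∀ q (z : D.Carrier) → proj₁ (EvalD.evalAt q z) ℂR.≈ eval q (proj₁ z)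
    proj₁-eval []      z = ℂR.refl
    proj₁-eval (a ∷ q) z = ℂR.+-congˡ (ℂR.*-congˡ (proj₁-eval q z))

    X : Carrier → D.Carrier
    X ρ = fromReal ρ , ℂR.1#

    -- A double zero of NO would be a zero in the dual numbers.
    not-double : ∀ m ρ q → ¬ ((X ρ D.- D.1#) D.* HD.w (X ρ) m D.≈ D.0#) →
      NO (suc m) ≋ (X- (ℂR.- fromReal ρ)) ^ 1 ⊗ q → ¬ IsZero q (ℂR.- fromReal ρ)
    not-double m ρ q nonzero eq q-zero = nonzero (HD.value⇒root m (X ρ) (D.trans
      (D.sym (NO-value constant (suc m) Z))
      (D.trans (EvalD.evalAt-≋ (NO (suc m)) ((X- α) ^ 1 ⊗ q) Z eq)
        (D.trans (EvalD.evalAt-⊗ ((X- α) ^ 1) q Z)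
          (D.trans (D.*-cong {_} {ℂR.0# , ℂR.- ℂR.1#} (D.trans (EvalD.evalAt-⊗ (X- α) (ℂR.1# ∷ []) Z) linear) D.refl)
            (ℂR.zeroˡ _ , ℂR.trans (ℂR.+-cong (ℂR.zeroˡ _) (ℂR.trans (ℂR.*-congˡ (ℂR.trans (proj₁-eval q Z) q-zero)) (ℂR.zeroʳ _))) (ℂR.+-identityˡ _)))))))
      where
      α : ℂ
      α = ℂR.- fromReal ρ
      Z : D.Carrier
      Z = D.- X ρ
      -- `Z` is `α - ε`, where the linear factor takes the value `- ε`; a cofactor that vanishes at
      -- `α` has a multiple of `ε` as its value at `Z`, and the product is zero.
      linear : EvalD.evalAt (X- α) Z D.* EvalD.evalAt (ℂR.1# ∷ []) Z D.≈ (ℂR.0# , ℂR.- ℂR.1#)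
      linear = ℂS.solve 1 (λ a → (ℂS.:- a ℂS.:+ a ℂS.:* (ℂS.con (+ 1) ℂS.:+ a ℂS.:* ℂS.con (+ 0))) ℂS.:* (ℂS.con (+ 1) ℂS.:+ a ℂS.:* ℂS.con (+ 0)) ℂS.:= ℂS.con (+ 0)) ℂR.refl α ,
        ℂS.solve 2 (λ a e →
          (ℂS.:- a ℂS.:+ a ℂS.:* (ℂS.con (+ 1) ℂS.:+ a ℂS.:* ℂS.con (+ 0))) ℂS.:* (ℂS.con (+ 0) ℂS.:+ (a ℂS.:* ℂS.con (+ 0) ℂS.:+ e ℂS.:* ℂS.con (+ 0)))
          ℂS.:+ (ℂS.con (+ 0) ℂS.:+ (a ℂS.:* (ℂS.con (+ 0) ℂS.:+ (a ℂS.:* ℂS.con (+ 0) ℂS.:+ e ℂS.:* ℂS.con (+ 0))) ℂS.:+ e ℂS.:* (ℂS.con (+ 1) ℂS.:+ a ℂS.:* ℂS.con (+ 0))))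
            ℂS.:* (ℂS.con (+ 1) ℂS.:+ a ℂS.:* ℂS.con (+ 0)) ℂS.:= e) ℂR.refl α (ℂR.- ℂR.1#)

  Conclusion : ℕ → Set _
  Conclusion n = ∃ λ (α : ℂ) → IsUniqueZeroOfMaximalModulus (NO n) α × im α ≈ 0# × re α < 0# × IsSimpleZero (NO n) α

  private
    assemble : ∀ m ρ → 1# ≤ ρ → (ρ - 1#) * HF.w ρ m ≈ 0# →
      (∀ z → (z ℂR.- ℂR.1#) ℂR.* HC.w z m ℂR.≈ ℂR.0# → ¬ (z ℂR.≈ fromReal ρ) → ∣ z ∣ < ρ) →
      ¬ ((X ρ D.- D.1#) D.* HD.w (X ρ) m D.≈ D.0#) → Conclusion (suc m)
    assemble m ρ 1≤ρ root maximal nonzero = α , (α-zero , largest) , -0≈0 , neg-pos 0<ρ , simple (factor (NO (suc m)) α α-zero)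
      where
      open OrderedSums F using (neg-pos)
      open LinearFactor complexCommutativeRing using (factor)
      α : ℂ
      α = ℂR.- fromReal ρ
      0<ρ : 0# < ρ
      0<ρ = <-≤-trans 0<1 1≤ρ
      -0≈0 : - 0# ≈ 0#
      -0≈0 = solve 0 (:- con (+ 0) := con (+ 0)) refl
      α-zero : IsZero (NO (suc m)) α
      α-zero = root⇒NO-zero m (fromReal ρ) (ℂR.trans (ℂR.*-congˡ (real-solution ρ m))
        (ℂR.trans (ℂR.*-congʳ (ℂR.sym (MapSolution.ι-1-minus κ realHom ρ)))
          (ℂR.trans (ℂR.sym (RingHom.ι-* realHom (ρ - 1#) (HF.w ρ m))) (RingHom.ι-cong realHom root))))
      ∣α∣≈ρ : ∣ α ∣ ≈ ρ
      ∣α∣≈ρ = trans (∣∣-neg (fromReal ρ)) (∣∣-real (inj₁ 0<ρ))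
      largest : ∀ β → IsZero (NO (suc m)) β → ¬ (β ℂR.≈ α) → ∣ β ∣ < ∣ α ∣
      largest β β-zero β≉α = <-respʳ-≈ (sym ∣α∣≈ρ) (<-respˡ-≈ (∣∣-neg β) (maximal (ℂR.- β) (NO-zero⇒root m β β-zero)
        (λ -β≈ρ → β≉α (ℂR.trans (ℂS.solve 1 (λ x → x ℂS.:= ℂS.:- (ℂS.:- x)) ℂR.refl β) (ℂR.-‿cong -β≈ρ)))))
      simple : (∃ λ q → NO (suc m) ≋ (X- α) ^ 1 ⊗ q) → IsSimpleZero (NO (suc m)) α
      simple (q , eq) = q , eq , not-double m ρ q nonzero eq

    -- Here the only zero comes from the factor `x - 1`, so `ρ = 1#`; the comparison arguments,
    -- which rely on `1# < ρ`, begin with the next polynomial.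
    first : Conclusion 1
    first = assemble 0 1# ≤-refl (trans (*-congʳ (-‿inverseʳ 1#)) (zeroˡ _))
      (λ z eq z≉1 → contradiction (z≈1 z eq) z≉1)
      (λ eq → 0≉1 (sym (proj₁ (ℂR.trans (ℂR.sym (proj₁ (Solution.start (HD.solution (X 1#))))) (P₀≈0 eq)))))
      where
      z≈1 : ∀ z → (z ℂR.- ℂR.1#) ℂR.* HC.w z 0 ℂR.≈ ℂR.0# → z ℂR.≈ fromReal 1#
      z≈1 z eq = ℂR.trans (ℂS.solve 1 (λ z → z ℂS.:= (z ℂS.:- ℂS.con (+ 1)) ℂS.:* ℂS.con (+ 1) ℂS.:+ ℂS.con (+ 1)) ℂR.refl z)
        (ℂR.trans (ℂR.+-congʳ (ℂR.trans (ℂR.*-congˡ (ℂR.sym (Solution.start (HC.solution z)))) eq)) (ℂR.+-identityˡ _))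
      P₀≈0 : (X 1# D.- D.1#) D.* HD.w (X 1#) 0 D.≈ D.0# → proj₁ (HD.w (X 1#) 0) ℂR.≈ ℂR.0#
      P₀≈0 (_ , eq) = ℂR.trans (ℂS.solve 2 (λ p q → p ℂS.:= (ℂS.con (+ 1) ℂS.:- ℂS.con (+ 1)) ℂS.:* q ℂS.:+ (ℂS.con (+ 1) ℂS.:- ℂS.con (+ 0)) ℂS.:* p) ℂR.refl _ _) eq

    module Higher (m : ℕ) where
      open Dominance F κ (s≤s z≤n) κ-second
      open LargestRoot (largestRoot (λ k x → HF.w x k) HF.solution m (barrier (λ k x → HF.w x k) HF.solution m))

      p : ℕ → Carrier
      p = HF.w ρ

      maximal : ∀ z → (z ℂR.- ℂR.1#) ℂR.* HC.w z (suc m) ℂR.≈ ℂR.0# → ¬ (z ℂR.≈ fromReal ρ) → ∣ z ∣ < ρ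
      maximal z eq z≉ρ = case ((re z ≟ 1#) ×-dec (im z ≟ 0#))
        where
        case : Dec (z ℂR.≈ ℂR.1#) → ∣ z ∣ < ρ
        -- The zero of the factor `x - 1` lies inside the circle; for all other zeros the factor
        -- cancels and leaves a zero of `w`.
        case (yes z≈1) = <-respˡ-≈ (sym (trans (∣∣-cong z≈1) (∣∣-real (inj₁ 0<1)))) 1<ρ
        case (no  z≉1) = disc z (inj₁ 1<ρ)
          (modulus-bound (HF.solution ρ) 1<ρ m root positive ∣_∣ ∣∣-nonneg ∣∣-square (HC.solution z)
            (*-zero-cancelᶜ (z ℂR.- ℂR.1#) _ (λ z-1≈0 → z≉1 (ℂR.trans (ℂS.solve 1 (λ z → z ℂS.:= (z ℂS.:- ℂS.con (+ 1)) ℂS.:+ ℂS.con (+ 1)) ℂR.refl z)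
              (ℂR.trans (ℂR.+-congʳ z-1≈0) (ℂR.+-identityˡ _)))) eq)) z≉ρ

      P Q : ℕ → ℂ
      P k = proj₁ (HD.w (X ρ) k)
      Q k = proj₂ (HD.w (X ρ) k)

      proj₁Hom : RingHom dualRing complexCommutativeRing
      proj₁Hom = record { ι = proj₁ ; ι-cong = proj₁ ; ι-+ = λ _ _ → ℂR.refl ; ι-* = λ _ _ → ℂR.refl ; ι-0 = ℂR.refl ; ι-1 = ℂR.refl }

      P≈p : ∀ k → P k ℂR.≈ fromReal (p k)
      P≈p = unique complexCommutativeRing HC.nat-cancel ℂR.refl (MapSolution.mapSolution κ proj₁Hom (HD.solution (X ρ)))
              (MapSolution.mapSolution κ realHom (HF.solution ρ))

      private
        module ΣD = Sums dualRing
        module SD = IntegerSolver dualRing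
        open Sums commutativeRing using (∑<; ∑<-cong)

        slope : D.Carrier → Carrier
        slope z = re (proj₂ z)

        slope-∑ : ∀ n f → slope (ΣD.∑< n f) ≈ ∑< n (slope ∘ f)
        slope-∑ zero    f = refl
        slope-∑ (suc n) f = +-congˡ (slope-∑ n (f ∘ suc))

        slope-nat : ∀ k z → slope (SD.nat k D.* z) ≈ nat k * slope z
        slope-nat k z = trans (proj₁ (proj₂ (D.*-congʳ {z} (D.sym (EvalF.ι-nat k)))))
          (solve 5 (λ n a b c d → (n :* b :+ :- (con (+ 0) :* c)) :+ (con (+ 0) :* a :+ :- (con (+ 0) :* d)) := n :* b) refl
            (nat k) (re (proj₁ z)) (slope z) (im (proj₂ z)) (im (proj₁ z)))
          where module EvalF = Evaluation (constant ∘ʰ realHom)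

      nonzero : ¬ ((X ρ D.- D.1#) D.* HD.w (X ρ) (suc m) D.≈ D.0#)
      nonzero (_ , eq) = no-double-root (HF.solution ρ) 1<ρ m root positive (λ k → re (Q k)) step Q-root
        where
        product-slope : ∀ k → slope ((X ρ D.- D.1#) D.* HD.w (X ρ) k) ≈ (ρ - 1#) * re (Q k) + p k
        product-slope k = trans
          (solve 5 (λ ρ a b c d → ((ρ :- con (+ 1)) :* a :+ :- ((con (+ 0) :- con (+ 0)) :* b)) :+ ((con (+ 1) :- con (+ 0)) :* c :+ :- ((con (+ 0) :- con (+ 0)) :* d)) :=
            (ρ :- con (+ 1)) :* a :+ c) refl ρ (re (Q k)) (im (Q k)) (re (P k)) (im (P k)))
          (+-congˡ (proj₁ (P≈p k)))
        step : ∀ k → (ρ - 1#) * re (Q k) + p k ≈ nat (2 ℕ.+ k) * re (Q (suc k)) + Recurrence.rest κ commutativeRing (λ k → re (Q k)) k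
        step k = trans (sym (product-slope k)) (trans (proj₁ (proj₂ (Solution.step (HD.solution (X ρ)) k)))
          (+-cong (slope-nat (2 ℕ.+ k) (HD.w (X ρ) (suc k)))
            (trans (slope-∑ (suc k) (λ j → SD.nat (κ k j) D.* HD.w (X ρ) (k ℕ.∸ j))) (∑<-cong (suc k) (λ j _ → slope-nat (κ k j) (HD.w (X ρ) (k ℕ.∸ j)))))))
        Q-root : re (Q (suc m)) ≈ 0#
        -- The `ε`-part of the product is `(ρ - 1#) Q + P`, and the real part of `P (suc m)`
        -- vanishes because `ρ` is a root; the factor `ρ - 1#` is nonzero.
        Q-root = *-zero-cancel (-‿≉0 (>⇒≉ 1<ρ)) (trans (sym (trans (+-congˡ root) (+-identityʳ _))) (trans (sym (product-slope (suc m))) (proj₁ eq)))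

      conclusion : Conclusion (2 ℕ.+ m)
      conclusion = assemble (suc m) ρ (inj₁ 1<ρ) (trans (*-congˡ root) (zeroʳ _)) maximal nonzero

  conclusion : ∀ n → n ≥ 1 → Conclusion n
  conclusion 1             _ = first
  conclusion (suc (suc m)) _ = Higher.conclusion m

corollary2p2 : ∀ {c ℓ₁ ℓ₂} (ℝ : CompleteOrderedField c ℓ₁ ℓ₂) →
    let open NekrasovOkounkov ℝ in
    ∀ (n : ℕ) → n ≥ 1 →
    ∃ λ (α : ℂ) →
    IsUniqueZeroOfMaximalModulus (NO n) α
    × im α ≈ 0#
    × re α < 0#
    × IsSimpleZero (NO n) α
corollary2p2 ℝ n n≥1 = Assembly.conclusion ℝ n n≥1
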